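{- If $\mu$ and $\lambda$ are strict partitions then $gp_{\lambda/\mu}=gp^{\mathrm{comb}}_{\lambda/\mu}$ and $gq_{\lambda/\mu}=gq^{\mathrm{comb}}_{\lambda/\mu}$.
   Context: Strict partitions $\lambda=(\lambda_1>\dots>\lambda_k>0)$, $|\lambda|=\sum\lambda_i$, shifted diagram $\mathsf{SD}_\lambda=\{(i,i+j-1):1\le i\le k,1\le j\le\lambda_i\}$; for strict $\mu\subseteq\lambda$, $\mathsf{SD}_{\lambda/\mu}=\mathsf{SD}_\lambda\setminus\mathsf{SD}_\mu$ and $|\lambda/\mu|=|\lambda|-|\mu|$; diagonal boxes $(i,i)$. Primed numbers $i'=i-\tfrac12$, ordered $1'<1<2'<2<\dots$; $\beta,x_i,y_i$ commuting indeterminates. A semistandard shifted set-valued tableau of shape $\lambda$ fills each box $(i,j)$ with a nonempty finite subset $T_{ij}$ of $\{1'<1<\dots\}$ with $\max T_{ij}\le\min T_{i+1,j}$, $\max T_{ij}\le\min T_{i,j+1}$ (when boxes exist), no unprimed number in two boxes of a column, no primed number in two boxes of a row; $|T|=\sum|T_{ij}|$, ${\bf x}^T=\prod x_i^{(\#i)+(\#i')}$. $GQ_\lambda=\sum\beta^{|\lambda|-|T|}{\bf x}^T$ over all such tableaux; $GP_\lambda$ the same over those with no primed diagonal entries. $gp_\lambda,gq_\lambda$ are the unique power series with $\sum_\lambda GQ_\lambda({\bf x})gp_\lambda({\bf y})=\sum_\lambda GP_\lambda({\bf x})gq_\lambda({\bf y})=\prod_{i,j}\frac{1-\overline{x_i}y_j}{1-x_iy_j}$,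 $\overline{x}=\frac{ -x}{1+\beta x}$. With $f({\bf x},{\bf y}):=f(x_1,y_1,x_2,y_2,\dots)$, the skew functions are defined (for all strict $\mu$) by $gp_\lambda({\bf x},{\bf y})=\sum_\mu gp_\mu({\bf x})gp_{\lambda/\mu}({\bf y})$ and $gq_\lambda({\bf x},{\bf y})=\sum_\mu gq_\mu({\bf x})gq_{\lambda/\mu}({\bf y})$. A shifted plane partition of shape $\lambda/\mu$ is a filling of $\mathsf{SD}_{\lambda/\mu}$ by elements of $\{1'<1<2'<\dots\}$ with weakly increasing rows and columns; for such $T$, $c_i$ is the number of distinct columns containing $i$, $r_i$ the number of distinct rows containing $i'$, $|\operatorname{wt}_{\mathrm{PP}}(T)|=\sum_i(c_i+r_i)$, ${\bf x}^{\operatorname{wt}_{\mathrm{PP}}(T)}=\prod_ix_i^{c_i+r_i}$. $\mathsf{ShPP}_Q(\lambda/\mu)$ is the set of such fillings, $\mathsf{ShPP}_P(\lambda/\mu)$ those with no unprimed diagonal entries (both empty if $\mu\not\subseteq\lambda$). $gp^{\mathrm{comb}}_{\lambda/\mu}=\sum_{T\in\mathsf{ShPP}_P(\lambda/\mu)}(-\beta)^{|\lambda/\mu|-|\operatorname{wt}_{\mathrm{PP}}(T)|}{\bf x}^{\operatorname{wt}_{\mathrm{PP}}(T)}$ and $gq^{\mathrm{comb}}_{\lambda/\mu}$ is the same sum over $\mathsf{ShPP}_Q(\lambda/\mu)$.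
   Formalization: GQ and GP are weighted by β^{|T|-|λ|} instead of the stated β^{|λ|-|T|}; with the stated exponent the claim already fails for λ=(2), μ=∅ in one variable, where gp would be y²-(β+1/β)y/2 instead of y²-βy. -}

module Defs where

open import Data.Bool using (Bool; true; false; _∧_; _∨_; not; if_then_else_)
open import Data.Nat using (ℕ; zero; suc; _+_; _*_; _∸_; _≤_; _<_; _>_; _≡ᵇ_; _≤ᵇ_; _⊔_; _⊓_)
import Data.Nat as N
open import Data.Nat.Properties using (_≟_)
open import Data.Integer using (ℤ; +_; -_) renaming (_+_ to _+ℤ_; _*_ to _*ℤ_)
open import Data.List using (List; []; _∷_; _++_; map; concatMap; length; foldr; upTo; zip; zipWith; deduplicate)
open import Data.Nat.ListAction using (sum)
open import Data.Bool.ListAction using (any; all)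
open import Data.List.Relation.Unary.All using (All)
open import Data.List.Relation.Unary.Linked using (Linked)
open import Data.Product using (_×_; _,_; proj₁; proj₂; ∃)
open import Relation.Binary.PropositionalEquality using (_≡_)
open import Relation.Nullary.Decidable using (does)
open import Data.Product.Properties using (≡-dec)

-- Conventions
--  * A (strict) partition is a list of naturals (λ₁, λ₂, …).
--  * Letters: the primed number i' is encoded as 2i-1 and the unprimed
--    number i as 2i (i ≥ 1); so 1' < 1 < 2' < 2 < … becomes 1 < 2 < 3 < 4 < ….
--    Odd = primed, even = unprimed.  Letters 2t+1, 2t+2 contribute to the
--    variable with list index t (i.e. x_{t+1}).
--  * A monomial β^b z^e is a pair (b , e) with b : ℕ and e : List ℕ the
--    exponent vector of z₁, z₂, … (missing entries are 0).
--  * A formal power series (in β and countably many variables z, integer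
--    coefficients) is its coefficient function  Ser = ℕ → List ℕ → ℤ.

Ser : Set
Ser = ℕ → List ℕ → ℤ

filterB : {A : Set} → (A → Bool) → List A → List A
filterB p []       = []
filterB p (x ∷ xs) = if p x then x ∷ filterB p xs else filterB p xs

Strict : List ℕ → Set
Strict l = Linked _>_ l × All (λ n → 0 < n) l

Σℤ : {A : Set} → List A → (A → ℤ) → ℤ
Σℤ xs f = foldr (λ x acc → f x +ℤ acc) (+ 0) xs

range0 : ℕ → List ℕ
range0 n = upTo (suc n)

subsets : ℕ → List (List ℕ)
subsets zero    = [] ∷ []
subsets (suc n) = subsets n ++ map (suc n ∷_) (subsets n)

strictUpTo : ℕ → List (List ℕ)
strictUpTo N = filterB (λ l → sum l ≤ᵇ N) (subsets N)

nth : ℕ → List ℕ → ℕ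
nth _       []       = 0
nth zero    (x ∷ _)  = x
nth (suc k) (_ ∷ xs) = nth k xs

below : List ℕ → List (List ℕ)
below []       = [] ∷ []
below (x ∷ xs) = concatMap (λ y → map (y ∷_) (below xs)) (range0 x)

boolℤ : Bool → ℤ
boolℤ true  = + 1
boolℤ false = + 0

oneS : Ser
oneS b e = boolℤ ((b ≡ᵇ 0) ∧ (sum e ≡ᵇ 0))

-- the variable z_{k+1} (list index k)
varS : ℕ → Ser
varS k b e = boolℤ ((b ≡ᵇ 0) ∧ (sum e ≡ᵇ 1) ∧ (nth k e ≡ᵇ 1))

betaS : Ser
betaS b e = boolℤ ((b ≡ᵇ 1) ∧ (sum e ≡ᵇ 0))

addS : Ser → Ser → Ser
addS F G b e = F b e +ℤ G b e

negS : Ser → Ser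
negS F b e = - F b e

mulS : Ser → Ser → Ser
mulS F G b e =
  Σℤ (range0 b) λ b1 → Σℤ (below e) λ e1 →
    F b1 e1 *ℤ G (b ∸ b1) (zipWith _∸_ e e1)

powS : Ser → ℕ → Ser
powS u zero    = oneS
powS u (suc n) = mulS u (powS u n)

-- 1/(1-u) for u without constant term: Σ_n u^n
-- (u^n has no monomial of total degree < n, so the sum is finite)
geomS : Ser → Ser
geomS u b e = Σℤ (range0 (b + sum e)) λ n → powS u n b e

-- the z-variables are  x₁, y₁, x₂, y₂, … :  x_{i+1} = z index 2i,
-- y_{j+1} = z index 2j+1.
interleave : List ℕ → List ℕ → List ℕ
interleave []       []       = []
interleave []       (y ∷ ys) = 0 ∷ y ∷ interleave [] ys
interleave (x ∷ xs) []       = x ∷ 0 ∷ interleave xs []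
interleave (x ∷ xs) (y ∷ ys) = x ∷ y ∷ interleave xs ys

-- one factor (1 - x̄ y)/(1 - x y),  x̄ = -x/(1+βx),
-- i.e. (1 + x y · 1/(1+βx)) · 1/(1 - x y)
kernelFactor : ℕ → ℕ → Ser
kernelFactor i j =
  mulS (addS oneS (mulS (mulS x y) (geomS (negS (mulS betaS x)))))
       (geomS (mulS x y))
  where
    x = varS (2 * i)
    y = varS (2 * j + 1)

-- ∏_{i < m, j < n} of the factors; coefficients of x^a y^c of the full
-- infinite product only involve factors with i < length a, j < length c
-- (the others are 1 + (terms involving variables with exponent 0)).
kernelS : ℕ → ℕ → Ser
kernelS m n = foldr mulS oneS (concatMap (λ i → map (kernelFactor i) (upTo n)) (upTo m))

kernelCoef : ℕ → List ℕ → List ℕ → ℤ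
kernelCoef b a c = kernelS (length a) (length c) b (interleave a c)

Box : Set
Box = ℕ × ℕ

-- SD_λ = {(i, i+j-1) : 1 ≤ i ≤ ℓ(λ), 1 ≤ j ≤ λ_i}
boxesFrom : ℕ → List ℕ → List Box
boxesFrom i []       = []
boxesFrom i (l ∷ ls) = map (λ j → (i , i + j)) (upTo l) ++ boxesFrom (suc i) ls

boxes : List ℕ → List Box
boxes = boxesFrom 1

_≡B_ : Box → Box → Bool
(i , j) ≡B (i' , j') = (i ≡ᵇ i') ∧ (j ≡ᵇ j')

memB : Box → List Box → Bool
memB p = any (p ≡B_)

memN : ℕ → List ℕ → Bool
memN x = any (x ≡ᵇ_)

containedB : List ℕ → List ℕ → Bool
containedB mu la = all (λ p → memB p (boxes la)) (boxes mu)

skewBoxes : List ℕ → List ℕ → List Box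
skewBoxes la mu = filterB (λ p → not (memB p (boxes mu))) (boxes la)

allPairs : {A : Set} → List A → (A → A → Bool) → Bool
allPairs xs f = all (λ p → all (λ q → f p q) xs) xs

tuples : {A : Set} → ℕ → List A → List (List A)
tuples zero    xs = [] ∷ []
tuples (suc n) xs = concatMap (λ x → map (x ∷_) (tuples n xs)) xs

eqList : List ℕ → List ℕ → Bool
eqList []       []       = true
eqList (x ∷ xs) (y ∷ ys) = (x ≡ᵇ y) ∧ eqList xs ys
eqList _        _        = false

isOdd : ℕ → Bool
isOdd zero          = false
isOdd (suc zero)    = true
isOdd (suc (suc n)) = isOdd n

isEven : ℕ → Bool
isEven n = not (isOdd n)

count : {A : Set} → (A → Bool) → List A → ℕ
count p []       = 0
count p (x ∷ xs) = (if p x then 1 else 0) + count p xs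

-- letters 2t+1 (= (t+1)') or 2t+2 (= t+1)
isVar : ℕ → ℕ → Bool
isVar t ℓ = (ℓ ≡ᵇ 2 * t + 1) ∨ (ℓ ≡ᵇ 2 * t + 2)

maxL : List ℕ → ℕ
maxL = foldr _⊔_ 0

minL : List ℕ → ℕ
minL []           = 0
minL (x ∷ [])     = x
minL (x ∷ y ∷ xs) = x ⊓ minL (y ∷ xs)

SVEntry : Set
SVEntry = Box × List ℕ

svPairOK : SVEntry → SVEntry → Bool
svPairOK ((i , j) , S) ((i' , j') , S') =
  (not ((i' ≡ᵇ suc i) ∧ (j' ≡ᵇ j)) ∨ (maxL S ≤ᵇ minL S')) ∧
  (not ((i' ≡ᵇ i) ∧ (j' ≡ᵇ suc j)) ∨ (maxL S ≤ᵇ minL S')) ∧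
  (not ((j' ≡ᵇ j) ∧ not (i' ≡ᵇ i)) ∨ not (any (λ ℓ → isEven ℓ ∧ memN ℓ S') S)) ∧
  (not ((i' ≡ᵇ i) ∧ not (j' ≡ᵇ j)) ∨ not (any (λ ℓ → isOdd ℓ ∧ memN ℓ S') S))

noPrimedDiag : SVEntry → Bool
noPrimedDiag ((i , j) , S) = not (i ≡ᵇ j) ∨ not (any isOdd S)

svWeight : ℕ → List SVEntry → List ℕ
svWeight k T = map (λ t → sum (map (λ E → count (isVar t) (proj₂ E)) T)) (upTo k)

svFillings : List ℕ → ℕ → List (List SVEntry)
svFillings la k =
  map (zip (boxes la))
      (tuples (length (boxes la)) (filterB (λ S → not (length S ≡ᵇ 0)) (subsets (2 * k))))

-- coefficient of β^b x^a in GQ_λ (P? = true gives GP_λ):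
-- #{T : x^T = x^a, |T| - |λ| = b}
GCoef : Bool → List ℕ → ℕ → List ℕ → ℤ
GCoef P? la b a = + count good (svFillings la (length a))
  where
    good : List SVEntry → Bool
    good T = allPairs T svPairOK
           ∧ (not P? ∨ all noPrimedDiag T)
           ∧ eqList (svWeight (length a) T) a
           ∧ (sum (map (λ E → length (proj₂ E)) T) ≡ᵇ sum la + b)

GQCoef GPCoef : List ℕ → ℕ → List ℕ → ℤ
GQCoef = GCoef false
GPCoef = GCoef true

PPEntry : Set
PPEntry = Box × ℕ

ppPairOK : PPEntry → PPEntry → Bool
ppPairOK ((i , j) , ℓ) ((i' , j') , ℓ') =
  (not ((i' ≡ᵇ i) ∧ (j ≤ᵇ j')) ∨ (ℓ ≤ᵇ ℓ')) ∧
  (not ((j' ≡ᵇ j) ∧ (i ≤ᵇ i')) ∨ (ℓ ≤ᵇ ℓ'))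

noUnprimedDiag : PPEntry → Bool
noUnprimedDiag ((i , j) , ℓ) = not (i ≡ᵇ j) ∨ not (isEven ℓ)

distinct : List ℕ → ℕ
distinct xs = length (deduplicate _≟_ xs)

ppWeight : ℕ → List PPEntry → List ℕ
ppWeight k T = map (λ t →
    distinct (map (λ E → proj₂ (proj₁ E)) (filterB (λ E → proj₂ E ≡ᵇ 2 * t + 2) T))
  + distinct (map (λ E → proj₁ (proj₁ E)) (filterB (λ E → proj₂ E ≡ᵇ 2 * t + 1) T)))
  (upTo k)

ppFillings : List ℕ → List ℕ → ℕ → List (List PPEntry)
ppFillings la mu k =
  map (zip (skewBoxes la mu)) (tuples (length (skewBoxes la mu)) (map suc (upTo (2 * k))))

signℤ : ℕ → ℤ
signℤ b = if isEven b then + 1 else - (+ 1)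

-- coefficient of β^b x^a in g?^comb_{λ/μ}  (P? = true: gp, false: gq)
-- = Σ_{T, wt(T)=a, |λ/μ|-|wt(T)| = b} (-1)^b
combCoef : Bool → List ℕ → List ℕ → ℕ → List ℕ → ℤ
combCoef P? la mu b a =
  if containedB mu la then signℤ b *ℤ (+ count good (ppFillings la mu (length a))) else + 0
  where
    good : List PPEntry → Bool
    good T = allPairs T ppPairOK
           ∧ (not P? ∨ all noUnprimedDiag T)
           ∧ eqList (ppWeight (length a) T) a
           ∧ (sum a + b ≡ᵇ length (skewBoxes la mu))

gpComb gqComb : List ℕ → List ℕ → Ser
gpComb = combCoef true
gqComb = combCoef false

-- Σ_λ G_λ(x) g_λ(y) = ∏ (1 - x̄_i y_j)/(1 - x_i y_j), coefficientwise at
-- β^b x^a y^c.  G_λ has no monomial x^a with |a| < |λ|, so only λ with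
-- |λ| ≤ |a| contribute.
CauchyDual : (List ℕ → ℕ → List ℕ → ℤ) → (List ℕ → Ser) → Set
CauchyDual G g = ∀ (b : ℕ) (a c : List ℕ) →
  Σℤ (strictUpTo (sum a)) (λ la → Σℤ (range0 b) λ b1 → G la b1 a *ℤ g la (b ∸ b1) c)
  ≡ kernelCoef b a c

-- g_λ(x,y) = Σ_μ g_μ(x) g_{λ/μ}(y) for every strict λ: coefficientwise at
-- β^b x^a y^c, the partial sums over strict μ with |μ| ≤ N are eventually
-- equal to the coefficient of β^b z^(interleave a c) in g_λ.
SkewOf : (List ℕ → Ser) → (List ℕ → List ℕ → Ser) → Set
SkewOf g gs = ∀ (la : List ℕ) → Strict la → ∀ (b : ℕ) (a c : List ℕ) →
  ∃ λ N → ∀ N' → N ≤ N' →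
    Σℤ (strictUpTo N') (λ mu → Σℤ (range0 b) λ b1 → g mu b1 a *ℤ gs la mu (b ∸ b1) c)
    ≡ g la b (interleave a c)

{-# OPTIONS --safe #-}
-- Words of n bits encode the strict partitions with parts ≤ n, and every family is computed by
-- removing one variable at a time.  For GP and GQ this is a finite automaton A reading a pair of
-- words; for the plane partition sums it is B = Col · Row, where Row and Col remove the boxes
-- with the last primed and the last unprimed letter.  Multiplying B by the unitriangular matrix X₀ of rook
-- strips cancels everything with two or more open rows or columns and leaves a finite automaton
-- X; A and X satisfy an exchange relation up to terms of high degree in x.  Cancelling X₀ gives
--   (1 + βx)(1 - xy) AᵀB = (1 + (y + β)x) BAᵀ,
-- hence the Cauchy identity for the plane partition sums.  At β = 0 all these families are
-- triangular with diagonal entries powers of 2, so by induction on the power of β their members are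
-- independent.  Therefore gp and gq are the plane partition sums, which are symmetric because
-- the kernel is.  Splitting the letters of a plane partition into small and large ones is the
-- branching rule, and independence once more identifies the skew functions.

module Submission where

open import Defs
open import Algebra.Bundles using (CommutativeRing)
import Algebra.Solver.Ring
open import Algebra.Solver.Ring.AlmostCommutativeRing using (fromCommutativeRing; _-Raw-AlmostCommutative⟶_)
open import Data.Bool using (Bool; true; false; if_then_else_; _∧_; T; _∨_; not)
open import Data.Bool.ListAction using (all; any)
import Data.Bool.Properties as BP
open import Data.Empty using (⊥-elim)
open import Data.Fin using (Fin; zero; suc; #_)
open import Data.Integer as ℤ using (ℤ; +_; -[1+_]; _⊖_)
import Data.Integer.Properties as ZP
open import Data.List using (List; []; _∷_; _++_; map; concatMap; foldr; allFin; upTo; applyUpTo; zipWith; length; zip; filter; deduplicate; reverse; downFrom; replicate)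
open import Data.List.Membership.Propositional using (_∈_)
open import Data.List.Membership.Propositional.Properties using (∈-allFin)
import Data.List.Properties as LP
open import Data.List.Relation.Binary.Permutation.Propositional as ↭ using (_↭_; ↭-sym)
open import Data.List.Relation.Binary.Permutation.Propositional.Properties using (↭-reverse; shift; ++⁺; ++⁺ˡ; map⁺; ↭-map-inv; ++⁺ʳ; ++-comm)
open import Data.List.Relation.Unary.All as All using (All; []; _∷_)
import Data.List.Relation.Unary.All.Properties as AllP
open import Data.List.Relation.Unary.AllPairs using ([]; _∷_)
open import Data.List.Relation.Unary.Any using (here; there; Any)
open import Data.List.Relation.Unary.Linked using (Linked; []; [-]; _∷_)
open import Data.List.Relation.Unary.Unique.DecPropositional.Properties using (deduplicate-!)
open import Data.List.Relation.Unary.Unique.Propositional using (Unique)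
open import Data.Maybe using (Maybe; just; nothing; is-just)
open import Data.Nat as ℕ using (ℕ; zero; suc; _≤_; z≤n; s≤s; _<_; _∸_; _≡ᵇ_; _≤ᵇ_; _⊔_)
open import Data.Nat.Induction using (<-rec)
open import Data.Nat.ListAction using (sum)
open import Data.Nat.ListAction.Properties using (sum-↭; sum-++)
import Data.Nat.Properties as NP
open import Data.Product using (_×_; _,_; ∃) renaming (proj₁ to fst; proj₂ to snd)
open import Data.Sum using (inj₁; inj₂; _⊎_)
open import Data.Unit using (tt)
open import Data.Vec as Vec using (Vec; []; _∷_)
import Data.Vec.Properties as VecP
open import Level using (0ℓ)
open import Relation.Binary.PropositionalEquality as P using (_≡_; _≢_)
open import Relation.Nullary using (yes; no)
open import Relation.Nullary.Decidable using (¬?)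
open import Algebra.Properties.CommutativeSemigroup NP.+-commutativeSemigroup using (interchange)

-- The obstacle is that `Row` and `Col` need a state for every number of open rows or columns, so
-- the product B has no finite state space, whereas A is finite from the start. A repeated box is
-- charged -β and a rook box β, so multiplying by rook strips makes states cancel in pairs. Two
-- strips are needed, one for `Row` and one for `Col`. Their product is X at y = 0, where B is the
-- identity; hence a single exchange relation, used once at y and once at 0, suffices. That relation
-- does not close on its own under reading letters. It is one member of a finite family that does,
-- and membership is a list of polynomial identities decided by normal forms. Words of n bits
-- truncate the sum over all λ. Every identity between transfer matrices is therefore accompanied by
-- an error whose degree in x is bounded below by the number of leading zeros of a word. With n =
-- |a| the accumulated error has x-degree beyond |a| and cannot be seen at x^a. Denominators stay
-- multiplied out until the kernel is compared, because only there are they known to be units.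

module RingKit (R : CommutativeRing 0ℓ 0ℓ) where
  open CommutativeRing R public hiding (zero)
  open import Algebra.Properties.Ring ring public using (-‿distribˡ-*; -‿distribʳ-*; -0#≈0#; -‿involutive)
  open import Algebra.Properties.AbelianGroup +-abelianGroup public using () renaming (⁻¹-∙-comm to -‿+-comm)
  open import Relation.Binary.Reasoning.Setoid setoid public

  -- The separate clause for 1 makes the image of `+ 1` the unit by computation. The solver constant
  -- `:1` then denotes `1#` itself, and `1-homo` is `refl`.
  fromℕ : ℕ → Carrier
  fromℕ 0 = 0#
  fromℕ 1 = 1#
  fromℕ (suc (suc n)) = 1# + fromℕ (suc n)

  fromℤ : ℤ → Carrier
  fromℤ (+ n) = fromℕ n
  fromℤ -[1+ n ] = - fromℕ (suc n)

  fromℕ-suc : ∀ n → fromℕ (suc n) ≈ 1# + fromℕ n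
  fromℕ-suc zero = sym (+-identityʳ 1#)
  fromℕ-suc (suc n) = refl

  fromℕ-+ : ∀ m n → fromℕ (m ℕ.+ n) ≈ fromℕ m + fromℕ n
  fromℕ-+ zero n = sym (+-identityˡ _)
  fromℕ-+ (suc m) n = begin
    fromℕ (suc (m ℕ.+ n)) ≈⟨ fromℕ-suc (m ℕ.+ n) ⟩
    1# + fromℕ (m ℕ.+ n) ≈⟨ +-congˡ (fromℕ-+ m n) ⟩
    1# + (fromℕ m + fromℕ n) ≈⟨ sym (+-assoc _ _ _) ⟩
    1# + fromℕ m + fromℕ n ≈⟨ +-congʳ (sym (fromℕ-suc m)) ⟩
    fromℕ (suc m) + fromℕ n ∎

  fromℕ-* : ∀ m n → fromℕ (m ℕ.* n) ≈ fromℕ m * fromℕ n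
  fromℕ-* zero n = sym (zeroˡ _)
  fromℕ-* (suc m) n = begin
    fromℕ (n ℕ.+ m ℕ.* n) ≈⟨ fromℕ-+ n (m ℕ.* n) ⟩
    fromℕ n + fromℕ (m ℕ.* n) ≈⟨ +-cong (sym (*-identityˡ _)) (fromℕ-* m n) ⟩
    1# * fromℕ n + fromℕ m * fromℕ n ≈⟨ sym (distribʳ _ _ _) ⟩
    (1# + fromℕ m) * fromℕ n ≈⟨ *-congʳ (sym (fromℕ-suc m)) ⟩
    fromℕ (suc m) * fromℕ n ∎

  fromℤ-⊖ : ∀ m n → fromℤ (m ⊖ n) ≈ fromℕ m - fromℕ n
  fromℤ-⊖ m zero = trans (sym (+-identityʳ _)) (+-congˡ (sym -0#≈0#))
  fromℤ-⊖ zero (suc n) = sym (+-identityˡ _)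
  fromℤ-⊖ (suc m) (suc n) = begin
    fromℤ (suc m ⊖ suc n) ≡⟨ P.cong fromℤ (ZP.[1+m]⊖[1+n]≡m⊖n m n) ⟩
    fromℤ (m ⊖ n) ≈⟨ fromℤ-⊖ m n ⟩
    fromℕ m - fromℕ n ≈⟨ sym (+-congʳ (trans (+-congʳ (+-comm _ _)) (trans (+-assoc _ _ _) (trans (+-congˡ (-‿inverseʳ _)) (+-identityʳ _))))) ⟩
    1# + fromℕ m - 1# - fromℕ n ≈⟨ trans (+-assoc _ _ _) (+-congˡ (-‿+-comm _ _)) ⟩
    1# + fromℕ m - (1# + fromℕ n) ≈⟨ +-cong (sym (fromℕ-suc m)) (-‿cong (sym (fromℕ-suc n))) ⟩
    fromℕ (suc m) - fromℕ (suc n) ∎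

  fromℤ-neg : ∀ i → fromℤ (ℤ.- i) ≈ - fromℤ i
  fromℤ-neg (+ zero) = sym -0#≈0#
  fromℤ-neg (+ suc n) = refl
  fromℤ-neg -[1+ n ] = sym (-‿involutive _)

  fromℤ-+ : ∀ i j → fromℤ (i ℤ.+ j) ≈ fromℤ i + fromℤ j
  fromℤ-+ (+ m) (+ n) = fromℕ-+ m n
  fromℤ-+ (+ m) -[1+ n ] = fromℤ-⊖ m (suc n)
  fromℤ-+ -[1+ m ] (+ n) = trans (fromℤ-⊖ n (suc m)) (+-comm _ _)
  fromℤ-+ -[1+ m ] -[1+ n ] = begin
    - fromℕ (suc (suc (m ℕ.+ n))) ≡⟨ P.cong (λ k → - fromℕ k) (P.sym (NP.+-suc (suc m) n)) ⟩
    - fromℕ (suc m ℕ.+ suc n) ≈⟨ -‿cong (fromℕ-+ (suc m) (suc n)) ⟩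
    - (fromℕ (suc m) + fromℕ (suc n)) ≈⟨ sym (-‿+-comm _ _) ⟩
    - fromℕ (suc m) - fromℕ (suc n) ∎
    where import Data.Nat.Properties as NP

  fromℤ-* : ∀ i j → fromℤ (i ℤ.* j) ≈ fromℤ i * fromℤ j
  fromℤ-* (+ m) (+ n) = trans (reflexive (P.cong fromℤ (P.sym (ZP.pos-* m n)))) (fromℕ-* m n)
  fromℤ-* (+ m) -[1+ n ] = begin
    fromℤ (+ m ℤ.* -[1+ n ]) ≡⟨ P.cong fromℤ (P.sym (ZP.neg-distribʳ-* (+ m) (+ suc n))) ⟩
    fromℤ (ℤ.- (+ m ℤ.* + suc n)) ≈⟨ fromℤ-neg (+ m ℤ.* + suc n) ⟩
    - fromℤ (+ m ℤ.* + suc n) ≈⟨ -‿cong (fromℤ-* (+ m) (+ suc n)) ⟩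
    - (fromℕ m * fromℕ (suc n)) ≈⟨ -‿distribʳ-* _ _ ⟩
    fromℕ m * - fromℕ (suc n) ∎
  fromℤ-* -[1+ m ] (+ n) = begin
    fromℤ (-[1+ m ] ℤ.* + n) ≡⟨ P.cong fromℤ (P.sym (ZP.neg-distribˡ-* (+ suc m) (+ n))) ⟩
    fromℤ (ℤ.- (+ suc m ℤ.* + n)) ≈⟨ fromℤ-neg (+ suc m ℤ.* + n) ⟩
    - fromℤ (+ suc m ℤ.* + n) ≈⟨ -‿cong (fromℤ-* (+ suc m) (+ n)) ⟩
    - (fromℕ (suc m) * fromℕ n) ≈⟨ -‿distribˡ-* _ _ ⟩
    - fromℕ (suc m) * fromℕ n ∎
  fromℤ-* -[1+ m ] -[1+ n ] = begin
    fromℕ (suc m ℕ.* suc n) ≈⟨ fromℕ-* (suc m) (suc n) ⟩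
    fromℕ (suc m) * fromℕ (suc n) ≈⟨ sym (-‿involutive _) ⟩
    - (- (fromℕ (suc m) * fromℕ (suc n))) ≈⟨ -‿cong (-‿distribˡ-* _ _) ⟩
    - (- fromℕ (suc m) * fromℕ (suc n)) ≈⟨ -‿distribʳ-* _ _ ⟩
    - fromℕ (suc m) * - fromℕ (suc n) ∎

  ℤ⟶R : CommutativeRing.rawRing ZP.+-*-commutativeRing -Raw-AlmostCommutative⟶ fromCommutativeRing R
  ℤ⟶R = record
    { ⟦_⟧ = fromℤ ; +-homo = fromℤ-+ ; *-homo = fromℤ-* ; -‿homo = fromℤ-neg
    ; 0-homo = refl ; 1-homo = refl }

  coeff≟ : ∀ i j → Maybe (fromℤ i ≈ fromℤ j)
  coeff≟ i j with i ℤ.≟ j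
  ... | yes i≡j = just (reflexive (P.cong fromℤ i≡j))
  ... | no _ = nothing

  module Sol = Algebra.Solver.Ring (CommutativeRing.rawRing ZP.+-*-commutativeRing) (fromCommutativeRing R) ℤ⟶R coeff≟
  open Sol public using (solve; _:=_; _:+_; _:*_; :-_; _:-_; con)

  :0 :1 : ∀ {n} → Sol.Polynomial n
  :0 = con (+ 0)
  :1 = con (+ 1)

  -- The shape to which a sum over the three automaton states unfolds, including the trailing zero
  -- of `∑`; most solver calls below collapse such sums.
  :lin : ∀ {n} (p a q b r c : Sol.Polynomial n) → Sol.Polynomial n
  :lin p a q b r c = p :* a :+ (q :* b :+ (r :* c :+ :0))

  resp : ∀ {A : Set} (f : A → Carrier) {a b} → a ≡ b → f a ≈ f b
  resp f e = reflexive (P.cong f e)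

  pw : Carrier → ℕ → Carrier
  pw z zero = 1#
  pw z (suc n) = z * pw z n

  ι : Bool → Carrier
  ι true = 1#
  ι false = 0#

  ι-∧ : ∀ a b → ι (a ∧ b) ≈ ι a * ι b
  ι-∧ true b = sym (*-identityˡ _)
  ι-∧ false b = sym (zeroˡ _)

  ∑ : {A : Set} → List A → (A → Carrier) → Carrier
  ∑ [] f = 0#
  ∑ (a ∷ as) f = f a + ∑ as f

  ∏ : {A : Set} → List A → (A → Carrier) → Carrier
  ∏ [] f = 1#
  ∏ (a ∷ as) f = f a * ∏ as f

  module _ {A : Set} where
    ∑-cong : ∀ (as : List A) {f g} → (∀ a → f a ≈ g a) → ∑ as f ≈ ∑ as g
    ∑-cong [] e = refl
    ∑-cong (a ∷ as) e = +-cong (e a) (∑-cong as e)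

    ∑-zero : ∀ (as : List A) → ∑ as (λ _ → 0#) ≈ 0#
    ∑-zero [] = refl
    ∑-zero (a ∷ as) = trans (+-identityˡ _) (∑-zero as)

    ∑-+ : ∀ (as : List A) f g → ∑ as (λ a → f a + g a) ≈ ∑ as f + ∑ as g
    ∑-+ [] f g = sym (+-identityˡ _)
    ∑-+ (a ∷ as) f g = trans (+-congˡ (∑-+ as f g))
      (solve 4 (λ p q r s → p :+ q :+ (r :+ s) := p :+ r :+ (q :+ s)) refl _ _ _ _)

    ∑-*ˡ : ∀ c (as : List A) f → c * ∑ as f ≈ ∑ as (λ a → c * f a)
    ∑-*ˡ c [] f = zeroʳ c
    ∑-*ˡ c (a ∷ as) f = trans (distribˡ _ _ _) (+-congˡ (∑-*ˡ c as f))

    ∑-*ʳ : ∀ c (as : List A) f → ∑ as f * c ≈ ∑ as (λ a → f a * c)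
    ∑-*ʳ c [] f = zeroˡ c
    ∑-*ʳ c (a ∷ as) f = trans (distribʳ _ _ _) (+-congˡ (∑-*ʳ c as f))

    ∑-++ : ∀ (as bs : List A) f → ∑ (as ++ bs) f ≈ ∑ as f + ∑ bs f
    ∑-++ [] bs f = sym (+-identityˡ _)
    ∑-++ (a ∷ as) bs f = trans (+-congˡ (∑-++ as bs f)) (sym (+-assoc _ _ _))

    ∑-filterB : ∀ p (as : List A) f → ∑ (filterB p as) f ≈ ∑ as (λ a → ι (p a) * f a)
    ∑-filterB p [] f = refl
    ∑-filterB p (a ∷ as) f with p a
    ... | true = +-cong (sym (*-identityˡ _)) (∑-filterB p as f)
    ... | false = trans (∑-filterB p as f) (trans (sym (+-identityˡ _)) (+-congʳ (sym (zeroˡ _))))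

    ∏-cong : ∀ (as : List A) {f g} → (∀ a → f a ≈ g a) → ∏ as f ≈ ∏ as g
    ∏-cong [] e = refl
    ∏-cong (a ∷ as) e = *-cong (e a) (∏-cong as e)

    ∏-++ : ∀ (as bs : List A) f → ∏ (as ++ bs) f ≈ ∏ as f * ∏ bs f
    ∏-++ [] bs f = sym (*-identityˡ _)
    ∏-++ (a ∷ as) bs f = trans (*-congˡ (∏-++ as bs f)) (sym (*-assoc _ _ _))

    ∏-* : ∀ (as : List A) f g → ∏ as (λ a → f a * g a) ≈ ∏ as f * ∏ as g
    ∏-* [] f g = sym (*-identityˡ _)
    ∏-* (a ∷ as) f g = trans (*-congˡ (∏-* as f g))
      (solve 4 (λ p q r s → p :* q :* (r :* s) := p :* r :* (q :* s)) refl _ _ _ _)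

  ∑-swap : ∀ {A B : Set} (as : List A) (bs : List B) (f : A → B → Carrier) →
    ∑ as (λ a → ∑ bs (f a)) ≈ ∑ bs (λ b → ∑ as (λ a → f a b))
  ∑-swap [] bs f = sym (∑-zero bs)
  ∑-swap (a ∷ as) bs f = trans (+-congˡ (∑-swap as bs f)) (sym (∑-+ bs (f a) (λ b → ∑ as (λ a′ → f a′ b))))

  ∑-map : ∀ {A B : Set} (h : A → B) as f → ∑ (map h as) f ≈ ∑ as (λ a → f (h a))
  ∑-map h [] f = refl
  ∑-map h (a ∷ as) f = +-congˡ (∑-map h as f)

  ∏-map : ∀ {A B : Set} (h : A → B) as f → ∏ (map h as) f ≈ ∏ as (λ a → f (h a))
  ∏-map h [] f = refl
  ∏-map h (a ∷ as) f = *-congˡ (∏-map h as f)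

  ∑-concatMap : ∀ {A B : Set} (h : A → List B) as f → ∑ (concatMap h as) f ≈ ∑ as (λ a → ∑ (h a) f)
  ∑-concatMap h [] f = refl
  ∑-concatMap h (a ∷ as) f = trans (∑-++ (h a) _ f) (+-congˡ (∑-concatMap h as f))

  Σᵇ : ∀ n → (Vec Bool n → Carrier) → Carrier
  Σᵇ zero f = f []
  Σᵇ (suc n) f = Σᵇ n (λ s → f (false ∷ s)) + Σᵇ n (λ s → f (true ∷ s))

  Σᵇ-cong : ∀ n {f g} → (∀ s → f s ≈ g s) → Σᵇ n f ≈ Σᵇ n g
  Σᵇ-cong zero e = e []
  Σᵇ-cong (suc n) e = +-cong (Σᵇ-cong n (λ s → e _)) (Σᵇ-cong n (λ s → e _))

  Σᵇ-+ : ∀ n f g → Σᵇ n (λ s → f s + g s) ≈ Σᵇ n f + Σᵇ n g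
  Σᵇ-+ zero f g = refl
  Σᵇ-+ (suc n) f g = trans (+-cong (Σᵇ-+ n _ _) (Σᵇ-+ n _ _))
    (solve 4 (λ p q r s → p :+ q :+ (r :+ s) := p :+ r :+ (q :+ s)) refl _ _ _ _)

  Σᵇ-*ˡ : ∀ n c f → Σᵇ n (λ s → c * f s) ≈ c * Σᵇ n f
  Σᵇ-*ˡ zero c f = refl
  Σᵇ-*ˡ (suc n) c f = trans (+-cong (Σᵇ-*ˡ n c _) (Σᵇ-*ˡ n c _)) (sym (distribˡ _ _ _))

  Σᵇ-*ʳ : ∀ n c f → Σᵇ n (λ s → f s * c) ≈ Σᵇ n f * c
  Σᵇ-*ʳ zero c f = refl
  Σᵇ-*ʳ (suc n) c f = trans (+-cong (Σᵇ-*ʳ n c _) (Σᵇ-*ʳ n c _)) (sym (distribʳ _ _ _))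

  Σᵇ-zero : ∀ n {f} → (∀ s → f s ≈ 0#) → Σᵇ n f ≈ 0#
  Σᵇ-zero zero e = e []
  Σᵇ-zero (suc n) e = trans (+-cong (Σᵇ-zero n (λ s → e _)) (Σᵇ-zero n (λ s → e _))) (+-identityˡ _)

  Σᵇ-swap : ∀ m n (f : Vec Bool m → Vec Bool n → Carrier) →
    Σᵇ m (λ s → Σᵇ n (f s)) ≈ Σᵇ n (λ t → Σᵇ m (λ s → f s t))
  Σᵇ-swap zero n f = refl
  Σᵇ-swap (suc m) n f = trans (+-cong (Σᵇ-swap m n _) (Σᵇ-swap m n _)) (sym (Σᵇ-+ n (λ t → Σᵇ m (λ s → f (false ∷ s) t)) (λ t → Σᵇ m (λ s → f (true ∷ s) t))))

  Σᵇ-∑ : ∀ {A : Set} n (as : List A) (f : Vec Bool n → A → Carrier) →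
    Σᵇ n (λ s → ∑ as (f s)) ≈ ∑ as (λ a → Σᵇ n (λ s → f s a))
  Σᵇ-∑ n [] f = Σᵇ-zero n (λ _ → refl)
  Σᵇ-∑ n (a ∷ as) f = trans (Σᵇ-+ n _ _) (+-congˡ (Σᵇ-∑ n as f))

-- Weighted automata reading pairs of words

all-∈ : {A : Set} (p : A → Bool) (as : List A) → T (all p as) → ∀ {a} → a ∈ as → T (p a)
all-∈ p (b ∷ as) h (here P.refl) with p b
... | true = tt
all-∈ p (b ∷ as) h (there i) with p b
... | true = all-∈ p as h i

-- Linear automata with weights in ℤ[β, x, y], reading pairs of letters, and
-- linear relations between two of them that every letter preserves.
module Automata (R : CommutativeRing 0ℓ 0ℓ) (ρ : Vec (CommutativeRing.Carrier R) 3) where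
  open RingKit R

  Poly : Set
  Poly = Sol.Polynomial 3

  ⟪_⟫ : Poly → Carrier
  ⟪ p ⟫ = Sol.⟦ p ⟧ ρ

  sumP : {A : Set} → List A → (A → Poly) → Poly
  sumP [] f = :0
  sumP (a ∷ as) f = f a :+ sumP as f

  sumP-sem : ∀ {A : Set} (as : List A) f → ⟪ sumP as f ⟫ ≈ ∑ as (λ a → ⟪ f a ⟫)
  sumP-sem [] f = refl
  sumP-sem (a ∷ as) f = +-congˡ (sumP-sem as f)

  -- Comparing normal forms turns a polynomial identity into a computation. The large tables of
  -- identities below are then proved by `tt`.
  eqP : Poly → Poly → Bool
  eqP p q = is-just (Sol.normalise p Sol.≟N Sol.normalise q)

  eqP-sound : ∀ p q → T (eqP p q) → ⟪ p ⟫ ≈ ⟪ q ⟫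
  eqP-sound p q h with Sol.normalise p Sol.≟N Sol.normalise q
  ... | just e = trans (sym (Sol.correct p ρ)) (trans (Sol.⟦ e ⟧N-cong ρ) (Sol.correct q ρ))

  Trans : Set → Set
  Trans Q = Q → Bool → Bool → Q → Poly

  Values : Set → Set
  Values Q = Q → ∀ {n} → Vec Bool n → Vec Bool n → Carrier

  -- A property rather than a construction, because products and transposes obey such a recursion
  -- without having the form `val`.
  Runs : {Q : Set} → List Q → Trans Q → Values Q → Set
  Runs qs w f = ∀ q {n} a b (s t : Vec Bool n) →
    f q (a ∷ s) (b ∷ t) ≈ ∑ qs (λ q′ → ⟪ w q a b q′ ⟫ * f q′ s t)

  val : {Q : Set} → List Q → Trans Q → (Q → Poly) → Values Q
  val qs w φ q [] [] = ⟪ φ q ⟫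
  val qs w φ q (a ∷ s) (b ∷ t) = ∑ qs (λ q′ → ⟪ w q a b q′ ⟫ * val qs w φ q′ s t)

  flip-runs : {Q : Set} (qs : List Q) (w : Trans Q) (f : Values Q) → Runs qs w f →
    Runs qs (λ q a b → w q b a) (λ q s t → f q t s)
  flip-runs qs w f r q a b s t = r q b a t s

  prodT : {P Q : Set} → Trans P → Trans Q → Trans (P × Q)
  prodT v w (p , q) a b (p′ , q′) = v p false a p′ :* w q false b q′ :+ v p true a p′ :* w q true b q′

  pairs : {P Q : Set} → List P → List Q → List (P × Q)
  pairs [] qs = []
  pairs (p ∷ ps) qs = Data.List.map (p ,_) qs Data.List.++ pairs ps qs

  ∑-pairs : {P Q : Set} (ps : List P) (qs : List Q) (f : P × Q → Carrier) →
    ∑ (pairs ps qs) f ≈ ∑ ps (λ p → ∑ qs (λ q → f (p , q)))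
  ∑-pairs [] qs f = refl
  ∑-pairs (p ∷ ps) qs f = trans (∑-++ (Data.List.map (p ,_) qs) _ f) (+-cong (∑-map (p ,_) qs f) (∑-pairs ps qs f))

  -- The summed word is the first argument of both factors, so this is the matrix product of the
  -- transpose of f with g. Other products are obtained by flipping the arguments of a factor.
  prodV : {P Q : Set} → Values P → Values Q → Values (P × Q)
  prodV f g (p , q) {n} s t = Σᵇ n (λ k → f p k s * g q k t)

  prod-runs : {P Q : Set} (ps : List P) (qs : List Q) (v : Trans P) (w : Trans Q) (f : Values P) (g : Values Q) →
    Runs ps v f → Runs qs w g → Runs (pairs ps qs) (prodT v w) (prodV f g)
  prod-runs ps qs v w f g rf rg (p , q) {n} a b s t = begin
    Σᵇ n (λ k → f p (false ∷ k) (a ∷ s) * g q (false ∷ k) (b ∷ t)) + Σᵇ n (λ k → f p (true ∷ k) (a ∷ s) * g q (true ∷ k) (b ∷ t))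
      ≈⟨ +-cong (half false) (half true) ⟩
    ∑ ps (λ p′ → ∑ qs (λ q′ → c false p′ q′ * K p′ q′)) + ∑ ps (λ p′ → ∑ qs (λ q′ → c true p′ q′ * K p′ q′))
      ≈⟨ sym (∑-+ ps _ _) ⟩
    ∑ ps (λ p′ → ∑ qs (λ q′ → c false p′ q′ * K p′ q′) + ∑ qs (λ q′ → c true p′ q′ * K p′ q′))
      ≈⟨ ∑-cong ps (λ p′ → trans (sym (∑-+ qs _ _)) (∑-cong qs (λ q′ → sym (distribʳ _ _ _)))) ⟩
    ∑ ps (λ p′ → ∑ qs (λ q′ → (c false p′ q′ + c true p′ q′) * K p′ q′))
      ≈⟨ sym (∑-pairs ps qs _) ⟩
    ∑ (pairs ps qs) (λ r → ⟪ prodT v w (p , q) a b r ⟫ * prodV f g r s t) ∎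
    where
    K = λ p′ q′ → prodV f g (p′ , q′) s t
    c = λ l p′ q′ → ⟪ v p l a p′ ⟫ * ⟪ w q l b q′ ⟫
    half : ∀ l → Σᵇ n (λ k → f p (l ∷ k) (a ∷ s) * g q (l ∷ k) (b ∷ t)) ≈ ∑ ps (λ p′ → ∑ qs (λ q′ → c l p′ q′ * K p′ q′))
    half l = begin
      Σᵇ n (λ k → f p (l ∷ k) (a ∷ s) * g q (l ∷ k) (b ∷ t))
        ≈⟨ Σᵇ-cong n (λ k → trans (*-cong (rf p l a k s) (rg q l b k t))
             (trans (∑-*ʳ _ ps _) (∑-cong ps (λ p′ → trans (∑-*ˡ _ qs _) (∑-cong qs (λ q′ →
               solve 4 (λ x y z u → (x :* y) :* (z :* u) := (x :* z) :* (y :* u)) refl _ _ _ _)))))) ⟩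
      Σᵇ n (λ k → ∑ ps (λ p′ → ∑ qs (λ q′ → c l p′ q′ * (f p′ k s * g q′ k t))))
        ≈⟨ trans (Σᵇ-∑ n ps _) (∑-cong ps (λ p′ → trans (Σᵇ-∑ n qs _) (∑-cong qs (λ q′ → Σᵇ-*ˡ n _ _)))) ⟩
      ∑ ps (λ p′ → ∑ qs (λ q′ → c l p′ q′ * K p′ q′)) ∎

  letters : List (Bool × Bool)
  letters = (false , false) ∷ (true , false) ∷ (false , true) ∷ (true , true) ∷ []

  letters-all : ∀ a b → (a , b) ∈ letters
  letters-all false false = here P.refl
  letters-all true false = there (here P.refl)
  letters-all false true = there (there (here P.refl))
  letters-all true true = there (there (there (here P.refl)))

  -- The rows of `l` and of `r` are linear forms in the states of the two automata. If for every
  -- letter pair both transition matrices act on these rows through the same matrix C, the two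
  -- pairings satisfy one and the same recursion. Agreement on the empty words then gives agreement
  -- everywhere.
  module Intertwine {P Q I : Set} (ps : List P) (qs : List Q) (is : List I)
      (all-ps : ∀ p → p ∈ ps) (all-qs : ∀ q → q ∈ qs) (all-is : ∀ i → i ∈ is)
      (l : I → P → Poly) (r : I → Q → Poly) (C : Bool → Bool → I → I → Poly) where

    pulled pushed : {S : Set} → List S → Trans S → (I → S → Poly) → Bool → Bool → I → S → Poly
    pulled ss w h a b i s = sumP ss (λ s₀ → h i s₀ :* w s₀ a b s)
    pushed ss w h a b i s = sumP is (λ j → C a b i j :* h j s)

    entryB : {S : Set} → List S → Trans S → (I → S → Poly) → Bool × Bool → I → S → Bool
    entryB ss w h (a , b) i s = eqP (pulled ss w h a b i s) (pushed ss w h a b i s)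

    rowB : {S : Set} → List S → Trans S → (I → S → Poly) → Bool × Bool → I → Bool
    rowB ss w h ab i = all (entryB ss w h ab i) ss

    letterB : {S : Set} → List S → Trans S → (I → S → Poly) → Bool × Bool → Bool
    letterB ss w h ab = all (rowB ss w h ab) is

    preservesB : {S : Set} → List S → Trans S → (I → S → Poly) → Bool
    preservesB ss w h = all (letterB ss w h) letters

    preserved : {S : Set} (ss : List S) → (∀ s → s ∈ ss) → (w : Trans S) (h : I → S → Poly) →
      T (preservesB ss w h) → ∀ a b i s → ⟪ pulled ss w h a b i s ⟫ ≈ ⟪ pushed ss w h a b i s ⟫
    preserved ss all-ss w h ok a b i s = eqP-sound (pulled ss w h a b i s) (pushed ss w h a b i s)
      (all-∈ (entryB ss w h (a , b) i) ss
        (all-∈ (rowB ss w h (a , b)) is (all-∈ (letterB ss w h) letters ok (letters-all a b)) (all-is i)) (all-ss s))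

    pairing : {S : Set} → List S → (I → S → Poly) → Values S → I → ∀ {n} → Vec Bool n → Vec Bool n → Carrier
    pairing ss h f i s t = ∑ ss (λ p → ⟪ h i p ⟫ * f p s t)

    step : {S : Set} (ss : List S) → (∀ s → s ∈ ss) → (w : Trans S) (h : I → S → Poly) (f : Values S) → Runs ss w f →
      T (preservesB ss w h) → ∀ i {n} a b (s t : Vec Bool n) →
      pairing ss h f i (a ∷ s) (b ∷ t) ≈ ∑ is (λ j → ⟪ C a b i j ⟫ * pairing ss h f j s t)
    step ss all-ss w h f rf ok i a b s t = begin
      ∑ ss (λ p → ⟪ h i p ⟫ * f p (a ∷ s) (b ∷ t))
        ≈⟨ ∑-cong ss (λ p → trans (*-congˡ (rf p a b s t)) (trans (∑-*ˡ _ ss _) (∑-cong ss (λ p′ → sym (*-assoc _ _ _))))) ⟩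
      ∑ ss (λ p → ∑ ss (λ p′ → ⟪ h i p ⟫ * ⟪ w p a b p′ ⟫ * f p′ s t))
        ≈⟨ ∑-swap ss ss _ ⟩
      ∑ ss (λ p′ → ∑ ss (λ p → ⟪ h i p ⟫ * ⟪ w p a b p′ ⟫ * f p′ s t))
        ≈⟨ ∑-cong ss (λ p′ → trans (sym (∑-*ʳ _ ss _)) (trans (*-congʳ (trans (sym (sumP-sem ss (λ p → h i p :* w p a b p′)))
             (trans (preserved ss all-ss w h ok a b i p′) (sumP-sem is (λ j → C a b i j :* h j p′)))))
             (trans (∑-*ʳ _ is _) (∑-cong is (λ j → *-assoc _ _ _))))) ⟩
      ∑ ss (λ p′ → ∑ is (λ j → ⟪ C a b i j ⟫ * (⟪ h j p′ ⟫ * f p′ s t)))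
        ≈⟨ ∑-swap ss is _ ⟩
      ∑ is (λ j → ∑ ss (λ p′ → ⟪ C a b i j ⟫ * (⟪ h j p′ ⟫ * f p′ s t)))
        ≈⟨ ∑-cong is (λ j → sym (∑-*ˡ _ ss _)) ⟩
      ∑ is (λ j → ⟪ C a b i j ⟫ * pairing ss h f j s t) ∎

    intertwine : (v : Trans P) (f : Values P) → Runs ps v f → (w : Trans Q) (g : Values Q) → Runs qs w g →
      T (preservesB ps v l) → T (preservesB qs w r) →
      (∀ i → pairing ps l f i [] [] ≈ pairing qs r g i [] []) →
      ∀ i {n} (s t : Vec Bool n) → pairing ps l f i s t ≈ pairing qs r g i s t
    intertwine v f rf w g rg okl okr fin i [] [] = fin i
    intertwine v f rf w g rg okl okr fin i (a ∷ s) (b ∷ t) =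
      trans (step ps all-ps v l f rf okl i a b s t)
        (trans (∑-cong is (λ j → *-congˡ (intertwine v f rf w g rg okl okr fin j s t)))
          (sym (step qs all-qs w r g rg okr i a b s t)))

-- Transfer automata for one variable

data St : Set where
  s₀ s₁ s₂ : St

sts : List St
sts = s₀ ∷ s₁ ∷ s₂ ∷ []

sts-all : ∀ q → q ∈ sts
sts-all s₀ = here P.refl
sts-all s₁ = there (here P.refl)
sts-all s₂ = there (there (here P.refl))

module Tables (R : CommutativeRing 0ℓ 0ℓ) where
  open RingKit R
  private
    Poly : Set
    Poly = Sol.Polynomial 3

    Trans : Set → Set
    Trans Q = Q → Bool → Bool → Q → Poly

  -- `ξ′` is the weight of a corner box that may or may not receive the letter in addition to its
  -- other entries. `u′` joins two ways of opening a row: an honest row, charged y, or a rook box,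
  -- charged β. `υ′` is the numerator of the kernel.
  b′ x′ y′ u′ ξ′ υ′ 𝟘 𝟙 𝟚 : Poly
  b′ = Sol.var (# 0)
  x′ = Sol.var (# 1)
  y′ = Sol.var (# 2)
  𝟘 = :0
  𝟙 = :1
  𝟚 = con (+ 2)
  u′ = y′ :+ b′
  ξ′ = 𝟙 :+ b′ :* x′
  υ′ = 𝟙 :+ u′ :* x′

  δ : St → St → Poly
  δ s₀ s₀ = 𝟙
  δ s₁ s₁ = 𝟙
  δ s₂ s₂ = 𝟙
  δ _ _ = 𝟘

  -- Letters are (λ_p , μ_p), where λ_p tells whether p is a part of λ, read from
  -- the largest p down.  In state s₁ one more part of λ than of μ has been read;
  -- s₂ remembers that the last letter was (1 , 1).
  vW hW aW xW : Trans St
  vW s₀ false false s₀ = 𝟙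
  vW s₀ true false s₁ = 𝟙
  vW s₀ true true s₂ = 𝟙
  vW s₁ false true s₀ = x′
  vW s₁ true true s₁ = x′
  vW s₂ false false s₀ = ξ′
  vW s₂ true false s₁ = ξ′
  vW s₂ true true s₂ = 𝟙
  vW _ _ _ _ = 𝟘

  hW s₀ false false s₀ = 𝟙
  hW s₀ true false s₁ = 𝟙
  hW s₀ true true s₂ = 𝟙
  hW s₁ false false s₁ = x′
  hW s₁ false true s₂ = x′
  hW s₂ false false s₀ = ξ′
  hW s₂ true false s₁ = 𝟙
  hW s₂ true true s₂ = 𝟙
  hW _ _ _ _ = 𝟘

  aW s₀ false false s₀ = 𝟙
  aW s₀ true false s₁ = 𝟙
  aW s₀ true true s₂ = 𝟙
  aW s₁ false false s₁ = x′
  aW s₁ false true s₀ = x′ :* ξ′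
  aW s₁ false true s₂ = x′
  aW s₁ true true s₁ = x′
  aW s₂ false false s₀ = ξ′ :* ξ′
  aW s₂ true false s₁ = ξ′
  aW s₂ true true s₂ = 𝟙
  aW _ _ _ _ = 𝟘

  xW s₀ false false s₀ = 𝟙
  xW s₀ true false s₁ = 𝟙
  xW s₀ true false s₂ = 𝟙
  xW s₀ true true s₀ = 𝟙
  xW s₁ false false s₁ = y′
  xW s₁ false false s₂ = u′
  xW s₁ false true s₀ = u′
  xW s₂ false true s₀ = u′
  xW s₂ true true s₁ = u′
  xW s₂ true true s₂ = y′
  xW _ _ _ _ = 𝟘

  -- The argument P? is true for the pair (GP , gq) and false for (GQ , gp).
  vF hF aF xF : Bool → St → Poly
  vF P? s₀ = 𝟙
  vF P? s₁ = if P? then 𝟘 else x′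
  vF P? s₂ = if P? then 𝟙 else ξ′
  hF P? s₀ = 𝟙
  hF P? s₁ = x′
  hF P? s₂ = ξ′
  aF P? s₀ = 𝟙
  aF P? s₁ = if P? then x′ else x′ :* (𝟙 :+ ξ′)
  aF P? s₂ = if P? then ξ′ else ξ′ :* ξ′
  xF P? s₀ = 𝟙
  xF P? s₁ = u′
  xF P? s₂ = if P? then u′ else 𝟘

  -- All tables are evaluated at a common triple (β , x , y), and one computation uses several
  -- values of y. This syntactic test lets the values of `A` at different y be identified.
  y-free : Poly → Bool
  y-free (Sol.op o p q) = y-free p ∧ y-free q
  y-free (Sol.con c) = true
  y-free (Sol.var zero) = true
  y-free (Sol.var (suc zero)) = true
  y-free (Sol.var (suc (suc i))) = false
  y-free (p Sol.:^ n) = false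
  y-free (Sol.:- p) = y-free p

  y-free-⟦⟧ : ∀ β x y z p → T (y-free p) → Sol.⟦ p ⟧ (β ∷ x ∷ y ∷ []) ≡ Sol.⟦ p ⟧ (β ∷ x ∷ z ∷ [])
  y-free-⟦⟧ β x y z (Sol.op Sol.[+] p q) h with y-free p in e
  ... | true = P.cong₂ _+_ (y-free-⟦⟧ β x y z p (P.subst T (P.sym e) tt)) (y-free-⟦⟧ β x y z q h)
  y-free-⟦⟧ β x y z (Sol.op Sol.[*] p q) h with y-free p in e
  ... | true = P.cong₂ _*_ (y-free-⟦⟧ β x y z p (P.subst T (P.sym e) tt)) (y-free-⟦⟧ β x y z q h)
  y-free-⟦⟧ β x y z (Sol.con c) h = P.refl
  y-free-⟦⟧ β x y z (Sol.var zero) h = P.refl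
  y-free-⟦⟧ β x y z (Sol.var (suc zero)) h = P.refl
  y-free-⟦⟧ β x y z (Sol.:- p) h = P.cong -_ (y-free-⟦⟧ β x y z p h)

module Transfer (R : CommutativeRing 0ℓ 0ℓ) (β x y : CommutativeRing.Carrier R) where
  open RingKit R
  open Automata R (β ∷ x ∷ y ∷ []) public
  open Tables R public

  V H A X : Bool → Values St
  V P? = val sts vW (vF P?)
  H P? = val sts hW (hF P?)
  A P? = val sts aW (aF P?)
  X P? = val sts xW (xF P?)

  val-runs : ∀ w φ → Runs sts w (val sts w φ)
  val-runs w φ q a b s t = refl

  pairs-all : ∀ q → q ∈ pairs sts sts
  pairs-all (s₀ , s₀) = here P.refl
  pairs-all (s₀ , s₁) = there (here P.refl)
  pairs-all (s₀ , s₂) = there (there (here P.refl))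
  pairs-all (s₁ , s₀) = there (there (there (here P.refl)))
  pairs-all (s₁ , s₁) = there (there (there (there (here P.refl))))
  pairs-all (s₁ , s₂) = there (there (there (there (there (here P.refl)))))
  pairs-all (s₂ , s₀) = there (there (there (there (there (there (here P.refl))))))
  pairs-all (s₂ , s₁) = there (there (there (there (there (there (there (here P.refl)))))))
  pairs-all (s₂ , s₂) = there (there (there (there (there (there (there (there (here P.refl))))))))

  -- The product of `H` and `V` has nine states, but the space spanned by the three forms in `l` is
  -- stable under every letter, and the action on it is the table `aW`.
  module HV where
    l : St → St × St → Poly
    l s₀ (s₀ , s₀) = 𝟙
    l s₁ (s₁ , s₀) = 𝟙
    l s₁ (s₂ , s₁) = 𝟙
    l s₂ (s₂ , s₂) = 𝟙
    l _ _ = 𝟘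

    open Intertwine (pairs sts sts) sts sts pairs-all sts-all sts-all l δ (λ a b i j → aW i a b j) public

    hv : Bool → Values (St × St)
    hv P? = prodV (λ q k s → H P? q s k) (V P?)

    A≈HV′ : ∀ P? i {n} (s t : Vec Bool n) → pairing (pairs sts sts) l (hv P?) i s t ≈ pairing sts δ (A P?) i s t
    A≈HV′ P? = intertwine (prodT (λ q a b → hW q b a) vW) (hv P?)
        (prod-runs sts sts (λ q a b → hW q b a) vW (λ q k s → H P? q s k) (V P?)
          (flip-runs sts hW (H P?) (val-runs hW (hF P?))) (val-runs vW (vF P?)))
        aW (A P?) (val-runs aW (aF P?)) tt tt (fin P?)
      where
      fin : ∀ P? i → pairing (pairs sts sts) l (hv P?) i [] [] ≈ pairing sts δ (A P?) i [] []
      fin P? i = trans (sym (sumP-sem (pairs sts sts) (λ p → l i p :* (hF P? (fst p) :* vF P? (snd p)))))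
        (trans (eqP-sound (sumP (pairs sts sts) (λ p → l i p :* (hF P? (fst p) :* vF P? (snd p)))) (sumP sts (λ p → δ i p :* aF P? p)) (ok P? i))
          (sumP-sem sts (λ p → δ i p :* aF P? p)))
        where
        ok : ∀ P? i → T (eqP (sumP (pairs sts sts) (λ p → l i p :* (hF P? (fst p) :* vF P? (snd p)))) (sumP sts (λ p → δ i p :* aF P? p)))
        ok false s₀ = tt
        ok false s₁ = tt
        ok false s₂ = tt
        ok true s₀ = tt
        ok true s₁ = tt
        ok true s₂ = tt

  A≈HV : ∀ P? {n} (s t : Vec Bool n) → A P? s₀ s t ≈ Σᵇ n (λ k → H P? s₀ s k * V P? s₀ k t)
  A≈HV P? s t = begin
    A P? s₀ s t
      ≈⟨ solve 3 (λ p q r → p := :lin :1 p :0 q :0 r) refl _ _ _ ⟩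
    HV.pairing sts δ (A P?) s₀ s t ≈⟨ sym (HV.A≈HV′ P? s₀ s t) ⟩
    HV.pairing (pairs sts sts) HV.l (HV.hv P?) s₀ s t
      ≈⟨ solve 9 (λ a b c d e f g h i → :1 :* a :+ (:0 :* b :+ (:0 :* c :+ (:0 :* d :+ (:0 :* e
           :+ (:0 :* f :+ (:lin :0 g :0 h :0 i)))))) := a) refl _ _ _ _ _ _ _ _ _ ⟩
    HV.hv P? (s₀ , s₀) s t ∎

  -- With L p q = ∑_λ A_p(λ , μ) X_q(λ , ν) and R p q = ∑_κ A_p(ν , κ) X_q(μ , κ),
  -- the eight relations l i · L = r i · R form a family closed under reading letters;
  -- they were found by closing the first one.
  module AX where
    I : Set
    I = Fin 8

    l : I → St × St → Poly
    l zero (s₀ , s₀) = 𝟙 :- x′ :* y′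
    l zero (s₁ , s₁) = 𝟙
    l zero (s₁ , s₂) = ξ′
    l (suc zero) (s₀ , s₁) = x′ :* y′ :* ξ′
    l (suc zero) (s₀ , s₂) = x′ :* u′ :* ξ′
    l (suc zero) (s₂ , s₁) = 𝟙
    l (suc zero) (s₂ , s₂) = ξ′
    l (suc (suc zero)) (s₁ , s₀) = 𝟙
    l (suc (suc (suc zero))) (s₀ , s₀) = ξ′
    l (suc (suc (suc zero))) (s₁ , s₁) = 𝟙
    l (suc (suc (suc zero))) (s₁ , s₂) = 𝟙
    l (suc (suc (suc zero))) (s₂ , s₀) = 𝟙
    l (suc (suc (suc (suc zero)))) (s₀ , s₁) = y′
    l (suc (suc (suc (suc zero)))) (s₀ , s₂) = u′
    l (suc (suc (suc (suc (suc zero))))) (s₀ , s₀) = 𝟚 :* u′ :+ b′ :* ξ′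
    l (suc (suc (suc (suc (suc zero))))) (s₁ , s₁) = u′ :+ b′
    l (suc (suc (suc (suc (suc zero))))) (s₁ , s₂) = u′
    l (suc (suc (suc (suc (suc (suc zero)))))) (s₂ , s₁) = u′
    l (suc (suc (suc (suc (suc (suc zero)))))) (s₂ , s₂) = y′
    l (suc (suc (suc (suc (suc (suc (suc zero))))))) (s₀ , s₀) = u′ :* (y′ :+ u′)
    l (suc (suc (suc (suc (suc (suc (suc zero))))))) (s₁ , s₁) = u′ :* u′
    l (suc (suc (suc (suc (suc (suc (suc zero))))))) (s₁ , s₂) = u′ :* y′
    l _ _ = 𝟘

    -- indexed by (state of X , state of A)
    r : I → St × St → Poly
    r zero (s₀ , s₀) = ξ′ :* υ′
    r (suc zero) (s₁ , s₀) = ξ′ :* υ′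
    r (suc zero) (s₂ , s₀) = ξ′ :* υ′
    r (suc (suc zero)) (s₀ , s₁) = 𝟙
    r (suc (suc (suc zero))) (s₀ , s₀) = ξ′
    r (suc (suc (suc zero))) (s₁ , s₁) = 𝟙
    r (suc (suc (suc zero))) (s₂ , s₁) = 𝟙
    r (suc (suc (suc zero))) (s₀ , s₂) = 𝟙
    r (suc (suc (suc (suc zero)))) (s₁ , s₀) = y′
    r (suc (suc (suc (suc zero)))) (s₂ , s₀) = u′
    r (suc (suc (suc (suc (suc zero))))) (s₀ , s₀) = b′ :* ξ′
    r (suc (suc (suc (suc (suc zero))))) (s₁ , s₁) = y′
    r (suc (suc (suc (suc (suc zero))))) (s₂ , s₁) = u′
    r (suc (suc (suc (suc (suc zero))))) (s₀ , s₂) = 𝟚 :* u′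
    r (suc (suc (suc (suc (suc (suc zero)))))) (s₁ , s₂) = u′
    r (suc (suc (suc (suc (suc (suc zero)))))) (s₂ , s₂) = y′
    r (suc (suc (suc (suc (suc (suc (suc zero))))))) (s₁ , s₁) = y′ :* y′
    r (suc (suc (suc (suc (suc (suc (suc zero))))))) (s₂ , s₁) = y′ :* u′
    r (suc (suc (suc (suc (suc (suc (suc zero))))))) (s₀ , s₂) = u′ :* (y′ :+ u′)
    r _ _ = 𝟘

    row : List (Fin 8 × Poly) → I → Poly
    row [] j = 𝟘
    row ((k , p) ∷ kps) j = (if same k j then p else 𝟘) :+ row kps j
      where
      same : ∀ {m} → Fin m → Fin m → Bool
      same zero zero = true
      same (suc a) (suc b) = same a b
      same _ _ = false

    c₅ : Poly
    c₅ = (𝟚 :* u′ :+ b′) :* υ′ :+ b′ :* b′ :* x′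

    -- Row i of the common matrix for a letter pair, listed by its nonzero entries. Both the forms
    -- `l` and the forms `r` are transformed with these same coefficients.
    C′ : Bool → Bool → I → List (Fin 8 × Poly)
    C′ false false zero = (# 0 , 𝟙) ∷ []
    C′ false false (suc zero) = (# 4 , ξ′ :* υ′) ∷ []
    C′ false false (suc (suc zero)) = (# 2 , x′) ∷ []
    C′ false false (suc (suc (suc zero))) = (# 0 , 𝟚) ∷ (# 5 , x′) ∷ []
    C′ false false (suc (suc (suc (suc zero)))) = (# 4 , y′) ∷ []
    C′ false false (suc (suc (suc (suc (suc zero))))) = (# 0 , 𝟚 :* u′ :+ b′) ∷ (# 7 , x′) ∷ []
    C′ false false (suc (suc (suc (suc (suc (suc zero)))))) = (# 4 , u′ :* ξ′ :* ξ′) ∷ []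
    C′ false false (suc (suc (suc (suc (suc (suc (suc zero))))))) = (# 0 , u′ :* (y′ :+ u′)) ∷ (# 7 , x′ :* y′) ∷ []
    C′ true false zero = (# 1 , 𝟙) ∷ []
    C′ true false (suc (suc zero)) = (# 3 , x′) ∷ []
    C′ true false (suc (suc (suc zero))) = (# 1 , 𝟚) ∷ (# 4 , :- (x′ :* ξ′)) ∷ (# 6 , x′) ∷ []
    C′ true false (suc (suc (suc (suc (suc zero))))) = (# 1 , 𝟚 :* u′ :+ b′) ∷ (# 4 , :- (x′ :* u′ :* ξ′)) ∷ (# 6 , x′ :* u′) ∷ []
    C′ true false (suc (suc (suc (suc (suc (suc (suc zero))))))) = (# 1 , u′ :* (y′ :+ u′)) ∷ (# 4 , :- (x′ :* y′ :* u′ :* ξ′)) ∷ (# 6 , x′ :* y′ :* u′) ∷ []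
    C′ true false _ = []
    C′ false true zero = (# 2 , ξ′ :* υ′) ∷ []
    C′ false true (suc zero) = (# 0 , :- (b′ :* ξ′)) ∷ (# 5 , ξ′ :* υ′) ∷ []
    C′ false true (suc (suc zero)) = []
    C′ false true (suc (suc (suc zero))) = (# 2 , 𝟚 :* (υ′ :+ b′ :* x′)) ∷ []
    C′ false true (suc (suc (suc (suc zero)))) = (# 7 , 𝟙) ∷ []
    C′ false true (suc (suc (suc (suc (suc zero))))) = (# 2 , c₅) ∷ []
    C′ false true (suc (suc (suc (suc (suc (suc zero)))))) = (# 0 , :- (b′ :* (y′ :+ u′))) ∷ (# 5 , (y′ :+ u′) :* υ′) ∷ (# 7 , :- (𝟙 :+ 𝟚 :* x′ :* u′)) ∷ []
    C′ false true (suc (suc (suc (suc (suc (suc (suc zero))))))) = (# 2 , u′ :* (y′ :+ u′) :* υ′) ∷ []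
    C′ true true zero = (# 0 , :- ξ′) ∷ (# 3 , ξ′ :* υ′) ∷ []
    C′ true true (suc zero) = (# 6 , ξ′ :* υ′) ∷ []
    C′ true true (suc (suc zero)) = (# 2 , x′) ∷ []
    C′ true true (suc (suc (suc zero))) = (# 0 , :- 𝟚) ∷ (# 3 , 𝟚 :* υ′ :+ b′ :* x′) ∷ (# 5 , :- x′) ∷ []
    C′ true true (suc (suc (suc (suc zero)))) = (# 6 , u′) ∷ []
    C′ true true (suc (suc (suc (suc (suc zero))))) = (# 0 , :- (𝟚 :* u′ :+ b′)) ∷ (# 3 , c₅) ∷ (# 5 , :- (b′ :* x′)) ∷ (# 7 , :- x′) ∷ []
    C′ true true (suc (suc (suc (suc (suc (suc zero)))))) = (# 6 , y′) ∷ []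
    C′ true true (suc (suc (suc (suc (suc (suc (suc zero))))))) = (# 0 , :- (u′ :* (y′ :+ u′))) ∷ (# 3 , u′ :* (y′ :+ u′) :* υ′) ∷ (# 7 , :- (x′ :* u′)) ∷ []

    open Intertwine (pairs sts sts) (pairs sts sts) (allFin 8) pairs-all pairs-all ∈-allFin
      l r (λ a b i → row (C′ a b i)) public

    LV RV : Bool → Values (St × St)
    LV P? = prodV (A P?) (X P?)
    RV P? = prodV (λ q k s → X P? q s k) (λ q k s → A P? q s k)

    finL finR : Bool → I → Poly
    finL P? i = sumP (pairs sts sts) (λ p → l i p :* (aF P? (fst p) :* xF P? (snd p)))
    finR P? i = sumP (pairs sts sts) (λ p → r i p :* (xF P? (fst p) :* aF P? (snd p)))

    finB : Bool → I → Bool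
    finB P? i = eqP (finL P? i) (finR P? i)

    fin-ok : ∀ P? → T (all (finB P?) (allFin 8))
    fin-ok false = tt
    fin-ok true = tt

    fin : ∀ P? i → pairing (pairs sts sts) l (LV P?) i [] [] ≈ pairing (pairs sts sts) r (RV P?) i [] []
    fin P? i = trans (sym (sumP-sem (pairs sts sts) (λ p → l i p :* (aF P? (fst p) :* xF P? (snd p)))))
      (trans (eqP-sound (finL P? i) (finR P? i) (all-∈ (finB P?) (allFin 8) (fin-ok P?) (∈-allFin i)))
        (sumP-sem (pairs sts sts) (λ p → r i p :* (xF P? (fst p) :* aF P? (snd p)))))

    AX≈XA : ∀ P? i {n} (s t : Vec Bool n) →
      pairing (pairs sts sts) l (LV P?) i s t ≈ pairing (pairs sts sts) r (RV P?) i s t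
    AX≈XA P? = intertwine (prodT aW xW) (LV P?) (prod-runs sts sts aW xW (A P?) (X P?) (val-runs aW (aF P?)) (val-runs xW (xF P?)))
      (prodT (λ q a b → xW q b a) (λ q a b → aW q b a)) (RV P?)
      (prod-runs sts sts (λ q a b → xW q b a) (λ q a b → aW q b a) (λ q k s → X P? q s k) (λ q k s → A P? q s k)
        (flip-runs sts xW (X P?) (val-runs xW (xF P?))) (flip-runs sts aW (A P?) (val-runs aW (aF P?))))
      tt tt (fin P?)

module _ (R : CommutativeRing 0ℓ 0ℓ) where
  open RingKit R
  open Tables R

  A-y-free : ∀ β x y z P? q {n} (s t : Vec Bool n) → Transfer.A R β x y P? q s t ≈ Transfer.A R β x z P? q s t
  A-y-free β x y z P? q [] [] = reflexive (y-free-⟦⟧ β x y z (aF P? q) (ok P? q))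
    where
    ok : ∀ P? q → T (y-free (aF P? q))
    ok false s₀ = tt
    ok false s₁ = tt
    ok false s₂ = tt
    ok true s₀ = tt
    ok true s₁ = tt
    ok true s₂ = tt
  A-y-free β x y z P? q (a ∷ s) (b ∷ t) =
    ∑-cong sts (λ q′ → *-cong (reflexive (y-free-⟦⟧ β x y z (aW q a b q′) (ok a b q q′))) (A-y-free β x y z P? q′ s t))
    where
    rowB : Bool → Bool → St → St → Bool
    rowB a b q q′ = y-free (aW q a b q′)
    ok′ : ∀ a b → T (all (λ q → all (rowB a b q) sts) sts)
    ok′ false false = tt
    ok′ false true = tt
    ok′ true false = tt
    ok′ true true = tt
    ok : ∀ a b q q′ → T (rowB a b q q′)
    ok a b q q′ = all-∈ (rowB a b q) sts (all-∈ (λ q → all (rowB a b q) sts) sts (ok′ a b) (sts-all q)) (sts-all q′)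

-- Rook strips and the one-variable operator of plane partitions

module Pieri (R : CommutativeRing 0ℓ 0ℓ) (β : CommutativeRing.Carrier R) where
  open RingKit R

  γ : Carrier
  γ = - β

  dot : ∀ n → (Vec Bool n → Carrier) → (Vec Bool n → Carrier) → Carrier
  dot n f g = Σᵇ n (λ k → f k * g k)

  dot-cong : ∀ n {f f′ g g′} → (∀ k → f k ≈ f′ k) → (∀ k → g k ≈ g′ k) → dot n f g ≈ dot n f′ g′
  dot-cong n p q = Σᵇ-cong n (λ k → *-cong (p k) (q k))

  dot-*ˡ : ∀ n c f g → dot n (λ k → c * f k) g ≈ c * dot n f g
  dot-*ˡ n c f g = trans (Σᵇ-cong n (λ k → *-assoc _ _ _)) (Σᵇ-*ˡ n c _)

  dot-*ʳ : ∀ n c f g → dot n f (λ k → c * g k) ≈ c * dot n f g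
  dot-*ʳ n c f g = trans (Σᵇ-cong n (λ k → solve 3 (λ p q r → p :* (q :* r) := q :* (p :* r)) refl _ _ _)) (Σᵇ-*ˡ n c _)

  dot-** : ∀ n c d f g → dot n (λ k → c * f k) (λ k → d * g k) ≈ c * d * dot n f g
  dot-** n c d f g = trans (dot-*ˡ n c f _) (trans (*-congˡ (dot-*ʳ n d f g)) (sym (*-assoc _ _ _)))

  dot-0ˡ : ∀ n g → dot n (λ _ → 0#) g ≈ 0#
  dot-0ˡ n g = Σᵇ-zero n (λ _ → zeroˡ _)

  dot-0ʳ : ∀ n f → dot n f (λ _ → 0#) ≈ 0#
  dot-0ʳ n f = Σᵇ-zero n (λ _ → zeroʳ _)

  dot-+ʳ : ∀ n f g h → dot n f (λ k → g k + h k) ≈ dot n f g + dot n f h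
  dot-+ʳ n f g h = trans (Σᵇ-cong n (λ k → distribˡ _ _ _)) (Σᵇ-+ n _ _)

  dot-assoc : ∀ m n (f : Vec Bool m → Carrier) (g : Vec Bool m → Vec Bool n → Carrier) h →
    dot m f (λ k → dot n (g k) h) ≈ dot n (λ l → dot m f (λ k → g k l)) h
  dot-assoc m n f g h = trans (Σᵇ-cong m (λ k → sym (Σᵇ-*ˡ n _ _))) (trans (Σᵇ-swap m n _)
    (Σᵇ-cong n (λ l → trans (Σᵇ-cong m (λ k → sym (*-assoc _ _ _))) (Σᵇ-*ʳ m _ _))))

  -- Removal of a rook strip. The flag records that the part just read is to be lowered by exactly
  -- one, at the price β, so the next letter pair must be (false , true). The value at the end
  -- decides whether the part 1, a diagonal box, may be removed; for `Col` this has to follow P?.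
  S : Bool → Bool → ∀ {n} → Vec Bool n → Vec Bool n → Carrier
  S P? false [] [] = 1#
  S P? true [] [] = if P? then 1# else 0#
  S P? false (false ∷ s) (false ∷ t) = S P? false s t
  S P? false (true ∷ s) (false ∷ t) = β * S P? true s t
  S P? false (true ∷ s) (true ∷ t) = S P? false s t
  S P? false (false ∷ s) (true ∷ t) = 0#
  S P? true (false ∷ s) (true ∷ t) = S P? false s t
  S P? true (false ∷ s) (false ∷ t) = 0#
  S P? true (true ∷ s) (_ ∷ t) = 0#

  module One (y : Carrier) where

    u : Carrier
    u = y + β

    -- A row or column with j ≥ 1 boxes of one letter is charged y once and γ for each further box.
    edge : ℕ → Carrier
    edge zero = 1#
    edge (suc j) = y * pw γ j

    -- j counts the open rows: parts of s whose partner in t has not yet been read. Partners are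
    -- assigned in order, so the oldest open row closes first. An open row pays γ at each level that
    -- it passes and y at the level where it closes, and the end closes all rows.
    Row : ℕ → ∀ {n} → Vec Bool n → Vec Bool n → Carrier
    Row j [] [] = pw y j
    Row j (false ∷ s) (false ∷ t) = pw γ j * Row j s t
    Row j (true ∷ s) (false ∷ t) = pw γ j * Row (suc j) s t
    Row j (true ∷ s) (true ∷ t) = edge j * Row j s t
    Row zero (false ∷ s) (true ∷ t) = 0#
    Row (suc j) (false ∷ s) (true ∷ t) = y * pw γ j * Row j s t

    -- A row still open at the end loses its diagonal box. For `Col` the letter there is unprimed,
    -- which is allowed for gq and forbidden for gp.
    colF : Bool → ℕ → Carrier
    colF P? zero = 1#
    colF P? (suc j) = if P? then y * pw y j else 0#

    -- Again j is the number of open rows, but the charge is by columns. Consecutive rows of a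
    -- shifted diagram are displaced by one, so a new part of s puts a box below those of the older
    -- open rows. This moves the factor y from the levels (true , true) to the levels (false ,
    -- false).
    Col : Bool → ℕ → ∀ {n} → Vec Bool n → Vec Bool n → Carrier
    Col P? j [] [] = colF P? j
    Col P? j (false ∷ s) (false ∷ t) = edge j * Col P? j s t
    Col P? j (true ∷ s) (false ∷ t) = pw γ j * Col P? (suc j) s t
    Col P? j (true ∷ s) (true ∷ t) = pw γ j * Col P? j s t
    Col P? zero (false ∷ s) (true ∷ t) = 0#
    Col P? (suc j) (false ∷ s) (true ∷ t) = y * pw γ j * Col P? j s t

    -- What remains of `Row` after multiplication by rook strips: at most one row is open, recorded
    -- by the flag.
    U : Bool → ∀ {n} → Vec Bool n → Vec Bool n → Carrier
    U _ [] [] = 1#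
    U false (false ∷ s) (false ∷ t) = U false s t
    U false (true ∷ s) (false ∷ t) = u * U true s t
    U false (true ∷ s) (true ∷ t) = U false s t
    U false (false ∷ s) (true ∷ t) = 0#
    U true (false ∷ s) (true ∷ t) = U false s t
    U true (true ∷ s) (true ∷ t) = y * U true s t
    U true (_ ∷ s) (false ∷ t) = 0#

    RS : ℕ → Bool → ∀ {n} → Vec Bool n → Vec Bool n → Carrier
    RS j a {n} s t = dot n (Row j s) (λ k → S true a k t)

    -- With two or more rows of κ / ν open at once the sum over rook strips cancels.
    RS-suc : ∀ j {n} (s t : Vec Bool n) → RS (suc j) false s t ≈ y * RS j true s t
    RS-suc j [] [] = solve 2 (λ a b → a :* b :* :1 := a :* (b :* :1)) refl _ _
    RS-suc j {suc n} (false ∷ s) (false ∷ t) = begin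
      dot n (λ k → γ * pw γ j * Row (suc j) s k) (λ k → S true false k t) + dot n (λ k → y * pw γ j * Row j s k) (λ k → β * S true true k t)
        ≈⟨ +-cong (dot-*ˡ n _ _ _) (dot-** n _ _ _ _) ⟩
      γ * pw γ j * RS (suc j) false s t + y * pw γ j * β * RS j true s t ≈⟨ +-congʳ (*-congˡ (RS-suc j s t)) ⟩
      -- The charge γ = -β of one more open row against the rook box of weight β.
      γ * pw γ j * (y * RS j true s t) + y * pw γ j * β * RS j true s t
        ≈⟨ solve 5 (λ b p y f r → :- b :* p :* (y :* f) :+ y :* p :* b :* f := y :* (:0 :+ :0)) refl β (pw γ j) y (RS j true s t) 0# ⟩
      y * (0# + 0#) ≈⟨ *-congˡ (sym (+-cong (dot-0ʳ n _) (dot-0ʳ n _))) ⟩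
      y * RS j true (false ∷ s) (false ∷ t) ∎
    RS-suc j {suc n} (true ∷ s) (false ∷ t) = begin
      dot n (λ k → γ * pw γ j * Row (suc (suc j)) s k) (λ k → S true false k t) + dot n (λ k → y * pw γ j * Row (suc j) s k) (λ k → β * S true true k t)
        ≈⟨ +-cong (dot-*ˡ n _ _ _) (dot-** n _ _ _ _) ⟩
      γ * pw γ j * RS (suc (suc j)) false s t + y * pw γ j * β * RS (suc j) true s t ≈⟨ +-congʳ (*-congˡ (RS-suc (suc j) s t)) ⟩
      γ * pw γ j * (y * RS (suc j) true s t) + y * pw γ j * β * RS (suc j) true s t
        ≈⟨ solve 5 (λ b p y f r → :- b :* p :* (y :* f) :+ y :* p :* b :* f := y :* (:0 :+ :0)) refl β (pw γ j) y (RS (suc j) true s t) 0# ⟩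
      y * (0# + 0#) ≈⟨ *-congˡ (sym (+-cong (dot-0ʳ n _) (dot-0ʳ n _))) ⟩
      y * RS j true (true ∷ s) (false ∷ t) ∎
    RS-suc j {suc n} (false ∷ s) (true ∷ t) = begin
      dot n _ (λ k → 0#) + dot n (λ k → y * pw γ j * Row j s k) (λ k → S true false k t)
        ≈⟨ +-cong (dot-0ʳ n _) (dot-*ˡ n _ _ _) ⟩
      0# + y * pw γ j * RS j false s t ≈⟨ solve 3 (λ y p f → :0 :+ y :* p :* f := y :* (p :* f :+ :0)) refl _ _ _ ⟩
      y * (pw γ j * RS j false s t + 0#) ≈⟨ *-congˡ (sym (+-cong (dot-*ˡ n _ _ _) (dot-0ʳ n _))) ⟩
      y * RS j true (false ∷ s) (true ∷ t) ∎
    RS-suc j {suc n} (true ∷ s) (true ∷ t) = begin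
      dot n _ (λ k → 0#) + dot n (λ k → y * pw γ j * Row (suc j) s k) (λ k → S true false k t)
        ≈⟨ +-cong (dot-0ʳ n _) (dot-*ˡ n _ _ _) ⟩
      0# + y * pw γ j * RS (suc j) false s t ≈⟨ solve 3 (λ y p f → :0 :+ y :* p :* f := y :* (p :* f :+ :0)) refl _ _ _ ⟩
      y * (pw γ j * RS (suc j) false s t + 0#) ≈⟨ *-congˡ (sym (+-cong (dot-*ˡ n _ _ _) (dot-0ʳ n _))) ⟩
      y * RS j true (true ∷ s) (true ∷ t) ∎

    RS≈U : ∀ a {n} (s t : Vec Bool n) → RS 0 a s t ≈ U a s t
    RS≈U false [] [] = *-identityˡ _
    RS≈U true [] [] = *-identityˡ _
    RS≈U false {suc n} (false ∷ s) (false ∷ t) =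
      trans (+-cong (trans (dot-*ˡ n _ _ _) (trans (*-identityˡ _) (RS≈U false s t))) (dot-0ˡ n _)) (+-identityʳ _)
    RS≈U false {suc n} (true ∷ s) (false ∷ t) = begin
      dot n (λ k → 1# * Row 1 s k) (λ k → S true false k t) + dot n (λ k → 1# * Row 0 s k) (λ k → β * S true true k t)
        ≈⟨ +-cong (trans (dot-*ˡ n _ _ _) (*-congˡ (RS-suc 0 s t))) (dot-** n _ _ _ _) ⟩
      1# * (y * RS 0 true s t) + 1# * β * RS 0 true s t
        ≈⟨ solve 3 (λ y b f → :1 :* (y :* f) :+ :1 :* b :* f := (y :+ b) :* f) refl _ _ _ ⟩
      u * RS 0 true s t ≈⟨ *-congˡ (RS≈U true s t) ⟩
      u * U true s t ∎
    RS≈U false {suc n} (true ∷ s) (true ∷ t) =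
      trans (+-cong (dot-0ʳ n _) (trans (dot-*ˡ n _ _ _) (trans (*-identityˡ _) (RS≈U false s t)))) (+-identityˡ _)
    RS≈U false {suc n} (false ∷ s) (true ∷ t) = trans (+-cong (dot-0ʳ n _) (dot-0ˡ n _)) (+-identityˡ _)
    RS≈U true {suc n} (false ∷ s) (true ∷ t) =
      trans (+-cong (trans (dot-*ˡ n _ _ _) (trans (*-identityˡ _) (RS≈U false s t))) (dot-0ʳ n _)) (+-identityʳ _)
    RS≈U true {suc n} (true ∷ s) (true ∷ t) =
      trans (+-cong (trans (dot-*ˡ n _ _ _) (trans (*-identityˡ _) (trans (RS-suc 0 s t) (*-congˡ (RS≈U true s t))))) (dot-0ʳ n _)) (+-identityʳ _)
    RS≈U true {suc n} (false ∷ s) (false ∷ t) = trans (+-cong (dot-0ʳ n _) (dot-0ʳ n _)) (+-identityˡ _)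
    RS≈U true {suc n} (true ∷ s) (false ∷ t) = trans (+-cong (dot-0ʳ n _) (dot-0ʳ n _)) (+-identityˡ _)

    module Diag (P? : Bool) where

      -- The rook strip used here is the one adapted to `Col`: it may remove a diagonal box exactly
      -- when `Col` may.
      W : Bool → Bool → ∀ {n} → Vec Bool n → Vec Bool n → Carrier
      W a b {n} s t = dot n (U a s) (λ k → S P? b k t)

      W′ : Bool → Bool → Bool → Bool → ∀ {n} → Vec Bool n → Vec Bool n → Carrier
      W′ false false false false s t = W false false s t
      W′ false false true false s t = u * W true false s t + β * W false true s t
      W′ false false true true s t = W false false s t
      W′ true false false false s t = β * W false true s t
      W′ true false false true s t = W false false s t
      W′ true false true false s t = y * β * W true true s t
      W′ true false true true s t = y * W true false s t
      W′ false true false true s t = W false false s t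
      W′ false true true true s t = u * W true false s t
      W′ _ _ _ _ s t = 0#

      W-step : ∀ a b l m {n} (s t : Vec Bool n) → W a b (l ∷ s) (m ∷ t) ≈ W′ a b l m s t
      W-step false false false false {n} s t = trans (+-congˡ (dot-0ˡ n _)) (+-identityʳ _)
      W-step false false true false {n} s t = +-cong (dot-*ˡ n _ _ _) (dot-*ʳ n _ _ _)
      W-step false false true true {n} s t = trans (+-congʳ (dot-0ʳ n _)) (+-identityˡ _)
      W-step false false false true {n} s t = trans (+-cong (dot-0ʳ n _) (dot-0ˡ n _)) (+-identityˡ _)
      W-step true false false false {n} s t = trans (+-cong (dot-0ˡ n _) (dot-*ʳ n _ _ _)) (+-identityˡ _)
      W-step true false false true {n} s t = trans (+-congʳ (dot-0ʳ n _)) (+-identityˡ _)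
      W-step true false true false {n} s t = trans (+-cong (dot-0ˡ n _) (dot-** n _ _ _ _)) (+-identityˡ _)
      W-step true false true true {n} s t = trans (+-cong (dot-0ʳ n _) (dot-*ˡ n _ _ _)) (+-identityˡ _)
      W-step false true false true {n} s t = trans (+-congˡ (dot-0ʳ n _)) (+-identityʳ _)
      W-step false true true true {n} s t = trans (+-cong (dot-*ˡ n _ _ _) (dot-0ʳ n _)) (+-identityʳ _)
      W-step false true false false {n} s t = trans (+-cong (dot-0ʳ n _) (dot-0ʳ n _)) (+-identityˡ _)
      W-step false true true false {n} s t = trans (+-cong (dot-0ʳ n _) (dot-0ʳ n _)) (+-identityˡ _)
      W-step true true false false {n} s t = trans (+-cong (dot-0ʳ n _) (dot-0ʳ n _)) (+-identityˡ _)
      W-step true true true false {n} s t = trans (+-cong (dot-0ʳ n _) (dot-0ʳ n _)) (+-identityˡ _)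
      W-step true true false true {n} s t = trans (+-cong (dot-0ˡ n _) (dot-0ʳ n _)) (+-identityˡ _)
      W-step true true true true {n} s t = trans (+-cong (dot-0ˡ n _) (dot-0ʳ n _)) (+-identityˡ _)

      -- j is the number of open rows in `Col`, a the state of `U`, and b tells whether a rook
      -- corner is pending. The state space is infinite because of j; the combinations `Hj` reduce
      -- it to three states.
      D : ℕ → Bool → Bool → ∀ {n} → Vec Bool n → Vec Bool n → Carrier
      D j a b {n} s t = dot n (Col P? j s) (λ k → W a b k t)

      W-split : ∀ n c d d′ (f g h : Vec Bool n → Carrier) →
        dot n (λ k → c * f k) (λ k → d * g k + d′ * h k) ≈ c * (d * dot n f g + d′ * dot n f h)
      W-split n c d d′ f g h = trans (dot-*ˡ n c f _) (*-congˡ (trans (dot-+ʳ n f _ _) (+-cong (dot-*ʳ n d f g) (dot-*ʳ n d′ f h))))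

      D-step : ∀ j a b l m {n} (s t : Vec Bool n) →
        D j a b (l ∷ s) (m ∷ t) ≈ dot n (λ k → Col P? j (l ∷ s) (false ∷ k)) (λ k → W′ a b false m k t)
          + dot n (λ k → Col P? j (l ∷ s) (true ∷ k)) (λ k → W′ a b true m k t)
      D-step j a b l m {n} s t = +-cong (dot-cong n (λ _ → refl) (λ k → W-step a b false m k t)) (dot-cong n (λ _ → refl) (λ k → W-step a b true m k t))

      D00 : ∀ (j : ℕ) (l m : Bool) {n} → Vec Bool n → Vec Bool n → Carrier
      D00 j true false s t = pw γ j * (D (suc j) false false s t + u * D j true false s t + β * D j false true s t)
      D00 j true true s t = pw γ j * D j false false s t
      D00 zero false false s t = D 0 false false s t
      D00 (suc j) false false s t = y * pw γ j * (D (suc j) false false s t + u * D j true false s t + β * D j false true s t)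
      D00 zero false true s t = 0#
      D00 (suc j) false true s t = y * pw γ j * D j false false s t

      D00-step : ∀ j l m {n} (s t : Vec Bool n) → D j false false (l ∷ s) (m ∷ t) ≈ D00 j l m s t
      D00-step zero false false {n} s t = trans (D-step 0 false false false false s t)
        (trans (+-cong (trans (dot-*ˡ n _ _ _) (*-identityˡ _)) (dot-0ˡ n _)) (+-identityʳ _))
      D00-step (suc j) false false {n} s t = trans (D-step (suc j) false false false false s t)
        (trans (+-cong (dot-*ˡ n _ _ _) (W-split n _ u β (Col P? j s) (λ k → W true false k t) (λ k → W false true k t)))
          (solve 6 (λ p a u b c d → p :* a :+ p :* (u :* b :+ c :* d) := p :* (a :+ u :* b :+ c :* d)) refl _ _ _ _ _ _))
      D00-step j true false {n} s t = trans (D-step j false false true false s t)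
        (trans (+-cong (dot-*ˡ n _ _ _) (W-split n _ u β (Col P? j s) (λ k → W true false k t) (λ k → W false true k t)))
          (solve 6 (λ p a u b c d → p :* a :+ p :* (u :* b :+ c :* d) := p :* (a :+ u :* b :+ c :* d)) refl _ _ _ _ _ _))
      D00-step zero false true {n} s t = trans (D-step 0 false false false true s t) (trans (+-cong (dot-0ʳ n _) (dot-0ˡ n _)) (+-identityˡ _))
      D00-step (suc j) false true {n} s t = trans (D-step (suc j) false false false true s t) (trans (+-cong (dot-0ʳ n _) (dot-*ˡ n _ _ _)) (+-identityˡ _))
      D00-step j true true {n} s t = trans (D-step j false false true true s t) (trans (+-cong (dot-0ʳ n _) (dot-*ˡ n _ _ _)) (+-identityˡ _))

      D10 : ∀ (j : ℕ) (l m : Bool) {n} → Vec Bool n → Vec Bool n → Carrier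
      D10 j true false s t = pw γ j * (β * D (suc j) false true s t + y * β * D j true true s t)
      D10 j true true s t = pw γ j * (D (suc j) false false s t + y * D j true false s t)
      D10 zero false false s t = β * D 0 false true s t
      D10 (suc j) false false s t = y * pw γ j * (β * D (suc j) false true s t + y * β * D j true true s t)
      D10 zero false true s t = D 0 false false s t
      D10 (suc j) false true s t = y * pw γ j * (D (suc j) false false s t + y * D j true false s t)

      D10-step : ∀ j l m {n} (s t : Vec Bool n) → D j true false (l ∷ s) (m ∷ t) ≈ D10 j l m s t
      D10-step zero false false {n} s t = trans (D-step 0 true false false false s t)
        (trans (+-cong (dot-** n _ _ _ _) (dot-0ˡ n _)) (solve 2 (λ b d → :1 :* b :* d :+ :0 := b :* d) refl _ _))
      D10-step (suc j) false false {n} s t = trans (D-step (suc j) true false false false s t)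
        (trans (+-cong (dot-** n _ _ _ _) (dot-** n _ _ _ _)) (solve 5 (λ p b d c e → p :* b :* d :+ p :* c :* e := p :* (b :* d :+ c :* e)) refl _ _ _ _ _))
      D10-step j true false {n} s t = trans (D-step j true false true false s t)
        (trans (+-cong (dot-** n _ _ _ _) (dot-** n _ _ _ _)) (solve 5 (λ p b d c e → p :* b :* d :+ p :* c :* e := p :* (b :* d :+ c :* e)) refl _ _ _ _ _))
      D10-step zero false true {n} s t = trans (D-step 0 true false false true s t)
        (trans (+-cong (trans (dot-*ˡ n _ _ _) (*-identityˡ _)) (dot-0ˡ n _)) (+-identityʳ _))
      D10-step (suc j) false true {n} s t = trans (D-step (suc j) true false false true s t)
        (trans (+-cong (dot-*ˡ n _ _ _) (dot-** n _ _ _ _)) (solve 4 (λ p d c e → p :* d :+ p :* c :* e := p :* (d :+ c :* e)) refl _ _ _ _))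
      D10-step j true true {n} s t = trans (D-step j true false true true s t)
        (trans (+-cong (dot-*ˡ n _ _ _) (dot-** n _ _ _ _)) (solve 4 (λ p d c e → p :* d :+ p :* c :* e := p :* (d :+ c :* e)) refl _ _ _ _))

      D01 : ∀ (j : ℕ) (l m : Bool) {n} → Vec Bool n → Vec Bool n → Carrier
      D01 j l false s t = 0#
      D01 j true true s t = pw γ j * (D (suc j) false false s t + u * D j true false s t)
      D01 zero false true s t = D 0 false false s t
      D01 (suc j) false true s t = y * pw γ j * (D (suc j) false false s t + u * D j true false s t)

      D01-step : ∀ j l m {n} (s t : Vec Bool n) → D j false true (l ∷ s) (m ∷ t) ≈ D01 j l m s t
      D01-step j l false {n} s t = trans (D-step j false true l false s t) (trans (+-cong (dot-0ʳ n _) (dot-0ʳ n _)) (+-identityˡ _))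
      D01-step zero false true {n} s t = trans (D-step 0 false true false true s t)
        (trans (+-cong (trans (dot-*ˡ n _ _ _) (*-identityˡ _)) (dot-0ˡ n _)) (+-identityʳ _))
      D01-step (suc j) false true {n} s t = trans (D-step (suc j) false true false true s t)
        (trans (+-cong (dot-*ˡ n _ _ _) (dot-** n _ _ _ _)) (solve 4 (λ p d c e → p :* d :+ p :* c :* e := p :* (d :+ c :* e)) refl _ _ _ _))
      D01-step j true true {n} s t = trans (D-step j false true true true s t)
        (trans (+-cong (dot-*ˡ n _ _ _) (dot-** n _ _ _ _)) (solve 4 (λ p d c e → p :* d :+ p :* c :* e := p :* (d :+ c :* e)) refl _ _ _ _))

      D11-step : ∀ j l m {n} (s t : Vec Bool n) → D j true true (l ∷ s) (m ∷ t) ≈ 0#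
      D11-step j l m {n} s t = trans (D-step j true true l m s t) (trans (+-cong (dot-cong n (λ _ → refl) (z false m)) (dot-cong n (λ _ → refl) (z true m)))
        (trans (+-cong (dot-0ʳ n _) (dot-0ʳ n _)) (+-identityˡ _)))
        where
        z : ∀ l m k → W′ true true l m k t ≈ 0#
        z false false k = refl
        z false true k = refl
        z true false k = refl
        z true true k = refl

      -- The part of h with j + 1 open columns; it cancels for j > 0.
      Hj : ℕ → ∀ {n} → Vec Bool n → Vec Bool n → Carrier
      Hj zero s t = D 1 false false s t + u * D 0 true false s t - y * D 0 false true s t
      Hj (suc j) s t = D (suc (suc j)) false false s t + u * D (suc j) true false s t - y * D (suc j) false true s t - u * y * D j true true s t

      -- Reading a letter turns such a combination into a multiple of another one with positive
      -- index, or into zero. It is therefore enough that it vanishes on the empty words.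
      Hj-suc : ∀ j {n} (s t : Vec Bool n) → Hj (suc j) s t ≈ 0#
      Hj-suc j [] [] = fin P?
        where
        fin : ∀ P? → colF P? (suc (suc j)) * (1# * 1#) + u * (colF P? (suc j) * (1# * 1#)) - y * (colF P? (suc j) * (1# * (if P? then 1# else 0#)))
          - u * y * (colF P? j * (1# * (if P? then 1# else 0#))) ≈ 0#
        fin true = trans (+-congˡ (-‿cong (*-congˡ (*-congʳ (colT j)))))
          (solve 3 (λ y b p → y :* (y :* p) :* (:1 :* :1) :+ (y :+ b) :* (y :* p :* (:1 :* :1)) :- y :* (y :* p :* (:1 :* :1))
            :- (y :+ b) :* y :* (p :* (:1 :* :1)) := :0) refl y β (pw y j))
          where
          colT : ∀ j → colF true j ≈ pw y j
          colT zero = refl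
          colT (suc j) = refl
        fin false = solve 4 (λ y b p c → :0 :* (:1 :* :1) :+ (y :+ b) :* (:0 :* (:1 :* :1)) :- y :* (:0 :* (:1 :* :0))
            :- (y :+ b) :* y :* (c :* (:1 :* :0)) := :0) refl y β (pw y j) (colF false j)
      Hj-suc j (false ∷ s) (false ∷ t) = begin
        Hj (suc j) (false ∷ s) (false ∷ t)
          ≈⟨ +-cong (+-cong (+-cong (D00-step (suc (suc j)) false false s t) (*-congˡ (D10-step (suc j) false false s t)))
               (-‿cong (*-congˡ (D01-step (suc j) false false s t)))) (-‿cong (*-congˡ (D11-step j false false s t))) ⟩
        y * (γ * pw γ j) * (D (suc (suc j)) false false s t + u * D (suc j) true false s t + β * D (suc j) false true s t)
          + u * (y * pw γ j * (β * D (suc j) false true s t + y * β * D j true true s t)) - y * 0# - u * y * 0#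
          ≈⟨ solve 7 (λ y b p d e f g → y :* (:- b :* p) :* (d :+ (y :+ b) :* e :+ b :* f) :+ (y :+ b) :* (y :* p :* (b :* f :+ y :* b :* g))
               :- y :* :0 :- (y :+ b) :* y :* :0 := :- (y :* b :* p) :* (d :+ (y :+ b) :* e :- y :* f :- (y :+ b) :* y :* g))
               refl y β (pw γ j) _ _ _ _ ⟩
        - (y * β * pw γ j) * Hj (suc j) s t ≈⟨ trans (*-congˡ (Hj-suc j s t)) (zeroʳ _) ⟩
        0# ∎
      Hj-suc j (true ∷ s) (false ∷ t) = begin
        Hj (suc j) (true ∷ s) (false ∷ t)
          ≈⟨ +-cong (+-cong (+-cong (D00-step (suc (suc j)) true false s t) (*-congˡ (D10-step (suc j) true false s t)))
               (-‿cong (*-congˡ (D01-step (suc j) true false s t)))) (-‿cong (*-congˡ (D11-step j true false s t))) ⟩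
        γ * (γ * pw γ j) * (D (suc (suc (suc j))) false false s t + u * D (suc (suc j)) true false s t + β * D (suc (suc j)) false true s t)
          + u * (γ * pw γ j * (β * D (suc (suc j)) false true s t + y * β * D (suc j) true true s t)) - y * 0# - u * y * 0#
          ≈⟨ solve 7 (λ y b p d e f g → :- b :* (:- b :* p) :* (d :+ (y :+ b) :* e :+ b :* f) :+ (y :+ b) :* (:- b :* p :* (b :* f :+ y :* b :* g))
               :- y :* :0 :- (y :+ b) :* y :* :0 := b :* b :* p :* (d :+ (y :+ b) :* e :- y :* f :- (y :+ b) :* y :* g))
               refl y β (pw γ j) _ _ _ _ ⟩
        β * β * pw γ j * Hj (suc (suc j)) s t ≈⟨ trans (*-congˡ (Hj-suc (suc j) s t)) (zeroʳ _) ⟩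
        0# ∎
      Hj-suc j (false ∷ s) (true ∷ t) = begin
        Hj (suc j) (false ∷ s) (true ∷ t)
          ≈⟨ +-cong (+-cong (+-cong (D00-step (suc (suc j)) false true s t) (*-congˡ (D10-step (suc j) false true s t)))
               (-‿cong (*-congˡ (D01-step (suc j) false true s t)))) (-‿cong (*-congˡ (D11-step j false true s t))) ⟩
        y * (γ * pw γ j) * D (suc j) false false s t + u * (y * pw γ j * (D (suc j) false false s t + y * D j true false s t))
          - y * (y * pw γ j * (D (suc j) false false s t + u * D j true false s t)) - u * y * 0#
          ≈⟨ solve 5 (λ y b p d e → y :* (:- b :* p) :* d :+ (y :+ b) :* (y :* p :* (d :+ y :* e)) :- y :* (y :* p :* (d :+ (y :+ b) :* e))
               :- (y :+ b) :* y :* :0 := :0) refl y β (pw γ j) _ _ ⟩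
        0# ∎
      Hj-suc j (true ∷ s) (true ∷ t) = begin
        Hj (suc j) (true ∷ s) (true ∷ t)
          ≈⟨ +-cong (+-cong (+-cong (D00-step (suc (suc j)) true true s t) (*-congˡ (D10-step (suc j) true true s t)))
               (-‿cong (*-congˡ (D01-step (suc j) true true s t)))) (-‿cong (*-congˡ (D11-step j true true s t))) ⟩
        γ * (γ * pw γ j) * D (suc (suc j)) false false s t + u * (γ * pw γ j * (D (suc (suc j)) false false s t + y * D (suc j) true false s t))
          - y * (γ * pw γ j * (D (suc (suc j)) false false s t + u * D (suc j) true false s t)) - u * y * 0#
          ≈⟨ solve 5 (λ y b p d e → :- b :* (:- b :* p) :* d :+ (y :+ b) :* (:- b :* p :* (d :+ y :* e)) :- y :* (:- b :* p :* (d :+ (y :+ b) :* e))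
               :- (y :+ b) :* y :* :0 := :0) refl y β (pw γ j) _ _ ⟩
        0# ∎

      B : ∀ {n} → Vec Bool n → Vec Bool n → Carrier
      B {n} s t = dot n (Col P? 0 s) (λ k → Row 0 k t)

      module Xs (x : Carrier) where
        module T = Transfer R β x y

        -- The three states of `X` are the product with nothing open, the one surviving combination
        -- `Hj 0`, and u times the product with a pending corner. The three identifications call
        -- each other and are proved by a joint induction.
        D≈X₀ : ∀ {n} (s t : Vec Bool n) → D 0 false false s t ≈ T.X P? s₀ s t
        H≈X₁ : ∀ {n} (s t : Vec Bool n) → Hj 0 s t ≈ T.X P? s₁ s t
        D≈X₂ : ∀ {n} (s t : Vec Bool n) → u * D 0 false true s t ≈ T.X P? s₂ s t

        D≈X₀ [] [] = trans (*-identityˡ _) (*-identityˡ _)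
        D≈X₀ (false ∷ s) (false ∷ t) = trans (D00-step 0 false false s t) (trans (D≈X₀ s t)
          (solve 3 (λ a b c → a := :lin :1 a :0 b :0 c) refl _ _ _))
        D≈X₀ (true ∷ s) (false ∷ t) = begin
          D 0 false false (true ∷ s) (false ∷ t) ≈⟨ D00-step 0 true false s t ⟩
          1# * (D 1 false false s t + u * D 0 true false s t + β * D 0 false true s t)
            -- Writing β as u - y in the last term separates `Hj 0` from the contribution of s₂.
            ≈⟨ solve 6 (λ y b d e f z → :1 :* (d :+ (y :+ b) :* e :+ b :* f)
                 := :0 :* z :+ (:1 :* (d :+ (y :+ b) :* e :- y :* f) :+ (:1 :* ((y :+ b) :* f) :+ :0))) refl y β _ _ _ _ ⟩
          0# * T.X P? s₀ s t + (1# * Hj 0 s t + (1# * (u * D 0 false true s t) + 0#))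
            ≈⟨ +-congˡ (+-cong (*-congˡ (H≈X₁ s t)) (+-congʳ (*-congˡ (D≈X₂ s t)))) ⟩
          T.X P? s₀ (true ∷ s) (false ∷ t) ∎
        D≈X₀ (true ∷ s) (true ∷ t) = trans (D00-step 0 true true s t) (trans (*-congˡ (D≈X₀ s t))
          (solve 3 (λ a b c → :1 :* a := :lin :1 a :0 b :0 c) refl _ _ _))
        D≈X₀ (false ∷ s) (true ∷ t) = trans (D00-step 0 false true s t)
          (solve 3 (λ a b c → :0 := :lin :0 a :0 b :0 c) refl _ _ _)

        H≈X₁ [] [] = fin P?
          where
          fin : ∀ P? → colF P? 1 * (1# * 1#) + u * (1# * (1# * 1#)) - y * (1# * (1# * (if P? then 1# else 0#))) ≈ T.⟪ T.xF P? s₁ ⟫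
          fin true = solve 2 (λ y b → y :* :1 :* (:1 :* :1) :+ (y :+ b) :* (:1 :* (:1 :* :1))
            :- y :* (:1 :* (:1 :* :1)) := y :+ b) refl y β
          fin false = solve 2 (λ y b → :0 :* (:1 :* :1) :+ (y :+ b) :* (:1 :* (:1 :* :1))
            :- y :* (:1 :* (:1 :* :0)) := y :+ b) refl y β
        H≈X₁ (false ∷ s) (false ∷ t) = begin
          Hj 0 (false ∷ s) (false ∷ t)
            ≈⟨ +-cong (+-cong (D00-step 1 false false s t) (*-congˡ (D10-step 0 false false s t))) (-‿cong (*-congˡ (D01-step 0 false false s t))) ⟩
          y * 1# * (D 1 false false s t + u * D 0 true false s t + β * D 0 false true s t) + u * (β * D 0 false true s t) - y * 0#
            ≈⟨ solve 6 (λ y b d e f z → y :* :1 :* (d :+ (y :+ b) :* e :+ b :* f) :+ (y :+ b) :* (b :* f) :- y :* :0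
                 := :0 :* z :+ (y :* (d :+ (y :+ b) :* e :- y :* f) :+ ((y :+ b) :* ((y :+ b) :* f) :+ :0))) refl y β _ _ _ _ ⟩
          0# * T.X P? s₀ s t + (y * Hj 0 s t + (u * (u * D 0 false true s t) + 0#))
            ≈⟨ +-congˡ (+-cong (*-congˡ (H≈X₁ s t)) (+-congʳ (*-congˡ (D≈X₂ s t)))) ⟩
          T.X P? s₁ (false ∷ s) (false ∷ t) ∎
        H≈X₁ (true ∷ s) (false ∷ t) = begin
          Hj 0 (true ∷ s) (false ∷ t)
            ≈⟨ +-cong (+-cong (D00-step 1 true false s t) (*-congˡ (D10-step 0 true false s t))) (-‿cong (*-congˡ (D01-step 0 true false s t))) ⟩
          γ * 1# * (D 2 false false s t + u * D 1 true false s t + β * D 1 false true s t)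
            + u * (1# * (β * D 1 false true s t + y * β * D 0 true true s t)) - y * 0#
            ≈⟨ solve 6 (λ y b d e f g → :- b :* :1 :* (d :+ (y :+ b) :* e :+ b :* f) :+ (y :+ b) :* (:1 :* (b :* f :+ y :* b :* g)) :- y :* :0
                 := :- b :* (d :+ (y :+ b) :* e :- y :* f :- (y :+ b) :* y :* g)) refl y β _ _ _ _ ⟩
          γ * Hj 1 s t ≈⟨ *-congˡ (Hj-suc 0 s t) ⟩
          γ * 0# ≈⟨ solve 4 (λ b p q r → b :* :0 := :lin :0 p :0 q :0 r) refl γ _ _ _ ⟩
          T.X P? s₁ (true ∷ s) (false ∷ t) ∎
        H≈X₁ (false ∷ s) (true ∷ t) = begin
          Hj 0 (false ∷ s) (true ∷ t)
            ≈⟨ +-cong (+-cong (D00-step 1 false true s t) (*-congˡ (D10-step 0 false true s t))) (-‿cong (*-congˡ (D01-step 0 false true s t))) ⟩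
          y * 1# * D 0 false false s t + u * D 0 false false s t - y * D 0 false false s t
            ≈⟨ solve 5 (λ y b d p q → y :* :1 :* d :+ (y :+ b) :* d :- y :* d := :lin (y :+ b) d :0 p :0 q) refl y β _ _ _ ⟩
          u * D 0 false false s t + (0# * T.X P? s₁ s t + (0# * T.X P? s₂ s t + 0#)) ≈⟨ +-congʳ (*-congˡ (D≈X₀ s t)) ⟩
          T.X P? s₁ (false ∷ s) (true ∷ t) ∎
        H≈X₁ (true ∷ s) (true ∷ t) = begin
          Hj 0 (true ∷ s) (true ∷ t)
            ≈⟨ +-cong (+-cong (D00-step 1 true true s t) (*-congˡ (D10-step 0 true true s t))) (-‿cong (*-congˡ (D01-step 0 true true s t))) ⟩
          γ * 1# * D 1 false false s t + u * (1# * (D 1 false false s t + y * D 0 true false s t)) - y * (1# * (D 1 false false s t + u * D 0 true false s t))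
            ≈⟨ solve 7 (λ y b d e p q r → :- b :* :1 :* d :+ (y :+ b) :* (:1 :* (d :+ y :* e)) :- y :* (:1 :* (d :+ (y :+ b) :* e))
                 := :lin :0 p :0 q :0 r) refl y β _ _ _ _ _ ⟩
          T.X P? s₁ (true ∷ s) (true ∷ t) ∎

        D≈X₂ [] [] = fin P?
          where
          fin : ∀ P? → u * (1# * (1# * (if P? then 1# else 0#))) ≈ T.⟪ T.xF P? s₂ ⟫
          fin true = solve 1 (λ u → u :* (:1 :* (:1 :* :1)) := u) refl u
          fin false = solve 1 (λ u → u :* (:1 :* (:1 :* :0)) := :0) refl u
        D≈X₂ (l ∷ s) (false ∷ t) = trans (*-congˡ (D01-step 0 l false s t)) (trans (zeroʳ _) (sym (z l)))
          where
          z : ∀ l → T.X P? s₂ (l ∷ s) (false ∷ t) ≈ 0#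
          z false = solve 3 (λ p q r → :lin :0 p :0 q :0 r := :0) refl _ _ _
          z true = solve 3 (λ p q r → :lin :0 p :0 q :0 r := :0) refl _ _ _
        D≈X₂ (false ∷ s) (true ∷ t) = begin
          u * D 0 false true (false ∷ s) (true ∷ t) ≈⟨ *-congˡ (trans (D01-step 0 false true s t) (D≈X₀ s t)) ⟩
          u * T.X P? s₀ s t ≈⟨ solve 4 (λ u a p q → u :* a := :lin u a :0 p :0 q) refl u _ _ _ ⟩
          T.X P? s₂ (false ∷ s) (true ∷ t) ∎
        D≈X₂ (true ∷ s) (true ∷ t) = begin
          u * D 0 false true (true ∷ s) (true ∷ t) ≈⟨ *-congˡ (D01-step 0 true true s t) ⟩
          u * (1# * (D 1 false false s t + u * D 0 true false s t))
            ≈⟨ solve 6 (λ y b d e f z → (y :+ b) :* (:1 :* (d :+ (y :+ b) :* e))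
                 := :0 :* z :+ ((y :+ b) :* (d :+ (y :+ b) :* e :- y :* f) :+ (y :* ((y :+ b) :* f) :+ :0))) refl y β _ _ _ _ ⟩
          0# * T.X P? s₀ s t + (u * Hj 0 s t + (y * (u * D 0 false true s t) + 0#))
            ≈⟨ +-congˡ (+-cong (*-congˡ (H≈X₁ s t)) (+-congʳ (*-congˡ (D≈X₂ s t)))) ⟩
          T.X P? s₂ (true ∷ s) (true ∷ t) ∎

  SS : Bool → ∀ {n} → Vec Bool n → Vec Bool n → Carrier
  SS P? {n} s t = dot n (S true false s) (λ k → S P? false k t)

  -- By associativity the first rook strip meets `Row`, where it removes the excess of open rows,
  -- and the second meets what is left together with `Col`.
  BSS≈X : ∀ P? x y {n} (s t : Vec Bool n) →
    dot n (One.Diag.B y P? s) (λ k → SS P? k t) ≈ Transfer.X R β x y P? s₀ s t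
  BSS≈X P? x y {n} s t = begin
    dot n (λ r → dot n (Col P? 0 s) (λ k → Row 0 k r)) (λ r → dot n (S true false r) (λ l → S P? false l t))
      ≈⟨ sym (dot-assoc n n (Col P? 0 s) (λ k r → Row 0 k r) _) ⟩
    dot n (Col P? 0 s) (λ k → dot n (λ r → Row 0 k r) (λ r → dot n (S true false r) (λ l → S P? false l t)))
      ≈⟨ dot-cong n (λ _ → refl) (λ k → dot-assoc n n (Row 0 k) (λ r l → S true false r l) _) ⟩
    dot n (Col P? 0 s) (λ k → dot n (λ l → RS 0 false k l) (λ l → S P? false l t))
      ≈⟨ dot-cong n (λ _ → refl) (λ k → dot-cong n (λ l → RS≈U false k l) (λ _ → refl)) ⟩
    D 0 false false s t ≈⟨ D≈X₀ s t ⟩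
    T.X P? s₀ s t ∎
    where
    open One y
    open Diag P?
    open Xs x

  δ : ∀ {n} → Vec Bool n → Vec Bool n → Carrier
  δ [] [] = 1#
  δ (false ∷ s) (false ∷ t) = δ s t
  δ (true ∷ s) (true ∷ t) = δ s t
  δ (true ∷ s) (false ∷ t) = 0#
  δ (false ∷ s) (true ∷ t) = 0#

  dot-δ : ∀ {n} (s : Vec Bool n) (f : Vec Bool n → Carrier) → dot n (δ s) f ≈ f s
  dot-δ [] f = *-identityˡ _
  dot-δ {suc n} (false ∷ s) f = trans (+-cong (dot-δ s _) (dot-0ˡ n _)) (+-identityʳ _)
  dot-δ {suc n} (true ∷ s) f = trans (+-cong (dot-0ˡ n _) (dot-δ s _)) (+-identityˡ _)

  module _ where
    open One 0#

    Row-suc≈0 : ∀ j {n} (s t : Vec Bool n) → Row (suc j) s t ≈ 0#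
    Row-suc≈0 j [] [] = zeroˡ _
    Row-suc≈0 j (false ∷ s) (false ∷ t) = trans (*-congˡ (Row-suc≈0 j s t)) (zeroʳ _)
    Row-suc≈0 j (true ∷ s) (false ∷ t) = trans (*-congˡ (Row-suc≈0 (suc j) s t)) (zeroʳ _)
    Row-suc≈0 j (true ∷ s) (true ∷ t) = trans (*-congʳ (zeroˡ _)) (zeroˡ _)
    Row-suc≈0 j (false ∷ s) (true ∷ t) = trans (*-congʳ (zeroˡ _)) (zeroˡ _)

    Row≈δ : ∀ {n} (s t : Vec Bool n) → Row 0 s t ≈ δ s t
    Row≈δ [] [] = refl
    Row≈δ (false ∷ s) (false ∷ t) = trans (*-identityˡ _) (Row≈δ s t)
    Row≈δ (true ∷ s) (false ∷ t) = trans (*-identityˡ _) (Row-suc≈0 0 s t)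
    Row≈δ (true ∷ s) (true ∷ t) = trans (*-identityˡ _) (Row≈δ s t)
    Row≈δ (false ∷ s) (true ∷ t) = refl

    Col-suc≈0 : ∀ P? j {n} (s t : Vec Bool n) → Col P? (suc j) s t ≈ 0#
    Col-suc≈0 true j [] [] = zeroˡ _
    Col-suc≈0 false j [] [] = refl
    Col-suc≈0 P? j (false ∷ s) (false ∷ t) = trans (*-congʳ (zeroˡ _)) (zeroˡ _)
    Col-suc≈0 P? j (true ∷ s) (false ∷ t) = trans (*-congˡ (Col-suc≈0 P? (suc j) s t)) (zeroʳ _)
    Col-suc≈0 P? j (true ∷ s) (true ∷ t) = trans (*-congˡ (Col-suc≈0 P? j s t)) (zeroʳ _)
    Col-suc≈0 P? j (false ∷ s) (true ∷ t) = trans (*-congʳ (zeroˡ _)) (zeroˡ _)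

    Col≈δ : ∀ P? {n} (s t : Vec Bool n) → Col P? 0 s t ≈ δ s t
    Col≈δ P? [] [] = refl
    Col≈δ P? (false ∷ s) (false ∷ t) = trans (*-identityˡ _) (Col≈δ P? s t)
    Col≈δ P? (true ∷ s) (false ∷ t) = trans (*-identityˡ _) (Col-suc≈0 P? 0 s t)
    Col≈δ P? (true ∷ s) (true ∷ t) = trans (*-identityˡ _) (Col≈δ P? s t)
    Col≈δ P? (false ∷ s) (true ∷ t) = refl

    -- At y = 0 nothing can be removed, so `Row` and `Col` are identity matrices and only the rook
    -- strips are left.
    SS≈X : ∀ P? x {n} (s t : Vec Bool n) → SS P? s t ≈ Transfer.X R β x 0# P? s₀ s t
    SS≈X P? x {n} s t = trans (sym (trans (dot-cong n (λ k → trans (dot-cong n (Col≈δ P? s) (λ l → Row≈δ l k)) (dot-δ s _)) (λ _ → refl)) (dot-δ s _))) (BSS≈X P? x 0# s t)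

-- The Cauchy identity up to terms of high degree

empty : ∀ {n} → Vec Bool n
empty = Vec.replicate _ false

-- The amount by which the largest part falls short of n. It measures how far a part beyond n is
-- from the partition, and hence the degree of truncation errors.
leading : ∀ {n} → Vec Bool n → ℕ
leading [] = 0
leading (false ∷ s) = suc (leading s)
leading (true ∷ s) = 0

size : ∀ {n} → Vec Bool n → ℕ
size [] = 0
size {suc n} (b ∷ s) = (if b then suc n else 0) ℕ.+ size s

n≤size+leading : ∀ {n} (s : Vec Bool n) → n ≤ size s ℕ.+ leading s
n≤size+leading [] = z≤n
n≤size+leading {suc n} (false ∷ s) = P.subst (suc n ≤_) (P.sym (NP.+-suc (size s) (leading s))) (s≤s (n≤size+leading s))
n≤size+leading {suc n} (true ∷ s) = NP.≤-trans (NP.m≤m+n (suc n) (size s)) (NP.m≤m+n _ 0)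

-- An abstract degree: `I k` stands for the elements of degree at least k in the variables x.
-- Keeping it abstract separates the error estimates from the concrete power series.
record Filtration (R : CommutativeRing 0ℓ 0ℓ) : Set₁ where
  open CommutativeRing R
  field
    I : ℕ → Carrier → Set
    I-cong : ∀ {k a b} → a ≈ b → I k a → I k b
    I-0 : ∀ {k} → I k 0#
    I-+ : ∀ {k a b} → I k a → I k b → I k (a + b)
    I-all : ∀ a → I 0 a
    I-* : ∀ {j k a b} → I j a → I k b → I (j ℕ.+ k) (a * b)
    I-mono : ∀ {j k a} → j ≤ k → I k a → I j a

module Cauchy (R : CommutativeRing 0ℓ 0ℓ) (F : Filtration R) (β : CommutativeRing.Carrier R) where
  open RingKit R
  open Filtration F public
  open Pieri R β

  I-*ˡ : ∀ {k} c {a} → I k a → I k (c * a)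
  I-*ˡ c h = I-* (I-all c) h

  I-*ʳ : ∀ {k} c {a} → I k a → I k (a * c)
  I-*ʳ c h = I-cong (*-comm _ _) (I-*ˡ c h)

  I-neg : ∀ {k a} → I k a → I k (- a)
  I-neg h = I-cong (solve 1 (λ a → :- :1 :* a := :- a) refl _) (I-*ˡ (- 1#) h)

  I-Σᵇ : ∀ {k} n {f : Vec Bool n → Carrier} → (∀ s → I k (f s)) → I k (Σᵇ n f)
  I-Σᵇ zero h = h []
  I-Σᵇ (suc n) h = I-+ (I-Σᵇ n (λ s → h (false ∷ s))) (I-Σᵇ n (λ s → h (true ∷ s)))

  _≈[_]_ : Carrier → ℕ → Carrier → Set
  a ≈[ k ] b = I k (a - b)

  ≈⇒mod : ∀ {k a b} → a ≈ b → a ≈[ k ] b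
  ≈⇒mod e = I-cong (sym (trans (+-congʳ e) (-‿inverseʳ _))) I-0

  mod-trans : ∀ {k a b c} → a ≈[ k ] b → b ≈[ k ] c → a ≈[ k ] c
  mod-trans p q = I-cong (solve 3 (λ a b c → a :- b :+ (b :- c) := a :- c) refl _ _ _) (I-+ p q)

  mod-*ˡ : ∀ {k a b} c → a ≈[ k ] b → (c * a) ≈[ k ] (c * b)
  mod-*ˡ c p = I-cong (solve 3 (λ a b c → c :* (a :- b) := c :* a :- c :* b) refl _ _ _) (I-*ˡ c p)

  mod-Σᵇ : ∀ {k} n {f g : Vec Bool n → Carrier} → (∀ s → f s ≈[ k ] g s) → Σᵇ n f ≈[ k ] Σᵇ n g
  mod-Σᵇ n {f} {g} h = I-cong (begin
    Σᵇ n (λ s → f s - g s) ≈⟨ Σᵇ-+ n f (λ s → - g s) ⟩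
    Σᵇ n f + Σᵇ n (λ s → - g s) ≈⟨ +-congˡ (Σᵇ-cong n (λ s → solve 1 (λ a → :- a := :- :1 :* a) refl (g s))) ⟩
    Σᵇ n f + Σᵇ n (λ s → - 1# * g s) ≈⟨ +-congˡ (trans (Σᵇ-*ˡ n (- 1#) g) (solve 1 (λ a → :- :1 :* a := :- a) refl _)) ⟩
    Σᵇ n f - Σᵇ n g ∎) (I-Σᵇ n h)

  I-idx : ∀ {j k a} → j ≡ k → I j a → I k a
  I-idx P.refl h = h

  δ∅ : ∀ {n} → Vec Bool n → Carrier
  δ∅ [] = 1#
  δ∅ (false ∷ s) = δ∅ s
  δ∅ (true ∷ s) = 0#

  Σᵇ-δ∅ : ∀ n (f : Vec Bool n → Carrier) → Σᵇ n (λ s → δ∅ s * f s) ≈ f empty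
  Σᵇ-δ∅ zero f = *-identityˡ _
  Σᵇ-δ∅ (suc n) f = trans (+-cong (Σᵇ-δ∅ n _) (Σᵇ-zero n (λ _ → zeroˡ _))) (+-identityʳ _)

  module Single (P? : Bool) (x : Carrier) (x∈I : I 1 x) where

    ξ : Carrier
    ξ = 1# + β * x

    A′ : St → ∀ {n} → Vec Bool n → Vec Bool n → Carrier
    A′ = Transfer.A R β x 0# P?

    A : ∀ {n} → Vec Bool n → Vec Bool n → Carrier
    A = A′ s₀

    A-empty : ∀ {n} (t : Vec Bool n) → A empty t ≈ δ∅ t
    A-empty [] = refl
    A-empty (false ∷ t) = trans (solve 3 (λ a b c → :lin :1 a :0 b :0 c := a) refl _ _ _) (A-empty t)
    A-empty (true ∷ t) = solve 3 (λ a b c → :lin :0 a :0 b :0 c := :0) refl _ _ _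

    -- State s₁ costs a factor x at each level and can be left only at a part of t or at the end.
    A₁-I : ∀ {n} (s t : Vec Bool n) → I (suc (leading t)) (A′ s₁ s t)
    A₁-I [] [] = fin P?
      where
      open Tables R
      fin : ∀ P? → I 1 (Sol.⟦ aF P? s₁ ⟧ (β ∷ x ∷ 0# ∷ []))
      fin true = x∈I
      fin false = I-*ʳ _ x∈I
    A₁-I (false ∷ s) (false ∷ t) = I-cong
      (solve 4 (λ a b c d → d :* b := :lin :0 a d b :0 c) refl _ _ _ _) (I-* x∈I (A₁-I s t))
    A₁-I (false ∷ s) (true ∷ t) = I-cong
      (solve 5 (λ a b c d e → d :* (e :* a :+ c) := d :* e :* a :+ (:0 :* b :+ (d :* c :+ :0))) refl _ _ _ _ _) (I-*ʳ _ x∈I)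
    A₁-I (true ∷ s) (false ∷ t) = I-cong
      (solve 3 (λ a b c → :0 := :lin :0 a :0 b :0 c) refl _ _ _) I-0
    A₁-I (true ∷ s) (true ∷ t) = I-cong
      (solve 4 (λ a b c d → d :* b := :lin :0 a d b :0 c) refl _ _ _ _) (I-*ʳ _ x∈I)

    module _ (y : Carrier) where
      open Transfer R β x y using (X)
      open Transfer.AX R β x y using (LV; RV; AX≈XA)

      υ : Carrier
      υ = 1# + (y + β) * x

      -- What the sum over all λ would contribute beyond the n sites.
      overflow : ∀ {n} → Vec Bool n → Vec Bool n → Carrier
      overflow {n} μ ν = Σᵇ n (λ k → A′ s₁ k μ * X P? s₁ k ν) + ξ * Σᵇ n (λ k → A′ s₁ k μ * X P? s₂ k ν)

      overflow-I : ∀ {n} (μ ν : Vec Bool n) → I (suc (leading μ)) (overflow μ ν)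
      overflow-I {n} μ ν = I-+ (I-Σᵇ n (λ k → I-*ʳ _ (A₁-I k μ))) (I-*ˡ ξ (I-Σᵇ n (λ k → I-*ʳ _ (A₁-I k μ))))

      -- Member 0 of the family in `AX`. Its two terms with A in state s₁ come from a λ with a part
      -- above n and form the overflow.
      exchange : ∀ {n} (μ ν : Vec Bool n) →
        (1# - x * y) * dot n (λ k → A k μ) (λ k → X P? s₀ k ν) + overflow μ ν ≈ ξ * υ * dot n (X P? s₀ μ) (λ k → A ν k)
      exchange {n} μ ν = begin
        (1# - x * y) * dot n (λ k → A k μ) (λ k → X P? s₀ k ν) + overflow μ ν
          ≈⟨ +-cong (*-congˡ (indep s₀ s₀)) (+-cong (indep s₁ s₁) (*-congˡ (indep s₁ s₂))) ⟩
        (1# - x * y) * LV P? (s₀ , s₀) μ ν + (LV P? (s₁ , s₁) μ ν + ξ * LV P? (s₁ , s₂) μ ν)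
          ≈⟨ solve 11 (λ p k a b c d e f g h i → p :* a :+ (e :+ k :* f) := p :* a :+ (:0 :* b :+ (:0 :* c :+ (:0 :* d :+
               (:1 :* e :+ (k :* f :+ (:lin :0 g :0 h :0 i)))))))
               refl _ _ _ _ _ _ _ _ _ _ _ ⟩
        _ ≈⟨ AX≈XA P? zero μ ν ⟩
        _ ≈⟨ solve 10 (λ p a b c d e f g h i → p :* a :+ (:0 :* b :+ (:0 :* c :+ (:0 :* d :+
               (:0 :* e :+ (:0 :* f :+ (:lin :0 g :0 h :0 i)))))) := p :* a)
               refl _ _ _ _ _ _ _ _ _ _ ⟩
        ξ * υ * RV P? (s₀ , s₀) μ ν
          ≈⟨ *-congˡ (Σᵇ-cong n (λ k → *-congˡ (A-y-free R β x y 0# P? s₀ ν k))) ⟩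
        ξ * υ * dot n (X P? s₀ μ) (λ k → A ν k) ∎
        where
        indep : ∀ p q → Σᵇ n (λ k → A′ p k μ * X P? q k ν) ≈ LV P? (p , q) μ ν
        indep p q = Σᵇ-cong n (λ k → *-congʳ (A-y-free R β x 0# y P? p k μ))

    X₀ : ∀ {n} → Vec Bool n → Vec Bool n → Carrier
    X₀ = Transfer.X R β x 0# P? s₀

    X₀≈SS : ∀ {n} (s t : Vec Bool n) → SS P? s t ≈ X₀ s t
    X₀≈SS = SS≈X P? x

    -- `X₀` is unitriangular. Testing against words t with top letter true sees only the values of f
    -- at words with top letter true, which induction disposes of. Subtracting their share from the
    -- other tests leaves the same problem with one letter less.
    cancel : ∀ {k} n (f : Vec Bool n → Carrier) → (∀ t → I k (dot n f (λ s → X₀ s t))) → ∀ s → I k (f s)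
    cancel zero f h [] = I-cong (*-identityʳ _) (h [])
    cancel {k} (suc n) f h = λ { (true ∷ s) → top s ; (false ∷ s) → cancel n (λ s → f (false ∷ s)) bottom s }
      where
      X₁ = Transfer.X R β x 0# P?
      top : ∀ s → I k (f (true ∷ s))
      top = cancel n (λ s → f (true ∷ s)) (λ t → I-cong (trans (+-cong
          (Σᵇ-zero n (λ s → solve 4 (λ f a b c → f :* (:lin :0 a :0 b :0 c) := :0) refl _ _ _ _))
          (Σᵇ-cong n (λ s → solve 4 (λ f a b c → f :* (:lin :1 a :0 b :0 c) := f :* a) refl _ _ _ _)))
        (+-identityˡ _)) (h (true ∷ t)))
      bottom : ∀ t → I k (dot n (λ s → f (false ∷ s)) (λ s → X₀ s t))
      bottom t = I-cong (trans (+-congʳ (trans (+-congʳ (Σᵇ-cong n (λ s →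
            solve 4 (λ f a b c → f :* (:lin :1 a :0 b :0 c) := f :* a) refl _ _ _ _))) refl))
          (solve 2 (λ a b → a :+ b :- b := a) refl _ _))
        (I-+ (h (false ∷ t)) (I-neg (I-Σᵇ n (λ s → I-*ʳ _ (top s)))))

    module _ (y : Carrier) where
      open One y using (module Diag; Row; Col)
      open Diag P? using (B)

      private
        Xy : ∀ {n} → Vec Bool n → Vec Bool n → Carrier
        Xy = Transfer.X R β x y P? s₀

      -- B s t vanishes unless the largest part of t is at most that of s, that is, unless t has at
      -- least as many leading zeros as s. A bound in terms of `leading` therefore survives the sum.
      B-I : ∀ {c} {n} (s : Vec Bool n) (f : Vec Bool n → Carrier) → (∀ t → I (c ℕ.+ leading t) (f t)) → I (c ℕ.+ leading s) (dot n (B s) f)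
      B-I [] f h = I-*ˡ _ (h [])
      B-I {c} {suc n} (true ∷ s) f h = I-Σᵇ (suc n) (λ t → I-*ˡ (B (true ∷ s) t) (I-mono (NP.+-monoʳ-≤ c z≤n) (h t)))
      B-I {c} {suc n} (false ∷ s) f h = I-cong
        (sym (trans (+-cong (Σᵇ-cong n (λ t → *-congʳ (B-ff s t))) (Σᵇ-zero n (λ t → trans (*-congʳ (B-ft s t)) (zeroˡ _)))) (+-identityʳ _)))
        (I-idx (P.sym (NP.+-suc c (leading s))) (B-I {suc c} s (λ t → f (false ∷ t)) (λ t → I-idx (NP.+-suc c (leading t)) (h (false ∷ t)))))
        where
        B-ff : ∀ {n} (s t : Vec Bool n) → B (false ∷ s) (false ∷ t) ≈ B s t
        B-ff {n} s t = trans (+-cong (trans (dot-** n _ _ _ _) (trans (*-congʳ (*-identityˡ _)) (*-identityˡ _))) (dot-0ˡ n _)) (+-identityʳ _)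
        B-ft : ∀ {n} (s t : Vec Bool n) → B (false ∷ s) (true ∷ t) ≈ 0#
        B-ft {n} s t = trans (+-cong (dot-0ʳ n _) (dot-0ˡ n _)) (+-identityˡ _)

      BX₀ : ∀ {n} (s t : Vec Bool n) → dot n (B s) (λ k → X₀ k t) ≈ Xy s t
      BX₀ {n} s t = trans (dot-cong n (λ _ → refl) (λ k → sym (X₀≈SS k t))) (BSS≈X P? x y s t)

      BTA ABT : ∀ {n} → Vec Bool n → Vec Bool n → Carrier
      BTA {n} ν μ = dot n (λ l → A l μ) (λ l → B l ν)
      ABT {n} ν μ = dot n (B μ) (λ k → A ν k)

      BTA-X₀ : ∀ {n} (ν′ μ : Vec Bool n) → dot n (λ ν → BTA ν μ) (λ ν → X₀ ν ν′) ≈ dot n (λ l → A l μ) (λ l → Xy l ν′)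
      BTA-X₀ {n} ν′ μ = trans (sym (dot-assoc n n (λ l → A l μ) (λ l ν → B l ν) (λ ν → X₀ ν ν′))) (dot-cong n (λ _ → refl) (λ l → BX₀ l ν′))

      -- The exchange relation at y = 0, where υ becomes ξ, multiplied by B from the left. `B-I`
      -- keeps the overflow small.
      ABT-X₀ : ∀ {n} (ν′ μ : Vec Bool n) →
        (ξ * ξ * dot n (Xy μ) (λ k → A ν′ k)) ≈[ suc (leading μ) ] dot n (λ ν → ABT ν μ) (λ ν → X₀ ν ν′)
      ABT-X₀ {n} ν′ μ = I-cong step (I-neg (I-neg (B-I {1} μ (λ k → overflow 0# k ν′) (λ k → overflow-I 0# k ν′))))
        where
        rhs = dot n (λ ν → ABT ν μ) (λ ν → X₀ ν ν′)
        over = dot n (B μ) (λ k → overflow 0# k ν′)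
        eq : ξ * ξ * dot n (Xy μ) (λ k → A ν′ k) ≈ rhs + over
        eq = begin
          ξ * ξ * dot n (Xy μ) (λ k → A ν′ k) ≈⟨ *-congˡ (dot-cong n (λ k → sym (BX₀ μ k)) (λ _ → refl)) ⟩
          ξ * ξ * dot n (λ k → dot n (B μ) (λ l → X₀ l k)) (λ k → A ν′ k) ≈⟨ *-congˡ (sym (dot-assoc n n (B μ) (λ l k → X₀ l k) (λ k → A ν′ k))) ⟩
          ξ * ξ * dot n (B μ) (λ l → dot n (X₀ l) (λ k → A ν′ k)) ≈⟨ sym (dot-*ʳ n _ _ _) ⟩
          dot n (B μ) (λ l → ξ * ξ * dot n (X₀ l) (λ k → A ν′ k))
            ≈⟨ dot-cong n (λ _ → refl) (λ l → trans (*-congʳ (*-congˡ (+-congˡ (solve 2 (λ b x → b :* x := (:0 :+ b) :* x) refl β x)))) (trans (sym (exchange 0# l ν′))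
                 (+-congʳ (solve 2 (λ x a → (:1 :- x :* :0) :* a := a) refl x _)))) ⟩
          dot n (B μ) (λ l → dot n (λ k → A k l) (λ k → X₀ k ν′) + overflow 0# l ν′) ≈⟨ dot-+ʳ n _ _ _ ⟩
          dot n (B μ) (λ l → dot n (λ k → A k l) (λ k → X₀ k ν′)) + over
            ≈⟨ +-congʳ (dot-assoc n n (B μ) (λ l k → A k l) (λ k → X₀ k ν′)) ⟩
          rhs + over ∎
        step : - (- over) ≈ ξ * ξ * dot n (Xy μ) (λ k → A ν′ k) - rhs
        step = trans (solve 2 (λ o r → :- (:- o) := r :+ o :- r) refl over rhs) (+-congʳ (sym eq))

      den num : Carrier
      den = ξ * (1# - x * y)
      num = 1# + (y + β) * x

      -- The exchange relation at y concerns X = B X₀. The relation at y = 0 moves A past X₀ alone,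
      -- so that X₀ stands on the right of both products. The extra factor ξ in `den` is the price
      -- of the second relation: it supplies the ξ² that occurs there.
      skewCauchy : ∀ {n} (ν μ : Vec Bool n) → (den * BTA ν μ) ≈[ suc (leading μ) ] (num * ABT ν μ)
      skewCauchy {n} ν μ = cancel n (λ ν → den * BTA ν μ - num * ABT ν μ) main ν
        where
        main : ∀ ν′ → I (suc (leading μ)) (dot n (λ ν → den * BTA ν μ - num * ABT ν μ) (λ ν → X₀ ν ν′))
        main ν′ = I-cong step (I-+ (I-neg (I-*ˡ ξ (overflow-I y μ ν′))) (I-*ˡ num (ABT-X₀ ν′ μ)))
          where
          a = dot n (λ k → A k μ) (λ k → Xy k ν′)
          b = dot n (Xy μ) (λ k → A ν′ k)
          c = dot n (λ ν → ABT ν μ) (λ ν → X₀ ν ν′)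
          step : - (ξ * overflow y μ ν′) + num * (ξ * ξ * b - c) ≈ dot n (λ ν → den * BTA ν μ - num * ABT ν μ) (λ ν → X₀ ν ν′)
          step = begin
            - (ξ * overflow y μ ν′) + num * (ξ * ξ * b - c)
              ≈⟨ solve 5 (λ k o m b c → :- (k :* o) :+ m :* (k :* k :* b :- c) := k :* (k :* m :* b) :- k :* o :+ :- m :* c) refl ξ (overflow y μ ν′) num b c ⟩
            ξ * (ξ * num * b) - ξ * overflow y μ ν′ + - num * c ≈⟨ +-congʳ (+-congʳ (*-congˡ (sym (exchange y μ ν′)))) ⟩
            ξ * ((1# - x * y) * a + overflow y μ ν′) - ξ * overflow y μ ν′ + - num * c
              ≈⟨ solve 6 (λ k q a o m c → k :* (q :* a :+ o) :- k :* o :+ :- m :* c := k :* q :* a :+ :- m :* c) refl ξ (1# - x * y) a (overflow y μ ν′) num c ⟩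
            den * a + - num * c ≈⟨ +-congʳ (*-congˡ (sym (BTA-X₀ ν′ μ))) ⟩
            den * dot n (λ ν → BTA ν μ) (λ ν → X₀ ν ν′) + - num * c ≈⟨ sym (+-cong (Σᵇ-*ˡ n den _) (Σᵇ-*ˡ n (- num) _)) ⟩
            _ ≈⟨ sym (Σᵇ-+ n _ _) ⟩
            _ ≈⟨ Σᵇ-cong n (λ ν → solve 5 (λ d p m q z → d :* (p :* z) :+ :- m :* (q :* z) := (d :* p :- m :* q) :* z) refl den (BTA ν μ) num (ABT ν μ) (X₀ ν ν′)) ⟩
            dot n (λ ν → den * BTA ν μ - num * ABT ν μ) (λ ν → X₀ ν ν′) ∎

  dens nums : Carrier → List Carrier → Carrier
  dens x ys = ∏ ys (λ y → (1# + β * x) * (1# - x * y))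
  nums x ys = ∏ ys (λ y → 1# + (y + β) * x)

  -- y₁ is the last variable of y₁ ∷ ys.
  chain : Bool → List Carrier → ∀ {n} → Vec Bool n → Carrier
  chain P? [] s = δ∅ s
  chain P? (y ∷ ys) {n} s = dot n (One.Diag.B y P? s) (chain P? ys)

  chain-empty : ∀ P? ys n → chain P? ys (empty {n}) ≈ 1#
  chain-empty P? [] zero = refl
  chain-empty P? [] (suc n) = chain-empty P? [] n
  chain-empty P? (y ∷ ys) n = trans (Σᵇ-cong n (λ t → *-congʳ (B-empty t))) (trans (Σᵇ-δ∅ n _) (chain-empty P? ys n))
    where
    open One y
    open Diag P?
    B-empty : ∀ {n} (t : Vec Bool n) → B (empty {n}) t ≈ δ∅ t
    B-empty [] = *-identityˡ _
    B-empty {suc n} (false ∷ t) = trans (+-cong (trans (dot-** n _ _ _ _) (trans (*-congʳ (*-identityˡ _)) (*-identityˡ _))) (dot-0ˡ n _))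
      (trans (+-identityʳ _) (B-empty t))
    B-empty {suc n} (true ∷ t) = trans (+-cong (dot-0ʳ n _) (dot-0ˡ n _)) (+-identityˡ _)

  module _ (P? : Bool) (x : Carrier) (x∈I : I 1 x) where
    open Single P? x x∈I

    -- A is moved past one B after the other until it meets the empty partition, where it acts
    -- trivially by `A-empty`. The precision does not deteriorate because of `B-I`.
    pass : ∀ ys {n} (μ : Vec Bool n) →
      (dens x ys * dot n (λ l → A l μ) (chain P? ys)) ≈[ suc (leading μ) ] (nums x ys * chain P? ys μ)
    pass [] {n} μ = ≈⇒mod (*-congˡ (trans (trans (Σᵇ-cong n (λ l → *-comm _ _)) (Σᵇ-δ∅ n (λ l → A l μ))) (A-empty μ)))
    pass (y ∷ ys) {n} μ = mod-trans (≈⇒mod e₁) (mod-trans (mod-*ˡ D′ (mod-Σᵇ n (λ ν → mod-*ˡ (g ν) (skewCauchy y ν μ))))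
        (mod-trans (≈⇒mod e₂) (mod-trans (mod-*ˡ (num y) bound) (≈⇒mod e₃))))
      where
      open One.Diag y P? using (B)
      D′ = dens x ys
      N′ = nums x ys
      g : Vec Bool n → Carrier
      g = chain P? ys
      e₁ : den y * D′ * dot n (λ l → A l μ) (λ l → dot n (B l) g) ≈ D′ * Σᵇ n (λ ν → g ν * (den y * BTA y ν μ))
      e₁ = begin
        den y * D′ * dot n (λ l → A l μ) (λ l → dot n (B l) g) ≈⟨ *-congˡ (dot-assoc n n (λ l → A l μ) B g) ⟩
        den y * D′ * dot n (λ ν → BTA y ν μ) g ≈⟨ solve 3 (λ d e z → d :* e :* z := e :* (d :* z)) refl _ _ _ ⟩
        D′ * (den y * dot n (λ ν → BTA y ν μ) g) ≈⟨ *-congˡ (sym (Σᵇ-*ˡ n _ _)) ⟩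
        D′ * Σᵇ n (λ ν → den y * (BTA y ν μ * g ν)) ≈⟨ *-congˡ (Σᵇ-cong n (λ ν → solve 3 (λ d a z → d :* (a :* z) := z :* (d :* a)) refl _ _ _)) ⟩
        D′ * Σᵇ n (λ ν → g ν * (den y * BTA y ν μ)) ∎
      e₂ : D′ * Σᵇ n (λ ν → g ν * (num y * ABT y ν μ)) ≈ num y * dot n (B μ) (λ k → D′ * dot n (λ ν → A ν k) g)
      e₂ = begin
        D′ * Σᵇ n (λ ν → g ν * (num y * ABT y ν μ)) ≈⟨ *-congˡ (dot-*ʳ n _ _ _) ⟩
        D′ * (num y * dot n g (λ ν → ABT y ν μ)) ≈⟨ *-congˡ (*-congˡ (Σᵇ-cong n (λ ν → *-comm _ _))) ⟩
        D′ * (num y * dot n (λ ν → ABT y ν μ) g) ≈⟨ *-congˡ (*-congˡ (sym (dot-assoc n n (B μ) (λ k ν → A ν k) g))) ⟩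
        D′ * (num y * dot n (B μ) (λ k → dot n (λ ν → A ν k) g)) ≈⟨ solve 3 (λ d e z → d :* (e :* z) := e :* (d :* z)) refl _ _ _ ⟩
        num y * (D′ * dot n (B μ) (λ k → dot n (λ ν → A ν k) g)) ≈⟨ *-congˡ (sym (dot-*ʳ n _ _ _)) ⟩
        num y * dot n (B μ) (λ k → D′ * dot n (λ ν → A ν k) g) ∎
      bound : dot n (B μ) (λ k → D′ * dot n (λ ν → A ν k) g) ≈[ suc (leading μ) ] dot n (B μ) (λ k → N′ * g k)
      bound = I-cong (trans (Σᵇ-cong n (λ k → solve 3 (λ b p q → b :* (p :- q) := b :* p :+ :- :1 :* (b :* q)) refl _ _ _))
          (trans (Σᵇ-+ n _ _) (trans (+-congˡ (Σᵇ-*ˡ n _ _)) (solve 2 (λ a b → a :+ :- :1 :* b := a :- b) refl _ _))))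
        (B-I y {1} μ (λ k → D′ * dot n (λ ν → A ν k) g - N′ * g k) (λ k → pass ys k))
      e₃ : num y * dot n (B μ) (λ k → N′ * g k) ≈ num y * N′ * dot n (B μ) g
      e₃ = trans (*-congˡ (dot-*ʳ n _ _ _)) (sym (*-assoc _ _ _))

  module _ (P? : Bool) (W : List Carrier → ∀ {n} → Vec Bool n → Carrier)
      (W-[] : ∀ {n} (s : Vec Bool n) → W [] s ≈ δ∅ s)
      (W-∷ : ∀ x xs {n} (s : Vec Bool n) → W (x ∷ xs) s ≈ dot n (Transfer.A R β x 0# P? s₀ s) (W xs))
      (W-I : ∀ {xs} → All (I 1) xs → ∀ {n} (s : Vec Bool n) → I (size s) (W xs s)) where

    -- The error of `pass` at μ has degree greater than the number of leading zeros of μ, and the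
    -- factor W xs μ has degree at least |μ|. By `n≤size+leading` the product always has degree
    -- greater than n, uniformly in μ.
    cauchy : ∀ {xs} → All (I 1) xs → ∀ ys n →
      (∏ xs (λ x → dens x ys) * dot n (W xs) (chain P? ys)) ≈[ suc n ] ∏ xs (λ x → nums x ys)
    cauchy [] ys n = ≈⇒mod (trans (*-identityˡ _) (trans (Σᵇ-cong n (λ s → *-congʳ (W-[] s))) (trans (Σᵇ-δ∅ n _) (chain-empty P? ys n))))
    cauchy {x ∷ xs} (x∈I ∷ xs∈I) ys n = mod-trans (≈⇒mod e₁) (mod-trans (mod-*ˡ Ds (mod-Σᵇ n step))
        (mod-trans (≈⇒mod e₂) (mod-*ˡ (nums x ys) (cauchy xs∈I ys n))))
      where
      open Single P? x x∈I using (A)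
      g : Vec Bool n → Carrier
      g = chain P? ys
      Ds = ∏ xs (λ x → dens x ys)
      e₁ : dens x ys * Ds * dot n (W (x ∷ xs)) g ≈ Ds * Σᵇ n (λ μ → W xs μ * (dens x ys * dot n (λ l → A l μ) g))
      e₁ = begin
        dens x ys * Ds * dot n (W (x ∷ xs)) g
          ≈⟨ *-congˡ (Σᵇ-cong n (λ s → trans (*-congʳ (W-∷ x xs s)) (*-comm _ _))) ⟩
        dens x ys * Ds * dot n g (λ s → dot n (A s) (W xs)) ≈⟨ *-congˡ (dot-assoc n n g A (W xs)) ⟩
        dens x ys * Ds * dot n (λ μ → dot n g (λ l → A l μ)) (W xs) ≈⟨ solve 3 (λ d e z → d :* e :* z := e :* (d :* z)) refl _ _ _ ⟩
        Ds * (dens x ys * dot n (λ μ → dot n g (λ l → A l μ)) (W xs)) ≈⟨ *-congˡ (sym (Σᵇ-*ˡ n _ _)) ⟩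
        Ds * Σᵇ n (λ μ → dens x ys * (dot n g (λ l → A l μ) * W xs μ))
          ≈⟨ *-congˡ (Σᵇ-cong n (λ μ → trans (solve 3 (λ d a w → d :* (a :* w) := w :* (d :* a)) refl _ _ _)
               (*-congˡ (*-congˡ (Σᵇ-cong n (λ l → *-comm _ _)))))) ⟩
        Ds * Σᵇ n (λ μ → W xs μ * (dens x ys * dot n (λ l → A l μ) g)) ∎
      step : ∀ μ → (W xs μ * (dens x ys * dot n (λ l → A l μ) g)) ≈[ suc n ] (W xs μ * (nums x ys * g μ))
      step μ = I-cong (solve 3 (λ w a b → w :* (a :- b) := w :* a :- w :* b) refl _ _ _)
        (I-mono (NP.≤-trans (s≤s (n≤size+leading μ)) (NP.≤-reflexive (P.sym (NP.+-suc (size μ) (leading μ)))))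
          (I-* (W-I xs∈I μ) (pass P? x x∈I ys μ)))
      e₂ : Ds * Σᵇ n (λ μ → W xs μ * (nums x ys * g μ)) ≈ nums x ys * (Ds * dot n (W xs) g)
      e₂ = trans (*-congˡ (dot-*ʳ n _ _ _)) (solve 3 (λ d e z → d :* (e :* z) := e :* (d :* z)) refl _ _ _)

-- Power series rings

module PowerSeries (R : CommutativeRing 0ℓ 0ℓ) where
  open RingKit R hiding (ring)

  Series : Set
  Series = ℕ → Carrier

  infix 4 _≋_
  _≋_ : Series → Series → Set
  f ≋ g = ∀ n → f n ≈ g n

  later : Series → Series
  later f n = f (suc n)

  0ₛ 1ₛ : Series
  0ₛ _ = 0#
  1ₛ zero = 1#
  1ₛ (suc n) = 0#

  infixl 6 _+ₛ_
  infixl 7 _·_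
  _+ₛ_ _·_ : Series → Series → Series
  (f +ₛ g) n = f n + g n
  (f · g) zero = f 0 * g 0
  (f · g) (suc n) = f 0 * g (suc n) + (later f · g) n

  -ₛ_ : Series → Series
  (-ₛ f) n = - f n

  ·-cong : ∀ {f f′ g g′} → f ≋ f′ → g ≋ g′ → f · g ≋ f′ · g′
  ·-cong p q zero = *-cong (p 0) (q 0)
  ·-cong p q (suc n) = +-cong (*-cong (p 0) (q (suc n))) (·-cong (λ k → p (suc k)) q n)

  ·-distribʳ : ∀ h f g → (f +ₛ g) · h ≋ f · h +ₛ g · h
  ·-distribʳ h f g zero = distribʳ _ _ _
  ·-distribʳ h f g (suc n) = trans (+-cong (distribʳ _ _ _) (·-distribʳ h (later f) (later g) n))
    (solve 4 (λ p q r s → p :+ q :+ (r :+ s) := p :+ r :+ (q :+ s)) refl _ _ _ _)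

  -- The product is defined by removing the constant term of the left factor. Removing that of the
  -- right factor instead is what commutativity rests on.
  ·-shiftʳ : ∀ f g n → (f · g) (suc n) ≈ f (suc n) * g 0 + (f · later g) n
  ·-shiftʳ f g zero = +-comm _ _
  ·-shiftʳ f g (suc n) = trans (+-congˡ (·-shiftʳ (later f) g n))
    (solve 3 (λ p q r → p :+ (q :+ r) := q :+ (p :+ r)) refl _ _ _)

  ·-comm : ∀ f g → f · g ≋ g · f
  ·-comm f g zero = *-comm _ _
  ·-comm f g (suc n) = trans (+-cong (*-comm _ _) (·-comm (later f) g n)) (sym (·-shiftʳ g f n))

  ·-scale : ∀ c f g n → ((λ k → c * f k) · g) n ≈ c * (f · g) n
  ·-scale c f g zero = *-assoc _ _ _
  ·-scale c f g (suc n) = trans (+-cong (*-assoc _ _ _) (·-scale c (later f) g n)) (sym (distribˡ _ _ _))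

  ·-assoc : ∀ f g h → f · g · h ≋ f · (g · h)
  ·-assoc f g h zero = *-assoc _ _ _
  ·-assoc f g h (suc n) = begin
    f 0 * g 0 * h (suc n) + (later (f · g) · h) n ≈⟨ +-congˡ (·-distribʳ h (λ k → f 0 * g (suc k)) (later f · g) n) ⟩
    f 0 * g 0 * h (suc n) + (((λ k → f 0 * g (suc k)) · h) n + (later f · g · h) n)
      ≈⟨ +-congˡ (+-cong (·-scale (f 0) (later g) h n) (·-assoc (later f) g h n)) ⟩
    f 0 * g 0 * h (suc n) + (f 0 * (later g · h) n + (later f · (g · h)) n)
      ≈⟨ solve 5 (λ a b c d e → a :* b :* c :+ (a :* d :+ e) := a :* (b :* c :+ d) :+ e) refl _ _ _ _ _ ⟩
    f 0 * (g · h) (suc n) + (later f · (g · h)) n ∎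

  ·-zeroˡ : ∀ g → 0ₛ · g ≋ 0ₛ
  ·-zeroˡ g zero = zeroˡ _
  ·-zeroˡ g (suc n) = trans (+-cong (zeroˡ _) (·-zeroˡ g n)) (+-identityˡ _)

  ·-identityˡ : ∀ g → 1ₛ · g ≋ g
  ·-identityˡ g zero = *-identityˡ _
  ·-identityˡ g (suc n) = trans (+-cong (*-identityˡ _) (·-zeroˡ g n)) (+-identityʳ _)

  ring : CommutativeRing 0ℓ 0ℓ
  ring = record
    { Carrier = Series ; _≈_ = _≋_ ; _+_ = _+ₛ_ ; _*_ = _·_ ; -_ = -ₛ_ ; 0# = 0ₛ ; 1# = 1ₛ
    ; isCommutativeRing = record
      { isRing = record
        { +-isAbelianGroup = record
          { isGroup = record
            { isMonoid = record
              { isSemigroup = record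
                { isMagma = record
                  { isEquivalence = record { refl = λ n → refl ; sym = λ p n → sym (p n) ; trans = λ p q n → trans (p n) (q n) }
                  ; ∙-cong = λ p q n → +-cong (p n) (q n) }
                ; assoc = λ f g h n → +-assoc _ _ _ }
              ; identity = (λ f n → +-identityˡ _) , (λ f n → +-identityʳ _) }
            ; inverse = (λ f n → -‿inverseˡ _) , (λ f n → -‿inverseʳ _)
            ; ⁻¹-cong = λ p n → -‿cong (p n) }
          ; comm = λ f g n → +-comm _ _ }
        ; *-cong = ·-cong
        ; *-assoc = ·-assoc
        ; *-identity = ·-identityˡ , (λ g n → trans (·-comm g 1ₛ n) (·-identityˡ g n))
        ; distrib = (λ h f g n → trans (·-comm h (f +ₛ g) n) (trans (·-distribʳ h f g n) (+-cong (·-comm f h n) (·-comm g h n)))) , ·-distribʳ }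
      ; *-comm = ·-comm } }

  ∑-upTo-suc : ∀ n (f : ℕ → Carrier) → ∑ (upTo (suc n)) f ≈ f 0 + ∑ (upTo n) (λ i → f (suc i))
  ∑-upTo-suc n f = +-congˡ (trans (resp (λ l → ∑ l f) (P.sym (LP.map-upTo suc n))) (∑-map suc (upTo n) f))

  ·-∑ : ∀ f g n → (f · g) n ≈ ∑ (range0 n) (λ i → f i * g (n ∸ i))
  ·-∑ f g zero = sym (+-identityʳ _)
  ·-∑ f g (suc n) = trans (+-congˡ (·-∑ (later f) g n)) (sym (∑-upTo-suc (suc n) (λ i → f i * g (suc n ∸ i))))

  module _ (F : Filtration R) (w : ℕ) where
    open Filtration F

    -- The new variable gets weight w, so the coefficient of its n-th power only has to supply the
    -- remaining degree. Truncated subtraction makes the condition vacuous once that power alone is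
    -- high enough.
    filtration : Filtration ring
    filtration = record
      { I = λ k f → ∀ n → I (k ∸ w ℕ.* n) (f n)
      ; I-cong = λ e h n → I-cong (e n) (h n)
      ; I-0 = λ n → I-0
      ; I-+ = λ h h′ n → I-+ (h n) (h′ n)
      ; I-all = λ f n → P.subst (λ k → I k (f n)) (P.sym (NP.0∸n≡0 (w ℕ.* n))) (I-all (f n))
      ; I-* = I-·
      ; I-mono = λ j≤k h n → I-mono (NP.∸-monoˡ-≤ (w ℕ.* n) j≤k) (h n) }
      where
      arith : ∀ j k p q → (j ℕ.+ k) ∸ (p ℕ.+ q) ≤ (j ∸ p) ℕ.+ (k ∸ q)
      arith j k p q = NP.m≤n+o⇒m∸n≤o (j ℕ.+ k) (p ℕ.+ q) (NP.≤-trans (NP.+-mono-≤ (NP.m≤n+m∸n j p) (NP.m≤n+m∸n k q))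
        (NP.≤-reflexive (interchange p (j ∸ p) q (k ∸ q))))
      I-· : ∀ {j k f g} → (∀ n → I (j ∸ w ℕ.* n) (f n)) → (∀ n → I (k ∸ w ℕ.* n) (g n)) → ∀ n → I ((j ℕ.+ k) ∸ w ℕ.* n) ((f · g) n)
      I-· {j} {k} {f} {g} hf hg n = I-cong (sym (·-∑ f g n)) (I-∑ (suc n) (λ i → i) (λ i i<sn → NP.≤-pred i<sn))
        where
        term : ∀ i → i ≤ n → I ((j ℕ.+ k) ∸ w ℕ.* n) (f i * g (n ∸ i))
        term i i≤n = I-mono (P.subst (λ m → (j ℕ.+ k) ∸ m ≤ (j ∸ w ℕ.* i) ℕ.+ (k ∸ w ℕ.* (n ∸ i)))
          (P.trans (P.sym (NP.*-distribˡ-+ w i (n ∸ i))) (P.cong (w ℕ.*_) (NP.m+[n∸m]≡n i≤n)))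
          (arith j k (w ℕ.* i) (w ℕ.* (n ∸ i)))) (I-* (hf i) (hg (n ∸ i)))
        I-∑ : ∀ m (c : ℕ → ℕ) → (∀ i → i < m → c i ≤ n) → I ((j ℕ.+ k) ∸ w ℕ.* n) (∑ (applyUpTo c m) (λ i → f i * g (n ∸ i)))
        I-∑ zero c h = I-0
        I-∑ (suc m) c h = I-+ (term (c 0) (h 0 (s≤s z≤n))) (I-∑ m (λ i → c (suc i)) (λ i i<m → h (suc i) (s≤s i<m)))

-- The variable of index 0 is the outermost one; the others belong to the coefficient ring with
-- their index lowered by one.
PS : ℕ → CommutativeRing 0ℓ 0ℓ
PS zero = ZP.+-*-commutativeRing
PS (suc L) = PowerSeries.ring (PS L)

module PS L = RingKit (PS L)

open PS 0 using () renaming (∑ to ∑₀; ∑-cong to ∑₀-cong; ∑-*ˡ to ∑₀-*ˡ; ∑-*ʳ to ∑₀-*ʳ; ∑-swap to ∑₀-swap; ∑-zero to ∑₀-zero; ∑-map to ∑₀-map;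
  ι to ι₀; ι-∧ to ι₀-∧; Σᵇ to Σ₀; Σᵇ-cong to Σ₀-cong; Σᵇ-zero to Σ₀-zero; Σᵇ-*ˡ to Σ₀-*ˡ)

-- w i is the weight of variable i. The comparison with A counts only the x's, while the geometric
-- series below give every variable weight 1.
𝔽 : (w : ℕ → ℕ) → ∀ L → Filtration (PS L)
𝔽 w zero = record
  { I = λ k c → 0 < k → c ≡ + 0
  ; I-cong = λ e h p → P.trans (P.sym e) (h p)
  ; I-0 = λ _ → P.refl
  ; I-+ = λ h h′ p → P.cong₂ ℤ._+_ (h p) (h′ p)
  ; I-all = λ a ()
  ; I-* = λ {j} {k} {a} {b} → base j k a b
  ; I-mono = λ j≤k h p → h (NP.≤-trans p j≤k) }
  where
  base : ∀ j k a b → (0 < j → a ≡ + 0) → (0 < k → b ≡ + 0) → 0 < j ℕ.+ k → a ℤ.* b ≡ + 0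
  base zero k a b h h′ p = P.trans (P.cong (a ℤ.*_) (h′ p)) (ZP.*-zeroʳ a)
  base (suc j) k a b h h′ p = P.trans (P.cong (ℤ._* b) (h (s≤s z≤n))) (ZP.*-zeroˡ b)
𝔽 w (suc L) = PowerSeries.filtration (PS L) (𝔽 (λ i → w (suc i)) L) (w 0)

curry : ∀ L → (List ℕ → ℤ) → PS.Carrier L
curry zero f = f []
curry (suc L) f n = curry L (λ e → f (n ∷ e))

coef : ∀ L → PS.Carrier L → Vec ℕ L → ℤ
coef zero c [] = c
coef (suc L) f (n ∷ e) = coef L (f n) e

coef-cong : ∀ L {f g} → PS._≈_ L f g → ∀ e → coef L f e ≡ coef L g e
coef-cong zero p [] = p
coef-cong (suc L) p (n ∷ e) = coef-cong L (p n) e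

coef-ext : ∀ L {f g} → (∀ e → coef L f e ≡ coef L g e) → PS._≈_ L f g
coef-ext zero p = p []
coef-ext (suc L) p n = coef-ext L (λ e → p (n ∷ e))

coef-curry : ∀ L f e → coef L (curry L f) e ≡ f (Vec.toList e)
coef-curry zero f [] = P.refl
coef-curry (suc L) f (n ∷ e) = coef-curry L (λ e → f (n ∷ e)) e

curry-cong : ∀ L {f g} → (∀ e → f e ≡ g e) → PS._≈_ L (curry L f) (curry L g)
curry-cong zero p = p []
curry-cong (suc L) p n = curry-cong L (λ e → p (n ∷ e))

coef-0 : ∀ L e → coef L (PS.0# L) e ≡ + 0
coef-0 zero [] = P.refl
coef-0 (suc L) (n ∷ e) = coef-0 L e

coef-+ : ∀ L f g e → coef L (PS._+_ L f g) e ≡ coef L f e ℤ.+ coef L g e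
coef-+ zero f g [] = P.refl
coef-+ (suc L) f g (n ∷ e) = coef-+ L (f n) (g n) e

coef-neg : ∀ L f e → coef L (PS.-_ L f) e ≡ ℤ.- coef L f e
coef-neg zero f [] = P.refl
coef-neg (suc L) f (n ∷ e) = coef-neg L (f n) e

coef-∑ : ∀ L {A : Set} (as : List A) f e → coef L (PS.∑ L as f) e ≡ Σℤ as (λ a → coef L (f a) e)
coef-∑ L [] f e = coef-0 L e
coef-∑ L (a ∷ as) f e = P.trans (coef-+ L (f a) _ e) (P.cong (λ z → coef L (f a) e ℤ.+ z) (coef-∑ L as f e))

curry-0 : ∀ L → PS._≈_ L (curry L (λ _ → + 0)) (PS.0# L)
curry-0 L = coef-ext L (λ e → P.trans (coef-curry L _ e) (P.sym (coef-0 L e)))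

curry-∑ : ∀ L {A : Set} (as : List A) (f : A → List ℕ → ℤ) →
  PS._≈_ L (curry L (λ e → Σℤ as (λ a → f a e))) (PS.∑ L as (λ a → curry L (f a)))
curry-∑ L as f = coef-ext L (λ e → P.trans (coef-curry L _ e) (P.trans (go as e) (P.sym (coef-∑ L as _ e))))
  where
  go : ∀ as e → Σℤ as (λ a → f a (Vec.toList e)) ≡ Σℤ as (λ a → coef L (curry L (f a)) e)
  go [] e = P.refl
  go (a ∷ as) e = P.cong₂ ℤ._+_ (P.sym (coef-curry L (f a) e)) (go as e)

Σℤ≡∑ : ∀ {A : Set} (as : List A) f → Σℤ as f ≡ PS.∑ 0 as f
Σℤ≡∑ [] f = P.refl
Σℤ≡∑ (a ∷ as) f = P.cong (λ z → f a ℤ.+ z) (Σℤ≡∑ as f)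

convolve : (List ℕ → ℤ) → (List ℕ → ℤ) → List ℕ → ℤ
convolve f g e = Σℤ (below e) (λ e₁ → f e₁ ℤ.* g (zipWith _∸_ e e₁))

curry-convolve : ∀ L f g → PS._≈_ L (curry L (convolve f g)) (PS._*_ L (curry L f) (curry L g))
curry-convolve zero f g = ZP.+-identityʳ _
curry-convolve (suc L) f g n = begin
    curry L (λ e → convolve f g (n ∷ e)) ≈⟨ curry-cong L split ⟩
    curry L (λ e → Σℤ (range0 n) (λ y → convolve (λ e → f (y ∷ e)) (λ e → g (n ∸ y ∷ e)) e)) ≈⟨ curry-∑ L (range0 n) (λ y → convolve (λ e → f (y ∷ e)) (λ e → g (n ∸ y ∷ e))) ⟩
    ∑ (range0 n) (λ y → curry L (convolve (λ e → f (y ∷ e)) (λ e → g (n ∸ y ∷ e)))) ≈⟨ ∑-cong (range0 n) (λ y → curry-convolve L _ _) ⟩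
    ∑ (range0 n) (λ y → curry (suc L) f y * curry (suc L) g (n ∸ y)) ≈⟨ sym (PowerSeries.·-∑ (PS L) (curry (suc L) f) (curry (suc L) g) n) ⟩
    PowerSeries._·_ (PS L) (curry (suc L) f) (curry (suc L) g) n ∎
  where
  open PS L
  split : ∀ e → convolve f g (n ∷ e) ≡ Σℤ (range0 n) (λ y → convolve (λ e → f (y ∷ e)) (λ e → g (n ∸ y ∷ e)) e)
  split e = P.trans (Σℤ≡∑ (below (n ∷ e)) h) (P.trans (PS.∑-concatMap 0 (λ y → map (y ∷_) (below e)) (range0 n) h)
    (P.trans (PS.∑-cong 0 (range0 n) (λ y → P.trans (PS.∑-map 0 (y ∷_) (below e) h) (P.sym (Σℤ≡∑ (below e) _))))
      (P.sym (Σℤ≡∑ (range0 n) (λ y → convolve (λ e → f (y ∷ e)) (λ e → g (n ∸ y ∷ e)) e)))))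
    where
    h : List ℕ → ℤ
    h e₁ = f e₁ ℤ.* g (zipWith _∸_ (n ∷ e) e₁)

-- β is the variable of index 0, and the z-variable with list index k has index k + 1.
φ : ∀ L → Ser → PS.Carrier (suc L)
φ L F b = curry L (F b)

φ-mul : ∀ L F G → PS._≈_ (suc L) (φ L (mulS F G)) (PS._*_ (suc L) (φ L F) (φ L G))
φ-mul L F G b = trans (curry-∑ L (range0 b) (λ b₁ → convolve (F b₁) (G (b ∸ b₁))))
    (trans (∑-cong (range0 b) (λ b₁ → curry-convolve L (F b₁) (G (b ∸ b₁)))) (sym (PowerSeries.·-∑ (PS L) (φ L F) (φ L G) b)))
  where open PS L

φ-add : ∀ L F G → PS._≈_ (suc L) (φ L (addS F G)) (PS._+_ (suc L) (φ L F) (φ L G))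
φ-add L F G b = coef-ext L (λ e → P.trans (coef-curry L _ e) (P.sym (P.trans (coef-+ L (φ L F b) (φ L G b) e)
  (P.cong₂ ℤ._+_ (coef-curry L (F b) e) (coef-curry L (G b) e)))))

φ-neg : ∀ L F → PS._≈_ (suc L) (φ L (negS F)) (PS.-_ (suc L) (φ L F))
φ-neg L F b = coef-ext L (λ e → P.trans (coef-curry L _ e) (P.sym (P.trans (coef-neg L (φ L F b) e) (P.cong ℤ.-_ (coef-curry L (F b) e)))))

var : ∀ L → ℕ → PS.Carrier L
var zero k = + 0
var (suc L) zero zero = PS.0# L
var (suc L) zero (suc zero) = PS.1# L
var (suc L) zero (suc (suc n)) = PS.0# L
var (suc L) (suc k) zero = var L k
var (suc L) (suc k) (suc n) = PS.0# L

curry-sum : ∀ L → PS._≈_ L (curry L (λ e → boolℤ (sum e ≡ᵇ 0))) (PS.1# L)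
curry-sum zero = P.refl
curry-sum (suc L) zero = curry-sum L
curry-sum (suc L) (suc n) = curry-0 L

curry-var : ∀ L k → PS._≈_ L (curry L (λ e → boolℤ ((sum e ≡ᵇ 1) ∧ (nth k e ≡ᵇ 1)))) (var L k)
curry-var zero k = P.refl
curry-var (suc L) zero zero = PS.trans L (curry-cong L (λ e → z (sum e ≡ᵇ 1))) (curry-0 L)
  where
  z : ∀ b → boolℤ (b ∧ false) ≡ + 0
  z false = P.refl
  z true = P.refl
curry-var (suc L) zero (suc zero) = PS.trans L (curry-cong L (λ e → z (sum e ≡ᵇ 0))) (curry-sum L)
  where
  z : ∀ b → boolℤ (b ∧ true) ≡ boolℤ b
  z false = P.refl
  z true = P.refl
curry-var (suc L) zero (suc (suc n)) = curry-0 L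
curry-var (suc L) (suc k) zero = curry-var L k
curry-var (suc L) (suc k) (suc n) = PS.trans L (curry-cong L (λ e → z n k e)) (curry-0 L)
  where
  nth≤sum : ∀ k e → nth k e ≤ sum e
  nth≤sum k [] = z≤n
  nth≤sum zero (x ∷ e) = NP.m≤m+n x _
  nth≤sum (suc k) (x ∷ e) = NP.≤-trans (nth≤sum k e) (NP.m≤n+m _ x)
  z : ∀ n k e → boolℤ ((suc n ℕ.+ sum e ≡ᵇ 1) ∧ (nth k e ≡ᵇ 1)) ≡ + 0
  z n k e with n ℕ.+ sum e in p
  ... | suc m = P.refl
  ... | zero with nth k e | nth≤sum k e
  ...   | zero | q = P.refl
  ...   | suc m | q with sum e | NP.m+n≡0⇒n≡0 n p
  ...     | .0 | P.refl with q
  ...       | ()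

φ-one : ∀ L → PS._≈_ (suc L) (φ L oneS) (PS.1# (suc L))
φ-one L zero = curry-sum L
φ-one L (suc n) = curry-0 L

φ-beta : ∀ L → PS._≈_ (suc L) (φ L betaS) (var (suc L) 0)
φ-beta L zero = curry-0 L
φ-beta L (suc zero) = curry-sum L
φ-beta L (suc (suc n)) = curry-0 L

φ-var : ∀ L k → PS._≈_ (suc L) (φ L (varS k)) (var (suc L) (suc k))
φ-var L k zero = curry-var L k
φ-var L k (suc n) = curry-0 L

degree : (ℕ → ℕ) → ∀ {L} → Vec ℕ L → ℕ
degree w [] = 0
degree w (n ∷ e) = w 0 ℕ.* n ℕ.+ degree (λ i → w (suc i)) e

open Filtration using () renaming (I to I[_])

-- Together with `I-coef` this identifies the filtration: `I k` consists of the series without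
-- monomials of weighted degree below k.
coef-I : ∀ w L {k f} → I[ 𝔽 w L ] k f → ∀ e → degree w e < k → coef L f e ≡ + 0
coef-I w zero h [] p = h p
coef-I w (suc L) {k} h (n ∷ e) p = coef-I (λ i → w (suc i)) L (h n) e
  (NP.m+n≤o⇒m≤o∸n _ (P.subst (_≤ k) (P.cong suc (NP.+-comm (w 0 ℕ.* n) _)) p))

I-coef : ∀ w L {k f} → (∀ e → degree w e < k → coef L f e ≡ + 0) → I[ 𝔽 w L ] k f
I-coef w zero h p = h [] p
I-coef w (suc L) {k} h n = I-coef (λ i → w (suc i)) L (λ e p → h (n ∷ e)
  (P.subst (_≤ k) (NP.+-suc (w 0 ℕ.* n) _) (lemma (w 0 ℕ.* n) _ k p)))
  where
  lemma : ∀ m a k → suc a ≤ k ∸ m → m ℕ.+ suc a ≤ k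
  lemma zero a k p = p
  lemma (suc m) a zero ()
  lemma (suc m) a (suc k) p = s≤s (lemma m a k p)

I-var : ∀ w L k → I[ 𝔽 w L ] (w k) (var L k)
I-var w zero k = λ _ → P.refl
I-var w (suc L) zero zero = Filtration.I-0 (𝔽 _ L)
I-var w (suc L) zero (suc zero) = P.subst (λ j → I[ 𝔽 (λ i → w (suc i)) L ] j (PS.1# L))
  (P.sym (P.trans (P.cong (w 0 ∸_) (NP.*-identityʳ (w 0))) (NP.n∸n≡0 (w 0)))) (Filtration.I-all (𝔽 _ L) (PS.1# L))
I-var w (suc L) zero (suc (suc n)) = Filtration.I-0 (𝔽 _ L)
I-var w (suc L) (suc k) zero = P.subst (λ j → I[ 𝔽 (λ i → w (suc i)) L ] (w (suc k) ∸ j) (var L k)) (P.sym (NP.*-zeroʳ (w 0))) (I-var (λ i → w (suc i)) L k)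
I-var w (suc L) (suc k) (suc n) = Filtration.I-0 (𝔽 _ L)

module Geometric (L : ℕ) where
  open PS L
  private
    one : ℕ → ℕ
    one _ = 1
  open Filtration (𝔽 one L)

  ∑-upTo-+ : ∀ m k (f : ℕ → Carrier) → ∑ (upTo (m ℕ.+ k)) f ≈ ∑ (upTo m) f + ∑ (upTo k) (λ i → f (m ℕ.+ i))
  ∑-upTo-+ zero k f = sym (+-identityˡ _)
  ∑-upTo-+ (suc m) k f = trans (∑-upTo-suc′ (m ℕ.+ k) f) (trans (+-congˡ (∑-upTo-+ m k (λ i → f (suc i))))
    (trans (sym (+-assoc _ _ _)) (+-congʳ (sym (∑-upTo-suc′ m f)))))
    where ∑-upTo-suc′ = PowerSeries.∑-upTo-suc (PS L)

  partial : Carrier → ℕ → Carrier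
  partial u N = ∑ (range0 N) (pw u)

  telescope : ∀ u m → (1# - u) * ∑ (upTo m) (pw u) ≈ 1# - pw u m
  telescope u zero = solve 1 (λ u → (:1 :- u) :* :0 := :1 :- :1) refl u
  telescope u (suc m) = begin
    (1# - u) * ∑ (upTo (suc m)) (pw u) ≈⟨ *-congˡ (PowerSeries.∑-upTo-suc (PS L) m (pw u)) ⟩
    (1# - u) * (1# + ∑ (upTo m) (λ i → u * pw u i)) ≈⟨ *-congˡ (+-congˡ (sym (∑-*ˡ u (upTo m) (pw u)))) ⟩
    (1# - u) * (1# + u * ∑ (upTo m) (pw u))
      ≈⟨ solve 2 (λ u s → (:1 :- u) :* (:1 :+ u :* s) := :1 :- u :+ u :* ((:1 :- u) :* s)) refl u _ ⟩
    1# - u + u * ((1# - u) * ∑ (upTo m) (pw u)) ≈⟨ +-congˡ (*-congˡ (telescope u m)) ⟩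
    1# - u + u * (1# - pw u m) ≈⟨ solve 2 (λ u p → :1 :- u :+ u :* (:1 :- p) := :1 :- u :* p) refl u _ ⟩
    1# - pw u (suc m) ∎

  I-pw : ∀ {u} → I 1 u → ∀ n → I n (pw u n)
  I-pw h zero = I-all 1#
  I-pw h (suc n) = I-* h (I-pw h n)

  coef-∑-vanish : ∀ k (f : ℕ → Carrier) e → (∀ i → coef L (f i) e ≡ + 0) → coef L (∑ (upTo k) f) e ≡ + 0
  coef-∑-vanish k f e h = P.trans (coef-∑ L (upTo k) f e) (go (upTo k))
    where
    go : ∀ (l : List ℕ) → Σℤ l (λ i → coef L (f i) e) ≡ + 0
    go [] = P.refl
    go (i ∷ l) = P.cong₂ ℤ._+_ (h i) (go l)

  -- At an exponent of degree N, both u^(N+1) and the difference of G from its partial sum up to N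
  -- have too high a degree to contribute, so the telescoping identity for the partial sum decides.
  geometric : ∀ G u → I 1 u → (∀ e → coef L G e ≡ coef L (partial u (degree one e)) e) → G * (1# - u) ≈ 1#
  geometric G u hu hG = coef-ext L at
    where
    agree : ∀ N e → degree one e < suc N → coef L (G - partial u N) e ≡ + 0
    agree N e (s≤s d≤N) = P.trans (coef-+ L G (- partial u N) e) (P.trans (P.cong₂ ℤ._+_ (hG e) (coef-neg L (partial u N) e))
        (P.trans (P.cong (λ z → coef L (partial u d) e ℤ.- z) same) (ZP.+-inverseʳ (coef L (partial u d) e))))
      where
      d = degree one e
      k = N ∸ d
      same : coef L (partial u N) e ≡ coef L (partial u d) e
      same = P.trans (P.cong (λ m → coef L (partial u m) e) (P.sym (NP.m+[n∸m]≡n d≤N)))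
        (P.trans (coef-cong L (∑-upTo-+ (suc d) k (pw u)) e) (P.trans (coef-+ L (partial u d) _ e)
          (P.trans (P.cong (λ z → coef L (partial u d) e ℤ.+ z) (coef-∑-vanish k (λ i → pw u (suc d ℕ.+ i)) e
            (λ i → coef-I one L (I-pw hu (suc d ℕ.+ i)) e (s≤s (NP.m≤m+n d i))))) (ZP.+-identityʳ _))))
    at : ∀ e → coef L (G * (1# - u)) e ≡ coef L 1# e
    at e = P.trans (coef-cong L split e) (P.trans (coef-+ L 1# _ e) (P.trans (P.cong (λ z → coef L 1# e ℤ.+ z)
        (coef-I one L (I-+ (I-cong (solve 1 (λ a → :- :1 :* a := :- a) refl _) (I-* (I-all (- 1#)) (I-pw hu (suc N)))) (I-* (I-all (1# - u)) (I-coef one L (agree N)))) e NP.≤-refl))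
        (ZP.+-identityʳ _)))
      where
      N = degree one e
      split : G * (1# - u) ≈ 1# + (- pw u (suc N) + (1# - u) * (G - partial u N))
      split = begin
        G * (1# - u) ≈⟨ solve 3 (λ g u p → g :* (:1 :- u) := (:1 :- u) :* p :+ (:1 :- u) :* (g :- p)) refl G u (partial u N) ⟩
        (1# - u) * partial u N + (1# - u) * (G - partial u N) ≈⟨ +-congʳ (telescope u (suc N)) ⟩
        1# - pw u (suc N) + (1# - u) * (G - partial u N) ≈⟨ +-assoc _ _ _ ⟩
        1# + (- pw u (suc N) + (1# - u) * (G - partial u N)) ∎

-- The kernel in the power series ring

module Kernel (L : ℕ) where
  open PS (suc L)
  open Geometric (suc L) using (geometric)
  open Filtration (𝔽 (λ _ → 1) (suc L)) using (I; I-*; I-cong; I-mono; I-all)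

  v : ℕ → Carrier
  v = var (suc L)

  β : Carrier
  β = v 0

  xv yv : ℕ → Carrier
  xv i = v (suc (2 ℕ.* i))
  yv j = v (suc (2 ℕ.* j ℕ.+ 1))

  φ-pow : ∀ u n → φ L (powS u n) ≈ pw (φ L u) n
  φ-pow u zero = φ-one L
  φ-pow u (suc n) = trans (φ-mul L u (powS u n)) (*-congˡ (φ-pow u n))

  degree-sum : ∀ {n} (e : Vec ℕ n) → degree (λ _ → 1) e ≡ sum (Vec.toList e)
  degree-sum [] = P.refl
  degree-sum (n ∷ e) = P.cong₂ ℕ._+_ (NP.*-identityˡ n) (degree-sum e)

  φ-geom : ∀ u → I 1 (φ L u) → φ L (geomS u) * (1# - φ L u) ≈ 1#
  φ-geom u h = geometric (φ L (geomS u)) (φ L u) h at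
    where
    at : ∀ e → coef (suc L) (φ L (geomS u)) e ≡ coef (suc L) (∑ (range0 (degree (λ _ → 1) e)) (pw (φ L u))) e
    at (b ∷ e) = P.trans (coef-curry L (geomS u b) e) (P.sym (P.trans (coef-∑ (suc L) (range0 (degree (λ _ → 1) (b ∷ e))) (pw (φ L u)) (b ∷ e))
      (P.trans (P.cong (λ d → Σℤ (range0 d) (λ n → coef (suc L) (pw (φ L u) n) (b ∷ e))) (degree-sum (b ∷ e)))
        (go (range0 (b ℕ.+ sum (Vec.toList e)))))))
      where
      go : ∀ l → Σℤ l (λ n → coef (suc L) (pw (φ L u) n) (b ∷ e)) ≡ Σℤ l (λ n → powS u n b (Vec.toList e))
      go [] = P.refl
      go (n ∷ l) = P.cong₂ ℤ._+_ (P.trans (coef-cong (suc L) (sym (φ-pow u n)) (b ∷ e)) (coef-curry L (powS u n b) e)) (go l)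

  den num : ℕ → ℕ → Carrier
  den i j = (1# + β * xv i) * (1# - xv i * yv j)
  num i j = 1# + (yv j + β) * xv i

  -- The inverse of `den`, needed to divide the denominator-free Cauchy identity.
  inv : ℕ → ℕ → Carrier
  inv i j = φ L (geomS (negS (mulS betaS (varS (2 ℕ.* i))))) * φ L (geomS (mulS (varS (2 ℕ.* i)) (varS (2 ℕ.* j ℕ.+ 1))))

  module _ (i j : ℕ) where
    private
      X = varS (2 ℕ.* i)
      Y = varS (2 ℕ.* j ℕ.+ 1)
      g₁ = φ L (geomS (negS (mulS betaS X)))
      g₂ = φ L (geomS (mulS X Y))

      xy : φ L (mulS X Y) ≈ xv i * yv j
      xy = trans (φ-mul L X Y) (*-cong (φ-var L _) (φ-var L _))

      bx : φ L (negS (mulS betaS X)) ≈ - (β * xv i)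
      bx = trans (φ-neg L _) (-‿cong (trans (φ-mul L betaS X) (*-cong (φ-beta L) (φ-var L _))))

      I-v : ∀ k → I 1 (v k)
      I-v = I-var (λ _ → 1) (suc L)

      g₁-inv : g₁ * (1# + β * xv i) ≈ 1#
      g₁-inv = trans (*-congˡ (trans (solve 1 (λ a → :1 :+ a := :1 :- :- a) refl _) (+-congˡ (-‿cong (sym bx)))))
        (φ-geom (negS (mulS betaS X)) (I-cong (sym bx) (I-cong (solve 2 (λ b x → :- b :* x := :- (b :* x)) refl _ _) (I-* (I-all (- β)) (I-v (suc (2 ℕ.* i)))))))

      g₂-inv : g₂ * (1# - xv i * yv j) ≈ 1#
      g₂-inv = trans (*-congˡ (+-congˡ (-‿cong (sym xy)))) (φ-geom (mulS X Y) (I-cong (sym xy) (I-* (I-all (xv i)) (I-v (suc (2 ℕ.* j ℕ.+ 1))))))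

    inv-den : inv i j * den i j ≈ 1#
    inv-den = trans (solve 4 (λ a b c d → a :* b :* (c :* d) := a :* c :* (b :* d)) refl g₁ g₂ _ _) (trans (*-cong g₁-inv g₂-inv) (*-identityˡ _))

    -- The denominators cancel and leave 1 + βx + xy, the numerator that `skewCauchy` produces.
    kernel-den : φ L (kernelFactor i j) * den i j ≈ num i j
    kernel-den = begin
      φ L (kernelFactor i j) * den i j ≈⟨ *-congʳ factor ⟩
      (1# + xv i * yv j * g₁) * g₂ * den i j
        ≈⟨ solve 5 (λ p a b c d → (:1 :+ p :* a) :* b :* (c :* d) := (c :+ p :* (a :* c)) :* (b :* d)) refl (xv i * yv j) g₁ g₂ _ _ ⟩
      (1# + β * xv i + xv i * yv j * (g₁ * (1# + β * xv i))) * (g₂ * (1# - xv i * yv j)) ≈⟨ *-cong (+-congˡ (*-congˡ g₁-inv)) g₂-inv ⟩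
      (1# + β * xv i + xv i * yv j * 1#) * 1#
        ≈⟨ solve 3 (λ b x y → (:1 :+ b :* x :+ x :* y :* :1) :* :1 := :1 :+ (y :+ b) :* x) refl β (xv i) (yv j) ⟩
      num i j ∎
      where
      factor : φ L (kernelFactor i j) ≈ (1# + xv i * yv j * g₁) * g₂
      factor = trans (φ-mul L (addS oneS (mulS (mulS X Y) (geomS (negS (mulS betaS X))))) (geomS (mulS X Y)))
        (*-congʳ (trans (φ-add L oneS _) (+-cong (φ-one L) (trans (φ-mul L (mulS X Y) _) (*-congʳ xy)))))

  φ-foldr : ∀ l → φ L (foldr mulS oneS l) ≈ ∏ l (φ L)
  φ-foldr [] = φ-one L
  φ-foldr (F ∷ l) = trans (φ-mul L F (foldr mulS oneS l)) (*-congˡ (φ-foldr l))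

  φ-kernel : ∀ m n → φ L (kernelS m n) ≈ ∏ (upTo m) (λ i → ∏ (upTo n) (λ j → φ L (kernelFactor i j)))
  φ-kernel m n = trans (φ-foldr (concatMap (λ i → map (kernelFactor i) (upTo n)) (upTo m))) (go (upTo m))
    where
    go : ∀ l → ∏ (concatMap (λ i → map (kernelFactor i) (upTo n)) l) (φ L) ≈ ∏ l (λ i → ∏ (upTo n) (λ j → φ L (kernelFactor i j)))
    go [] = refl
    go (i ∷ l) = trans (∏-++ (map (kernelFactor i) (upTo n)) _ (φ L)) (*-cong (∏-map (kernelFactor i) (upTo n) (φ L)) (go l))

-- Boolean tests and fillings box by box

T⇒≡ : ∀ {b} → T b → b ≡ true
T⇒≡ {true} _ = P.refl

≡ᵇ-refl : ∀ n → (n ≡ᵇ n) ≡ true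
≡ᵇ-refl zero = P.refl
≡ᵇ-refl (suc n) = ≡ᵇ-refl n

<⇒≢ᵇ : ∀ {m n} → m < n → (m ≡ᵇ n) ≡ false
<⇒≢ᵇ {zero} (s≤s _) = P.refl
<⇒≢ᵇ {suc m} (s≤s p) = <⇒≢ᵇ p

>⇒≢ᵇ : ∀ {m n} → n < m → (m ≡ᵇ n) ≡ false
>⇒≢ᵇ {suc m} {zero} _ = P.refl
>⇒≢ᵇ {suc m} {suc n} (s≤s p) = >⇒≢ᵇ p

≤⇒≤ᵇ≡ : ∀ {m n} → m ≤ n → (m ≤ᵇ n) ≡ true
≤⇒≤ᵇ≡ p = T⇒≡ (NP.≤⇒≤ᵇ p)

<⇒≰ᵇ : ∀ {m n} → n < m → (m ≤ᵇ n) ≡ false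
<⇒≰ᵇ {m} {n} p with m ≤ᵇ n in e
... | false = P.refl
... | true = ⊥-elim (NP.<⇒≱ p (NP.≤ᵇ⇒≤ m n (P.subst T (P.sym e) _)))

≰ᵇ⇒> : ∀ m n → (m ≤ᵇ n) ≡ false → n < m
≰ᵇ⇒> m n e = NP.≰⇒> (λ le → BP.not-¬ {true} P.refl (P.trans (P.sym (≤⇒≤ᵇ≡ le)) e))

≤ᵇ⇒≤′ : ∀ m n → (m ≤ᵇ n) ≡ true → m ≤ n
≤ᵇ⇒≤′ m n e = NP.≤ᵇ⇒≤ m n (P.subst T (P.sym e) _)

all-∧ : {A : Set} (p q : A → Bool) (l : List A) → all (λ a → p a ∧ q a) l ≡ all p l ∧ all q l
all-∧ p q [] = P.refl
all-∧ p q (a ∷ l) rewrite all-∧ p q l with p a | q a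
... | true | true = P.refl
... | true | false = P.sym (BP.∧-zeroʳ _)
... | false | _ = P.refl

all-cong : {A : Set} {p q : A → Bool} (l : List A) → All (λ a → p a ≡ q a) l → all p l ≡ all q l
all-cong [] [] = P.refl
all-cong (a ∷ l) (e ∷ es) = P.cong₂ _∧_ e (all-cong l es)

all-map : {A joint : Set} (f : A → joint) (p : joint → Bool) (l : List A) → all p (map f l) ≡ all (λ a → p (f a)) l
all-map f p [] = P.refl
all-map f p (a ∷ l) = P.cong (p (f a) ∧_) (all-map f p l)

all-true : {A : Set} (p : A → Bool) (l : List A) → All (λ a → p a ≡ true) l → all p l ≡ true
all-true p [] [] = P.refl
all-true p (a ∷ l) (e ∷ es) rewrite e = all-true p l es

allPairs-∷ : {A : Set} (ok : A → A → Bool) (e : A) (l : List A) →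
  allPairs (e ∷ l) ok ≡ ok e e ∧ all (λ a → ok e a ∧ ok a e) l ∧ allPairs l ok
allPairs-∷ ok e l = begin
    (ok e e ∧ all (ok e) l) ∧ all (λ a → ok a e ∧ all (ok a) l) l
      ≡⟨ P.cong ((ok e e ∧ all (ok e) l) ∧_) (all-∧ (λ a → ok a e) (λ a → all (ok a) l) l) ⟩
    (ok e e ∧ all (ok e) l) ∧ (all (λ a → ok a e) l ∧ allPairs l ok)
      ≡⟨ lemma (ok e e) _ _ _ ⟩
    ok e e ∧ (all (ok e) l ∧ all (λ a → ok a e) l) ∧ allPairs l ok
      ≡⟨ P.cong (λ b → ok e e ∧ b ∧ allPairs l ok) (P.sym (all-∧ (ok e) (λ a → ok a e) l)) ⟩
    ok e e ∧ all (λ a → ok e a ∧ ok a e) l ∧ allPairs l ok ∎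
  where
  open P.≡-Reasoning
  lemma : ∀ a b c d → (a ∧ b) ∧ (c ∧ d) ≡ a ∧ (b ∧ c) ∧ d
  lemma false b c d = P.refl
  lemma true b c d = P.sym (BP.∧-assoc b c d)

-- The reading order, row by row. Only in this order does every constraint between boxes point from
-- an earlier box to a later one.
After : Box → Box → Set
After (i , j) (i′ , j′) = i < i′ ⊎ (i ≡ i′ × j < j′)

data Sorted : List Box → Set where
  [] : Sorted []
  _∷_ : ∀ {b bs} → All (After b) bs → Sorted bs → Sorted (b ∷ bs)

module Fillings (R : CommutativeRing 0ℓ 0ℓ) where
  open RingKit R

  -- Nested sums, one per box, replace the list of fillings, so that the choice on the first box can
  -- be split off.
  FS : {A : Set} → List A → List Box → (List (Box × A) → Carrier) → Carrier
  FS as [] f = f []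
  FS as (b ∷ bs) f = ∑ as (λ a → FS as bs (λ E → f ((b , a) ∷ E)))

  FS-fillings : {A : Set} (as : List A) (bs : List Box) (f : List (Box × A) → Carrier) →
    ∑ (map (zip bs) (tuples (length bs) as)) f ≈ FS as bs f
  FS-fillings as [] f = +-identityʳ _
  FS-fillings as (b ∷ bs) f = trans (∑-map (zip (b ∷ bs)) (tuples (suc (length bs)) as) f)
    (trans (∑-concatMap (λ x → map (x ∷_) (tuples (length bs) as)) as (λ t → f (zip (b ∷ bs) t)))
      (∑-cong as (λ a → trans (∑-map (a ∷_) (tuples (length bs) as) (λ t → f (zip (b ∷ bs) t)))
        (trans (sym (∑-map (zip bs) (tuples (length bs) as) (λ E → f ((b , a) ∷ E)))) (FS-fillings as bs _)))))

  ∑-congᵃ : {A : Set} {P : A → Set} (as : List A) → All P as → ∀ {f g} → (∀ a → P a → f a ≈ g a) → ∑ as f ≈ ∑ as g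
  ∑-congᵃ [] [] h = refl
  ∑-congᵃ (a ∷ as) (p ∷ ps) h = +-cong (h a p) (∑-congᵃ as ps h)

  FS-cong : {A : Set} {P : A → Set} (as : List A) → All P as → (bs : List Box) → ∀ {f g} →
    (∀ E → All (λ e → P (snd e)) E → f E ≈ g E) → FS as bs f ≈ FS as bs g
  FS-cong as ps [] h = h [] []
  FS-cong as ps (b ∷ bs) h = ∑-congᵃ as ps (λ a p → FS-cong as ps bs (λ E q → h ((b , a) ∷ E) (p ∷ q)))

  FS-cong′ : {A : Set} (as : List A) (bs : List Box) → ∀ {f g} → (∀ E → f E ≈ g E) → FS as bs f ≈ FS as bs g
  FS-cong′ as [] h = h []
  FS-cong′ as (b ∷ bs) h = ∑-cong as (λ a → FS-cong′ as bs (λ E → h ((b , a) ∷ E)))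

  FS-∑ : {A joint : Set} (as : List A) (bs : List Box) (l : List joint) (f : List (Box × A) → joint → Carrier) →
    FS as bs (λ E → ∑ l (f E)) ≈ ∑ l (λ b → FS as bs (λ E → f E b))
  FS-∑ as [] l f = refl
  FS-∑ as (b ∷ bs) l f = trans (∑-cong as (λ a → FS-∑ as bs l (λ E → f ((b , a) ∷ E)))) (∑-swap as l (λ a c → FS as bs (λ E → f ((b , a) ∷ E) c)))

  FS-*ˡ : {A : Set} (as : List A) (bs : List Box) (c : Carrier) (f : List (Box × A) → Carrier) → FS as bs (λ E → c * f E) ≈ c * FS as bs f
  FS-*ˡ as [] c f = refl
  FS-*ˡ as (b ∷ bs) c f = trans (∑-cong as (λ a → FS-*ˡ as bs c _)) (sym (∑-*ˡ c as _))

data Mark : Set where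
  absent alone joint : Mark

marked isO kept? : Mark → Bool
marked absent = false
marked alone = true
marked joint = true
isO alone = true
isO _ = false
kept? m = not (isO m)

below? right? column? row? : Box → Box → Bool
below? (i , j) (i′ , j′) = (i′ ≡ᵇ suc i) ∧ (j′ ≡ᵇ j)
right? (i , j) (i′ , j′) = (i′ ≡ᵇ i) ∧ (j′ ≡ᵇ suc j)
column? (i , j) (i′ , j′) = (j′ ≡ᵇ j) ∧ not (i′ ≡ᵇ i)
row? (i , j) (i′ , j′) = (i′ ≡ᵇ i) ∧ not (j′ ≡ᵇ j)

-- Set-valued tableaux

-- A mark on a box records how the set-valued tableau uses its largest letter ℓ there:
-- not at all (absent), as the only entry (alone), or together with smaller ones (joint).
full : ℕ → Mark → List ℕ → List ℕ
full ℓ absent S = S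
full ℓ alone S = ℓ ∷ []
full ℓ joint S = ℓ ∷ S

-- The share of the largest letter in `svPairOK`: a neighbour below or to the right of a marked box
-- can contain nothing smaller, and the letter is not repeated in a column if unprimed, in a row if
-- primed.
markOK : Bool → Box × Mark → Box × Mark → Bool
markOK even (b , m) (b′ , m′) =
  (not (below? b b′) ∨ (not (marked m) ∨ isO m′)) ∧
  (not (right? b b′) ∨ (not (marked m) ∨ isO m′)) ∧
  (not (column? b b′) ∨ not (even ∧ marked m ∧ marked m′)) ∧
  (not (row? b b′) ∨ not (not even ∧ marked m ∧ marked m′))

record Below (L : ℕ) (S : List ℕ) : Set where
  field
    nonempty : S ≢ []
    bounded : All (_≤ L) S

  max≤ : maxL S ≤ L
  max≤ = go S bounded
    where
    go : ∀ S → All (_≤ L) S → maxL S ≤ L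
    go [] [] = z≤n
    go (x ∷ S) (p ∷ ps) = NP.⊔-lub p (go S ps)

  min≤ : minL S ≤ L
  min≤ = go S nonempty bounded
    where
    go : ∀ S → S ≢ [] → All (_≤ L) S → minL S ≤ L
    go [] ne _ = ⊥-elim (ne P.refl)
    go (x ∷ []) _ (p ∷ _) = p
    go (x ∷ y ∷ S) _ (p ∷ _) = NP.≤-trans (NP.m⊓n≤m x _) p

  min-full : minL (suc L ∷ S) ≡ minL S
  min-full = go S nonempty min≤
    where
    go : ∀ S → S ≢ [] → minL S ≤ L → minL (suc L ∷ S) ≡ minL S
    go [] ne _ = ⊥-elim (ne P.refl)
    go (x ∷ S) _ p = NP.m≥n⇒m⊓n≡n (NP.m≤n⇒m≤1+n p)

  max-full : maxL (suc L ∷ S) ≡ suc L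
  max-full = NP.m≥n⇒m⊔n≡m (NP.m≤n⇒m≤1+n max≤)

mem-∉ : ∀ {L} {S} → All (_≤ L) S → memN (suc L) S ≡ false
mem-∉ {L} {[]} [] = P.refl
mem-∉ {L} {x ∷ S} (p ∷ ps) rewrite >⇒≢ᵇ (s≤s p) = mem-∉ ps

common : (ℕ → Bool) → List ℕ → List ℕ → Bool
common p S S′ = any (λ ℓ → p ℓ ∧ memN ℓ S′) S

common-skip : ∀ {L} p S S′ → All (_≤ L) S → common p S (suc L ∷ S′) ≡ common p S S′
common-skip p [] S′ [] = P.refl
common-skip {L} p (x ∷ S) S′ (q ∷ qs) rewrite <⇒≢ᵇ (s≤s q) = P.cong ((p x ∧ memN x S′) ∨_) (common-skip p S S′ qs)

common-[] : ∀ p S → common p S [] ≡ false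
common-[] p [] = P.refl
common-[] p (x ∷ S) rewrite BP.∧-zeroʳ (p x) = common-[] p S

-- The set stored on a box marked `alone` is ignored by `full`. Normalising it to the empty list
-- makes the bound by L available on every box.
keep : Mark → List ℕ → List ℕ
keep alone S = []
keep _ S = S

common-full : ∀ {L} p m m′ S S′ → All (_≤ L) S → All (_≤ L) S′ →
  common p (full (suc L) m S) (full (suc L) m′ S′) ≡ (p (suc L) ∧ marked m ∧ marked m′) ∨ common p (keep m S) (keep m′ S′)
common-full {L} p absent absent S S′ q q′ rewrite BP.∧-zeroʳ (p (suc L)) = P.refl
common-full {L} p absent alone S S′ q q′ rewrite BP.∧-zeroʳ (p (suc L)) = common-skip p S [] q
common-full {L} p absent joint S S′ q q′ rewrite BP.∧-zeroʳ (p (suc L)) = common-skip p S S′ q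
common-full {L} p alone absent S S′ q q′ rewrite mem-∉ q′ | BP.∧-zeroʳ (p (suc L)) = P.refl
common-full {L} p alone alone S S′ q q′ rewrite ≡ᵇ-refl L = P.refl
common-full {L} p alone joint S S′ q q′ rewrite ≡ᵇ-refl L = P.refl
common-full {L} p joint absent S S′ q q′ rewrite mem-∉ q′ | BP.∧-zeroʳ (p (suc L)) = P.refl
common-full {L} p joint alone S S′ q q′ rewrite ≡ᵇ-refl L = P.cong ((p (suc L) ∧ true) ∨_) (common-skip p S [] q)
common-full {L} p joint joint S S′ q q′ rewrite ≡ᵇ-refl L = P.cong ((p (suc L) ∧ true) ∨_) (common-skip p S S′ q)

bothKept : Mark → Mark → Bool
bothKept m m′ = kept? m ∧ kept? m′

-- The letter suc L exceeds every other entry. A marked box can thus be followed only by a box with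
-- no other letter, such a box may follow anything, and in the remaining cases the old extrema
-- decide.
order-full : ∀ {L} m m′ S S′ → (kept? m ≡ true → Below L S) → (kept? m′ ≡ true → Below L S′) →
  (maxL (full (suc L) m S) ≤ᵇ minL (full (suc L) m′ S′)) ≡ (not (marked m) ∨ isO m′) ∧ (not (bothKept m m′) ∨ (maxL S ≤ᵇ minL S′))
order-full absent absent S S′ q q′ = P.refl
order-full absent alone S S′ q q′ = ≤⇒≤ᵇ≡ (NP.m≤n⇒m≤1+n (Below.max≤ (q P.refl)))
order-full absent joint S S′ q q′ = P.cong (maxL S ≤ᵇ_) (Below.min-full (q′ P.refl))
order-full alone absent S S′ q q′ = <⇒≰ᵇ (NP.≤-trans (s≤s (Below.min≤ (q′ P.refl))) (NP.m≤m⊔n _ 0))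
order-full {L} alone alone S S′ q q′ = ≤⇒≤ᵇ≡ (NP.≤-refl {suc L})
order-full {L} alone joint S S′ q q′ = <⇒≰ᵇ (NP.≤-trans (P.subst (λ k → suc k ≤ suc L) (P.sym (Below.min-full (q′ P.refl))) (s≤s (Below.min≤ (q′ P.refl)))) (NP.m≤m⊔n _ 0))
order-full {L} joint absent S S′ q q′ = <⇒≰ᵇ (NP.≤-trans (s≤s (Below.min≤ (q′ P.refl))) (NP.m≤m⊔n _ (maxL S)))
order-full {L} joint alone S S′ q q′ = ≤⇒≤ᵇ≡ (NP.≤-reflexive (Below.max-full (q P.refl)))
order-full {L} joint joint S S′ q q′ = <⇒≰ᵇ (NP.≤-trans (P.subst (λ k → suc k ≤ suc L) (P.sym (Below.min-full (q′ P.refl))) (s≤s (Below.min≤ (q′ P.refl)))) (NP.m≤m⊔n _ (maxL S)))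

-- Each of the four clauses splits into one about the marks and one about the remaining sets; the
-- latter is required only if both boxes survive the removal of the letter.
svPairOK-full : ∀ {L} b b′ m m′ S S′ → (kept? m ≡ true → Below L S) → (kept? m′ ≡ true → Below L S′) →
  svPairOK (b , full (suc L) m S) (b′ , full (suc L) m′ S′)
    ≡ markOK (isEven (suc L)) (b , m) (b′ , m′) ∧ (not (bothKept m m′) ∨ svPairOK (b , S) (b′ , S′))
svPairOK-full {L} b b′ m m′ S S′ q q′
  rewrite order-full m m′ S S′ q q′ = begin
    (not a ∨ (o ∧ x)) ∧ (not c ∨ (o ∧ x)) ∧ (not d ∨ not (common isEven F F′)) ∧ (not r ∨ not (common isOdd F F′))
      ≡⟨ P.cong₂ (λ u v → (not a ∨ (o ∧ x)) ∧ (not c ∨ (o ∧ x)) ∧ (not d ∨ not u) ∧ (not r ∨ not v))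
           (cf isEven) (P.trans (cf isOdd) (P.cong (λ k → (k ∧ marked m ∧ marked m′) ∨ (bothKept m m′ ∧ common isOdd S S′)) (P.sym (BP.not-involutive (isOdd (suc L)))))) ⟩
    (not a ∨ (o ∧ x)) ∧ (not c ∨ (o ∧ x)) ∧ (not d ∨ not (pe ∨ ye)) ∧ (not r ∨ not (po ∨ yo))
      ≡⟨ P.cong₂ _∧_ (g₁ a) (P.cong₂ _∧_ (g₁ c) (P.cong₂ _∧_ (g₂ d pe ye) (g₂ r po yo))) ⟩
    ((not a ∨ o) ∧ (not a ∨ x)) ∧ ((not c ∨ o) ∧ (not c ∨ x)) ∧ ((not d ∨ not pe) ∧ (not d ∨ not ye)) ∧ ((not r ∨ not po) ∧ (not r ∨ not yo))
      ≡⟨ regroup (not a ∨ o) (not a ∨ x) (not c ∨ o) (not c ∨ x) (not d ∨ not pe) (not d ∨ not ye) (not r ∨ not po) (not r ∨ not yo) ⟩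
    M ∧ ((not a ∨ x) ∧ (not c ∨ x) ∧ (not d ∨ not ye) ∧ (not r ∨ not yo)) ≡⟨ P.cong (M ∧_) (last (bothKept m m′)) ⟩
    M ∧ (not (bothKept m m′) ∨ svPairOK (b , S) (b′ , S′)) ∎
  where
  open P.≡-Reasoning
  F = full (suc L) m S
  F′ = full (suc L) m′ S′
  a = below? b b′
  c = right? b b′
  d = column? b b′
  r = row? b b′
  o = not (marked m) ∨ isO m′
  le = maxL S ≤ᵇ minL S′
  x = not (bothKept m m′) ∨ le
  pe = isEven (suc L) ∧ marked m ∧ marked m′
  po = not (isEven (suc L)) ∧ marked m ∧ marked m′
  ye = bothKept m m′ ∧ common isEven S S′
  yo = bothKept m m′ ∧ common isOdd S S′
  M = markOK (isEven (suc L)) (b , m) (b′ , m′)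
  bound : ∀ m S → (kept? m ≡ true → Below L S) → All (_≤ L) (keep m S)
  bound absent S q = Below.bounded (q P.refl)
  bound alone S q = []
  bound joint S q = Below.bounded (q P.refl)
  common-keep : ∀ p m m′ → common p (keep m S) (keep m′ S′) ≡ bothKept m m′ ∧ common p S S′
  common-keep p alone m′ = P.refl
  common-keep p absent alone = common-[] p S
  common-keep p joint alone = common-[] p S
  common-keep p absent absent = P.refl
  common-keep p absent joint = P.refl
  common-keep p joint absent = P.refl
  common-keep p joint joint = P.refl
  full-keep : ∀ m S → full (suc L) m S ≡ full (suc L) m (keep m S)
  full-keep absent S = P.refl
  full-keep alone S = P.refl
  full-keep joint S = P.refl
  keep-keep : ∀ m S → keep m (keep m S) ≡ keep m S
  keep-keep absent S = P.refl
  keep-keep alone S = P.refl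
  keep-keep joint S = P.refl
  cf : ∀ p → common p F F′ ≡ (p (suc L) ∧ marked m ∧ marked m′) ∨ (bothKept m m′ ∧ common p S S′)
  cf p = begin
    common p F F′ ≡⟨ P.cong₂ (common p) (full-keep m S) (full-keep m′ S′) ⟩
    common p (full (suc L) m (keep m S)) (full (suc L) m′ (keep m′ S′)) ≡⟨ common-full p m m′ (keep m S) (keep m′ S′) (bound m S q) (bound m′ S′ q′) ⟩
    (p (suc L) ∧ marked m ∧ marked m′) ∨ common p (keep m (keep m S)) (keep m′ (keep m′ S′))
      ≡⟨ P.cong ((p (suc L) ∧ marked m ∧ marked m′) ∨_) (P.trans (P.cong₂ (common p) (keep-keep m S) (keep-keep m′ S′)) (common-keep p m m′)) ⟩
    (p (suc L) ∧ marked m ∧ marked m′) ∨ (bothKept m m′ ∧ common p S S′) ∎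
  g₁ : ∀ a → not a ∨ (o ∧ x) ≡ (not a ∨ o) ∧ (not a ∨ x)
  g₁ false = P.refl
  g₁ true = P.refl
  g₂ : ∀ d p y → not d ∨ not (p ∨ y) ≡ (not d ∨ not p) ∧ (not d ∨ not y)
  g₂ false p y = P.refl
  g₂ true false y = P.refl
  g₂ true true y = P.refl
  swap : ∀ a b c d → (a ∧ b) ∧ (c ∧ d) ≡ (a ∧ c) ∧ (b ∧ d)
  swap false b c d = P.refl
  swap true b false d = BP.∧-zeroʳ b
  swap true b true d = P.refl
  regroup : ∀ a a′ b b′ c c′ d d′ → (a ∧ a′) ∧ (b ∧ b′) ∧ (c ∧ c′) ∧ (d ∧ d′) ≡ (a ∧ b ∧ c ∧ d) ∧ (a′ ∧ b′ ∧ c′ ∧ d′)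
  regroup a a′ b b′ c c′ d d′ = P.trans (P.cong ((a ∧ a′) ∧_) (P.trans (P.cong ((b ∧ b′) ∧_) (swap c c′ d d′)) (swap b b′ (c ∧ d) (c′ ∧ d′))))
    (swap a a′ (b ∧ c ∧ d) (b′ ∧ c′ ∧ d′))
  last : ∀ k → (not a ∨ (not k ∨ le)) ∧ (not c ∨ (not k ∨ le)) ∧ (not d ∨ not (k ∧ common isEven S S′)) ∧ (not r ∨ not (k ∧ common isOdd S S′))
    ≡ not k ∨ svPairOK (b , S) (b′ , S′)
  last true = P.refl
  last false rewrite BP.∨-zeroʳ (not a) | BP.∨-zeroʳ (not c) | BP.∨-zeroʳ (not d) | BP.∨-zeroʳ (not r) = P.refl

diagOK : ℕ → Box × Mark → Bool
diagOK ℓ ((i , j) , m) = not (i ≡ᵇ j) ∨ not (isOdd ℓ ∧ marked m)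

noPrimedDiag-full : ∀ ℓ b m S → noPrimedDiag (b , full ℓ m S) ≡ diagOK ℓ (b , m) ∧ (not (kept? m) ∨ noPrimedDiag (b , S))
noPrimedDiag-full ℓ (i , j) absent S = n (i ≡ᵇ j) (isOdd ℓ)
  where
  n : ∀ d o → not d ∨ not (any isOdd S) ≡ (not d ∨ not (o ∧ false)) ∧ (not d ∨ not (any isOdd S))
  n false o = P.refl
  n true false = P.refl
  n true true = P.refl
noPrimedDiag-full ℓ (i , j) alone S = o′ (i ≡ᵇ j) (isOdd ℓ)
  where
  o′ : ∀ d o → not d ∨ not (o ∨ false) ≡ (not d ∨ not (o ∧ true)) ∧ true
  o′ false o = P.refl
  o′ true false = P.refl
  o′ true true = P.refl
noPrimedDiag-full ℓ (i , j) joint S = b′ (i ≡ᵇ j) (isOdd ℓ)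
  where
  b′ : ∀ d o → not d ∨ not (o ∨ any isOdd S) ≡ (not d ∨ not (o ∧ true)) ∧ (not d ∨ not (any isOdd S))
  b′ false o = P.refl
  b′ true false = P.refl
  b′ true true = P.refl

Dec : Set
Dec = Mark × List ℕ

marks : List (Box × Dec) → List (Box × Mark)
marks = map (λ e → fst e , fst (snd e))

kepts : List (Box × Dec) → List SVEntry
kepts [] = []
kepts ((b , m , S) ∷ E) = if kept? m then (b , S) ∷ kepts E else kepts E

keptBoxes : List (Box × Mark) → List Box
keptBoxes [] = []
keptBoxes ((b , m) ∷ M) = if kept? m then b ∷ keptBoxes M else keptBoxes M

render : ℕ → List (Box × Dec) → List SVEntry
render ℓ = map (λ e → fst e , full ℓ (fst (snd e)) (snd (snd e)))

all-kepts : ∀ (p : SVEntry → Bool) E →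
  all (λ e → not (kept? (fst (snd e))) ∨ p (fst e , snd (snd e))) E ≡ all p (kepts E)
all-kepts p [] = P.refl
all-kepts p ((b , absent , S) ∷ E) = P.cong (p (b , S) ∧_) (all-kepts p E)
all-kepts p ((b , alone , S) ∷ E) = all-kepts p E
all-kepts p ((b , joint , S) ∷ E) = P.cong (p (b , S) ∧_) (all-kepts p E)

allPairs-render : ∀ L E → All (λ e → kept? (fst (snd e)) ≡ true → Below L (snd (snd e))) E →
  allPairs (render (suc L) E) svPairOK ≡ allPairs (marks E) (markOK (isEven (suc L))) ∧ allPairs (kepts E) svPairOK
allPairs-render L E v = begin
    all (λ e → all (svPairOK e) (render (suc L) E)) (render (suc L) E)
      ≡⟨ P.trans (all-map _ _ E) (all-cong E (All.map (λ {e} q → P.trans (all-map _ _ E) (P.trans (all-cong E (All.map (λ {e′} q′ →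
           svPairOK-full (fst e) (fst e′) (fst (snd e)) (fst (snd e′)) _ _ q q′) v)) (all-∧ (mk e) (sv e) E))) v)) ⟩
    all (λ e → all (mk e) E ∧ all (sv e) E) E ≡⟨ all-∧ (λ e → all (mk e) E) (λ e → all (sv e) E) E ⟩
    all (λ e → all (mk e) E) E ∧ all (λ e → all (sv e) E) E
      ≡⟨ P.cong₂ _∧_ (P.sym (P.trans (all-map _ _ E) (all-cong E (All.map (λ _ → all-map _ _ E) v))))
           (P.trans (all-cong E (All.map (λ {e} _ → pull e) v)) (all-kepts (λ e → all (svPairOK e) (kepts E)) E)) ⟩
    allPairs (marks E) (markOK (isEven (suc L))) ∧ allPairs (kepts E) svPairOK ∎
  where
  open P.≡-Reasoning
  mk sv : Box × Dec → Box × Dec → Bool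
  mk (b , m , S) (b′ , m′ , S′) = markOK (isEven (suc L)) (b , m) (b′ , m′)
  sv (b , m , S) (b′ , m′ , S′) = not (bothKept m m′) ∨ svPairOK (b , S) (b′ , S′)
  pull : ∀ e → all (sv e) E ≡ not (kept? (fst (snd e))) ∨ all (svPairOK (fst e , snd (snd e))) (kepts E)
  pull (b , absent , S) = all-kepts (svPairOK (b , S)) E
  pull (b , alone , S) = all-true _ E (All.map (λ _ → P.refl) v)
  pull (b , joint , S) = all-kepts (svPairOK (b , S)) E

diag-render : ∀ ℓ P? E → (not P? ∨ all noPrimedDiag (render ℓ E)) ≡ all (λ e → not P? ∨ diagOK ℓ e) (marks E) ∧ (not P? ∨ all noPrimedDiag (kepts E))
diag-render ℓ false E = P.sym (P.trans (BP.∧-identityʳ _) (all-true _ (marks E) (go (marks E))))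
  where
  go : ∀ (M : List (Box × Mark)) → All (λ _ → true ≡ true) M
  go [] = []
  go (_ ∷ M) = P.refl ∷ go M
diag-render ℓ true E = P.trans (all-map _ noPrimedDiag E) (P.trans (all-cong E (go E))
    (P.trans (all-∧ _ _ E) (P.cong₂ _∧_ (P.sym (all-map _ (diagOK ℓ) E)) (all-kepts noPrimedDiag E))))
  where
  go : ∀ (E : List (Box × Dec)) → All (λ e → noPrimedDiag (fst e , full ℓ (fst (snd e)) (snd (snd e)))
    ≡ diagOK ℓ (fst e , fst (snd e)) ∧ (not (kept? (fst (snd e))) ∨ noPrimedDiag (fst e , snd (snd e)))) E
  go [] = []
  go ((b , m , S) ∷ E) = noPrimedDiag-full ℓ b m S ∷ go E

nonemptyB : List ℕ → Bool
nonemptyB S = not (length S ≡ᵇ 0)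

NE : ℕ → List (List ℕ)
NE L = filterB nonemptyB (subsets L)

filterB-++ : {A : Set} (p : A → Bool) (l l′ : List A) → filterB p (l ++ l′) ≡ filterB p l ++ filterB p l′
filterB-++ p [] l′ = P.refl
filterB-++ p (a ∷ l) l′ with p a
... | true = P.cong (a ∷_) (filterB-++ p l l′)
... | false = filterB-++ p l l′

NE-suc : ∀ L → NE (suc L) ≡ NE L ++ map (suc L ∷_) (subsets L)
NE-suc L = P.trans (filterB-++ nonemptyB (subsets L) _) (P.cong (NE L ++_) (go (subsets L)))
  where
  go : ∀ l → filterB nonemptyB (map (suc L ∷_) l) ≡ map (suc L ∷_) l
  go [] = P.refl
  go (S ∷ l) = P.cong ((suc L ∷ S) ∷_) (go l)

NE-below : ∀ L → All (Below L) (NE L)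
NE-below L = go (subsets L) (subsets-bounded L)
  where
  subsets-bounded : ∀ L → All (All (_≤ L)) (subsets L)
  subsets-bounded zero = [] ∷ []
  subsets-bounded (suc L) = AllP.++⁺ (All.map (All.map NP.m≤n⇒m≤1+n) (subsets-bounded L))
    (AllP.map⁺ (All.map (λ b → NP.≤-refl ∷ All.map NP.m≤n⇒m≤1+n b) (subsets-bounded L)))
  go : ∀ l → All (All (_≤ L)) l → All (Below L) (filterB nonemptyB l)
  go [] [] = []
  go ([] ∷ l) (b ∷ bs) = go l bs
  go ((x ∷ S) ∷ l) (b ∷ bs) = record { nonempty = λ () ; bounded = b } ∷ go l bs

module Peel (R : CommutativeRing 0ℓ 0ℓ) (β : CommutativeRing.Carrier R) (P? : Bool) (z : ℕ → CommutativeRing.Carrier R) where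
  open RingKit R
  open Fillings R

  ∑-subsets : ∀ L (f : List ℕ → Carrier) → ∑ (subsets L) f ≈ f [] + ∑ (NE L) f
  ∑-subsets zero f = refl
  ∑-subsets (suc L) f = begin
    ∑ (subsets L ++ map (suc L ∷_) (subsets L)) f ≈⟨ ∑-++ (subsets L) _ f ⟩
    ∑ (subsets L) f + ∑ (map (suc L ∷_) (subsets L)) f ≈⟨ trans (+-congʳ (∑-subsets L f)) (+-assoc _ _ _) ⟩
    f [] + (∑ (NE L) f + ∑ (map (suc L ∷_) (subsets L)) f) ≈⟨ +-congˡ (sym (∑-++ (NE L) _ f)) ⟩
    f [] + ∑ (NE L ++ map (suc L ∷_) (subsets L)) f ≡⟨ P.cong (λ l → f [] + ∑ l f) (P.sym (NE-suc L)) ⟩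
    f [] + ∑ (NE (suc L)) f ∎

  -- Every nonempty set of letters up to L + 1 arises from exactly one of these by `full`.
  decs : ℕ → List Dec
  decs L = map (absent ,_) (NE L) ++ (alone , []) ∷ map (joint ,_) (NE L)

  decs-valid : ∀ L → All (λ d → kept? (fst d) ≡ true → Below L (snd d)) (decs L)
  decs-valid L = AllP.++⁺ (AllP.map⁺ (All.map (λ b _ → b) (NE-below L))) ((λ ()) ∷ AllP.map⁺ (All.map (λ b _ → b) (NE-below L)))

  ∑-decs : ∀ L (f : Dec → Carrier) → ∑ (decs L) f ≈ ∑ (NE L) (λ S → f (absent , S)) + (f (alone , []) + ∑ (NE L) (λ S → f (joint , S)))
  ∑-decs L f = trans (∑-++ (map (absent ,_) (NE L)) _ f) (+-cong (∑-map (absent ,_) (NE L) f) (+-congˡ (∑-map (joint ,_) (NE L) f)))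

  ∑-NE-suc : ∀ L (f : List ℕ → Carrier) → ∑ (NE (suc L)) f ≈ ∑ (decs L) (λ d → f (full (suc L) (fst d) (snd d)))
  ∑-NE-suc L f = begin
    ∑ (NE (suc L)) f ≡⟨ P.cong (λ l → ∑ l f) (NE-suc L) ⟩
    ∑ (NE L ++ map (suc L ∷_) (subsets L)) f ≈⟨ trans (∑-++ (NE L) _ f) (+-congˡ (trans (∑-map (suc L ∷_) (subsets L) f) (∑-subsets L _))) ⟩
    ∑ (NE L) f + (f (suc L ∷ []) + ∑ (NE L) (λ S → f (suc L ∷ S))) ≈⟨ sym (∑-decs L _) ⟩
    ∑ (decs L) (λ d → f (full (suc L) (fst d) (snd d))) ∎

  FS-NE-suc : ∀ L bs (f : List SVEntry → Carrier) → FS (NE (suc L)) bs f ≈ FS (decs L) bs (λ E → f (render (suc L) E))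
  FS-NE-suc L [] f = refl
  FS-NE-suc L (b ∷ bs) f = trans (∑-cong (NE (suc L)) (λ S → FS-NE-suc L bs (λ T → f ((b , S) ∷ T)))) (∑-NE-suc L _)

  allMarks : List Mark
  allMarks = absent ∷ alone ∷ joint ∷ []

  FS-decs : ∀ L bs (f : List (Box × Mark) → List SVEntry → Carrier) →
    FS (decs L) bs (λ E → f (marks E) (kepts E)) ≈ FS allMarks bs (λ M → FS (NE L) (keptBoxes M) (f M))
  FS-decs L [] f = refl
  FS-decs L (b ∷ bs) f = begin
    ∑ (decs L) (λ d → FS (decs L) bs (λ E → f (marks ((b , d) ∷ E)) (kepts ((b , d) ∷ E)))) ≈⟨ ∑-decs L _ ⟩
    ∑ (NE L) (λ S → FS (decs L) bs (λ E → f ((b , absent) ∷ marks E) ((b , S) ∷ kepts E)))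
      + (FS (decs L) bs (λ E → f ((b , alone) ∷ marks E) (kepts E)) + ∑ (NE L) (λ S → FS (decs L) bs (λ E → f ((b , joint) ∷ marks E) ((b , S) ∷ kepts E))))
      ≈⟨ +-cong (inner absent) (+-cong (FS-decs L bs _) (trans (inner joint) (sym (+-identityʳ _)))) ⟩
    FS allMarks (b ∷ bs) (λ M → FS (NE L) (keptBoxes M) (f M)) ∎
    where
    inner : ∀ m → ∑ (NE L) (λ S → FS (decs L) bs (λ E → f ((b , m) ∷ marks E) ((b , S) ∷ kepts E)))
      ≈ FS allMarks bs (λ M → ∑ (NE L) (λ S → FS (NE L) (keptBoxes M) (λ T → f ((b , m) ∷ M) ((b , S) ∷ T))))
    inner m = trans (∑-cong (NE L) (λ S → FS-decs L bs (λ M T → f ((b , m) ∷ M) ((b , S) ∷ T)))) (sym (FS-∑ allMarks bs (NE L) _))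

  boxwt : List ℕ → Carrier
  boxwt S = pw β (length S ∸ 1) * ∏ S z

  good : List SVEntry → Bool
  good T = allPairs T svPairOK ∧ (not P? ∨ all noPrimedDiag T)

  weight : List SVEntry → Carrier
  weight T = ι (good T) * ∏ T (λ e → boxwt (snd e))

  G : ℕ → List Box → Carrier
  G L bs = FS (NE L) bs weight

  markwt : ℕ → Box × Mark → Carrier
  markwt ℓ (b , absent) = 1#
  markwt ℓ (b , alone) = ι (not P? ∨ diagOK ℓ (b , alone)) * z ℓ
  markwt ℓ (b , joint) = ι (not P? ∨ diagOK ℓ (b , joint)) * (β * z ℓ)

  flat : ℕ → List Box → (List Box → Carrier) → Carrier
  flat ℓ bs H = FS allMarks bs (λ M → ι (allPairs M (markOK (isEven ℓ))) * ∏ M (markwt ℓ) * H (keptBoxes M))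

  weight-render : ∀ L E → All (λ e → kept? (fst (snd e)) ≡ true → Below L (snd (snd e))) E →
    weight (render (suc L) E) ≈ ι (allPairs (marks E) (markOK (isEven (suc L)))) * ∏ (marks E) (markwt (suc L)) * weight (kepts E)
  weight-render L E v = begin
    ι (good (render ℓ E)) * ∏ (render ℓ E) (λ e → boxwt (snd e))
      ≈⟨ *-cong (trans (resp ι (P.cong₂ _∧_ (allPairs-render L E v) (diag-render ℓ P? E))) (splitι mo ko dm dk)) (prod E v) ⟩
    ι mo * ι ko * (ι dm * ι dk) * (∏ (marks E) mw * ∏ (kepts E) (λ e → boxwt (snd e)))
      ≈⟨ solve 6 (λ a b c d e f → a :* b :* (c :* d) :* (e :* f) := a :* (c :* e) :* (b :* d :* f)) refl _ _ _ _ _ _ ⟩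
    ι mo * (ι dm * ∏ (marks E) mw) * (ι ko * ι dk * ∏ (kepts E) (λ e → boxwt (snd e)))
      ≈⟨ *-cong (*-congˡ (diags (marks E))) (*-congʳ (sym (ι-∧ ko dk))) ⟩
    ι mo * ∏ (marks E) (markwt ℓ) * weight (kepts E) ∎
    where
    ℓ = suc L
    mo = allPairs (marks E) (markOK (isEven ℓ))
    ko = allPairs (kepts E) svPairOK
    dm = all (λ e → not P? ∨ diagOK ℓ e) (marks E)
    dk = not P? ∨ all noPrimedDiag (kepts E)
    mw : Box × Mark → Carrier
    mw (b , absent) = 1#
    mw (b , alone) = z ℓ
    mw (b , joint) = β * z ℓ
    splitι : ∀ a b c d → ι ((a ∧ b) ∧ (c ∧ d)) ≈ ι a * ι b * (ι c * ι d)
    splitι a b c d = trans (ι-∧ (a ∧ b) (c ∧ d)) (*-cong (ι-∧ a b) (ι-∧ c d))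
    prod : ∀ E → All (λ e → kept? (fst (snd e)) ≡ true → Below L (snd (snd e))) E →
      ∏ (render ℓ E) (λ e → boxwt (snd e)) ≈ ∏ (marks E) mw * ∏ (kepts E) (λ e → boxwt (snd e))
    prod [] [] = sym (*-identityˡ _)
    prod ((b , absent , S) ∷ E) (q ∷ v) = trans (*-congˡ (prod E v)) (solve 3 (λ a b c → a :* (b :* c) := :1 :* b :* (a :* c)) refl _ _ _)
    prod ((b , alone , S) ∷ E) (q ∷ v) = trans (*-congˡ (prod E v)) (solve 3 (λ a b c → :1 :* (a :* :1) :* (b :* c) := a :* b :* c) refl _ _ _)
    prod ((b , joint , []) ∷ E) (q ∷ v) = ⊥-elim (Below.nonempty (q P.refl) P.refl)
    prod ((b , joint , x ∷ S) ∷ E) (q ∷ v) = trans (*-congˡ (prod E v))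
      (solve 7 (λ b p a x s m k → b :* p :* (a :* (x :* s)) :* (m :* k) := b :* a :* m :* (p :* (x :* s) :* k)) refl β _ _ _ _ _ _)
    diags : ∀ M → ι (all (λ e → not P? ∨ diagOK ℓ e) M) * ∏ M mw ≈ ∏ M (markwt ℓ)
    diags [] = *-identityˡ _
    diags (e ∷ M) = trans (*-congʳ (ι-∧ (not P? ∨ diagOK ℓ e) _))
      (trans (solve 4 (λ a b c d → a :* b :* (c :* d) := a :* c :* (b :* d)) refl _ _ _ _) (*-cong (one e) (diags M)))
      where
      one : ∀ e → ι (not P? ∨ diagOK ℓ e) * mw e ≈ markwt ℓ e
      one ((i , j) , absent) = trans (*-congʳ (resp ι (t P? (i ≡ᵇ j) (isOdd ℓ)))) (*-identityˡ _)
        where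
        t : ∀ p d o → not p ∨ (not d ∨ not (o ∧ false)) ≡ true
        t false d o = P.refl
        t true false o = P.refl
        t true true false = P.refl
        t true true true = P.refl
      one (b , alone) = refl
      one (b , joint) = refl

  -- Boxes holding only the largest letter disappear and the rest carry a filling by smaller
  -- letters. A joint mark removes an entry from a box that stays, whence its factor β. That the
  -- surviving boxes form a shifted diagram again is not visible at this stage; it comes out of the
  -- strip computations.
  G-suc : ∀ L bs → G (suc L) bs ≈ flat (suc L) bs (G L)
  G-suc L bs = begin
    FS (NE (suc L)) bs weight ≈⟨ FS-NE-suc L bs weight ⟩
    FS (decs L) bs (λ E → weight (render (suc L) E)) ≈⟨ FS-cong (decs L) (decs-valid L) bs (λ E v → weight-render L E v) ⟩
    FS (decs L) bs (λ E → c (marks E) * weight (kepts E)) ≈⟨ FS-decs L bs (λ M T → c M * weight T) ⟩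
    FS allMarks bs (λ M → FS (NE L) (keptBoxes M) (λ T → c M * weight T))
      ≈⟨ FS-cong′ allMarks bs (λ M → FS-*ˡ (NE L) (keptBoxes M) (c M) weight) ⟩
    flat (suc L) bs (G L) ∎
    where
    c : List (Box × Mark) → Carrier
    c M = ι (allPairs M (markOK (isEven (suc L)))) * ∏ M (markwt (suc L))

parts : ∀ {n} → Vec Bool n → List ℕ
parts [] = []
parts (false ∷ s) = parts s
parts {suc n} (true ∷ s) = suc n ∷ parts s

cells : ℕ → ℕ → ℕ → List Box
cells i c zero = []
cells i c (suc r) = (i , c) ∷ cells i (suc c) r

rows : ℕ → ∀ {n} → Vec Bool n → List Box
rows i [] = []
rows i (false ∷ s) = rows i s
rows i {suc n} (true ∷ s) = cells i i (suc n) ++ rows (suc i) s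

map-cells : ∀ i c l → map (λ j → (i , c ℕ.+ j)) (upTo l) ≡ cells i c l
map-cells i c l = P.trans (LP.map-upTo _ l) (go c l)
  where
  go : ∀ c l → applyUpTo (λ j → (i , c ℕ.+ j)) l ≡ cells i c l
  go c zero = P.refl
  go c (suc l) = P.cong₂ _∷_ (P.cong (i ,_) (NP.+-identityʳ c))
    (P.trans (P.trans (P.sym (LP.map-upTo _ l)) (P.trans (LP.map-cong (λ j → P.cong (i ,_) (NP.+-suc c j)) (upTo l)) (LP.map-upTo _ l))) (go (suc c) l))

boxesFrom-rows : ∀ i {n} (s : Vec Bool n) → boxesFrom i (parts s) ≡ rows i s
boxesFrom-rows i [] = P.refl
boxesFrom-rows i (false ∷ s) = boxesFrom-rows i s
boxesFrom-rows i {suc n} (true ∷ s) = P.cong₂ _++_ (map-cells i i (suc n)) (boxesFrom-rows (suc i) s)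

InRows : ℕ → ℕ → Box → Set
InRows i n (i′ , c) = i ≤ i′ × i′ ≤ c × c < i ℕ.+ n

cells-in : ∀ i c r → All (λ b → fst b ≡ i × c ≤ snd b × snd b < c ℕ.+ r) (cells i c r)
cells-in i c zero = []
cells-in i c (suc r) = (P.refl , NP.≤-refl , NP.m<m+n c (s≤s z≤n)) ∷
  All.map (λ { (e , p , q) → e , NP.≤-trans (NP.n≤1+n c) p , NP.≤-trans q (NP.≤-reflexive (P.sym (NP.+-suc c r))) }) (cells-in i (suc c) r)

rows-in : ∀ i {n} (s : Vec Bool n) → All (InRows i n) (rows i s)
rows-in i [] = []
rows-in i {suc n} (false ∷ s) = All.map (λ { (p , d , q) → p , d , NP.≤-trans q (NP.+-monoʳ-≤ i (NP.n≤1+n n)) }) (rows-in i s)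
rows-in i {suc n} (true ∷ s) = AllP.++⁺ (All.map (λ { (e , p , q) → NP.≤-reflexive (P.sym e) , NP.≤-trans (NP.≤-reflexive e) p , q }) (cells-in i i (suc n)))
  (All.map (λ { (p , d , q) → NP.≤-trans (NP.n≤1+n i) p , d , NP.≤-trans q (NP.≤-reflexive (P.sym (NP.+-suc i n))) }) (rows-in (suc i) s))

sorted-++ : ∀ i c r bs → All (λ b → i < fst b) bs → Sorted bs → Sorted (cells i c r ++ bs)
sorted-++ i c zero bs lower so = so
sorted-++ i c (suc r) bs lower so = AllP.++⁺ (All.map (λ { (e , p , q) → inj₂ (P.sym e , p) }) (cells-in i (suc c) r)) (All.map inj₁ lower)
  ∷ sorted-++ i (suc c) r bs lower so

rows-sorted : ∀ i {n} (s : Vec Bool n) → Sorted (rows i s)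
rows-sorted i [] = []
rows-sorted i (false ∷ s) = rows-sorted i s
rows-sorted i {suc n} (true ∷ s) = sorted-++ i i (suc n) _ (All.map fst (rows-in (suc i) s)) (rows-sorted (suc i) s)

adj : Box → Box → Bool
adj b b′ = below? b b′ ∨ right? b b′

parity? : Bool → Box → Box → Bool
parity? even b b′ = if even then column? b b′ else row? b b′

allowM : Bool → Bool → Mark → Bool
allowM o n absent = not o
allowM o n alone = not n
allowM o n joint = not o ∧ not n

allow : (Box → Bool) → (Box → Bool) → Box × Mark → Bool
allow mo mn (b , m) = allowM (mo b) (mn b) m

_∪_ : (Box → Bool) → (Box → Bool) → Box → Bool
(p ∪ q) b = p b ∨ q b

none : Box → Bool
none _ = false

≡ᵇ-sym : ∀ m n → (m ≡ᵇ n) ≡ (n ≡ᵇ m)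
≡ᵇ-sym zero zero = P.refl
≡ᵇ-sym zero (suc n) = P.refl
≡ᵇ-sym (suc m) zero = P.refl
≡ᵇ-sym (suc m) (suc n) = ≡ᵇ-sym m n

before-below : ∀ b b′ → After b b′ → below? b′ b ≡ false
before-below (i , j) (i′ , j′) (inj₁ p) rewrite <⇒≢ᵇ (NP.m≤n⇒m≤1+n p) = P.refl
before-below (i , j) (.i , j′) (inj₂ (P.refl , p)) rewrite <⇒≢ᵇ (NP.n<1+n i) = P.refl

before-right : ∀ b b′ → After b b′ → right? b′ b ≡ false
before-right (i , j) (i′ , j′) (inj₁ p) rewrite <⇒≢ᵇ p = P.refl
before-right (i , j) (.i , j′) (inj₂ (P.refl , p)) rewrite <⇒≢ᵇ (NP.m≤n⇒m≤1+n p) = BP.∧-zeroʳ (i ≡ᵇ i)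

column-sym : ∀ b b′ → column? b′ b ≡ column? b b′
column-sym (i , j) (i′ , j′) = P.cong₂ (λ u v → u ∧ not v) (≡ᵇ-sym j j′) (≡ᵇ-sym i i′)

row-sym : ∀ b b′ → row? b′ b ≡ row? b b′
row-sym (i , j) (i′ , j′) = P.cong₂ (λ u v → u ∧ not v) (≡ᵇ-sym i i′) (≡ᵇ-sym j j′)

guarded : Bool → Bool → Bool → Bool → Bool → Mark → Mark → Bool
guarded ev a r c d m m′ = (not a ∨ (not (marked m) ∨ isO m′)) ∧ (not r ∨ (not (marked m) ∨ isO m′)) ∧
  (not c ∨ not (ev ∧ marked m ∧ marked m′)) ∧ (not d ∨ not (not ev ∧ marked m ∧ marked m′))

markOK-N : ∀ ev b b′ m → After b b′ → markOK ev (b , absent) (b′ , m) ∧ markOK ev (b′ , m) (b , absent) ≡ true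
markOK-N ev b b′ m p rewrite before-below b b′ p | before-right b b′ p =
  lemma ev (below? b b′) (right? b b′) (column? b b′) (row? b b′) (column? b′ b) (row? b′ b) m
  where
  lemma : ∀ ev a r c d c′ d′ m → guarded ev a r c d absent m ∧ guarded ev false false c′ d′ m absent ≡ true
  lemma ev a r c d c′ d′ m rewrite BP.∧-zeroʳ ev | BP.∧-zeroʳ (not ev) | BP.∧-zeroʳ (marked m) | BP.∧-zeroʳ ev | BP.∧-zeroʳ (not ev)
    | BP.∨-zeroʳ (not a) | BP.∨-zeroʳ (not r) | BP.∨-zeroʳ (not c) | BP.∨-zeroʳ (not d) | BP.∨-zeroʳ (not c′) | BP.∨-zeroʳ (not d′) = P.refl

-- The later box is never above or to the left of the earlier one, and the column and row tests are
-- symmetric. Hence both directions of the test amount to one restriction on the later mark.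
markOK-marked : ∀ ev b b′ m m′ → marked m ≡ true → After b b′ →
  markOK ev (b , m) (b′ , m′) ∧ markOK ev (b′ , m′) (b , m) ≡ allow (adj b) (parity? ev b) (b′ , m′)
markOK-marked ev b b′ m m′ e p rewrite before-below b b′ p | before-right b b′ p | column-sym b b′ | row-sym b b′ | e =
  lemma ev m′ (below? b b′) (right? b b′) (column? b b′) (row? b b′)
  where
  lemma : ∀ ev m′ a r c d →
    ((not a ∨ isO m′) ∧ (not r ∨ isO m′) ∧ (not c ∨ not (ev ∧ marked m′)) ∧ (not d ∨ not (not ev ∧ marked m′)))
      ∧ (not c ∨ not (ev ∧ marked m′ ∧ true)) ∧ (not d ∨ not (not ev ∧ marked m′ ∧ true))
    ≡ allowM (a ∨ r) (if ev then c else d) m′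
  lemma true absent a r c d rewrite BP.∨-zeroʳ (not c) | BP.∨-zeroʳ (not d) = go a r
    where
    go : ∀ a r → ((not a ∨ false) ∧ (not r ∨ false) ∧ true) ∧ true ≡ not (a ∨ r)
    go false false = P.refl
    go false true = P.refl
    go true r = P.refl
  lemma false absent a r c d rewrite BP.∨-zeroʳ (not c) | BP.∨-zeroʳ (not d) = go a r
    where
    go : ∀ a r → ((not a ∨ false) ∧ (not r ∨ false) ∧ true) ∧ true ≡ not (a ∨ r)
    go false false = P.refl
    go false true = P.refl
    go true r = P.refl
  lemma true alone a r false d rewrite BP.∨-zeroʳ (not a) | BP.∨-zeroʳ (not r) | BP.∨-zeroʳ (not d) = P.refl
  lemma true alone a r true d rewrite BP.∨-zeroʳ (not a) | BP.∨-zeroʳ (not r) = P.refl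
  lemma false alone a r c false rewrite BP.∨-zeroʳ (not a) | BP.∨-zeroʳ (not r) | BP.∨-zeroʳ (not c) = P.refl
  lemma false alone a r c true rewrite BP.∨-zeroʳ (not a) | BP.∨-zeroʳ (not r) | BP.∨-zeroʳ (not c) = P.refl
  lemma true joint a r c d rewrite BP.∨-zeroʳ (not d) = go a r c
    where
    go : ∀ a r c → ((not a ∨ false) ∧ (not r ∨ false) ∧ (not c ∨ false) ∧ true) ∧ (not c ∨ false) ∧ true ≡ not (a ∨ r) ∧ not c
    go true r c = P.refl
    go false true c = P.refl
    go false false true = P.refl
    go false false false = P.refl
  lemma false joint a r c d rewrite BP.∨-zeroʳ (not c) = go a r d
    where
    go : ∀ a r d → ((not a ∨ false) ∧ (not r ∨ false) ∧ (not d ∨ false)) ∧ (not d ∨ false) ≡ not (a ∨ r) ∧ not d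
    go true r d = P.refl
    go false true d = P.refl
    go false false true = P.refl
    go false false false = P.refl

markOK-self : ∀ ev b m → markOK ev (b , m) (b , m) ≡ true
markOK-self ev (i , j) m rewrite <⇒≢ᵇ (NP.n<1+n i) | ≡ᵇ-refl i | ≡ᵇ-refl j | <⇒≢ᵇ (NP.n<1+n j) = P.refl

not-∨ : ∀ a b → not (a ∨ b) ≡ not a ∧ not b
not-∨ false b = P.refl
not-∨ true b = P.refl

allow-∪ : ∀ mo mn mo′ mn′ e → allow (mo ∪ mo′) (mn ∪ mn′) e ≡ allow mo mn e ∧ allow mo′ mn′ e
allow-∪ mo mn mo′ mn′ (b , absent) = not-∨ (mo b) (mo′ b)
allow-∪ mo mn mo′ mn′ (b , alone) = not-∨ (mn b) (mn′ b)
allow-∪ mo mn mo′ mn′ (b , joint) = lemma (mo b) (mo′ b) (mn b) (mn′ b)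
  where
  lemma : ∀ a b c d → not (a ∨ b) ∧ not (c ∨ d) ≡ (not a ∧ not c) ∧ (not b ∧ not d)
  lemma true b c d = P.refl
  lemma false false false d = P.refl
  lemma false false true d = P.refl
  lemma false true false d = P.refl
  lemma false true true d = P.refl

module Sequential (R : CommutativeRing 0ℓ 0ℓ) (β : CommutativeRing.Carrier R) (even : Bool) (c : Box → CommutativeRing.Carrier R) where
  open RingKit R
  open Fillings R

  -- mo and mn tell which boxes the marks made so far force to be alone or absent.
  SC : (Box → Bool) → (Box → Bool) → List Box → (List Box → Carrier) → Carrier
  SC mo mn [] H = H []
  SC mo mn (b ∷ bs) H = ι (not (mo b)) * SC mo mn bs (λ k → H (b ∷ k))
    + (ι (not (mn b)) * c b * SC (mo ∪ adj b) (mn ∪ parity? even b) bs H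
    + ι (not (mo b) ∧ not (mn b)) * (β * c b) * SC (mo ∪ adj b) (mn ∪ parity? even b) bs (λ k → H (b ∷ k)))

  w : Box × Mark → Carrier
  w (b , absent) = 1#
  w (b , alone) = c b
  w (b , joint) = β * c b

  allMarks : List Mark
  allMarks = absent ∷ alone ∷ joint ∷ []

  flatC : (Box → Bool) → (Box → Bool) → List Box → (List Box → Carrier) → Carrier
  flatC mo mn bs H = FS allMarks bs (λ M → ι (all (allow mo mn) M ∧ allPairs M (markOK even)) * ∏ M w * H (keptBoxes M))

  FS-congᵇ : {A : Set} {Q : Box → Set} (as : List A) (bs : List Box) → All Q bs → ∀ {f g} →
    (∀ E → All (λ e → Q (fst e)) E → f E ≈ g E) → FS as bs f ≈ FS as bs g
  FS-congᵇ as [] [] h = h [] []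
  FS-congᵇ as (b ∷ bs) (q ∷ qs) h = ∑-cong as (λ a → FS-congᵇ as bs qs (λ E p → h ((b , a) ∷ E) (q ∷ p)))

  -- In reading order the pair conditions become a growing list of prohibitions: an unmarked box
  -- adds none, a marked one adds its neighbours to mo and its row or column to mn.
  flatC≈SC : ∀ {bs} → Sorted bs → ∀ mo mn H → flatC mo mn bs H ≈ SC mo mn bs H
  flatC≈SC [] mo mn H = trans (*-congʳ (*-identityˡ _)) (*-identityˡ _)
  flatC≈SC {b ∷ bs} (after ∷ so) mo mn H =
      +-cong (branchN) (+-cong (branch alone P.refl) (trans (+-identityʳ _) (branch joint P.refl)))
    where
    mo′ = mo ∪ adj b
    mn′ = mn ∪ parity? even b
    H′ : Mark → List Box → Carrier
    H′ m k = H (if kept? m then b ∷ k else k)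
    kb : ∀ m M → H (keptBoxes ((b , m) ∷ M)) ≡ H′ m (keptBoxes M)
    kb absent M = P.refl
    kb alone M = P.refl
    kb joint M = P.refl
    branchN : FS allMarks bs (λ M → ι (all (allow mo mn) ((b , absent) ∷ M) ∧ allPairs ((b , absent) ∷ M) (markOK even)) * ∏ ((b , absent) ∷ M) w * H (b ∷ keptBoxes M))
      ≈ ι (not (mo b)) * SC mo mn bs (λ k → H (b ∷ k))
    branchN = trans (FS-congᵇ allMarks bs after (λ M am → trans (*-congʳ (*-congʳ (trans (resp ι (cond M am)) (ι-∧ (not (mo b)) _))))
        (solve 4 (λ a b c d → a :* b :* (:1 :* c) :* d := a :* (b :* c :* d)) refl _ _ _ _)))
      (trans (FS-*ˡ allMarks bs _ _) (*-congˡ (flatC≈SC so mo mn (λ k → H (b ∷ k)))))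
      where
      cond : ∀ M → All (λ e → After b (fst e)) M → all (allow mo mn) ((b , absent) ∷ M) ∧ allPairs ((b , absent) ∷ M) (markOK even)
        ≡ not (mo b) ∧ (all (allow mo mn) M ∧ allPairs M (markOK even))
      cond M am = P.trans (P.cong (all (allow mo mn) ((b , absent) ∷ M) ∧_) (P.trans (allPairs-∷ (markOK even) (b , absent) M)
          (P.cong₂ (λ u v → u ∧ v ∧ allPairs M (markOK even)) (markOK-self even b absent)
            (all-true _ M (All.map (λ {e} a → markOK-N even b (fst e) (snd e) a) am)))))
        (BP.∧-assoc (not (mo b)) _ _)
    branch : ∀ m → marked m ≡ true → FS allMarks bs (λ M → ι (all (allow mo mn) ((b , m) ∷ M) ∧ allPairs ((b , m) ∷ M) (markOK even)) * ∏ ((b , m) ∷ M) w * H (keptBoxes ((b , m) ∷ M)))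
      ≈ ι (allow mo mn (b , m)) * w (b , m) * SC mo′ mn′ bs (H′ m)
    branch m e = trans (FS-congᵇ allMarks bs after (λ M am → trans (*-cong (*-congʳ (trans (resp ι (cond M am)) (ι-∧ (allow mo mn (b , m)) _))) (reflexive (kb m M)))
        (solve 5 (λ a b w c d → a :* b :* (w :* c) :* d := a :* w :* (b :* c :* d)) refl _ _ _ _ _)))
      (trans (FS-*ˡ allMarks bs _ _) (*-congˡ (flatC≈SC so mo′ mn′ (H′ m))))
      where
      cond : ∀ M → All (λ e → After b (fst e)) M → all (allow mo mn) ((b , m) ∷ M) ∧ allPairs ((b , m) ∷ M) (markOK even)
        ≡ allow mo mn (b , m) ∧ (all (allow mo′ mn′) M ∧ allPairs M (markOK even))
      cond M am = P.trans (P.cong (all (allow mo mn) ((b , m) ∷ M) ∧_) (P.trans (allPairs-∷ (markOK even) (b , m) M)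
            (P.cong₂ (λ u v → u ∧ v ∧ allPairs M (markOK even)) (markOK-self even b m)
              (all-cong M (All.map (λ {e′} a → markOK-marked even b (fst e′) m (snd e′) e a) am)))))
          (P.trans (assoc4 (allow mo mn (b , m)) (all (allow mo mn) M) _ _)
            (P.cong (λ u → allow mo mn (b , m) ∧ (u ∧ allPairs M (markOK even)))
              (P.trans (P.sym (all-∧ (allow mo mn) (allow (adj b) (parity? even b)) M))
                (P.sym (all-cong M (All.map (λ {e′} _ → allow-∪ mo mn (adj b) (parity? even b) e′) am))))))
        where
        assoc4 : ∀ a b c d → (a ∧ b) ∧ (c ∧ d) ≡ a ∧ ((b ∧ c) ∧ d)
        assoc4 false b c d = P.refl
        assoc4 true b c d = P.sym (BP.∧-assoc b c d)

  flat≈SC : ∀ {bs} → Sorted bs → ∀ H →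
    FS allMarks bs (λ M → ι (allPairs M (markOK even)) * ∏ M w * H (keptBoxes M)) ≈ SC none none bs H
  flat≈SC {bs} so H = trans (FS-cong′ allMarks bs (λ M → *-congʳ (*-congʳ (resp (λ u → ι (u ∧ allPairs M (markOK even)))
      (P.sym (all-true (allow none none) M (ok M)))))))
    (flatC≈SC so none none H)
    where
    ok : ∀ M → All (λ e → allow none none e ≡ true) M
    ok [] = []
    ok ((b , absent) ∷ M) = P.refl ∷ ok M
    ok ((b , alone) ∷ M) = P.refl ∷ ok M
    ok ((b , joint) ∷ M) = P.refl ∷ ok M

  SC-cong : ∀ {mo mn mo′ mn′} bs → All (λ b → mo b ≡ mo′ b × mn b ≡ mn′ b) bs → ∀ {H H′} → (∀ k → H k ≈ H′ k) →
    SC mo mn bs H ≈ SC mo′ mn′ bs H′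
  SC-cong [] [] h = h []
  SC-cong {mo} {mn} {mo′} {mn′} (b ∷ bs) ((p , q) ∷ r) h = +-cong (*-cong (resp (λ u → ι (not u)) p) (SC-cong bs r (λ k → h (b ∷ k))))
    (+-cong (*-cong (*-congʳ (resp (λ u → ι (not u)) q)) (SC-cong bs r′ h))
      (*-cong (*-congʳ (reflexive (P.cong₂ (λ u v → ι (not u ∧ not v)) p q))) (SC-cong bs r′ (λ k → h (b ∷ k)))))
    where
    r′ : All (λ b′ → (mo ∪ adj b) b′ ≡ (mo′ ∪ adj b) b′ × (mn ∪ parity? even b) b′ ≡ (mn′ ∪ parity? even b) b′) bs
    r′ = All.map (λ {b′} e → P.cong (_∨ adj b b′) (fst e) , P.cong (_∨ parity? even b b′) (snd e)) r

  -- A box that has to be `alone` and `absent` at once admits no mark, and prohibitions never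
  -- disappear.
  SC-zero : ∀ {mo mn} bs → Any (λ b → mo b ≡ true × mn b ≡ true) bs → ∀ H → SC mo mn bs H ≈ 0#
  SC-zero {mo} {mn} (b ∷ bs) (here (p , q)) H rewrite p | q =
    solve 5 (λ a b c d e → :0 :* a :+ (:0 :* d :* b :+ :0 :* e :* c) := :0) refl _ _ _ _ _
  SC-zero {mo} {mn} (b ∷ bs) (there a) H = trans (+-cong (*-congˡ (SC-zero bs a _)) (+-cong (*-congˡ (SC-zero bs (grow a) _)) (*-congˡ (SC-zero bs (grow a) _))))
    (solve 3 (λ a b c → a :* :0 :+ (b :* :0 :+ c :* :0) := :0) refl _ _ _)
    where
    grow : ∀ {bs} → Any (λ b → mo b ≡ true × mn b ≡ true) bs → Any (λ b′ → (mo ∪ adj b) b′ ≡ true × (mn ∪ parity? even b) b′ ≡ true) bs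
    grow (here {x = b′} (p , q)) = here (P.cong (_∨ adj b b′) p , P.cong (_∨ parity? even b b′) q)
    grow (there a) = there (grow a)

pt : ℕ → ℕ → Box → Bool
pt i k b = (fst b ≡ᵇ i) ∧ (snd b ≡ᵇ k)

module Weighted (R : CommutativeRing 0ℓ 0ℓ) where
  open RingKit R
  module _ {w : Carrier} n {f g k h : Vec Bool n → Carrier} where
    weighted₀ : Σᵇ n (λ t → (w * f t + (0# * g t + (0# * k t + 0#))) * h t) ≈ w * Σᵇ n (λ t → f t * h t)
    weighted₀ = trans (Σᵇ-cong n (λ t → solve 5 (λ a b c h z → (:lin z a :0 b :0 c) :* h := z :* (a :* h)) refl _ _ _ _ w)) (Σᵇ-*ˡ n w _)

    weighted₁ : Σᵇ n (λ t → (0# * f t + (w * g t + (0# * k t + 0#))) * h t) ≈ w * Σᵇ n (λ t → g t * h t)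
    weighted₁ = trans (Σᵇ-cong n (λ t → solve 5 (λ a b c h z → (:lin :0 a z b :0 c) :* h := z :* (b :* h)) refl _ _ _ _ w)) (Σᵇ-*ˡ n w _)

    weighted₂ : Σᵇ n (λ t → (0# * f t + (0# * g t + (w * k t + 0#))) * h t) ≈ w * Σᵇ n (λ t → k t * h t)
    weighted₂ = trans (Σᵇ-cong n (λ t → solve 5 (λ a b c h z → (:lin :0 a :0 b z c) :* h := z :* (c :* h)) refl _ _ _ _ w)) (Σᵇ-*ˡ n w _)

  weightless : ∀ n {f g k h : Vec Bool n → Carrier} → Σᵇ n (λ t → (0# * f t + (0# * g t + (0# * k t + 0#))) * h t) ≈ 0#
  weightless n = trans (weighted₀ n) (zeroˡ _)

-- Removing the largest primed letter

module VStrips (R : CommutativeRing 0ℓ 0ℓ) (β : CommutativeRing.Carrier R) (P? : Bool) (z : CommutativeRing.Carrier R) where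
  open RingKit R

  -- The rule that GP has no primed diagonal entries is built into the weight as a zero.
  c : Box → Carrier
  c (i , j) = ι (not P? ∨ not (i ≡ᵇ j)) * z

  open Sequential R β false c
  open Weighted R
  open Transfer R β z 0# using (V; ⟪_⟫; vF)

  -- A marked box demands that its right neighbour hold only the letter, while the letter may not
  -- recur in the row. Hence only the last box of a row can be marked, and its mark affects nothing
  -- but the box directly below.
  row-end : ∀ r c₀ i d → c₀ ℕ.+ r ≡ d → ∀ mo rest H → All (λ b → i < fst b) rest → All (λ b → mo b ≡ false) rest →
    (∀ k → k < d → mo (i , k) ≡ false) →
    SC mo none (cells i c₀ (suc r) ++ rest) H ≈
      ι (not (mo (i , d))) * SC none none rest (λ k → H (cells i c₀ (suc r) ++ k))
      + (c (i , d) * SC (pt (suc i) d) none rest (λ k → H (cells i c₀ r ++ k))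
      + ι (not (mo (i , d))) * (β * c (i , d)) * SC (pt (suc i) d) none rest (λ k → H (cells i c₀ (suc r) ++ k)))
  row-end zero c₀ i d e mo rest H lower free prefix rewrite P.trans (P.sym (NP.+-identityʳ c₀)) e =
    +-cong (*-congˡ (SC-cong rest (All.map (λ p → p , P.refl) free) (λ k → refl)))
      (+-cong (*-cong (*-identityˡ _) (SC-cong rest both (λ k → refl)))
        (*-cong (*-congʳ (resp ι (BP.∧-identityʳ (not (mo (i , d)))))) (SC-cong rest both (λ k → refl))))
    where
    both : All (λ b → (mo ∪ adj (i , d)) b ≡ pt (suc i) d b × (none ∪ parity? false (i , d)) b ≡ none b) rest
    both = All.map (λ { {b} (p , q) → P.trans (P.cong₂ (λ u v → u ∨ ((fst b ≡ᵇ suc i) ∧ (snd b ≡ᵇ d)) ∨ (v ∧ (snd b ≡ᵇ suc d))) q (>⇒≢ᵇ p)) (BP.∨-identityʳ _)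
      , P.cong (_∧ not (snd b ≡ᵇ d)) (>⇒≢ᵇ p) }) (All.zip (lower , free))
  row-end (suc r) c₀ i d e mo rest H lower free prefix = trans
    (+-cong (trans (*-cong (resp (λ u → ι (not u)) (prefix c₀ c₀<d)) (row-end r (suc c₀) i d (P.trans (P.sym (NP.+-suc c₀ r)) e) mo rest (λ k → H ((i , c₀) ∷ k)) lower free prefix)) (*-identityˡ _))
      (+-cong (trans (*-congˡ (SC-zero _ clash _)) (zeroʳ _)) (trans (*-congˡ (SC-zero _ clash _)) (zeroʳ _))))
    (trans (+-congˡ (+-identityˡ _)) (+-identityʳ _))
    where
    c₀<d : c₀ < d
    c₀<d = P.subst (c₀ <_) e (NP.m<m+n c₀ (s≤s z≤n))
    clash : Any (λ b → (mo ∪ adj (i , c₀)) b ≡ true × (none ∪ parity? false (i , c₀)) b ≡ true) (cells i (suc c₀) (suc r) ++ rest)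
    clash = here (right , apart)
      where
      right : mo (i , suc c₀) ∨ ((i ≡ᵇ suc i) ∧ (suc c₀ ≡ᵇ c₀)) ∨ ((i ≡ᵇ i) ∧ (suc c₀ ≡ᵇ suc c₀)) ≡ true
      right rewrite ≡ᵇ-refl i | ≡ᵇ-refl c₀ = P.trans (P.cong (mo (i , suc c₀) ∨_) (BP.∨-zeroʳ _)) (BP.∨-zeroʳ _)
      apart : (i ≡ᵇ i) ∧ not (suc c₀ ≡ᵇ c₀) ≡ true
      apart rewrite ≡ᵇ-refl i | >⇒≢ᵇ (NP.n<1+n c₀) = P.refl

  c-off : ∀ i n → c (i , i ℕ.+ suc n) ≈ z
  c-off i n = trans (*-congʳ (resp (λ u → ι (not P? ∨ not u)) (<⇒≢ᵇ (NP.m<m+n i (s≤s z≤n)))))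
    (trans (*-congʳ (resp ι (BP.∨-zeroʳ (not P?)))) (*-identityˡ _))

  c-diag : ∀ i → c (i , i ℕ.+ 0) ≈ ⟪ vF P? s₁ ⟫
  c-diag i rewrite NP.+-identityʳ i | ≡ᵇ-refl i = go P?
    where
    go : ∀ P? → ι (not P? ∨ false) * z ≈ ⟪ vF P? s₁ ⟫
    go false = *-identityˡ _
    go true = zeroˡ _

  -- A row that ends before column d has no box there, so the restriction at that column is void.
  below-free : ∀ i {n} (s : Vec Bool n) d → i ℕ.+ n ≤ d → All (λ b → pt i d b ≡ false × none b ≡ false) (rows i s)
  below-free i s d le = All.map (λ { {b} (_ , _ , q) → P.trans (P.cong ((fst b ≡ᵇ i) ∧_) (<⇒≢ᵇ (NP.≤-trans q le))) (BP.∧-zeroʳ _) , P.refl }) (rows-in i s)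

  -- With n levels left, state s₁ means that row i, of length n + 1, has lost its last box in column
  -- i + n, so that a box directly below must be lost as well. State s₂ means that row i keeps its
  -- length; its last box is either unmarked or shares the letter, the latter at the price β.
  V₀ : ∀ {n} i (s : Vec Bool n) H → Σᵇ n (λ t → V P? s₀ s t * H (rows i t)) ≈ SC none none (rows i s) H
  V₁ : ∀ {n} i (s : Vec Bool n) H → Σᵇ n (λ t → V P? s₁ s t * H (rows i t)) ≈
    c (i , i ℕ.+ n) * SC (pt (suc i) (i ℕ.+ n)) none (rows (suc i) s) (λ k → H (cells i i n ++ k))
  V₂ : ∀ {n} i (s : Vec Bool n) H → Σᵇ n (λ t → V P? s₂ s t * H (rows (suc i) t)) ≈
    SC none none (rows (suc i) s) H + β * c (i , i ℕ.+ n) * SC (pt (suc i) (i ℕ.+ n)) none (rows (suc i) s) H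

  V₀ i [] H = *-identityˡ _
  V₀ {suc n} i (false ∷ s) H = begin
    _ ≈⟨ +-cong (trans (weighted₀ n) (*-identityˡ _))
           (weightless n) ⟩
    Σᵇ n (λ t → V P? s₀ s t * H (rows i t)) + 0# ≈⟨ trans (+-identityʳ _) (V₀ i s H) ⟩
    SC none none (rows i s) H ∎
  V₀ {suc n} i (true ∷ s) H = begin
    _ ≈⟨ +-cong (trans (weighted₁ n) (*-identityˡ _))
           (trans (weighted₂ n) (*-identityˡ _)) ⟩
    Σᵇ n (λ t → V P? s₁ s t * H (rows i t)) + Σᵇ n (λ t → V P? s₂ s t * Hᶜ (rows (suc i) t)) ≈⟨ +-cong (V₁ i s H) (V₂ i s Hᶜ) ⟩
    c (i , i ℕ.+ n) * SC p none rest (λ k → H (cells i i n ++ k)) + (SC none none rest Hᶜ + β * c (i , i ℕ.+ n) * SC p none rest Hᶜ)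
      ≈⟨ solve 5 (λ a b d e f → a :* b :+ (d :+ e :* a :* f) := :1 :* d :+ (a :* b :+ :1 :* (e :* a) :* f)) refl _ _ _ _ _ ⟩
    _ ≈⟨ sym (row-end n i i (i ℕ.+ n) P.refl none rest H (All.map fst (rows-in (suc i) s)) (All.map (λ _ → P.refl) (rows-in (suc i) s)) (λ _ _ → P.refl)) ⟩
    SC none none (cells i i (suc n) ++ rest) H ∎
    where
    p = pt (suc i) (i ℕ.+ n)
    rest = rows (suc i) s
    Hᶜ : List Box → Carrier
    Hᶜ k = H (cells i i (suc n) ++ k)

  V₁ i [] H = *-congʳ (sym (c-diag i))
  V₁ {suc n} i (false ∷ s) H = begin
    _ ≈⟨ +-cong (weightless n)
           (weighted₀ n) ⟩
    0# + z * Σᵇ n (λ t → V P? s₀ s t * H (cells i i (suc n) ++ rows (suc i) t)) ≈⟨ trans (+-identityˡ _) (*-cong (sym (c-off i n)) (V₀ (suc i) s (λ k → H (cells i i (suc n) ++ k)))) ⟩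
    c (i , i ℕ.+ suc n) * SC none none (rows (suc i) s) (λ k → H (cells i i (suc n) ++ k))
      ≈⟨ *-congˡ (SC-cong _ (All.map (λ { (p , q) → P.sym p , P.refl }) (below-free (suc i) s _ (NP.≤-reflexive (P.sym (NP.+-suc i n))))) (λ _ → refl)) ⟩
    c (i , i ℕ.+ suc n) * SC (pt (suc i) (i ℕ.+ suc n)) none (rows (suc i) s) (λ k → H (cells i i (suc n) ++ k)) ∎
  V₁ {suc n} i (true ∷ s) H = begin
    _ ≈⟨ +-cong (weightless n)
           (weighted₁ n) ⟩
    0# + z * Σᵇ n (λ t → V P? s₁ s t * Hᶜ (rows (suc i) t)) ≈⟨ trans (+-identityˡ _) (*-cong (sym (c-off i n)) (V₁ (suc i) s Hᶜ)) ⟩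
    c (i , i ℕ.+ suc n) * (c (suc i , d) * SC (pt (suc (suc i)) d) none rest (λ k → Hᶜ (cells (suc i) (suc i) n ++ k)))
      ≈⟨ *-congˡ (trans (solve 5 (λ a b e f g → a :* b := :0 :* e :+ (a :* b :+ :0 :* f :* g)) refl _ _ _ _ _) (sym re)) ⟩
    c (i , i ℕ.+ suc n) * SC (pt (suc i) (i ℕ.+ suc n)) none (cells (suc i) (suc i) (suc n) ++ rest) Hᶜ ∎
    where
    d = suc i ℕ.+ n
    rest = rows (suc (suc i)) s
    mo = pt (suc i) (i ℕ.+ suc n)
    Hᶜ : List Box → Carrier
    Hᶜ k = H (cells i i (suc n) ++ k)
    mo-d : mo (suc i , d) ≡ true
    mo-d rewrite ≡ᵇ-refl i | NP.+-suc i n | ≡ᵇ-refl (i ℕ.+ n) = P.refl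
    re : SC mo none (cells (suc i) (suc i) (suc n) ++ rest) Hᶜ ≈ 0# * SC none none rest (λ k → Hᶜ (cells (suc i) (suc i) (suc n) ++ k))
      + (c (suc i , d) * SC (pt (suc (suc i)) d) none rest (λ k → Hᶜ (cells (suc i) (suc i) n ++ k))
      + 0# * (β * c (suc i , d)) * SC (pt (suc (suc i)) d) none rest (λ k → Hᶜ (cells (suc i) (suc i) (suc n) ++ k)))
    re = trans (row-end n (suc i) (suc i) d P.refl mo rest Hᶜ (All.map fst (rows-in _ s))
        (All.map (λ { {b} (p , _) → P.cong (_∧ (snd b ≡ᵇ i ℕ.+ suc n)) (>⇒≢ᵇ p) }) (rows-in _ s))
        (λ k p → P.trans (P.cong ((suc i ≡ᵇ suc i) ∧_) (<⇒≢ᵇ (NP.≤-trans p (NP.≤-reflexive (P.sym (NP.+-suc i n)))))) (BP.∧-zeroʳ (suc i ≡ᵇ suc i))))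
      (resp (λ u → ι (not u) * SC none none rest (λ k → Hᶜ (cells (suc i) (suc i) (suc n) ++ k))
        + (c (suc i , d) * SC (pt (suc (suc i)) d) none rest (λ k → Hᶜ (cells (suc i) (suc i) n ++ k))
        + ι (not u) * (β * c (suc i , d)) * SC (pt (suc (suc i)) d) none rest (λ k → Hᶜ (cells (suc i) (suc i) (suc n) ++ k)))) mo-d)

  V₂ i [] H = fin P?
    where
    fin : ∀ P? → ⟪ vF P? s₂ ⟫ * H [] ≈ H [] + β * (ι (not P? ∨ not (i ≡ᵇ i ℕ.+ 0)) * z) * H []
    fin true rewrite NP.+-identityʳ i | ≡ᵇ-refl i = solve 3 (λ b z h → :1 :* h := h :+ b :* (:0 :* z) :* h) refl β z _
    fin false = solve 3 (λ b z h → (:1 :+ b :* z) :* h := h :+ b :* (:1 :* z) :* h) refl β z _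
  V₂ {suc n} i (false ∷ s) H = begin
    _ ≈⟨ +-cong (weighted₀ n)
           (weightless n) ⟩
    (1# + β * z) * Σᵇ n (λ t → V P? s₀ s t * H (rows (suc i) t)) + 0# ≈⟨ trans (+-identityʳ _) (*-congˡ (V₀ (suc i) s H)) ⟩
    (1# + β * z) * SC none none (rows (suc i) s) H ≈⟨ solve 3 (λ b z h → (:1 :+ b :* z) :* h := h :+ b :* z :* h) refl β z _ ⟩
    SC none none (rows (suc i) s) H + β * z * SC none none (rows (suc i) s) H
      ≈⟨ +-congˡ (*-cong (*-congˡ (sym (c-off i n))) (SC-cong _ (All.map (λ { (p , q) → P.sym p , P.refl }) (below-free (suc i) s _ (NP.≤-reflexive (P.sym (NP.+-suc i n))))) (λ _ → refl))) ⟩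
    SC none none (rows (suc i) s) H + β * c (i , i ℕ.+ suc n) * SC (pt (suc i) (i ℕ.+ suc n)) none (rows (suc i) s) H ∎
  V₂ {suc n} i (true ∷ s) H = begin
    _ ≈⟨ +-cong (weighted₁ n)
           (trans (weighted₂ n) (*-identityˡ _)) ⟩
    (1# + β * z) * Σᵇ n (λ t → V P? s₁ s t * H (rows (suc i) t)) + Σᵇ n (λ t → V P? s₂ s t * Hᶜ (rows (suc (suc i)) t))
      ≈⟨ +-cong (*-congˡ (V₁ (suc i) s H)) (V₂ (suc i) s Hᶜ) ⟩
    (1# + β * z) * (c (suc i , d) * SC p none rest (λ k → H (cells (suc i) (suc i) n ++ k))) + (SC none none rest Hᶜ + β * c (suc i , d) * SC p none rest Hᶜ)
      ≈⟨ solve 6 (λ b z a m e f → (:1 :+ b :* z) :* (a :* m) :+ (e :+ b :* a :* f)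
           := :1 :* e :+ (a :* m :+ :1 :* (b :* a) :* f) :+ b :* z :* (:0 :* e :+ (a :* m :+ :0 :* (b :* a) :* f))) refl β z _ _ _ _ ⟩
    _ ≈⟨ +-cong (sym re₀) (*-cong (*-congˡ (sym (c-off i n))) (sym re)) ⟩
    SC none none (cells (suc i) (suc i) (suc n) ++ rest) H + β * c (i , i ℕ.+ suc n) * SC (pt (suc i) (i ℕ.+ suc n)) none (cells (suc i) (suc i) (suc n) ++ rest) H ∎
    where
    d = suc i ℕ.+ n
    p = pt (suc (suc i)) d
    rest = rows (suc (suc i)) s
    mo = pt (suc i) (i ℕ.+ suc n)
    Hᶜ : List Box → Carrier
    Hᶜ k = H (cells (suc i) (suc i) (suc n) ++ k)
    mo-d : mo (suc i , d) ≡ true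
    mo-d rewrite ≡ᵇ-refl i | NP.+-suc i n | ≡ᵇ-refl (i ℕ.+ n) = P.refl
    re₀ : SC none none (cells (suc i) (suc i) (suc n) ++ rest) H ≈ 1# * SC none none rest Hᶜ
      + (c (suc i , d) * SC p none rest (λ k → H (cells (suc i) (suc i) n ++ k)) + 1# * (β * c (suc i , d)) * SC p none rest Hᶜ)
    re₀ = row-end n (suc i) (suc i) d P.refl none rest H (All.map fst (rows-in _ s)) (All.map (λ _ → P.refl) (rows-in _ s)) (λ _ _ → P.refl)
    re : SC mo none (cells (suc i) (suc i) (suc n) ++ rest) H ≈ 0# * SC none none rest Hᶜ
      + (c (suc i , d) * SC p none rest (λ k → H (cells (suc i) (suc i) n ++ k)) + 0# * (β * c (suc i , d)) * SC p none rest Hᶜ)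
    re = trans (row-end n (suc i) (suc i) d P.refl mo rest H (All.map fst (rows-in _ s))
        (All.map (λ { {b} (p , _) → P.cong (_∧ (snd b ≡ᵇ i ℕ.+ suc n)) (>⇒≢ᵇ p) }) (rows-in _ s))
        (λ k p → P.trans (P.cong ((suc i ≡ᵇ suc i) ∧_) (<⇒≢ᵇ (NP.≤-trans p (NP.≤-reflexive (P.sym (NP.+-suc i n)))))) (BP.∧-zeroʳ (suc i ≡ᵇ suc i))))
      (resp (λ u → ι (not u) * SC none none rest Hᶜ + (c (suc i , d) * SC p none rest (λ k → H (cells (suc i) (suc i) n ++ k))
        + ι (not u) * (β * c (suc i , d)) * SC p none rest Hᶜ)) mo-d)

-- Removing the largest unprimed letter

between : ℕ → ℕ → ℕ → Bool
between θ c k = (θ ℕ.≤ᵇ k) ∧ (k ℕ.<ᵇ c)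

<ᵇ-suc : ∀ k c → (k ℕ.<ᵇ suc c) ≡ (k ℕ.<ᵇ c) ∨ (k ≡ᵇ c)
<ᵇ-suc zero zero = P.refl
<ᵇ-suc zero (suc c) = P.refl
<ᵇ-suc (suc k) zero = P.refl
<ᵇ-suc (suc k) (suc c) = <ᵇ-suc k c

≡ᵇ⇒≡′ : ∀ m n → (m ≡ᵇ n) ≡ true → m ≡ n
≡ᵇ⇒≡′ m n e = NP.≡ᵇ⇒≡ m n (P.subst T (P.sym e) _)

between-suc : ∀ θ c k → θ ≤ c → between θ (suc c) k ≡ between θ c k ∨ (k ≡ᵇ c)
between-suc θ c k θ≤c rewrite <ᵇ-suc k c with k ≡ᵇ c in e
... | false = P.trans (P.cong ((θ ℕ.≤ᵇ k) ∧_) (BP.∨-identityʳ _)) (P.sym (BP.∨-identityʳ _))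
... | true rewrite ≡ᵇ⇒≡′ k c e | ≤⇒≤ᵇ≡ θ≤c = P.cong (λ b → b) (P.trans (BP.∨-zeroʳ (c ℕ.<ᵇ c)) (P.sym (BP.∨-zeroʳ (c ℕ.<ᵇ c))))

between-empty : ∀ θ k → between θ θ k ≡ false
between-empty zero k = go k
  where
  go : ∀ k → (k ℕ.<ᵇ 0) ≡ false
  go zero = P.refl
  go (suc k) = P.refl
between-empty (suc θ) zero = P.refl
between-empty (suc zero) (suc k) = between-empty 0 k
between-empty (suc (suc θ)) (suc k) = between-empty (suc θ) k

between-all : ∀ θ c k → k < c → between θ c k ≡ (θ ℕ.≤ᵇ k)
between-all θ c k p = P.trans (P.cong ((θ ℕ.≤ᵇ k) ∧_) (T⇒≡ (NP.<⇒<ᵇ p))) (BP.∧-identityʳ _)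

∧-distribˡ-∨ : ∀ a b c → a ∧ (b ∨ c) ≡ (a ∧ b) ∨ (a ∧ c)
∧-distribˡ-∨ true b c = P.refl
∧-distribˡ-∨ false b c = P.refl

cells-last : ∀ {P : Box → Set} i c r rest → P (i , c ℕ.+ r) → Any P (cells i c (suc r) ++ rest)
cells-last {P} i c zero rest p = here (P.subst (λ k → P (i , k)) (NP.+-identityʳ c) p)
cells-last {P} i c (suc r) rest p = there (cells-last i (suc c) r rest (P.subst (λ k → P (i , k)) (NP.+-suc c r) p))

module HStrips (R : CommutativeRing 0ℓ 0ℓ) (β : CommutativeRing.Carrier R) (P? : Bool) (z : CommutativeRing.Carrier R) where
  open RingKit R
  open Sequential R β true (λ _ → z)
  open Weighted R
  open Transfer R β z 0# using (⟪_⟫; hF) renaming (H to Hₜ)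

  -- With `forceN` this is the restriction left behind by a row i whose marks start in column θ:
  -- boxes directly below them may hold only the letter, and no lower box in these columns may hold
  -- it.
  forceO : ℕ → ℕ → Box → Bool
  forceO i θ b = (fst b ≡ᵇ suc i) ∧ (θ ℕ.≤ᵇ snd b)

  forceN : ℕ → Box → Bool
  forceN θ b = θ ℕ.≤ᵇ snd b

  SCθ : ℕ → ℕ → List Box → (List Box → Carrier) → Carrier
  SCθ i θ = SC (forceO i θ) (forceN θ)

  -- After one marked box of a row each further box must hold only the letter, so the marks fill the
  -- row to its end. The interval from θ to c collects the columns passed so far; as no lower row
  -- reaches beyond the end of this one, it finally amounts to all columns from θ on.
  forced : ∀ r c i θ → θ ≤ c → ∀ mo mn rest H → (0 < r → mo (i , c) ≡ true) → (∀ k → mn (i , k) ≡ false) →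
    All (λ b → i < fst b × snd b < c ℕ.+ r) rest →
    All (λ b → mo b ≡ (fst b ≡ᵇ suc i) ∧ between θ c (snd b) × mn b ≡ between θ c (snd b)) rest →
    SC mo mn (cells i c r ++ rest) H ≈ pw z r * SCθ i θ rest H
  forced zero c i θ θ≤c mo mn rest H _ _ lower st = trans (SC-cong rest (All.map (λ { {b} ((_ , q) , (e , e′)) →
      let q′ = between-all θ c (snd b) (P.subst (snd b <_) (NP.+-identityʳ c) q) in
      P.trans e (P.cong ((fst b ≡ᵇ suc i) ∧_) q′) , P.trans e′ q′ }) (All.zip (lower , st))) (λ _ → refl)) (sym (*-identityˡ _))
  forced (suc r) c i θ θ≤c mo mn rest H first free lower st = begin
    SC mo mn (cells i c (suc r) ++ rest) H
      ≈⟨ +-cong (*-congʳ (resp (λ u → ι (not u)) (first (s≤s z≤n))))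
           (+-cong (*-cong (*-congʳ (resp (λ u → ι (not u)) (free c))) ih)
             (*-congʳ (*-congʳ (resp (λ u → ι (not u ∧ not (mn (i , c)))) (first (s≤s z≤n)))))) ⟩
    0# * _ + (1# * z * (pw z r * SCθ i θ rest H) + 0# * (β * z) * _)
      ≈⟨ solve 6 (λ a z p s b d → :0 :* a :+ (:1 :* z :* (p :* s) :+ :0 :* b :* d) := z :* p :* s) refl _ _ _ _ _ _ ⟩
    pw z (suc r) * SCθ i θ rest H ∎
    where
    ih = forced r (suc c) i θ (NP.m≤n⇒m≤1+n θ≤c) (mo ∪ adj (i , c)) (mn ∪ parity? true (i , c)) rest H
      (λ _ → right) (λ k → P.cong₂ _∨_ (free k) (P.trans (P.cong (λ u → (k ≡ᵇ c) ∧ not u) (≡ᵇ-refl i)) (BP.∧-zeroʳ _)))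
      (All.map (λ { (p , q) → p , NP.≤-trans q (NP.≤-reflexive (NP.+-suc c r)) }) lower)
      (All.map (λ { {b} ((p , _) , (e , e′)) → upd b p e , upd′ b p e′ }) (All.zip (lower , st)))
      where
      right : mo (i , suc c) ∨ ((i ≡ᵇ suc i) ∧ (suc c ≡ᵇ c)) ∨ ((i ≡ᵇ i) ∧ (suc c ≡ᵇ suc c)) ≡ true
      right rewrite ≡ᵇ-refl i | ≡ᵇ-refl c = P.trans (P.cong (mo (i , suc c) ∨_) (BP.∨-zeroʳ _)) (BP.∨-zeroʳ _)
      upd : ∀ b → i < fst b → mo b ≡ (fst b ≡ᵇ suc i) ∧ between θ c (snd b) →
        mo b ∨ ((fst b ≡ᵇ suc i) ∧ (snd b ≡ᵇ c)) ∨ ((fst b ≡ᵇ i) ∧ (snd b ≡ᵇ suc c)) ≡ (fst b ≡ᵇ suc i) ∧ between θ (suc c) (snd b)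
      upd b p e rewrite e | >⇒≢ᵇ p | between-suc θ c (snd b) θ≤c | BP.∨-identityʳ ((fst b ≡ᵇ suc i) ∧ (snd b ≡ᵇ c)) =
        P.sym (∧-distribˡ-∨ (fst b ≡ᵇ suc i) _ _)
      upd′ : ∀ b → i < fst b → mn b ≡ between θ c (snd b) → mn b ∨ ((snd b ≡ᵇ c) ∧ not (fst b ≡ᵇ i)) ≡ between θ (suc c) (snd b)
      upd′ b p e rewrite e | >⇒≢ᵇ p | between-suc θ c (snd b) θ≤c | BP.∧-identityʳ (snd b ≡ᵇ c) = P.refl

  -- Either the first box is unmarked or the marks start there. In the second case the box is
  -- dropped if it is `alone` and kept, with a factor β, if it is `joint`.
  row-front : ∀ r i θ rest H → All (λ b → i < fst b × snd b < θ ℕ.+ suc r) rest →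
    SC none none (cells i θ (suc r) ++ rest) H ≈ SC none none (cells i (suc θ) r ++ rest) (λ k → H ((i , θ) ∷ k))
      + (pw z (suc r) * SCθ i θ rest H + β * pw z (suc r) * SCθ i θ rest (λ k → H ((i , θ) ∷ k)))
  row-front r i θ rest H lower = +-cong (*-identityˡ _) (+-cong
      (trans (*-congˡ (marked-first H)) (solve 3 (λ z p s → :1 :* z :* (p :* s) := z :* p :* s) refl _ _ _))
      (trans (*-congˡ (marked-first _)) (solve 4 (λ b z p s → :1 :* (b :* z) :* (p :* s) := b :* (z :* p) :* s) refl _ _ _ _)))
    where
    marked-first : ∀ H → SC (none ∪ adj (i , θ)) (none ∪ parity? true (i , θ)) (cells i (suc θ) r ++ rest) H ≈ pw z r * SCθ i θ rest H
    marked-first H = forced r (suc θ) i θ (NP.n≤1+n θ) _ _ rest H (λ _ → right) (λ k → P.trans (P.cong (λ u → (k ≡ᵇ θ) ∧ not u) (≡ᵇ-refl i)) (BP.∧-zeroʳ _))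
      (All.map (λ { (p , q) → p , NP.≤-trans q (NP.≤-reflexive (NP.+-suc θ r)) }) lower)
      (All.map (λ { {b} (p , _) → upd b p , upd′ b p }) lower)
      where
      right : ((i ≡ᵇ suc i) ∧ (suc θ ≡ᵇ θ)) ∨ ((i ≡ᵇ i) ∧ (suc θ ≡ᵇ suc θ)) ≡ true
      right rewrite ≡ᵇ-refl i | ≡ᵇ-refl θ = BP.∨-zeroʳ _
      single : ∀ k → between θ (suc θ) k ≡ (k ≡ᵇ θ)
      single k rewrite between-suc θ θ k NP.≤-refl | between-empty θ k = P.refl
      upd : ∀ b → i < fst b → ((fst b ≡ᵇ suc i) ∧ (snd b ≡ᵇ θ)) ∨ ((fst b ≡ᵇ i) ∧ (snd b ≡ᵇ suc θ)) ≡ (fst b ≡ᵇ suc i) ∧ between θ (suc θ) (snd b)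
      upd b p rewrite >⇒≢ᵇ p | single (snd b) = BP.∨-identityʳ _
      upd′ : ∀ b → i < fst b → (snd b ≡ᵇ θ) ∧ not (fst b ≡ᵇ i) ≡ between θ (suc θ) (snd b)
      upd′ b p rewrite >⇒≢ᵇ p | single (snd b) = BP.∧-identityʳ _

  -- A row with r + 1 cells from column θ on, at most r of which are kept.
  PH : ℕ → ℕ → ℕ → List Box → (List Box → Carrier) → Carrier
  PH i θ zero rest H = z * SCθ i θ rest H
  PH i θ (suc r) rest H = pw z (suc (suc r)) * SCθ i θ rest H
    + (β * pw z (suc (suc r)) * SCθ i θ rest (λ k → H ((i , θ) ∷ k)) + PH i (suc θ) r rest (λ k → H ((i , θ) ∷ k)))

  -- The choices sorted by whether the row keeps all its boxes. That happens if nothing is marked or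
  -- if only the last box is, jointly; all other choices are in `PH`.
  row-split : ∀ r i θ d → θ ℕ.+ r ≡ d → ∀ rest H → All (λ b → i < fst b × snd b < suc d) rest →
    SC none none (cells i θ (suc r) ++ rest) H ≈ SC none none rest (λ k → H (cells i θ (suc r) ++ k))
      + β * z * SCθ i d rest (λ k → H (cells i θ (suc r) ++ k)) + PH i θ r rest H
  row-split zero i θ d e rest H lower rewrite P.trans (P.sym (NP.+-identityʳ θ)) e = trans
    (row-front 0 i d rest H (All.map (λ { (p , q) → p , NP.≤-trans q (NP.≤-reflexive (P.sym (P.trans (NP.+-suc d 0) (P.cong suc (NP.+-identityʳ d))))) }) lower))
    (solve 5 (λ a z s b t → a :+ (z :* :1 :* s :+ b :* (z :* :1) :* t) := a :+ b :* z :* t :+ z :* s) refl _ _ _ _ _)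
  row-split (suc r) i θ d e rest H lower = trans
    (row-front (suc r) i θ rest H (All.map (λ { (p , q) → p , NP.≤-trans q (NP.≤-reflexive (P.trans (P.cong suc (P.sym e)) (P.sym (NP.+-suc θ (suc r))))) }) lower))
    (trans (+-congʳ (row-split r i (suc θ) d (P.trans (P.sym (NP.+-suc θ r)) e) rest (λ k → H ((i , θ) ∷ k)) lower))
      (solve 5 (λ a b p s t → a :+ b :+ p :+ (s :+ t) := a :+ b :+ (s :+ (t :+ p))) refl _ _ _ _ _))

  -- In a row that gets shorter the last box always holds only the letter, whence the common factor
  -- z. The row without that box may be shortened further, or be kept whole with the marks starting
  -- at the last box or, jointly, just before it.
  PH-extend : ∀ r i θ d → θ ℕ.+ r ≡ d → ∀ rest H → PH i θ (suc r) rest H ≈ z * PH i θ r rest H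
    + z * (SCθ i (suc d) rest (λ k → H (cells i θ (suc r) ++ k)) + β * z * SCθ i d rest (λ k → H (cells i θ (suc r) ++ k)))
  PH-extend zero i θ d e rest H rewrite P.trans (P.sym (NP.+-identityʳ θ)) e =
    solve 5 (λ z a b t u → z :* (z :* :1) :* a :+ (b :* (z :* (z :* :1)) :* t :+ z :* u) := z :* (z :* a) :+ z :* (u :+ b :* z :* t)) refl z _ β _ _
  PH-extend (suc r) i θ d e rest H = trans (+-congˡ (+-congˡ (PH-extend r i (suc θ) d (P.trans (P.sym (NP.+-suc θ r)) e) rest (λ k → H ((i , θ) ∷ k)))))
    (solve 7 (λ z p s b t q w → z :* p :* s :+ (b :* (z :* p) :* t :+ (z :* q :+ w)) := z :* (p :* s :+ (b :* p :* t :+ q)) :+ w) refl z _ _ β _ _ _)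

  PH-zero : ∀ r i θ rest → (∀ θ′ → θ′ ≤ θ ℕ.+ r → ∀ H → SCθ i θ′ rest H ≈ 0#) → ∀ H → PH i θ r rest H ≈ 0#
  PH-zero zero i θ rest h H = trans (*-congˡ (h θ (NP.m≤m+n θ 0) H)) (zeroʳ _)
  PH-zero (suc r) i θ rest h H = trans (+-cong (*-congˡ (h θ (NP.m≤m+n θ _) H)) (+-cong (*-congˡ (h θ (NP.m≤m+n θ _) _))
      (PH-zero r i (suc θ) rest (λ θ′ p → h θ′ (NP.≤-trans p (NP.≤-reflexive (P.sym (NP.+-suc θ r))))) _)))
    (solve 2 (λ a b → a :* :0 :+ (b :* :0 :+ :0) := :0) refl _ _)

  beyond : ∀ i {n} (s : Vec Bool n) d → suc i ℕ.+ n ≤ d → ∀ H → SCθ i d (rows (suc i) s) H ≈ SC none none (rows (suc i) s) H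
  beyond i s d le H = SC-cong _ (All.map (λ { {b} (_ , _ , q) → let f = <⇒≰ᵇ (NP.≤-trans q le) in
    P.trans (P.cong ((fst b ≡ᵇ suc i) ∧_) f) (BP.∧-zeroʳ _) , f }) (rows-in (suc i) s)) (λ _ → refl)

  -- The last box of the next row lies in a column from θ on, where it would have to be both `alone`
  -- and `absent`. This is the interlacing condition of horizontal strips.
  blocked : ∀ i {n} (s : Vec Bool n) θ → θ ≤ i ℕ.+ suc n → ∀ H → SCθ i θ (rows (suc i) (true ∷ s)) H ≈ 0#
  blocked i {n} s θ le H = SC-zero _ (cells-last (suc i) (suc i) n _ (o , p)) H
    where
    p : (θ ℕ.≤ᵇ suc i ℕ.+ n) ≡ true
    p = ≤⇒≤ᵇ≡ (NP.≤-trans le (NP.≤-reflexive (NP.+-suc i n)))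
    o : (suc i ≡ᵇ suc i) ∧ (θ ℕ.≤ᵇ suc i ℕ.+ n) ≡ true
    o rewrite ≡ᵇ-refl i = p

  -- With n levels left, state s₁ means that row i had n + 1 boxes and keeps at most n of them.
  -- State s₂ means that it keeps all of them and that the last one may share the letter.
  H₀ : ∀ {n} i (s : Vec Bool n) F → Σᵇ n (λ t → Hₜ P? s₀ s t * F (rows i t)) ≈ SC none none (rows i s) F
  H₁ : ∀ {n} i (s : Vec Bool n) F → Σᵇ n (λ t → Hₜ P? s₁ s t * F (rows i t)) ≈ PH i i n (rows (suc i) s) F
  H₂ : ∀ {n} i (s : Vec Bool n) F → Σᵇ n (λ t → Hₜ P? s₂ s t * F (rows (suc i) t)) ≈
    SC none none (rows (suc i) s) F + β * z * SCθ i (i ℕ.+ n) (rows (suc i) s) F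

  H₀ i [] F = *-identityˡ _
  H₀ {suc n} i (false ∷ s) F = trans
    (+-cong (trans (weighted₀ n) (*-identityˡ _))
      (weightless n))
    (trans (+-identityʳ _) (H₀ i s F))
  H₀ {suc n} i (true ∷ s) F = begin
    _ ≈⟨ +-cong (trans (weighted₁ n) (*-identityˡ _))
           (trans (weighted₂ n) (*-identityˡ _)) ⟩
    Σᵇ n (λ t → Hₜ P? s₁ s t * F (rows i t)) + Σᵇ n (λ t → Hₜ P? s₂ s t * Fᶜ (rows (suc i) t)) ≈⟨ +-cong (H₁ i s F) (H₂ i s Fᶜ) ⟩
    _ ≈⟨ +-comm _ _ ⟩
    _ ≈⟨ sym (row-split n i i (i ℕ.+ n) P.refl (rows (suc i) s) F (All.map (λ { (p , _ , q) → p , q }) (rows-in (suc i) s))) ⟩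
    SC none none (cells i i (suc n) ++ rows (suc i) s) F ∎
    where
    Fᶜ : List Box → Carrier
    Fᶜ k = F (cells i i (suc n) ++ k)

  H₁ i [] F = refl
  H₁ {suc n} i (false ∷ s) F = begin
    _ ≈⟨ +-cong (weighted₁ n)
           (weighted₂ n) ⟩
    z * Σᵇ n (λ t → Hₜ P? s₁ s t * F (rows i t)) + z * Σᵇ n (λ t → Hₜ P? s₂ s t * Fᶜ (rows (suc i) t)) ≈⟨ +-cong (*-congˡ (H₁ i s F)) (*-congˡ (H₂ i s Fᶜ)) ⟩
    z * PH i i n rest F + z * (SC none none rest Fᶜ + β * z * SCθ i (i ℕ.+ n) rest Fᶜ)
      ≈⟨ +-congˡ (*-congˡ (+-congʳ (sym (beyond i s (suc (i ℕ.+ n)) NP.≤-refl Fᶜ)))) ⟩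
    z * PH i i n rest F + z * (SCθ i (suc (i ℕ.+ n)) rest Fᶜ + β * z * SCθ i (i ℕ.+ n) rest Fᶜ) ≈⟨ sym (PH-extend n i i (i ℕ.+ n) P.refl rest F) ⟩
    PH i i (suc n) rest F ∎
    where
    rest = rows (suc i) s
    Fᶜ : List Box → Carrier
    Fᶜ k = F (cells i i (suc n) ++ k)
  H₁ {suc n} i (true ∷ s) F = trans (+-cong (weightless n) (weightless n))
    (trans (+-identityˡ _) (sym (PH-zero (suc n) i i (rows (suc i) (true ∷ s)) (λ θ p → blocked i s θ p) F)))

  H₂ i [] F = solve 3 (λ b z h → (:1 :+ b :* z) :* h := h :+ b :* z :* h) refl β z _
  H₂ {suc n} i (false ∷ s) F = begin
    _ ≈⟨ +-cong (weighted₀ n)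
           (weightless n) ⟩
    (1# + β * z) * Σᵇ n (λ t → Hₜ P? s₀ s t * F (rows (suc i) t)) + 0# ≈⟨ trans (+-identityʳ _) (*-congˡ (H₀ (suc i) s F)) ⟩
    (1# + β * z) * SC none none (rows (suc i) s) F ≈⟨ solve 3 (λ b z h → (:1 :+ b :* z) :* h := h :+ b :* z :* h) refl β z _ ⟩
    SC none none (rows (suc i) s) F + β * z * SC none none (rows (suc i) s) F
      ≈⟨ +-congˡ (*-congˡ (sym (beyond i s _ (NP.≤-reflexive (P.sym (NP.+-suc i n))) F))) ⟩
    SC none none (rows (suc i) s) F + β * z * SCθ i (i ℕ.+ suc n) (rows (suc i) s) F ∎
  H₂ {suc n} i (true ∷ s) F = begin
    Σᵇ n (λ t → Hₜ P? s₂ (true ∷ s) (false ∷ t) * F (rows (suc i) t)) + Σᵇ n (λ t → Hₜ P? s₂ (true ∷ s) (true ∷ t) * F (rows (suc i) (true ∷ t)))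
      ≈⟨ refl ⟩
    Σᵇ (suc n) (λ t → Hₜ P? s₀ (true ∷ s) t * F (rows (suc i) t)) ≈⟨ H₀ (suc i) (true ∷ s) F ⟩
    SC none none (rows (suc i) (true ∷ s)) F ≈⟨ solve 2 (λ a b → a := a :+ b :* :0) refl _ _ ⟩
    SC none none (rows (suc i) (true ∷ s)) F + β * z * 0# ≈⟨ +-congˡ (*-congˡ (sym (blocked i s (i ℕ.+ suc n) NP.≤-refl F))) ⟩
    SC none none (rows (suc i) (true ∷ s)) F + β * z * SCθ i (i ℕ.+ suc n) (rows (suc i) (true ∷ s)) F ∎

-- Set-valued tableaux as products of transfer matrices

dbl : ℕ → ℕ
dbl zero = 0
dbl (suc k) = suc (suc (dbl k))

isOdd-dbl : ∀ k → isOdd (dbl k) ≡ false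
isOdd-dbl zero = P.refl
isOdd-dbl (suc k) = isOdd-dbl k

isOdd-suc-dbl : ∀ k → isOdd (suc (dbl k)) ≡ true
isOdd-suc-dbl zero = P.refl
isOdd-suc-dbl (suc k) = isOdd-suc-dbl k

length-cells : ∀ i c r → length (cells i c r) ≡ r
length-cells i c zero = P.refl
length-cells i c (suc r) = P.cong suc (length-cells i (suc c) r)

length-rows : ∀ i {n} (s : Vec Bool n) → length (rows i s) ≡ size s
length-rows i [] = P.refl
length-rows i (false ∷ s) = length-rows i s
length-rows i {suc n} (true ∷ s) = P.trans (LP.length-++ (cells i i (suc n))) (P.cong₂ ℕ._+_ (length-cells i i (suc n)) (length-rows (suc i) s))

module SetValued (R : CommutativeRing 0ℓ 0ℓ) (β : CommutativeRing.Carrier R) (P? : Bool) where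
  open RingKit R
  open Fillings R
  open Pieri R β using (dot; dot-cong; dot-assoc)

  -- Letters 2k - 1 and 2k belong to x in x ∷ xs, where k = length (x ∷ xs).
  letter : List Carrier → ℕ → Carrier
  letter [] ℓ = 0#
  letter (x ∷ xs) ℓ = if ℓ ℕ.≤ᵇ dbl (length xs) then letter xs ℓ else x

  letter-old : ∀ x xs ℓ → ℓ ≤ dbl (length xs) → letter (x ∷ xs) ℓ ≡ letter xs ℓ
  letter-old x xs ℓ p rewrite ≤⇒≤ᵇ≡ p = P.refl

  letter-new : ∀ x xs ℓ → dbl (length xs) < ℓ → letter (x ∷ xs) ℓ ≡ x
  letter-new x xs ℓ p rewrite <⇒≰ᵇ p = P.refl

  W : List Carrier → ∀ {n} → Vec Bool n → Carrier
  W xs s = Peel.G R β P? (letter xs) (dbl (length xs)) (rows 1 s)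

  δ∅ : ∀ {n} → Vec Bool n → Carrier
  δ∅ [] = 1#
  δ∅ (false ∷ s) = δ∅ s
  δ∅ (true ∷ s) = 0#

  W-[] : ∀ {n} (s : Vec Bool n) → W [] s ≈ δ∅ s
  W-[] [] = trans (*-identityʳ _) (resp ι (BP.∨-zeroʳ (not P?)))
  W-[] (false ∷ s) = W-[] s
  W-[] (true ∷ s) = refl

  G-cong : ∀ {z z′} L → (∀ ℓ → ℓ ≤ L → z ℓ ≈ z′ ℓ) → ∀ bs → Peel.G R β P? z L bs ≈ Peel.G R β P? z′ L bs
  G-cong {z} {z′} L e bs = FS-cong (NE L) (NE-below L) bs (λ E v → *-congˡ (prod E v))
    where
    word : ∀ S → All (_≤ L) S → ∏ S z ≈ ∏ S z′
    word [] [] = refl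
    word (ℓ ∷ S) (p ∷ ps) = *-cong (e ℓ p) (word S ps)
    prod : ∀ E → All (λ e → Below L (snd e)) E → ∏ E (λ e → Peel.boxwt R β P? z (snd e)) ≈ ∏ E (λ e → Peel.boxwt R β P? z′ (snd e))
    prod [] [] = refl
    prod (e ∷ E) (b ∷ bs) = *-cong (*-congˡ (word (snd e) (Below.bounded b))) (prod E bs)

  module _ (z : ℕ → Carrier) where
    open Peel R β P? z

    odd-step : ∀ L → isOdd (suc L) ≡ true → ∀ {n} (s : Vec Bool n) →
      G (suc L) (rows 1 s) ≈ dot n (Transfer.V R β (z (suc L)) 0# P? s₀ s) (λ t → G L (rows 1 t))
    odd-step L odd {n} s = trans (G-suc L (rows 1 s)) (trans (FS-cong′ (absent ∷ alone ∷ joint ∷ []) (rows 1 s) (λ M →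
        *-congʳ (*-cong (resp (λ o → ι (allPairs M (markOK (not o)))) odd) (∏-cong M wt))))
      (trans (flat≈SC (rows-sorted 1 s) (G L)) (sym (V₀ 1 s (G L)))))
      where
      open VStrips R β P? (z (suc L))
      open Sequential R β false c
      wt : ∀ e → markwt (suc L) e ≈ w e
      wt (b , absent) = refl
      wt ((i , j) , alone) rewrite odd = *-congʳ (resp (λ u → ι (not P? ∨ u)) (BP.∨-identityʳ _))
      wt ((i , j) , joint) rewrite odd = trans (*-congʳ (resp (λ u → ι (not P? ∨ u)) (BP.∨-identityʳ _)))
        (solve 3 (λ a b c → a :* (b :* c) := b :* (a :* c)) refl _ _ _)

    even-step : ∀ L → isOdd (suc L) ≡ false → ∀ {n} (s : Vec Bool n) →
      G (suc L) (rows 1 s) ≈ dot n (Transfer.H R β (z (suc L)) 0# P? s₀ s) (λ t → G L (rows 1 t))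
    even-step L odd {n} s = trans (G-suc L (rows 1 s)) (trans (FS-cong′ (absent ∷ alone ∷ joint ∷ []) (rows 1 s) (λ M →
        *-congʳ (*-cong (resp (λ o → ι (allPairs M (markOK (not o)))) odd) (∏-cong M wt))))
      (trans (flat≈SC (rows-sorted 1 s) (G L)) (sym (H₀ 1 s (G L)))))
      where
      open HStrips R β P? (z (suc L))
      open Sequential R β true (λ _ → z (suc L))
      one : ∀ (b : Box) → ι (not P? ∨ (not (fst b ≡ᵇ snd b) ∨ true)) ≈ 1#
      one b = resp ι (P.trans (P.cong (not P? ∨_) (BP.∨-zeroʳ _)) (BP.∨-zeroʳ (not P?)))
      wt : ∀ e → markwt (suc L) e ≈ w e
      wt (b , absent) = refl
      wt ((i , j) , alone) rewrite odd = trans (*-congʳ (one (i , j))) (*-identityˡ _)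
      wt ((i , j) , joint) rewrite odd = trans (*-congʳ (one (i , j))) (*-identityˡ _)

  -- The unprimed letter of x is the larger of its two and goes first. This is why A is `H` times
  -- `V` in that order.
  W-∷ : ∀ x xs {n} (s : Vec Bool n) → W (x ∷ xs) s ≈ dot n (Transfer.A R β x 0# P? s₀ s) (W xs)
  W-∷ x xs {n} s = begin
    G (suc (suc L)) (rows 1 s) ≈⟨ even-step z (suc L) (isOdd-dbl (length xs)) s ⟩
    dot n (Transfer.H R β (z (suc (suc L))) 0# P? s₀ s) (λ t → G (suc L) (rows 1 t))
      ≡⟨ P.cong (λ y → dot n (Transfer.H R β y 0# P? s₀ s) (λ t → G (suc L) (rows 1 t))) (letter-new x xs (suc (suc L)) (NP.n≤1+n _)) ⟩
    dot n (TH s) (λ t → G (suc L) (rows 1 t)) ≈⟨ dot-cong n (λ _ → refl) (λ t → odd-step z L (isOdd-suc-dbl (length xs)) t) ⟩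
    dot n (TH s) (λ t → dot n (Transfer.V R β (z (suc L)) 0# P? s₀ t) (λ r → G L (rows 1 r)))
      ≡⟨ P.cong (λ y → dot n (TH s) (λ t → dot n (Transfer.V R β y 0# P? s₀ t) (λ r → G L (rows 1 r)))) (letter-new x xs (suc L) NP.≤-refl) ⟩
    dot n (TH s) (λ t → dot n (Transfer.V R β x 0# P? s₀ t) (λ r → G L (rows 1 r))) ≈⟨ dot-assoc n n (TH s) (Transfer.V R β x 0# P? s₀) _ ⟩
    dot n (λ r → dot n (TH s) (λ t → Transfer.V R β x 0# P? s₀ t r)) (λ r → G L (rows 1 r))
      ≈⟨ dot-cong n (λ r → sym (Transfer.A≈HV R β x 0# P? s r)) (λ r → G-cong L (λ ℓ p → reflexive (letter-old x xs ℓ p)) (rows 1 r)) ⟩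
    dot n (Transfer.A R β x 0# P? s₀ s) (W xs) ∎
    where
    L = dbl (length xs)
    z = letter (x ∷ xs)
    open Peel R β P? z using (G)
    TH : Vec Bool n → Vec Bool n → Carrier
    TH = Transfer.H R β x 0# P? s₀

  module _ (F : Filtration R) where
    open Filtration F

    letter-I : ∀ {xs} → All (I 1) xs → ∀ ℓ → I 1 (letter xs ℓ)
    letter-I [] ℓ = I-0
    letter-I {x ∷ xs} (p ∷ ps) ℓ with ℓ ℕ.≤ᵇ dbl (length xs)
    ... | true = letter-I ps ℓ
    ... | false = p

    I-*ʳ : ∀ {k a} b → I k a → I k (a * b)
    I-*ʳ b h = I-cong (*-comm _ _) (I-* (I-all b) h)

    I-∑ᵃ : ∀ {A : Set} {P : A → Set} {k} (as : List A) → All P as → ∀ {f} → (∀ a → P a → I k (f a)) → I k (∑ as f)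
    I-∑ᵃ [] [] h = I-0
    I-∑ᵃ (a ∷ as) (p ∷ ps) h = I-+ (h a p) (I-∑ᵃ as ps h)

    I-FS : ∀ {A : Set} {P : A → Set} {k} (as : List A) → All P as → ∀ bs {f} → (∀ E → length E ≡ length bs → All (λ e → P (snd e)) E → I k (f E)) → I k (FS as bs f)
    I-FS as ps [] h = h [] P.refl []
    I-FS as ps (b ∷ bs) h = I-∑ᵃ as ps (λ a p → I-FS as ps bs (λ E e q → h ((b , a) ∷ E) (P.cong suc e) (p ∷ q)))

    -- Every box contains at least one letter and hence contributes at least one factor x.
    W-I : ∀ {xs} → All (I 1) xs → ∀ {n} (s : Vec Bool n) → I (size s) (W xs s)
    W-I {xs} xs∈I s = I-FS (NE L) (NE-below L) (rows 1 s) (λ E e v → I-cong (*-comm _ _) (I-*ʳ _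
        (P.subst (λ k → I k _) (P.trans e (length-rows 1 s)) (prod E v))))
      where
      L = dbl (length xs)
      z = letter xs
      word : ∀ S → S ≢ [] → I 1 (∏ S z)
      word [] ne = ⊥-elim (ne P.refl)
      word (ℓ ∷ S) _ = I-*ʳ _ (letter-I xs∈I ℓ)
      prod : ∀ E → All (λ e → Below L (snd e)) E → I (length E) (∏ E (λ e → Peel.boxwt R β P? z (snd e)))
      prod [] [] = I-all 1#
      prod (e ∷ E) (b ∷ bs) = I-* (I-* (I-all _) (word (snd e) (Below.nonempty b))) (prod E bs)

-- Distinct lines, and plane partitions cut at a letter

≢-filter-mem : ∀ x y l → (x ≡ᵇ y) ≡ false → memN x (filter (λ z → ¬? (y NP.≟ z)) l) ≡ memN x l
≢-filter-mem x y [] e = P.refl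
≢-filter-mem x y (z ∷ l) e with y ≡ᵇ z in q
... | false = P.cong ((x ≡ᵇ z) ∨_) (≢-filter-mem x y l e)
... | true rewrite P.sym (NP.≡ᵇ⇒≡ y z (P.subst T (P.sym q) _)) | e = ≢-filter-mem x y l e

deduplicate-mem : ∀ x l → memN x (deduplicate NP._≟_ l) ≡ memN x l
deduplicate-mem x [] = P.refl
deduplicate-mem x (y ∷ l) with x ≡ᵇ y in e
... | true = P.refl
... | false = P.trans (≢-filter-mem x y (deduplicate NP._≟_ l) e) (deduplicate-mem x l)

-- Deduplication filters the new element out of an already deduplicated list. There it occurs at
-- most once, so the length drops by at most one.
≢-filter-length : ∀ x d → Unique d → suc (length (filter (λ z → ¬? (x NP.≟ z)) d)) ≡ (if memN x d then 0 else 1) ℕ.+ length d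
≢-filter-length x [] [] = P.refl
≢-filter-length x (y ∷ d) (p ∷ u) with x ≡ᵇ y in e
... | true rewrite NP.≡ᵇ⇒≡ x y (P.subst T (P.sym e) _) = P.cong (λ l → suc (length l)) (LP.filter-all (λ z → ¬? (y NP.≟ z)) p)
... | false with memN x d | ≢-filter-length x d u
...   | true | h = P.cong suc h
...   | false | h = P.cong suc h

distinct-∷ : ∀ x xs → distinct (x ∷ xs) ≡ (if memN x xs then 0 else 1) ℕ.+ distinct xs
distinct-∷ x xs = P.trans (≢-filter-length x (deduplicate NP._≟_ xs) (deduplicate-! NP._≟_ xs))
  (P.cong (λ b → (if b then 0 else 1) ℕ.+ distinct xs) (deduplicate-mem x xs))

rel : Box → Box → Bool
rel (i , j) (i′ , j′) = ((i′ ≡ᵇ i) ∧ (j ≤ᵇ j′)) ∨ ((j′ ≡ᵇ j) ∧ (i ≤ᵇ i′))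

ppPairOK-rel : ∀ b ℓ b′ ℓ′ → ppPairOK (b , ℓ) (b′ , ℓ′) ≡ not (rel b b′) ∨ (ℓ ≤ᵇ ℓ′)
ppPairOK-rel (i , j) ℓ (i′ , j′) ℓ′ = lemma ((i′ ≡ᵇ i) ∧ (j ≤ᵇ j′)) _ _
  where
  lemma : ∀ a b c → (not a ∨ c) ∧ (not b ∨ c) ≡ not (a ∨ b) ∨ c
  lemma false b c = P.refl
  lemma true false false = P.refl
  lemma true true false = P.refl
  lemma true false true = P.refl
  lemma true true true = P.refl

-- Filling a shape with the letters ≤ p (mark false) and > p (mark true).
idealOK : Box × Bool → Box × Bool → Bool
idealOK (b , m) (b′ , m′) = not (rel b b′) ∨ (not m ∨ m′)

module Split (p : ℕ) where
  highs : List PPEntry → List (Box × Bool)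
  highs = map (λ e → fst e , not (snd e ≤ᵇ p))

  low high : List PPEntry → List PPEntry
  low = filterB (λ e → snd e ≤ᵇ p)
  high = filterB (λ e → not (snd e ≤ᵇ p))

  -- Between a letter up to p and one beyond p the comparison is already settled by the marks; two
  -- letters on the same side satisfy the mark condition trivially.
  pair : ∀ e e′ → ppPairOK e e′ ≡ idealOK (fst e , not (snd e ≤ᵇ p)) (fst e′ , not (snd e′ ≤ᵇ p))
    ∧ (not ((snd e ≤ᵇ p) ∧ (snd e′ ≤ᵇ p)) ∨ ppPairOK e e′) ∧ (not (not (snd e ≤ᵇ p) ∧ not (snd e′ ≤ᵇ p)) ∨ ppPairOK e e′)
  pair (b , ℓ) (b′ , ℓ′) rewrite ppPairOK-rel b ℓ b′ ℓ′ with ℓ ≤ᵇ p in q | ℓ′ ≤ᵇ p in q′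
  ... | true | true = lemma (rel b b′) (ℓ ≤ᵇ ℓ′)
    where
    lemma : ∀ r c → not r ∨ c ≡ (not r ∨ true) ∧ (not r ∨ c) ∧ true
    lemma false c = P.refl
    lemma true false = P.refl
    lemma true true = P.refl
  ... | false | false = lemma (rel b b′) (ℓ ≤ᵇ ℓ′)
    where
    lemma : ∀ r c → not r ∨ c ≡ (not r ∨ true) ∧ (not r ∨ c)
    lemma false c = P.refl
    lemma true c = P.refl
  ... | true | false = P.trans (P.cong (not (rel b b′) ∨_) (≤⇒≤ᵇ≡ {ℓ} {ℓ′} (NP.≤-trans (≤ᵇ⇒≤′ ℓ p q) (NP.<⇒≤ (≰ᵇ⇒> ℓ′ p q′))))) (lemma (rel b b′))
    where
    lemma : ∀ r → not r ∨ true ≡ (not r ∨ true) ∧ true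
    lemma false = P.refl
    lemma true = P.refl
  ... | false | true = P.trans (P.cong (not (rel b b′) ∨_) (<⇒≰ᵇ {ℓ} {ℓ′} (NP.≤-trans (s≤s (≤ᵇ⇒≤′ ℓ′ p q′)) (≰ᵇ⇒> ℓ p q)))) (lemma (rel b b′))
    where
    lemma : ∀ r → not r ∨ false ≡ (not r ∨ false) ∧ true
    lemma false = P.refl
    lemma true = P.refl

  all-filterB : {A : Set} (q r : A → Bool) (l : List A) → all (λ a → not (q a) ∨ r a) l ≡ all r (filterB q l)
  all-filterB q r [] = P.refl
  all-filterB q r (a ∷ l) with q a
  ... | true = P.cong (r a ∧_) (all-filterB q r l)
  ... | false = all-filterB q r l

  allPairs-filterB : {A : Set} (q : A → Bool) (r : A → A → Bool) (l : List A) →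
    all (λ a → all (λ a′ → not (q a ∧ q a′) ∨ r a a′) l) l ≡ allPairs (filterB q l) r
  allPairs-filterB q r l = P.trans (all-cong l (universal l)) (all-filterB q (λ a → all (r a) (filterB q l)) l)
    where
    one : ∀ a → all (λ a′ → not (q a ∧ q a′) ∨ r a a′) l ≡ not (q a) ∨ all (r a) (filterB q l)
    one a with q a
    ... | true = all-filterB q (r a) l
    ... | false = all-true _ l (All.universal (λ _ → P.refl) l)
    universal : ∀ l′ → All (λ a → all (λ a′ → not (q a ∧ q a′) ∨ r a a′) l ≡ not (q a) ∨ all (r a) (filterB q l)) l′
    universal l′ = All.universal one l′

  crossB lowB highB : PPEntry → PPEntry → Bool
  crossB e e′ = idealOK (fst e , not (snd e ≤ᵇ p)) (fst e′ , not (snd e′ ≤ᵇ p))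
  lowB e e′ = not ((snd e ≤ᵇ p) ∧ (snd e′ ≤ᵇ p)) ∨ ppPairOK e e′
  highB e e′ = not (not (snd e ≤ᵇ p) ∧ not (snd e′ ≤ᵇ p)) ∨ ppPairOK e e′

  allPairs-split : ∀ E → allPairs E ppPairOK ≡ allPairs (highs E) idealOK ∧ allPairs (low E) ppPairOK ∧ allPairs (high E) ppPairOK
  allPairs-split E = begin
      allPairs E ppPairOK
        ≡⟨ all-cong E (All.universal (λ e → P.trans (all-cong E (All.universal (pair e) E)) (all-∧ (crossB e) (λ e′ → lowB e e′ ∧ highB e e′) E)) E) ⟩
      all (λ e → all (crossB e) E ∧ all (λ e′ → lowB e e′ ∧ highB e e′) E) E
        ≡⟨ all-∧ (λ e → all (crossB e) E) (λ e → all (λ e′ → lowB e e′ ∧ highB e e′) E) E ⟩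
      allPairs E crossB ∧ all (λ e → all (λ e′ → lowB e e′ ∧ highB e e′) E) E
        ≡⟨ P.cong (allPairs E crossB ∧_) (P.trans (all-cong E (All.universal (λ e → all-∧ (lowB e) (highB e) E) E)) (all-∧ (λ e → all (lowB e) E) (λ e → all (highB e) E) E)) ⟩
      allPairs E crossB ∧ allPairs E lowB ∧ allPairs E highB
        ≡⟨ P.cong₂ _∧_ (P.sym (P.trans (all-map _ _ E) (all-cong E (All.universal (λ e → all-map _ _ E) E))))
             (P.cong₂ _∧_ (allPairs-filterB (λ e → snd e ≤ᵇ p) ppPairOK E) (allPairs-filterB (λ e → not (snd e ≤ᵇ p)) ppPairOK E)) ⟩
      allPairs (highs E) idealOK ∧ allPairs (low E) ppPairOK ∧ allPairs (high E) ppPairOK ∎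
    where open P.≡-Reasoning

  all-split : ∀ (q : PPEntry → Bool) E → all q E ≡ all q (low E) ∧ all q (high E)
  all-split q [] = P.refl
  all-split q (e ∷ E) with snd e ≤ᵇ p
  ... | true = P.trans (P.cong (q e ∧_) (all-split q E)) (P.sym (BP.∧-assoc (q e) (all q (low E)) (all q (high E))))
  ... | false = P.trans (P.cong (q e ∧_) (all-split q E)) (lemma (q e) (all q (low E)) (all q (high E)))
    where
    lemma : ∀ a b c → a ∧ (b ∧ c) ≡ b ∧ (a ∧ c)
    lemma false false c = P.refl
    lemma false true c = P.refl
    lemma true b c = P.refl

  filterB-low : ∀ ℓ → ℓ ≤ p → ∀ (T : List PPEntry) → filterB (λ e → snd e ≡ᵇ ℓ) T ≡ filterB (λ e → snd e ≡ᵇ ℓ) (low T)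
  filterB-low ℓ le [] = P.refl
  filterB-low ℓ le ((b , k) ∷ T) with k ≤ᵇ p in q
  ... | true with k ≡ᵇ ℓ
  ...   | true = P.cong ((b , k) ∷_) (filterB-low ℓ le T)
  ...   | false = filterB-low ℓ le T
  filterB-low ℓ le ((b , k) ∷ T) | false rewrite >⇒≢ᵇ {k} {ℓ} (NP.≤-trans (s≤s le) (≰ᵇ⇒> k p q)) = filterB-low ℓ le T

  filterB-high : ∀ ℓ → p < ℓ → ∀ (T : List PPEntry) → filterB (λ e → snd e ≡ᵇ ℓ) T ≡ filterB (λ e → snd e ≡ᵇ ℓ) (high T)
  filterB-high ℓ lt [] = P.refl
  filterB-high ℓ lt ((b , k) ∷ E) with k ≤ᵇ p in q
  ... | false with k ≡ᵇ ℓ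
  ...   | true = P.cong ((b , k) ∷_) (filterB-high ℓ lt E)
  ...   | false = filterB-high ℓ lt E
  filterB-high ℓ lt ((b , k) ∷ E) | true rewrite <⇒≢ᵇ {k} {ℓ} (NP.≤-trans (s≤s (≤ᵇ⇒≤′ k p q)) lt) = filterB-high ℓ lt E

lows′ highs′ : List (Box × Bool) → List Box
lows′ M = map fst (filterB (λ e → not (snd e)) M)
highs′ M = map fst (filterB snd M)

-- Shifted plane partitions

module PlaneFillings (R : CommutativeRing 0ℓ 0ℓ) (γ : CommutativeRing.Carrier R) (P? : Bool) (z : ℕ → CommutativeRing.Carrier R) where
  open RingKit R
  open Fillings R

  -- With γ = -β this is the share of one letter in the summand of the plane partition sums: y for
  -- each distinct line and -β for each box beyond the first on a line.
  stat : Carrier → List ℕ → Carrier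
  stat y xs = pw y (distinct xs) * pw γ (length xs ∸ distinct xs)

  stat-∷ : ∀ y x xs → stat y (x ∷ xs) ≈ (if memN x xs then γ else y) * stat y xs
  stat-∷ y x xs = trans (resp (λ d → pw y d * pw γ (suc (length xs) ∸ d)) (distinct-∷ x xs)) (go (memN x xs))
    where
    d = distinct xs
    go : ∀ b → pw y ((if b then 0 else 1) ℕ.+ d) * pw γ (suc (length xs) ∸ ((if b then 0 else 1) ℕ.+ d)) ≈ (if b then γ else y) * (pw y d * pw γ (length xs ∸ d))
    go true = trans (*-congˡ (resp (pw γ) (NP.+-∸-assoc 1 (LP.length-deduplicate NP._≟_ xs))))
      (solve 3 (λ a b c → a :* (b :* c) := b :* (a :* c)) refl _ _ _)
    go false = *-assoc _ _ _

  index : ℕ → PPEntry → ℕ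
  index ℓ e = if isEven ℓ then snd (fst e) else fst (fst e)

  letterwt : ℕ → List PPEntry → Carrier
  letterwt ℓ T = stat (z ℓ) (map (index ℓ) (filterB (λ e → snd e ≡ᵇ ℓ) T))

  good : List PPEntry → Bool
  good T = allPairs T ppPairOK ∧ (not P? ∨ all noUnprimedDiag T)

  weight : List ℕ → List PPEntry → Carrier
  weight as T = ι (good T) * ∏ as (λ ℓ → letterwt ℓ T)

  G : List ℕ → List Box → Carrier
  G as bs = FS as bs (weight as)

  marks₂ : List Bool
  marks₂ = false ∷ true ∷ []

  module _ (p : ℕ) where
    open Split p

    FS-split : ∀ as₁ as₂ → All (_≤ p) as₁ → All (p <_) as₂ → ∀ bs (g : List (Box × Bool) → List PPEntry → List PPEntry → Carrier) →
      FS (as₁ ++ as₂) bs (λ T → g (highs T) (low T) (high T)) ≈ FS marks₂ bs (λ M → FS as₁ (lows′ M) (λ T₁ → FS as₂ (highs′ M) (λ T₂ → g M T₁ T₂)))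
    FS-split as₁ as₂ ≤p >p [] g = refl
    FS-split as₁ as₂ ≤p >p (b ∷ bs) g = begin
      ∑ (as₁ ++ as₂) (λ a → FS (as₁ ++ as₂) bs (λ T → g (highs ((b , a) ∷ T)) (low ((b , a) ∷ T)) (high ((b , a) ∷ T)))) ≈⟨ ∑-++ as₁ as₂ _ ⟩
      ∑ as₁ (λ a → FS (as₁ ++ as₂) bs (λ T → g (highs ((b , a) ∷ T)) (low ((b , a) ∷ T)) (high ((b , a) ∷ T))))
        + ∑ as₂ (λ a → FS (as₁ ++ as₂) bs (λ T → g (highs ((b , a) ∷ T)) (low ((b , a) ∷ T)) (high ((b , a) ∷ T))))
        ≈⟨ +-cong (∑-congᵃ as₁ ≤p (λ a q → trans (FS-cong′ (as₁ ++ as₂) bs (λ T → reflexive (isLow a q T))) (FS-split as₁ as₂ ≤p >p bs (λ M T₁ T₂ → g ((b , false) ∷ M) ((b , a) ∷ T₁) T₂))))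
             (∑-congᵃ as₂ >p (λ a q → trans (FS-cong′ (as₁ ++ as₂) bs (λ T → reflexive (isHigh a q T))) (FS-split as₁ as₂ ≤p >p bs (λ M T₁ T₂ → g ((b , true) ∷ M) T₁ ((b , a) ∷ T₂))))) ⟩
      ∑ as₁ (λ a → FS marks₂ bs (λ M → FS as₁ (lows′ M) (λ T₁ → FS as₂ (highs′ M) (λ T₂ → g ((b , false) ∷ M) ((b , a) ∷ T₁) T₂))))
        + ∑ as₂ (λ a → FS marks₂ bs (λ M → FS as₁ (lows′ M) (λ T₁ → FS as₂ (highs′ M) (λ T₂ → g ((b , true) ∷ M) T₁ ((b , a) ∷ T₂)))))
        ≈⟨ +-cong (sym (FS-∑ marks₂ bs as₁ _))
             (trans (trans (sym (FS-∑ marks₂ bs as₂ _)) (FS-cong′ marks₂ bs (λ M → sym (FS-∑ as₁ (lows′ M) as₂ _)))) (sym (+-identityʳ _))) ⟩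
      FS marks₂ (b ∷ bs) (λ M → FS as₁ (lows′ M) (λ T₁ → FS as₂ (highs′ M) (λ T₂ → g M T₁ T₂))) ∎
      where
      isLow : ∀ a → a ≤ p → ∀ T → g (highs ((b , a) ∷ T)) (low ((b , a) ∷ T)) (high ((b , a) ∷ T)) ≡ g ((b , false) ∷ highs T) ((b , a) ∷ low T) (high T)
      isLow a q T rewrite ≤⇒≤ᵇ≡ q = P.refl
      isHigh : ∀ a → p < a → ∀ T → g (highs ((b , a) ∷ T)) (low ((b , a) ∷ T)) (high ((b , a) ∷ T)) ≡ g ((b , true) ∷ highs T) (low T) ((b , a) ∷ high T)
      isHigh a q T rewrite <⇒≰ᵇ q = P.refl

    -- Neither the diagonal rule nor the weight mixes letters from the two sides of p, so beyond the
    -- position of the cut the two halves are independent.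
    G-split : ∀ as₁ as₂ → All (_≤ p) as₁ → All (p <_) as₂ → ∀ bs →
      G (as₁ ++ as₂) bs ≈ FS marks₂ bs (λ M → ι (allPairs M idealOK) * (G as₁ (lows′ M) * G as₂ (highs′ M)))
    G-split as₁ as₂ ≤p >p bs = begin
      FS (as₁ ++ as₂) bs (weight (as₁ ++ as₂)) ≈⟨ FS-cong′ (as₁ ++ as₂) bs split ⟩
      FS (as₁ ++ as₂) bs (λ T → ι (allPairs (highs T) idealOK) * (weight as₁ (low T) * weight as₂ (high T)))
        ≈⟨ FS-split as₁ as₂ ≤p >p bs (λ M T₁ T₂ → ι (allPairs M idealOK) * (weight as₁ T₁ * weight as₂ T₂)) ⟩
      FS marks₂ bs (λ M → FS as₁ (lows′ M) (λ T₁ → FS as₂ (highs′ M) (λ T₂ → ι (allPairs M idealOK) * (weight as₁ T₁ * weight as₂ T₂))))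
        ≈⟨ FS-cong′ marks₂ bs (λ M → trans (FS-cong′ as₁ (lows′ M) (λ T₁ → trans (FS-*ˡ as₂ (highs′ M) _ _) (*-congˡ (FS-*ˡ as₂ (highs′ M) _ _))))
             (trans (FS-*ˡ as₁ (lows′ M) _ _) (*-congˡ (trans (FS-cong′ as₁ (lows′ M) (λ T₁ → *-comm _ _)) (trans (FS-*ˡ as₁ (lows′ M) _ _) (*-comm _ _)))))) ⟩
      FS marks₂ bs (λ M → ι (allPairs M idealOK) * (G as₁ (lows′ M) * G as₂ (highs′ M))) ∎
      where
      split : ∀ T → weight (as₁ ++ as₂) T ≈ ι (allPairs (highs T) idealOK) * (weight as₁ (low T) * weight as₂ (high T))
      split T = begin
        ι (good T) * ∏ (as₁ ++ as₂) (λ ℓ → letterwt ℓ T)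
          ≈⟨ *-cong (trans (resp ι (goods T)) (trans (ι-∧ (allPairs (highs T) idealOK) _) (*-congˡ (ι-∧ (good (low T)) (good (high T))))))
               (trans (∏-++ as₁ as₂ _) (*-cong (prod as₁ ≤p (λ ℓ q → P.cong (λ l → stat (z ℓ) (map (index ℓ) l)) (filterB-low ℓ q T)))
                 (prod as₂ >p (λ ℓ q → P.cong (λ l → stat (z ℓ) (map (index ℓ) l)) (filterB-high ℓ q T))))) ⟩
        ι (allPairs (highs T) idealOK) * (ι (good (low T)) * ι (good (high T))) * (∏ as₁ (λ ℓ → letterwt ℓ (low T)) * ∏ as₂ (λ ℓ → letterwt ℓ (high T)))
          ≈⟨ solve 5 (λ a b c d e → a :* (b :* c) :* (d :* e) := a :* (b :* d :* (c :* e))) refl _ _ _ _ _ ⟩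
        ι (allPairs (highs T) idealOK) * (weight as₁ (low T) * weight as₂ (high T)) ∎
        where
        prod : ∀ {Q : ℕ → Set} as → All Q as → ∀ {f g : ℕ → Carrier} → (∀ ℓ → Q ℓ → f ℓ ≡ g ℓ) → ∏ as f ≈ ∏ as g
        prod [] [] h = refl
        prod (ℓ ∷ as) (q ∷ qs) h = *-cong (reflexive (h ℓ q)) (prod as qs h)
        goods : ∀ T → good T ≡ allPairs (highs T) idealOK ∧ good (low T) ∧ good (high T)
        goods T = P.trans (P.cong₂ _∧_ (allPairs-split T) (P.trans (P.cong (not P? ∨_) (all-split noUnprimedDiag T))
            (∨-distribˡ P? (all noUnprimedDiag (low T)) (all noUnprimedDiag (high T)))))
          (lemma (allPairs (highs T) idealOK) (allPairs (low T) ppPairOK) (allPairs (high T) ppPairOK)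
            (not P? ∨ all noUnprimedDiag (low T)) (not P? ∨ all noUnprimedDiag (high T)))
          where
          ∨-distribˡ : ∀ p a b → not p ∨ (a ∧ b) ≡ (not p ∨ a) ∧ (not p ∨ b)
          ∨-distribˡ false a b = P.refl
          ∨-distribˡ true a b = P.refl
          lemma : ∀ a b c d e → (a ∧ b ∧ c) ∧ (d ∧ e) ≡ a ∧ (b ∧ d) ∧ (c ∧ e)
          lemma false b c d e = P.refl
          lemma true false c d e = P.refl
          lemma true true false d e = P.sym (BP.∧-zeroʳ d)
          lemma true true true d e = P.refl

-- Strictness and positivity are built into the constructor: a part suc k leaves at most k for the
-- next one. This matches the shift by one column from a row to the next.
data Str : ℕ → List ℕ → Set where
  [] : ∀ {K} → Str K []
  _∷_ : ∀ {K k ks} → k < K → Str k ks → Str K (suc k ∷ ks)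

Str-mono : ∀ {K K′ ks} → K ≤ K′ → Str K ks → Str K′ ks
Str-mono le [] = []
Str-mono le (p ∷ s) = NP.≤-trans p le ∷ s

Str-parts : ∀ {n} (s : Vec Bool n) → Str n (parts s)
Str-parts [] = []
Str-parts (false ∷ s) = Str-mono (NP.n≤1+n _) (Str-parts s)
Str-parts (true ∷ s) = NP.≤-refl ∷ Str-parts s

sub : List ℕ → List ℕ → Bool
sub [] ks = true
sub (m ∷ ms) [] = false
sub (m ∷ ms) (k ∷ ks) = (m ≤ᵇ k) ∧ sub ms ks

segs : ℕ → List ℕ → List ℕ → List Box
segs i [] ms = []
segs i (l ∷ ls) [] = cells i i l ++ segs (suc i) ls []
segs i (l ∷ ls) (m ∷ ms) = cells i (i ℕ.+ m) (l ∸ m) ++ segs (suc i) ls ms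

segs-in : ∀ i {K ls} → Str K ls → ∀ ms → sub ms ls ≡ true → All (λ b → i ≤ fst b × fst b ≤ snd b × snd b < i ℕ.+ K) (segs i ls ms)
segs-in i [] ms e = []
segs-in i {K} {suc l ∷ ls} (p ∷ s) [] e = AllP.++⁺
  (All.map (λ { (P.refl , q , q′) → NP.≤-refl , q , NP.≤-trans q′ (NP.+-monoʳ-≤ i p) }) (cells-in i i (suc l)))
  (All.map (λ { (r , q , q′) → NP.≤-trans (NP.n≤1+n i) r , q , NP.≤-trans q′ (NP.≤-trans (NP.≤-reflexive (P.sym (NP.+-suc i l))) (NP.+-monoʳ-≤ i p)) }) (segs-in (suc i) s [] P.refl))
segs-in i {K} {suc l ∷ ls} (p ∷ s) (m ∷ ms) e with m ≤ᵇ suc l in f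
... | true = AllP.++⁺
  (All.map (λ { (P.refl , q , q′) → NP.≤-refl , NP.≤-trans (NP.m≤m+n i m) q , NP.≤-trans q′ (NP.≤-trans (NP.≤-reflexive (P.trans (NP.+-assoc i m _) (P.cong (i ℕ.+_) (NP.m+[n∸m]≡n (≤ᵇ⇒≤′ m (suc l) f))))) (NP.+-monoʳ-≤ i p)) }) (cells-in i (i ℕ.+ m) (suc l ∸ m)))
  (All.map (λ { (r , q , q′) → NP.≤-trans (NP.n≤1+n i) r , q , NP.≤-trans q′ (NP.≤-trans (NP.≤-reflexive (P.sym (NP.+-suc i l))) (NP.+-monoʳ-≤ i p)) }) (segs-in (suc i) s ms e))

sorted-cells : ∀ i c r bs → All (λ b → i < fst b) bs → Sorted bs → Sorted (cells i c r ++ bs)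
sorted-cells i c zero bs lower so = so
sorted-cells i c (suc r) bs lower so = AllP.++⁺ (All.map (λ { (e , p , q) → inj₂ (P.sym e , p) }) (cells-in i (suc c) r)) (All.map inj₁ lower)
  ∷ sorted-cells i (suc c) r bs lower so

segs-lower : ∀ i ls ms → All (λ b → i ≤ fst b) (segs i ls ms)
segs-lower i [] ms = []
segs-lower i (l ∷ ls) [] = AllP.++⁺ (All.map (λ { (P.refl , _) → NP.≤-refl }) (cells-in i i l)) (All.map (NP.≤-trans (NP.n≤1+n i)) (segs-lower (suc i) ls []))
segs-lower i (l ∷ ls) (m ∷ ms) = AllP.++⁺ (All.map (λ { (P.refl , _) → NP.≤-refl }) (cells-in i (i ℕ.+ m) (l ∸ m))) (All.map (NP.≤-trans (NP.n≤1+n i)) (segs-lower (suc i) ls ms))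

segs-sorted : ∀ i ls ms → Sorted (segs i ls ms)
segs-sorted i [] ms = []
segs-sorted i (l ∷ ls) [] = sorted-cells i i l _ (segs-lower (suc i) ls []) (segs-sorted (suc i) ls [])
segs-sorted i (l ∷ ls) (m ∷ ms) = sorted-cells i (i ℕ.+ m) (l ∸ m) _ (segs-lower (suc i) ls ms) (segs-sorted (suc i) ls ms)

rel-before : ∀ b b′ → After b b′ → rel b′ b ≡ false
rel-before (i , j) (i′ , j′) (inj₁ p) rewrite <⇒≢ᵇ p | <⇒≰ᵇ p = BP.∧-zeroʳ (j ≡ᵇ j′)
rel-before (i , j) (.i , j′) (inj₂ (P.refl , p)) rewrite <⇒≰ᵇ p | <⇒≢ᵇ p = P.trans (BP.∨-identityʳ _) (BP.∧-zeroʳ (i ≡ᵇ i))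

forcedB : (Box → Bool) → Box × Bool → Bool
forcedB mo (b , m) = not (mo b) ∨ m

module Ideals (R : CommutativeRing 0ℓ 0ℓ) where
  open RingKit R
  open Fillings R

  marks₂ : List Bool
  marks₂ = false ∷ true ∷ []

  -- The sum over all ways to cut the boxes into a low part and a high part, in reading order. `mo`
  -- holds the boxes forced to be high by earlier ones; the arguments of F are the two parts.
  SI : (Box → Bool) → List Box → (List Box → List Box → Carrier) → Carrier
  SI mo [] F = F [] []
  SI mo (b ∷ bs) F = ι (not (mo b)) * SI mo bs (λ k t → F (b ∷ k) t) + SI (mo ∪ rel b) bs (λ k t → F k (b ∷ t))

  FS-congᵇ : {A : Set} {Q : Box → Set} (as : List A) (bs : List Box) → All Q bs → ∀ {f g} →
    (∀ E → All (λ e → Q (fst e)) E → f E ≈ g E) → FS as bs f ≈ FS as bs g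
  FS-congᵇ as [] [] h = h [] []
  FS-congᵇ as (b ∷ bs) (q ∷ qs) h = ∑-cong as (λ a → FS-congᵇ as bs qs (λ E p → h ((b , a) ∷ E) (q ∷ p)))

  flatI : (Box → Bool) → List Box → (List Box → List Box → Carrier) → Carrier
  flatI mo bs F = FS marks₂ bs (λ M → ι (all (forcedB mo) M ∧ allPairs M idealOK) * F (lows′ M) (highs′ M))

  flatI≈SI : ∀ {bs} → Sorted bs → ∀ mo F → flatI mo bs F ≈ SI mo bs F
  flatI≈SI [] mo F = *-identityˡ _
  flatI≈SI {b ∷ bs} (after ∷ so) mo F = +-cong
      (trans (FS-congᵇ marks₂ bs after (λ M am → trans (*-congʳ (trans (resp ι (condF M am)) (ι-∧ (not (mo b)) _))) (*-assoc _ _ _)))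
        (trans (FS-*ˡ marks₂ bs _ _) (*-congˡ (flatI≈SI so mo _))))
      (trans (+-identityʳ _) (trans (FS-congᵇ marks₂ bs after (λ M am → *-congʳ (resp ι (condT M am)))) (flatI≈SI so (mo ∪ rel b) _)))
    where
    self : ∀ m → not (rel b b) ∨ (not m ∨ m) ≡ true
    self m = P.trans (P.cong (not (rel b b) ∨_) (BP.∨-inverseˡ m)) (BP.∨-zeroʳ _)
    later : ∀ m b′ m′ → After b b′ → idealOK (b , m) (b′ , m′) ∧ idealOK (b′ , m′) (b , m) ≡ not (rel b b′) ∨ (not m ∨ m′)
    later m b′ m′ a rewrite rel-before b b′ a = BP.∧-identityʳ _
    condF : ∀ M → All (λ e → After b (fst e)) M → all (forcedB mo) ((b , false) ∷ M) ∧ allPairs ((b , false) ∷ M) idealOK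
      ≡ not (mo b) ∧ (all (forcedB mo) M ∧ allPairs M idealOK)
    condF M am = P.trans (P.cong₂ (λ u v → (u ∧ all (forcedB mo) M) ∧ v) (BP.∨-identityʳ (not (mo b)))
        (P.trans (allPairs-∷ idealOK (b , false) M) (P.cong₂ (λ u v → u ∧ v ∧ allPairs M idealOK) (self false)
          (all-true _ M (All.map (λ {e} a → P.trans (later false (fst e) (snd e) a) (BP.∨-zeroʳ _)) am)))))
      (BP.∧-assoc (not (mo b)) (all (forcedB mo) M) (allPairs M idealOK))
    condT : ∀ M → All (λ e → After b (fst e)) M → all (forcedB mo) ((b , true) ∷ M) ∧ allPairs ((b , true) ∷ M) idealOK
      ≡ all (forcedB (mo ∪ rel b)) M ∧ allPairs M idealOK
    condT M am = P.trans (P.cong₂ (λ u v → (u ∧ all (forcedB mo) M) ∧ v) (BP.∨-zeroʳ (not (mo b)))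
        (P.trans (allPairs-∷ idealOK (b , true) M) (P.cong₂ (λ u v → u ∧ v ∧ allPairs M idealOK) (self true)
          (all-cong {q = forcedB (rel b)} M (All.map (λ {e} a → later true (fst e) (snd e) a) am)))))
      (P.trans (P.sym (BP.∧-assoc (all (forcedB mo) M) (all (forcedB (rel b)) M) (allPairs M idealOK)))
        (P.cong (_∧ allPairs M idealOK) (P.trans (P.sym (all-∧ (forcedB mo) (forcedB (rel b)) M))
          (all-cong M (All.map (λ {e} _ → both (mo (fst e)) (rel b (fst e)) (snd e)) am)))))
      where
      both : ∀ a c m → (not a ∨ m) ∧ (not c ∨ m) ≡ not (a ∨ c) ∨ m
      both false c m = P.refl
      both true false false = P.refl
      both true true false = P.refl
      both true false true = P.refl
      both true true true = P.refl

  flat≈SI : ∀ {bs} → Sorted bs → ∀ F → FS marks₂ bs (λ M → ι (allPairs M idealOK) * F (lows′ M) (highs′ M)) ≈ SI none bs F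
  flat≈SI {bs} so F = trans (FS-cong′ marks₂ bs (λ M → *-congʳ (resp (λ u → ι (u ∧ allPairs M idealOK))
    (P.sym (all-true (forcedB none) M (All.universal (λ _ → P.refl) M)))))) (flatI≈SI so none F)

  SI-cong : ∀ {mo mo′} bs → All (λ b → mo b ≡ mo′ b) bs → ∀ {F F′} → (∀ k t → F k t ≈ F′ k t) → SI mo bs F ≈ SI mo′ bs F′
  SI-cong [] [] h = h [] []
  SI-cong (b ∷ bs) (e ∷ es) h = +-cong (*-cong (resp (λ u → ι (not u)) e) (SI-cong bs es (λ k t → h (b ∷ k) t)))
    (SI-cong bs (All.map (λ {b′} p → P.cong (_∨ rel b b′) p) es) (λ k t → h k (b ∷ t)))

  SI-all : ∀ {mo} bs → All (λ b → mo b ≡ true) bs → ∀ F → SI mo bs F ≈ F [] bs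
  SI-all [] [] F = refl
  SI-all {mo} (b ∷ bs) (e ∷ es) F = trans (+-cong (trans (*-congʳ (resp (λ u → ι (not u)) e)) (zeroˡ _))
    (SI-all bs (All.map (λ {b′} p → P.cong (_∨ rel b b′) p) es) _)) (+-identityˡ _)

  SIθ : ℕ → List Box → (List Box → List Box → Carrier) → Carrier
  SIθ θ = SI (λ b → θ ≤ᵇ snd b)

  -- Once the row is cut in column θ₀ its remaining boxes are high, and so are all boxes below them.
  -- Since the row reaches at least as far as any later one, in the end the new threshold θ₀ absorbs
  -- the old one θ.
  tail-forced : ∀ r c i θ θ₀ → θ₀ ≤ c → θ₀ ≤ θ → ∀ mo rest F → (∀ k → c ≤ k → mo (i , k) ≡ true) →
    All (λ b → i < fst b × snd b < c ℕ.+ r) rest → All (λ b → mo b ≡ between θ₀ c (snd b) ∨ (θ ≤ᵇ snd b)) rest →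
    SI mo (cells i c r ++ rest) F ≈ SIθ θ₀ rest (λ k t → F k (cells i c r ++ t))
  tail-forced zero c i θ θ₀ le le′ mo rest F first lower st = SI-cong rest (All.map (λ { {b} ((_ , q) , e) → P.trans e
      (P.trans (P.cong (_∨ (θ ≤ᵇ snd b)) (between-all θ₀ c (snd b) (NP.≤-trans q (NP.≤-reflexive (NP.+-identityʳ c))))) (absorb (snd b))) }) (All.zip (lower , st))) (λ _ _ → refl)
    where
    absorb : ∀ k → (θ₀ ≤ᵇ k) ∨ (θ ≤ᵇ k) ≡ (θ₀ ≤ᵇ k)
    absorb k with θ₀ ≤ᵇ k in f
    ... | true = P.refl
    ... | false = <⇒≰ᵇ (NP.≤-trans (≰ᵇ⇒> θ₀ k f) le′)
  tail-forced (suc r) c i θ θ₀ le le′ mo rest F first lower st = trans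
    (+-cong (trans (*-congʳ (resp (λ u → ι (not u)) (first c NP.≤-refl))) (zeroˡ _))
      (tail-forced r (suc c) i θ θ₀ (NP.m≤n⇒m≤1+n le) le′ (mo ∪ rel (i , c)) rest _
        (λ k p → P.cong (_∨ rel (i , c) (i , k)) (first k (NP.≤-trans (NP.n≤1+n c) p)))
        (All.map (λ { (p , q) → p , NP.≤-trans q (NP.≤-reflexive (NP.+-suc c r)) }) lower)
        (All.map (λ { {b} ((p , _) , e) → upd b p e }) (All.zip (lower , st)))))
    (+-identityˡ _)
    where
    upd : ∀ b → i < fst b → mo b ≡ between θ₀ c (snd b) ∨ (θ ≤ᵇ snd b) →
      mo b ∨ rel (i , c) b ≡ between θ₀ (suc c) (snd b) ∨ (θ ≤ᵇ snd b)
    upd b p e rewrite e | >⇒≢ᵇ p | ≤⇒≤ᵇ≡ (NP.<⇒≤ p) | between-suc θ₀ c (snd b) le =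
      lemma (between θ₀ c (snd b)) (θ ≤ᵇ snd b) (snd b ≡ᵇ c)
      where
      lemma : ∀ x y z → (x ∨ y) ∨ (z ∧ true) ≡ (x ∨ z) ∨ y
      lemma true y z = P.refl
      lemma false false false = P.refl
      lemma false false true = P.refl
      lemma false true false = P.refl
      lemma false true true = P.refl

  row-first : ∀ r c i θ → c ≤ θ → ∀ rest F → All (λ b → i < fst b × snd b < c ℕ.+ suc r) rest →
    SIθ θ (cells i c (suc r) ++ rest) F ≈ ι (not (θ ≤ᵇ c)) * SIθ θ (cells i (suc c) r ++ rest) (λ k t → F ((i , c) ∷ k) t)
      + SIθ c rest (λ k t → F k (cells i c (suc r) ++ t))
  row-first r c i θ le rest F lower = +-congˡ (tail-forced r (suc c) i θ c (NP.n≤1+n c) le _ rest _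
      (λ k p → P.trans (P.cong₂ (λ u v → (θ ≤ᵇ k) ∨ (u ∧ v) ∨ ((k ≡ᵇ c) ∧ (i ≤ᵇ i))) (≡ᵇ-refl i) (≤⇒≤ᵇ≡ (NP.≤-trans (NP.n≤1+n c) p))) (BP.∨-zeroʳ _))
      (All.map (λ { (p , q) → p , NP.≤-trans q (NP.≤-reflexive (NP.+-suc c r)) }) lower)
      (All.map (λ { {b} (p , _) → upd b p }) lower))
    where
    upd : ∀ b → i < fst b → (θ ≤ᵇ snd b) ∨ rel (i , c) b ≡ between c (suc c) (snd b) ∨ (θ ≤ᵇ snd b)
    upd b p rewrite >⇒≢ᵇ p | ≤⇒≤ᵇ≡ (NP.<⇒≤ p) | between-suc c c (snd b) NP.≤-refl | between-empty c (snd b) =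
      P.trans (P.cong ((θ ≤ᵇ snd b) ∨_) (BP.∧-identityʳ _)) (BP.∨-comm (θ ≤ᵇ snd b) (snd b ≡ᵇ c))

  ΣP : ℕ → (List ℕ → Carrier) → Carrier
  ΣP K f = Σᵇ K (λ s → f (parts s))

  -- Strict partitions sorted by their largest part suc k, whose other parts are at most k.
  ascend : ℕ → ℕ → (ℕ → List ℕ → Carrier) → Carrier
  ascend k zero h = 0#
  ascend k (suc r) h = ΣP k (h k) + ascend (suc k) r h

  ascend-last : ∀ k r h → ascend k (suc r) h ≈ ascend k r h + ΣP (k ℕ.+ r) (h (k ℕ.+ r))
  ascend-last k zero h rewrite NP.+-identityʳ k = +-comm _ _
  ascend-last k (suc r) h rewrite NP.+-suc k r = trans (+-congˡ (ascend-last (suc k) r h)) (sym (+-assoc _ _ _))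

  ΣP-ascend : ∀ K f → ΣP K f ≈ f [] + ascend 0 K (λ k t → f (suc k ∷ t))
  ΣP-ascend zero f = sym (+-identityʳ _)
  ΣP-ascend (suc K) f = trans (+-congʳ (ΣP-ascend K f)) (trans (+-assoc _ _ _) (+-congˡ (sym (ascend-last 0 K _))))

  ΣP-cong : ∀ K {f g} → (∀ t → Str K t → f t ≈ g t) → ΣP K f ≈ ΣP K g
  ΣP-cong K h = Σᵇ-cong K (λ s → h (parts s) (Str-parts s))

  ascend-cong : ∀ k r {h h′} → (∀ j t → k ≤ j → Str j t → h j t ≈ h′ j t) → ascend k r h ≈ ascend k r h′
  ascend-cong k zero e = refl
  ascend-cong k (suc r) e = +-cong (ΣP-cong k (λ t s → e k t NP.≤-refl s)) (ascend-cong (suc k) r (λ j t p s → e j t (NP.≤-trans (NP.n≤1+n k) p) s))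

  ascend-zero : ∀ k r {h} → (∀ j t → k ≤ j → j < k ℕ.+ r → h j t ≈ 0#) → ascend k r h ≈ 0#
  ascend-zero k zero e = refl
  ascend-zero k (suc r) e = trans (+-cong (Σᵇ-zero k (λ s → e k _ NP.≤-refl (NP.m<m+n k (s≤s z≤n))))
    (ascend-zero (suc k) r (λ j t p q → e j t (NP.≤-trans (NP.n≤1+n k) p) (NP.≤-trans q (NP.≤-reflexive (P.sym (NP.+-suc k r))))))) (+-identityˡ _)

  ascend-+ : ∀ k r r′ h → ascend k (r ℕ.+ r′) h ≈ ascend k r h + ascend (k ℕ.+ r) r′ h
  ascend-+ k zero r′ h rewrite NP.+-identityʳ k = sym (+-identityˡ _)
  ascend-+ k (suc r) r′ h rewrite NP.+-suc k r = trans (+-congˡ (ascend-+ (suc k) r r′ h)) (sym (+-assoc _ _ _))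

  chainF : ℕ → List ℕ → List ℕ → (List Box → List Box → Carrier) → List ℕ → Carrier
  chainF i ls ms F t = ι (sub ms t ∧ sub t ls) * F (segs i t ms) (segs i ls t)

  -- A cut is determined by the number of low boxes in each row. If row i keeps suc k columns low,
  -- counted from the diagonal, all columns from i + suc k on are high further down. As row i + 1
  -- starts one column later, at most k of its columns can be low: this is the strictness of the
  -- intermediate partition.
  IS : ∀ {K N M} i {ls ms} → Str N ls → Str M ms → sub ms ls ≡ true → M ≤ K → ∀ F →
    SIθ (i ℕ.+ K) (segs i ls ms) F ≈ ΣP K (chainF i ls ms F)

  module Row (i l : ℕ) {ls ms : List ℕ} {M : ℕ} (sl : Str l ls) (sm : Str M ms) (ok : sub ms ls ≡ true) (K : ℕ) where
    rest : List Box
    rest = segs (suc i) ls ms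

    rest-in : All (λ b → i < fst b × snd b < i ℕ.+ suc l) rest
    rest-in = All.map (λ { (p , _ , q) → p , NP.≤-trans q (NP.≤-reflexive (P.sym (NP.+-suc i l))) }) (segs-in (suc i) sl ms ok)

    h : ℕ → (List Box → List Box → Carrier) → ℕ → List ℕ → Carrier
    h k F k′ t = ι (suc k′ ≤ᵇ suc l) * (ι (sub ms t ∧ sub t ls) * F (cells i (i ℕ.+ suc k) (k′ ∸ k) ++ segs (suc i) t ms)
      (cells i (i ℕ.+ suc k′) (l ∸ k′) ++ segs (suc i) ls t))

    here-term : ∀ k r → k ℕ.+ r ≡ l → M ≤ k → ∀ F → SIθ (i ℕ.+ suc k) rest (λ u t → F u (cells i (i ℕ.+ suc k) r ++ t)) ≈ ΣP k (h k F k)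
    here-term k r e M≤k F = begin
      SIθ (i ℕ.+ suc k) rest (λ u t → F u (cells i (i ℕ.+ suc k) r ++ t)) ≡⟨ P.cong (λ θ → SIθ θ rest (λ u t → F u (cells i (i ℕ.+ suc k) r ++ t))) (NP.+-suc i k) ⟩
      SIθ (suc i ℕ.+ k) rest (λ u t → F u (cells i (i ℕ.+ suc k) r ++ t)) ≈⟨ IS (suc i) sl sm ok M≤k _ ⟩
      ΣP k (chainF (suc i) ls ms (λ u t → F u (cells i (i ℕ.+ suc k) r ++ t))) ≈⟨ Σᵇ-cong k (λ s → trans (sym (*-identityˡ _)) (*-cong (resp ι (P.sym (≤⇒≤ᵇ≡ (s≤s k≤l))))
          (*-congˡ (reflexive (P.cong₂ (λ a b → F (cells i (i ℕ.+ suc k) a ++ segs (suc i) (parts s) ms) (cells i (i ℕ.+ suc k) b ++ segs (suc i) ls (parts s))) (P.sym (NP.n∸n≡0 k)) r≡))))) ⟩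
      ΣP k (h k F k) ∎
      where
      k≤l : k ≤ l
      k≤l = P.subst (k ≤_) e (NP.m≤m+n k r)
      r≡ : r ≡ l ∸ k
      r≡ = P.trans (P.sym (NP.m+n∸m≡n k r)) (P.cong (_∸ k) e)

    row-sum : ∀ r k → k ℕ.+ r ≡ l → k < K → M ≤ k → ∀ F →
      SIθ (i ℕ.+ K) (cells i (i ℕ.+ suc k) r ++ rest) F ≈ ascend k (K ∸ k) (h k F)
    row-sum zero k e k<K M≤k F = begin
      SIθ (i ℕ.+ K) rest F ≈⟨ SI-cong rest (All.map (λ { {b} (_ , q) → P.trans (<⇒≰ᵇ (NP.≤-trans q (NP.≤-trans (NP.≤-reflexive (P.cong (λ z → i ℕ.+ suc z) (P.sym k≡l))) (NP.+-monoʳ-≤ i k<K))))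
          (P.sym (<⇒≰ᵇ (NP.≤-trans q (NP.≤-reflexive (P.cong (λ z → i ℕ.+ suc z) (P.sym k≡l)))))) }) rest-in) (λ _ _ → refl) ⟩
      SIθ (i ℕ.+ suc k) rest F ≈⟨ here-term k 0 e M≤k F ⟩
      ΣP k (h k F k) ≈⟨ sym (+-identityʳ _) ⟩
      ΣP k (h k F k) + 0# ≈⟨ +-congˡ (sym (ascend-zero (suc k) (K ∸ suc k) (λ j t q _ →
          trans (*-congʳ (resp ι (<⇒≰ᵇ (s≤s (NP.≤-trans (s≤s (NP.≤-reflexive (P.sym k≡l))) q))))) (zeroˡ _)))) ⟩
      ascend k (suc (K ∸ suc k)) (h k F) ≡⟨ P.cong (λ n → ascend k n (h k F)) (P.sym (NP.+-∸-assoc 1 k<K)) ⟩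
      ascend k (K ∸ k) (h k F) ∎
      where
      k≡l : k ≡ l
      k≡l = P.trans (P.sym (NP.+-identityʳ k)) e
    row-sum (suc r) k e k<K M≤k F = begin
      SIθ (i ℕ.+ K) (cells i (i ℕ.+ suc k) (suc r) ++ rest) F
        ≈⟨ row-first r (i ℕ.+ suc k) i (i ℕ.+ K) (NP.+-monoʳ-≤ i k<K) rest F
             (All.map (λ { (p , q) → p , NP.≤-trans q (NP.≤-reflexive (P.trans (P.cong (λ z → i ℕ.+ suc z) (P.sym e)) (P.sym (NP.+-assoc i (suc k) (suc r))))) }) rest-in) ⟩
      ι (not (i ℕ.+ K ≤ᵇ i ℕ.+ suc k)) * SIθ (i ℕ.+ K) (cells i (suc (i ℕ.+ suc k)) r ++ rest) F′ + SIθ (i ℕ.+ suc k) rest (λ u t → F u (cells i (i ℕ.+ suc k) (suc r) ++ t))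
        ≈⟨ +-cong next (here-term k (suc r) e M≤k F) ⟩
      ascend (suc k) (K ∸ suc k) (h k F) + ΣP k (h k F k) ≈⟨ +-comm _ _ ⟩
      ascend k (suc (K ∸ suc k)) (h k F) ≡⟨ P.cong (λ n → ascend k n (h k F)) (P.sym (NP.+-∸-assoc 1 k<K)) ⟩
      ascend k (K ∸ k) (h k F) ∎
      where
      F′ : List Box → List Box → Carrier
      F′ u t = F ((i , i ℕ.+ suc k) ∷ u) t
      next : ι (not (i ℕ.+ K ≤ᵇ i ℕ.+ suc k)) * SIθ (i ℕ.+ K) (cells i (suc (i ℕ.+ suc k)) r ++ rest) F′ ≈ ascend (suc k) (K ∸ suc k) (h k F)
      -- If suc k reaches K, the next box is forced high by the threshold, and the remaining range
      -- of largest parts is empty as well.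
      next with suc k NP.<? K
      ... | no ¬p = trans (*-congʳ (resp (λ u → ι (not u)) (≤⇒≤ᵇ≡ (NP.+-monoʳ-≤ i (NP.≮⇒≥ ¬p))))) (trans (zeroˡ _)
          (resp (λ n → ascend (suc k) n (h k F)) (P.sym (NP.m≤n⇒m∸n≡0 (NP.≮⇒≥ ¬p)))))
      ... | yes p = begin
        ι (not (i ℕ.+ K ≤ᵇ i ℕ.+ suc k)) * SIθ (i ℕ.+ K) (cells i (suc (i ℕ.+ suc k)) r ++ rest) F′
          ≈⟨ trans (*-congʳ (resp (λ u → ι (not u)) (<⇒≰ᵇ (NP.+-monoʳ-< i p)))) (*-identityˡ _) ⟩
        SIθ (i ℕ.+ K) (cells i (suc (i ℕ.+ suc k)) r ++ rest) F′ ≡⟨ P.cong (λ c → SIθ (i ℕ.+ K) (cells i c r ++ rest) F′) (P.sym (NP.+-suc i (suc k))) ⟩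
        SIθ (i ℕ.+ K) (cells i (i ℕ.+ suc (suc k)) r ++ rest) F′ ≈⟨ row-sum r (suc k) (P.trans (P.sym (NP.+-suc k r)) e) p (NP.m≤n⇒m≤1+n M≤k) F′ ⟩
        ascend (suc k) (K ∸ suc k) (h (suc k) F′) ≈⟨ ascend-cong (suc k) (K ∸ suc k) (λ j t q _ → *-congˡ (*-congˡ (resp (λ u → F (u ++ segs (suc i) t ms) _)
            (P.trans (P.cong (λ c → (i , i ℕ.+ suc k) ∷ cells i c (j ∸ suc k)) (NP.+-suc i (suc k))) (P.cong (cells i (i ℕ.+ suc k)) (P.sym (NP.+-∸-assoc 1 q))))))) ⟩
        ascend (suc k) (K ∸ suc k) (h k F) ∎

  IS {K} i [] [] ok M≤K F = begin
    F [] [] ≈⟨ solve 1 (λ a → a := :1 :* a :+ :0) refl _ ⟩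
    1# * F [] [] + 0# ≈⟨ +-congˡ (sym (ascend-zero 0 K (λ j t _ _ → zeroˡ _))) ⟩
    1# * F [] [] + ascend 0 K (λ k t → chainF i [] [] F (suc k ∷ t)) ≈⟨ sym (ΣP-ascend K (chainF i [] [] F)) ⟩
    ΣP K (chainF i [] [] F) ∎
  IS {K} i {suc l ∷ ls} {[]} (p ∷ sl) [] ok M≤K F = begin
    SIθ (i ℕ.+ K) (cells i i (suc l) ++ rest) F
      ≈⟨ row-first l i i (i ℕ.+ K) (NP.m≤m+n i K) rest F rest-in ⟩
    ι (not (i ℕ.+ K ≤ᵇ i)) * SIθ (i ℕ.+ K) (cells i (suc i) l ++ rest) F′ + SIθ i rest (λ u t → F u (cells i i (suc l) ++ t))
      -- The second summand has its diagonal box high; everything below is then high, and the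
      -- intermediate partition is empty.
      ≈⟨ +-cong (rows-k K) (SI-all rest (All.map (λ { (q , q′ , _) → ≤⇒≤ᵇ≡ (NP.≤-trans (NP.≤-trans (NP.n≤1+n i) q) q′) }) (segs-in (suc i) sl [] P.refl)) _) ⟩
    ascend 0 K (λ k t → chainF i (suc l ∷ ls) [] F (suc k ∷ t)) + F [] (cells i i (suc l) ++ rest)
      ≈⟨ trans (+-comm _ _) (+-congʳ (sym (*-identityˡ _))) ⟩
    chainF i (suc l ∷ ls) [] F [] + ascend 0 K (λ k t → chainF i (suc l ∷ ls) [] F (suc k ∷ t)) ≈⟨ sym (ΣP-ascend K (chainF i (suc l ∷ ls) [] F)) ⟩
    ΣP K (chainF i (suc l ∷ ls) [] F) ∎
    where
    open Row i l {M = 0} sl [] P.refl K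
    F′ : List Box → List Box → Carrier
    F′ u t = F ((i , i) ∷ u) t
    rows-k : ∀ K → ι (not (i ℕ.+ K ≤ᵇ i)) * SIθ (i ℕ.+ K) (cells i (suc i) l ++ rest) F′ ≈ ascend 0 K (λ k t → chainF i (suc l ∷ ls) [] F (suc k ∷ t))
    rows-k zero rewrite NP.+-identityʳ i | ≤⇒≤ᵇ≡ (NP.≤-refl {i}) = zeroˡ _
    rows-k (suc K) = begin
      ι (not (i ℕ.+ suc K ≤ᵇ i)) * SIθ (i ℕ.+ suc K) (cells i (suc i) l ++ rest) F′
        ≈⟨ trans (*-congʳ (resp (λ u → ι (not u)) (<⇒≰ᵇ (NP.m<m+n i (s≤s z≤n))))) (*-identityˡ _) ⟩
      SIθ (i ℕ.+ suc K) (cells i (suc i) l ++ rest) F′ ≡⟨ P.cong (λ c → SIθ (i ℕ.+ suc K) (cells i c l ++ rest) F′) (P.trans (P.cong suc (P.sym (NP.+-identityʳ i))) (P.sym (NP.+-suc i 0))) ⟩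
      SIθ (i ℕ.+ suc K) (cells i (i ℕ.+ 1) l ++ rest) F′ ≈⟨ Row.row-sum i l {M = 0} sl [] P.refl (suc K) l 0 P.refl (s≤s z≤n) z≤n F′ ⟩
      ascend 0 (suc K) (h 0 F′) ≈⟨ ascend-cong 0 (suc K) (λ j t q _ → trans (sym (*-assoc _ _ _)) (*-cong (sym (ι-∧ (suc j ≤ᵇ suc l) (sub t ls)))
          (resp (λ c → F ((i , i) ∷ cells i c j ++ segs (suc i) t []) (cells i (i ℕ.+ suc j) (l ∸ j) ++ segs (suc i) ls t)) (P.trans (NP.+-suc i 0) (P.cong suc (NP.+-identityʳ i)))))) ⟩
      ascend 0 (suc K) (λ k t → chainF i (suc l ∷ ls) [] F (suc k ∷ t)) ∎
  IS {K} i {suc l ∷ ls} {suc m ∷ ms} (p ∷ sl) (q ∷ sm) ok M≤K F with suc m ≤ᵇ suc l in f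
  ... | true = begin
    SIθ (i ℕ.+ K) (cells i (i ℕ.+ suc m) (l ∸ m) ++ rest) F
      ≈⟨ row-sum (l ∸ m) m (NP.m+[n∸m]≡n (NP.≤-pred (≤ᵇ⇒≤′ (suc m) (suc l) f))) (NP.≤-trans q M≤K) NP.≤-refl F ⟩
    ascend m (K ∸ m) (h m F) ≈⟨ ascend-cong m (K ∸ m) (λ j t m≤j _ → term j t m≤j) ⟩
    ascend m (K ∸ m) H ≈⟨ solve 1 (λ a → a := :0 :+ (:0 :+ a)) refl _ ⟩
    0# + (0# + ascend m (K ∸ m) H)
      -- The range of largest parts is completed downwards by terms that vanish because they do not
      -- contain the first part of the inner partition.
      ≈⟨ +-cong (sym (zeroˡ _)) (+-congʳ (sym (ascend-zero 0 m (λ j t _ j<m → trans (*-congʳ (resp (λ u → ι ((u ∧ sub ms t) ∧ sub (suc j ∷ t) (suc l ∷ ls))) (<⇒≰ᵇ (s≤s j<m)))) (zeroˡ _))))) ⟩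
    chainF i (suc l ∷ ls) (suc m ∷ ms) F [] + (ascend 0 m H + ascend m (K ∸ m) H) ≈⟨ +-congˡ (sym (ascend-+ 0 m (K ∸ m) H)) ⟩
    chainF i (suc l ∷ ls) (suc m ∷ ms) F [] + ascend 0 (m ℕ.+ (K ∸ m)) H
      ≡⟨ P.cong (λ n → chainF i (suc l ∷ ls) (suc m ∷ ms) F [] + ascend 0 n H) (NP.m+[n∸m]≡n (NP.<⇒≤ (NP.≤-trans q M≤K))) ⟩
    chainF i (suc l ∷ ls) (suc m ∷ ms) F [] + ascend 0 K H ≈⟨ sym (ΣP-ascend K (chainF i (suc l ∷ ls) (suc m ∷ ms) F)) ⟩
    ΣP K (chainF i (suc l ∷ ls) (suc m ∷ ms) F) ∎
    where
    open Row i l {M = m} sl sm ok K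
    H : ℕ → List ℕ → Carrier
    H k t = chainF i (suc l ∷ ls) (suc m ∷ ms) F (suc k ∷ t)
    term : ∀ j t → m ≤ j → h m F j t ≈ H j t
    term j t m≤j = trans (sym (*-assoc _ _ _)) (*-congʳ (trans (sym (ι-∧ (suc j ≤ᵇ suc l) (sub ms t ∧ sub t ls)))
      (resp ι (P.trans (lemma (suc j ≤ᵇ suc l) (sub ms t) (sub t ls)) (P.cong (λ u → (u ∧ sub ms t) ∧ (suc j ≤ᵇ suc l) ∧ sub t ls) (P.sym (≤⇒≤ᵇ≡ (s≤s m≤j))))))))
      where
      lemma : ∀ a b c → a ∧ (b ∧ c) ≡ b ∧ (a ∧ c)
      lemma false false c = P.refl
      lemma false true c = P.refl
      lemma true b c = P.refl

  ideal-sum : ∀ {K N} {ls ms} → Str K ls → Str N ms → sub ms ls ≡ true → N ≤ K → ∀ F →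
    FS marks₂ (segs 1 ls ms) (λ M → ι (allPairs M idealOK) * F (lows′ M) (highs′ M)) ≈ ΣP K (chainF 1 ls ms F)
  ideal-sum {K} {ls = ls} {ms} sl sm ok le F = trans (flat≈SI (segs-sorted 1 ls ms) F)
    (trans (SI-cong _ (All.map (λ { (_ , _ , q) → P.sym (<⇒≰ᵇ q) }) (segs-in 1 sl ms ok)) (λ _ _ → refl)) (IS 1 sl sm ok le F))

-- The weight of a single letter on a skew shape

length-snoc : ∀ {A : Set} (P : List A) x → length (P ++ x ∷ []) ≡ suc (length P)
length-snoc P x = P.trans (LP.length-++ P) (NP.+-comm _ 1)

not-mem : ∀ x xs → All (λ y → (x ≡ᵇ y) ≡ false) xs → memN x xs ≡ false
not-mem x [] [] = P.refl
not-mem x (y ∷ xs) (e ∷ es) rewrite e = not-mem x xs es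

mem-++ : ∀ x xs ys → memN x (xs ++ ys) ≡ memN x xs ∨ memN x ys
mem-++ x [] ys = P.refl
mem-++ x (z ∷ xs) ys = P.trans (P.cong ((x ≡ᵇ z) ∨_) (mem-++ x xs ys)) (P.sym (BP.∨-assoc (x ≡ᵇ z) _ _))

first : List ℕ → ℕ
first [] = 0
first (l ∷ _) = l

first-Str : ∀ {K ls} → Str K ls → first ls ≤ K
first-Str [] = z≤n
first-Str (p ∷ _) = p

-- Open parts in the order in which they will be closed; all of them exceed the levels still to be
-- read.
data Desc (n : ℕ) : List ℕ → Set where
  [] : Desc n []
  single : ∀ {l} → n < l → Desc n (l ∷ [])
  _∷_ : ∀ {l l′ ls} → l′ < l → Desc n (l′ ∷ ls) → Desc n (l ∷ l′ ∷ ls)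

Desc-pred : ∀ {n ls} → Desc (suc n) ls → Desc n ls
Desc-pred [] = []
Desc-pred (single p) = single (NP.<-trans (NP.n<1+n _) p)
Desc-pred (p ∷ d) = p ∷ Desc-pred d

Desc-snoc : ∀ {n ls} → Desc (suc n) ls → Desc n (ls ++ suc n ∷ [])
Desc-snoc [] = single NP.≤-refl
Desc-snoc (single p) = p ∷ single NP.≤-refl
Desc-snoc (p ∷ d) = p ∷ Desc-snoc d

Desc-head : ∀ {n l ls} → Desc n (l ∷ ls) → n < l
Desc-head (single p) = p
Desc-head (p ∷ d) = NP.<-trans (Desc-head d) p

Desc-tail : ∀ {n l ls} → Desc n (l ∷ ls) → Desc n ls
Desc-tail (single p) = []
Desc-tail (p ∷ d) = d

∸-suc : ∀ {m l} → m < l → l ∸ m ≡ suc (l ∸ suc m)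
∸-suc {m} {l} p = NP.+-∸-assoc 1 p

mem-cells : ∀ i c r k → c ≤ k → k < c ℕ.+ r → memN k (map snd (cells i c r)) ≡ true
mem-cells i c zero k p q = ⊥-elim (NP.<⇒≱ q (P.subst (_≤ k) (P.sym (NP.+-identityʳ c)) p))
mem-cells i c (suc r) k p q with k ≡ᵇ c in e
... | true = P.refl
... | false = mem-cells i (suc c) r k (NP.≤∧≢⇒< p (λ { P.refl → BP.not-¬ {true} P.refl (P.trans (P.sym (≡ᵇ-refl k)) e) })) (P.subst (k <_) (NP.+-suc c r) q)

-- In columns to the right of the inner shape the top row alone decides: rows further down do not
-- reach beyond it.
mem-segs : ∀ i {K M ls ms} → Str K ls → Str M ms → sub ms ls ≡ true → ∀ k → suc i ℕ.+ first ms ≤ k →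
  memN k (map snd (segs (suc i) ls ms)) ≡ (k ≤ᵇ i ℕ.+ first ls)
mem-segs i [] [] ok k p = P.sym (<⇒≰ᵇ p)
mem-segs i {ls = suc l ∷ ls} {ms} (q ∷ sl) sm ok k p with k ≤ᵇ i ℕ.+ suc l in e
... | false = not-mem k (map snd (segs (suc i) (suc l ∷ ls) ms)) (AllP.map⁺ (All.map (λ { (_ , _ , u) → >⇒≢ᵇ (NP.<-≤-trans u (≰ᵇ⇒> k (i ℕ.+ suc l) e)) }) (segs-in (suc i) (NP.≤-refl ∷ sl) ms ok)))
... | true = inside sm ok p
  where
  inside : ∀ {M ms} → Str M ms → sub ms (suc l ∷ ls) ≡ true → suc i ℕ.+ first ms ≤ k → memN k (map snd (segs (suc i) (suc l ∷ ls) ms)) ≡ true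
  inside [] ok p = P.trans (P.cong (memN k) (LP.map-++ snd (cells (suc i) (suc i) (suc l)) _)) (P.trans (mem-++ k (map snd (cells (suc i) (suc i) (suc l))) _)
    (P.cong (_∨ memN k (map snd (segs (suc (suc i)) ls []))) (mem-cells (suc i) (suc i) (suc l) k (P.subst (_≤ k) (NP.+-identityʳ (suc i)) p) (s≤s (≤ᵇ⇒≤′ k (i ℕ.+ suc l) e)))))
  inside {ms = suc m ∷ ms} (_ ∷ sm) ok p with suc m ≤ᵇ suc l in f
  ... | true = P.trans (P.cong (memN k) (LP.map-++ snd (cells (suc i) (suc i ℕ.+ suc m) (l ∸ m)) _)) (P.trans (mem-++ k (map snd (cells (suc i) (suc i ℕ.+ suc m) (l ∸ m))) _)
    (P.cong (_∨ memN k (map snd (segs (suc (suc i)) ls ms))) (mem-cells (suc i) (suc i ℕ.+ suc m) (l ∸ m) k p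
      (P.subst (k <_) (P.sym (P.trans (NP.+-assoc (suc i) (suc m) _) (P.cong (suc i ℕ.+_) (NP.m+[n∸m]≡n (≤ᵇ⇒≤′ (suc m) (suc l) f))))) (s≤s (≤ᵇ⇒≤′ k (i ℕ.+ suc l) e))))))

offDiag : Box → Bool
offDiag (i , j) = not (i ≡ᵇ j)

offDiag-cells : ∀ i c r rest → i < c → all offDiag (cells i c r ++ rest) ≡ all offDiag rest
offDiag-cells i c zero rest p = P.refl
offDiag-cells i c (suc r) rest p rewrite <⇒≢ᵇ p = offDiag-cells i (suc c) r rest (NP.m≤n⇒m≤1+n p)

module OneLetter (R : CommutativeRing 0ℓ 0ℓ) (β : CommutativeRing.Carrier R) (P? : Bool) (z : ℕ → CommutativeRing.Carrier R) (y : CommutativeRing.Carrier R) where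
  open RingKit R
  open Pieri R β
  open PlaneFillings R γ (not P?) z
  open One y

  rowW : List ℕ → List ℕ → Carrier
  rowW [] [] = 1#
  rowW [] (m ∷ ms) = 0#
  rowW (l ∷ ls) [] = edge l * rowW ls []
  rowW (l ∷ ls) (m ∷ ms) = ι (m ≤ᵇ l) * (edge (l ∸ m) * rowW ls ms)

  stat-row : ∀ i c r rest → All (λ b → i < fst b) rest → stat y (map fst (cells i c r ++ rest)) ≈ edge r * stat y (map fst rest)
  stat-row i c zero rest lo = sym (*-identityˡ _)
  stat-row i c (suc zero) rest lo = trans (stat-∷ y i (map fst rest))
    (trans (*-congʳ (resp (if_then γ else y) (not-mem i (map fst rest) (AllP.map⁺ (All.map <⇒≢ᵇ lo)))))
      (solve 2 (λ y a → y :* a := y :* :1 :* a) refl _ _))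
  stat-row i c (suc (suc r)) rest lo = trans (stat-∷ y i (map fst (cells i (suc c) (suc r) ++ rest)))
    (trans (*-cong (resp (λ b → if b ∨ memN i (map fst (cells i (suc (suc c)) r ++ rest)) then γ else y) (≡ᵇ-refl i)) (stat-row i (suc c) (suc r) rest lo))
      (solve 4 (λ g y p s → g :* (y :* p :* s) := y :* (g :* p) :* s) refl _ _ _ _))

  rowW-stat : ∀ i ls ms → ι (sub ms ls) * stat y (map fst (segs i ls ms)) ≈ rowW ls ms
  rowW-stat i [] [] = trans (*-identityˡ _) (*-identityˡ _)
  rowW-stat i [] (m ∷ ms) = zeroˡ _
  rowW-stat i (l ∷ ls) [] = trans (*-identityˡ _) (trans (stat-row i i l (segs (suc i) ls []) (segs-lower (suc i) ls []))
    (*-congˡ (trans (sym (*-identityˡ _)) (rowW-stat (suc i) ls []))))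
  rowW-stat i (l ∷ ls) (m ∷ ms) = trans (*-cong (ι-∧ (m ≤ᵇ l) (sub ms ls)) (stat-row i (i ℕ.+ m) (l ∸ m) (segs (suc i) ls ms) (segs-lower (suc i) ls ms)))
    (trans (solve 4 (λ a b c d → a :* b :* (c :* d) := a :* (c :* (b :* d))) refl _ _ _ _) (*-congˡ (*-congˡ (rowW-stat (suc i) ls ms))))

  -- The factors γ that the open rows have already paid at the levels above n. Such a row of length
  -- l has passed l - suc n of them.
  pend : ℕ → List ℕ → Carrier
  pend n P = ∏ P (λ l → pw γ (l ∸ suc n))

  pend-pred : ∀ n P → Desc (suc n) P → pend n P ≈ pw γ (length P) * pend (suc n) P
  pend-pred n [] d = sym (*-identityˡ _)
  pend-pred n (l ∷ P) d = trans (*-cong (resp (pw γ) (∸-suc (Desc-head d))) (pend-pred n P (Desc-tail d)))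
    (solve 4 (λ g p q r → g :* p :* (q :* r) := g :* q :* (p :* r)) refl _ _ _ _)

  pend-snoc : ∀ n P → Desc (suc n) P → pend n (P ++ suc n ∷ []) ≈ pw γ (length P) * pend (suc n) P
  pend-snoc n P d = trans (∏-++ P (suc n ∷ []) _) (trans (*-cong (pend-pred n P d) (trans (*-identityʳ _) (resp (pw γ) (NP.n∸n≡0 n)))) (*-identityʳ _))

  parts-low : ∀ {n} (s : Vec Bool n) ms → rowW (parts s) (suc n ∷ ms) ≈ 0#
  parts-low s ms with parts s | Str-parts s
  ... | [] | _ = refl
  ... | l ∷ ls | p ∷ _ = trans (*-congʳ (resp ι (<⇒≰ᵇ (s≤s p)))) (zeroˡ _)

  -- `rowW` compares parts row by row, `Row` level by level. The list P of open rows carries the row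
  -- description along the word, and `pend` accounts for what `Row` has charged before.
  row-automaton : ∀ {n} P → Desc n P → (s t : Vec Bool n) → rowW (P ++ parts s) (parts t) ≈ pend n P * Row (length P) s t
  row-automaton P d [] [] = trans (resp (λ l → rowW l []) (LP.++-identityʳ P)) (go P d)
    where
    go : ∀ P → Desc 0 P → rowW P [] ≈ pend 0 P * pw y (length P)
    go [] d = sym (*-identityˡ _)
    go (l ∷ P) d = trans (*-cong (resp edge (∸-suc (Desc-head d))) (go P (Desc-tail d)))
      (solve 4 (λ y p q r → y :* p :* (q :* r) := p :* q :* (y :* r)) refl _ _ _ _)
  row-automaton {suc n} P d (false ∷ s) (false ∷ t) = trans (row-automaton P (Desc-pred d) s t) (trans (*-congʳ (pend-pred n P d))
    (solve 3 (λ a b c → a :* b :* c := b :* (a :* c)) refl _ _ _))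
  row-automaton {suc n} P d (true ∷ s) (false ∷ t) = trans (resp (λ l → rowW l (parts t)) (P.sym (LP.++-assoc P (suc n ∷ []) (parts s))))
    (trans (row-automaton (P ++ suc n ∷ []) (Desc-snoc d) s t) (trans (*-cong (pend-snoc n P d) (resp (λ j → Row j s t) (length-snoc P (suc n))))
    (solve 3 (λ a b c → a :* b :* c := b :* (a :* c)) refl _ _ _)))
  row-automaton {suc n} [] d (true ∷ s) (true ∷ t) = trans (*-cong (resp ι (≤⇒≤ᵇ≡ (NP.≤-refl {suc n}))) (*-cong (resp edge (NP.n∸n≡0 n)) (row-automaton [] [] s t)))
    (solve 1 (λ a → :1 :* (:1 :* (:1 :* a)) := :1 :* (:1 :* a)) refl _)
  row-automaton {suc n} (l ∷ P) d (true ∷ s) (true ∷ t) = trans (*-cong (resp ι (≤⇒≤ᵇ≡ (NP.<⇒≤ (Desc-head d)))) (*-cong (resp edge (∸-suc (Desc-head d)))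
      (trans (resp (λ l → rowW l (parts t)) (P.sym (LP.++-assoc P (suc n ∷ []) (parts s))))
        (trans (row-automaton (P ++ suc n ∷ []) (Desc-snoc (Desc-tail d)) s t) (*-cong (pend-snoc n P (Desc-tail d)) (resp (λ j → Row j s t) (length-snoc P (suc n))))))))
    (solve 5 (λ y a b c d → :1 :* (y :* a :* (b :* c :* d)) := a :* c :* (y :* b :* d)) refl _ _ _ _ _)
  row-automaton {suc n} [] d (false ∷ s) (true ∷ t) = trans (parts-low s (parts t)) (sym (zeroʳ _))
  row-automaton {suc n} (l ∷ P) d (false ∷ s) (true ∷ t) = trans (*-cong (resp ι (≤⇒≤ᵇ≡ (NP.<⇒≤ (Desc-head d)))) (*-cong (resp edge (∸-suc (Desc-head d)))
      (trans (row-automaton P (Desc-pred (Desc-tail d)) s t) (*-congʳ (pend-pred n P (Desc-tail d))))))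
    (solve 5 (λ y a b c d → :1 :* (y :* a :* (b :* c :* d)) := a :* c :* (y :* b :* d)) refl _ _ _ _ _)

  -- A column is charged y at its lowest box and γ at the others.
  colW : List ℕ → List ℕ → Carrier
  colW [] [] = 1#
  colW [] (m ∷ ms) = 0#
  colW (l ∷ ls) [] = ι P? * (pw γ (first ls) * pw y (l ∸ first ls)) * colW ls []
  colW (l ∷ ls) (m ∷ ms) = ι (m ≤ᵇ l) * (pw γ (suc (first ls) ∸ m) * pw y (l ∸ (m ⊔ suc (first ls)))) * colW ls ms

  -- θ is the last column met by the rows below. Boxes up to that column repeat a column and are
  -- charged γ; those beyond it are the lowest in theirs and are charged y.
  stat-col : ∀ r i c θ rest → θ < c ℕ.+ r → (∀ k → c ≤ k → memN k (map snd rest) ≡ (k ≤ᵇ θ)) →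
    stat y (map snd (cells i c r ++ rest)) ≈ pw γ (suc θ ∸ c) * pw y (c ℕ.+ r ∸ (c ⊔ suc θ)) * stat y (map snd rest)
  stat-col zero i c θ rest lt mem = trans (solve 1 (λ a → a := :1 :* :1 :* a) refl _) (*-congʳ (*-cong
      (resp (pw γ) (P.sym (NP.m≤n⇒m∸n≡0 lt′))) (resp (pw y) (P.sym (P.trans (P.cong₂ _∸_ (NP.+-identityʳ c) (NP.m≥n⇒m⊔n≡m lt′)) (NP.n∸n≡0 c))))))
    where
    lt′ : suc θ ≤ c
    lt′ = P.subst (suc θ ≤_) (NP.+-identityʳ c) lt
  stat-col (suc r) i c θ rest lt mem = trans (stat-∷ y c (map snd (cells i (suc c) r ++ rest)))
    (trans (*-cong (resp (if_then γ else y) member) (stat-col r i (suc c) θ rest (P.subst (θ <_) (NP.+-suc c r) lt) (λ k p → mem k (NP.<⇒≤ p)))) (step (c ≤ᵇ θ) P.refl))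
    where
    member : memN c (map snd (cells i (suc c) r ++ rest)) ≡ (c ≤ᵇ θ)
    member = P.trans (P.cong (memN c) (LP.map-++ snd (cells i (suc c) r) rest)) (P.trans (mem-++ c (map snd (cells i (suc c) r)) (map snd rest))
      (P.trans (P.cong (_∨ memN c (map snd rest)) (not-mem c (map snd (cells i (suc c) r)) (AllP.map⁺ (All.map (λ { (_ , p , _) → <⇒≢ᵇ p }) (cells-in i (suc c) r))))) (mem c NP.≤-refl)))
    s = stat y (map snd rest)
    step : ∀ b → (c ≤ᵇ θ) ≡ b → (if b then γ else y) * (pw γ (θ ∸ c) * pw y (suc c ℕ.+ r ∸ (suc c ⊔ suc θ)) * s) ≈ pw γ (suc θ ∸ c) * pw y (c ℕ.+ suc r ∸ (c ⊔ suc θ)) * s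
    step true e = trans (solve 4 (λ g a b c → g :* (a :* b :* c) := g :* a :* b :* c) refl _ _ _ _) (*-congʳ (*-cong
        (resp (pw γ) (P.sym (NP.+-∸-assoc 1 c≤θ)))
        (resp (pw y) (P.cong₂ _∸_ (P.sym (NP.+-suc c r)) (P.trans (NP.m≤n⇒m⊔n≡n (s≤s c≤θ)) (P.sym (NP.m≤n⇒m⊔n≡n (NP.m≤n⇒m≤1+n c≤θ))))))))
      where
      c≤θ = ≤ᵇ⇒≤′ c θ e
    step false e = trans (solve 4 (λ g a b c → g :* (a :* b :* c) := a :* (g :* b) :* c) refl _ _ _ _) (*-congʳ (*-cong
        (resp (pw γ) (P.trans (NP.m≤n⇒m∸n≡0 (NP.<⇒≤ θ<c)) (P.sym (NP.m≤n⇒m∸n≡0 θ<c))))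
        (resp (pw y) (P.trans (P.cong (λ k → suc (suc c ℕ.+ r ∸ k)) (NP.m≥n⇒m⊔n≡m (s≤s (NP.<⇒≤ θ<c))))
          (P.trans (P.cong suc (NP.m+n∸m≡n (suc c) r)) (P.sym (P.trans (P.cong (c ℕ.+ suc r ∸_) (NP.m≥n⇒m⊔n≡m θ<c)) (NP.m+n∸m≡n c (suc r)))))))))
      where
      θ<c = ≰ᵇ⇒> c θ e

  diag : List Box → Carrier
  diag bs = ι (P? ∨ all offDiag bs)

  -- The diagonal rule enters only through rows without an inner part, as these are the ones that
  -- contain their diagonal box; there it becomes the factor ι P? of `colW`.
  colW-stat : ∀ i {K M ls ms} → Str K ls → Str M ms →
    ι (sub ms ls) * (diag (segs i ls ms) * stat y (map snd (segs i ls ms))) ≈ colW ls ms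
  colW-stat i [] [] = trans (*-identityˡ _) (trans (*-cong (resp ι (BP.∨-zeroʳ P?)) (*-identityˡ _)) (*-identityˡ _))
  colW-stat i [] (_ ∷ _) = zeroˡ _
  colW-stat i {ls = suc l ∷ ls} (p ∷ sl) [] = begin
    1# * (diag (cells i i (suc l) ++ rest) * stat y (i ∷ map snd (cells i (suc i) l ++ rest)))
      ≈⟨ trans (*-identityˡ _) (*-cong (diagonal P? P.refl) (trans (stat-∷ y i (map snd (cells i (suc i) l ++ rest))) (*-congʳ (resp (if_then γ else y) (not-mem i (map snd (cells i (suc i) l ++ rest))
           (AllP.map⁺ (All.map <⇒≢ᵇ (AllP.++⁺ (All.map (λ { (_ , q , _) → q }) (cells-in i (suc i) l)) (All.map (λ { (q , q′ , _) → NP.≤-trans q q′ }) (segs-in (suc i) sl [] P.refl))))))))) ) ⟩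
    ι P? * diag rest * (y * stat y (map snd (cells i (suc i) l ++ rest)))
      ≈⟨ *-congˡ (*-congˡ (trans (stat-col l i (suc i) (i ℕ.+ first ls) rest (s≤s (NP.+-monoʳ-≤ i (first-Str sl)))
           (λ k q → mem-segs i {M = 0} sl [] P.refl k (P.subst (_≤ k) (P.sym (NP.+-identityʳ (suc i))) q)))
           (*-congʳ (*-cong (resp (pw γ) (NP.m+n∸m≡n i (first ls)))
             (resp (pw y) (P.trans (P.cong (suc i ℕ.+ l ∸_) (NP.m≤n⇒m⊔n≡n (s≤s (NP.m≤m+n i (first ls))))) (NP.[m+n]∸[m+o]≡n∸o i l (first ls)))))))) ⟩
    ι P? * diag rest * (y * (pw γ (first ls) * pw y (l ∸ first ls) * stat y (map snd rest)))
      ≈⟨ solve 6 (λ a b y c d e → a :* b :* (y :* (c :* d :* e)) := a :* (c :* (y :* d)) :* (:1 :* (b :* e))) refl _ _ _ _ _ _ ⟩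
    ι P? * (pw γ (first ls) * (y * pw y (l ∸ first ls))) * (1# * (diag rest * stat y (map snd rest)))
      ≈⟨ *-cong (*-congˡ (*-congˡ (resp (pw y) (P.sym (NP.+-∸-assoc 1 (first-Str sl)))))) (colW-stat (suc i) {M = 0} sl []) ⟩
    colW (suc l ∷ ls) [] ∎
    where
    rest = segs (suc i) ls []
    diagonal : ∀ b → P? ≡ b → diag (cells i i (suc l) ++ rest) ≈ ι P? * diag rest
    diagonal true P.refl = sym (*-identityˡ _)
    diagonal false P.refl = trans (resp (λ b → ι (not b ∧ all offDiag (cells i (suc i) l ++ rest))) (≡ᵇ-refl i)) (sym (zeroˡ _))
  colW-stat i {ls = suc l ∷ ls} {ms = suc m ∷ ms} (p ∷ sl) (q ∷ sm) with suc m ≤ᵇ suc l in f | sub ms ls in ok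
  ... | false | _ = trans (zeroˡ _) (sym (trans (*-congʳ (zeroˡ _)) (zeroˡ _)))
  ... | true | false = trans (zeroˡ _) (sym (trans (*-congˡ (trans (sym (colW-stat (suc i) sl sm)) (trans (*-congʳ (resp ι ok)) (zeroˡ _)))) (zeroʳ _)))
  ... | true | true = begin
    1# * (diag (cells i (i ℕ.+ suc m) (l ∸ m) ++ rest) * stat y (map snd (cells i (i ℕ.+ suc m) (l ∸ m) ++ rest)))
      ≈⟨ *-congˡ (*-cong (resp (λ b → ι (P? ∨ b)) (offDiag-cells i (i ℕ.+ suc m) (l ∸ m) rest (NP.m<m+n i (s≤s z≤n))))
           (trans (stat-col (l ∸ m) i (i ℕ.+ suc m) (i ℕ.+ first ls) rest (P.subst (suc (i ℕ.+ first ls) ≤_) (P.sym sum≡) (NP.≤-trans (s≤s (NP.+-monoʳ-≤ i (first-Str sl))) (NP.≤-reflexive (P.sym (NP.+-suc i l)))))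
             (λ k r → mem-segs i sl sm ok k (NP.≤-trans (NP.≤-trans (s≤s (NP.+-monoʳ-≤ i (first-Str sm))) (NP.≤-reflexive (P.sym (NP.+-suc i m)))) r)))
           (*-congʳ (*-cong (resp (pw γ) (P.trans (P.cong (_∸ (i ℕ.+ suc m)) (P.sym (NP.+-suc i (first ls)))) (NP.[m+n]∸[m+o]≡n∸o i (suc (first ls)) (suc m))))
             (resp (pw y) (P.trans (P.cong₂ _∸_ sum≡ (P.trans (P.cong ((i ℕ.+ suc m) ⊔_) (P.sym (NP.+-suc i (first ls)))) (P.sym (NP.+-distribˡ-⊔ i (suc m) (suc (first ls))))))
               (NP.[m+n]∸[m+o]≡n∸o i (suc l) (suc m ⊔ suc (first ls))))))))) ⟩
    1# * (diag rest * (pw γ (first ls ∸ m) * pw y (l ∸ (m ⊔ first ls)) * stat y (map snd rest)))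
      ≈⟨ solve 4 (λ a b c d → :1 :* (a :* (b :* c :* d)) := :1 :* (b :* c) :* (:1 :* (a :* d))) refl _ _ _ _ ⟩
    1# * (pw γ (first ls ∸ m) * pw y (l ∸ (m ⊔ first ls))) * (1# * (diag rest * stat y (map snd rest)))
      ≈⟨ *-congˡ (trans (*-congʳ (resp ι (P.sym ok))) (colW-stat (suc i) sl sm)) ⟩
    1# * (pw γ (first ls ∸ m) * pw y (l ∸ (m ⊔ first ls))) * colW ls ms ∎
    where
    rest = segs (suc i) ls ms
    sum≡ : i ℕ.+ suc m ℕ.+ (l ∸ m) ≡ i ℕ.+ suc l
    sum≡ = P.trans (NP.+-assoc i (suc m) _) (P.cong (i ℕ.+_) (NP.m+[n∸m]≡n (≤ᵇ⇒≤′ (suc m) (suc l) f)))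

  -- The part of colW contributed by the columns that are still open when only parts ≤ n remain.
  Ψ : ℕ → List ℕ → Carrier
  Ψ n [] = 1#
  Ψ n (l ∷ []) = pw y (l ∸ suc n)
  Ψ n (l ∷ l′ ∷ P) = pw γ (l′ ∸ n) * pw y (l ∸ suc l′) * Ψ n (l′ ∷ P)

  Ψ-false : ∀ n P → Desc (suc n) P → Ψ n P ≈ edge (length P) * Ψ (suc n) P
  Ψ-false n [] d = sym (*-identityˡ _)
  Ψ-false n (l ∷ []) (single p) = trans (resp (pw y) (∸-suc p)) (*-congʳ (sym (*-identityʳ _)))
  Ψ-false n (l ∷ l′ ∷ P) (p ∷ d) = trans (*-cong (*-congʳ (resp (pw γ) (∸-suc (NP.<-trans (NP.n<1+n n) (Desc-head d))))) (Ψ-false n (l′ ∷ P) d))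
    (solve 6 (λ g a b y e f → g :* a :* b :* (y :* e :* f) := y :* (g :* e) :* (a :* b :* f)) refl _ _ _ _ _ _)

  Ψ-true : ∀ n P → Desc (suc n) P → Ψ n (P ++ suc n ∷ []) ≈ pw γ (length P) * Ψ (suc n) P
  Ψ-true n [] d = trans (resp (pw y) (NP.n∸n≡0 n)) (sym (*-identityˡ _))
  Ψ-true n (l ∷ []) (single p) = trans (*-cong (*-congʳ (resp (pw γ) (P.trans (∸-suc (NP.n<1+n n)) (P.cong suc (NP.n∸n≡0 n))))) (resp (pw y) (NP.n∸n≡0 n)))
    (*-identityʳ _)
  Ψ-true n (l ∷ l′ ∷ P) (p ∷ d) = trans (*-cong (*-congʳ (resp (pw γ) (∸-suc (NP.<-trans (NP.n<1+n n) (Desc-head d))))) (Ψ-true n (l′ ∷ P) d))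
    (solve 5 (λ g a b e f → g :* a :* b :* (g :* e :* f) := g :* (g :* e) :* (a :* b :* f)) refl _ _ _ _ _)

  Ψ-close : ∀ n l P {ks} → Desc n (l ∷ P) → Str n ks → pw γ (suc (first (P ++ ks)) ∸ suc n) * pw y (l ∸ (suc n ⊔ suc (first (P ++ ks)))) * Ψ n P ≈ Ψ n (l ∷ P)
  Ψ-close n l [] {ks} d s = trans (*-identityʳ _) (trans (*-cong (resp (pw γ) (NP.m≤n⇒m∸n≡0 (first-Str s)))
    (resp (λ k → pw y (l ∸ suc k)) (NP.m≥n⇒m⊔n≡m (first-Str s)))) (*-identityˡ _))
  Ψ-close n l (l′ ∷ P) (p ∷ d) s = *-congʳ (*-congˡ (resp (λ k → pw y (l ∸ suc k)) (NP.m≤n⇒m⊔n≡n (NP.<⇒≤ (Desc-head d)))))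

  -- As in `row-automaton`, with `Ψ` for the charges already made. The charge of a row depends on
  -- the length of the next one, so it is complete only when that row is known; `close` deals with
  -- the oldest open row.
  col-automaton : ∀ {n} P → Desc n P → (s t : Vec Bool n) → colW (P ++ parts s) (parts t) ≈ Ψ n P * Col P? (length P) s t

  close : ∀ {n} l P → Desc n (l ∷ P) → (s t : Vec Bool n) → colW (l ∷ P ++ parts s) (suc n ∷ parts t) ≈ Ψ n (l ∷ P) * Col P? (length P) s t
  close {n} l P d s t = trans (*-cong (*-congʳ (resp ι (≤⇒≤ᵇ≡ (Desc-head d)))) (col-automaton P (Desc-tail d) s t))
    (trans (solve 4 (λ a b c d → :1 :* (a :* b) :* (c :* d) := a :* b :* c :* d) refl _ _ _ _) (*-congʳ (Ψ-close n l P d (Str-parts s))))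

  colW-low : ∀ {n} (s : Vec Bool n) ms → colW (parts s) (suc n ∷ ms) ≈ 0#
  colW-low s ms with parts s | Str-parts s
  ... | [] | _ = refl
  ... | l ∷ ls | p ∷ _ = trans (*-congʳ (trans (*-congʳ (resp ι (<⇒≰ᵇ (s≤s p)))) (zeroˡ _))) (zeroˡ _)

  col-automaton P d [] [] = trans (resp (λ l → colW l []) (LP.++-identityʳ P)) (go P d)
    where
    last : ∀ b j → (if b then y * pw y j else 0#) ≈ ι b * (y * pw y j)
    last true j = sym (*-identityˡ _)
    last false j = sym (zeroˡ _)
    slide : ∀ b j → ι b * (y * (if b then y * pw y j else 0#)) ≈ (if b then y * (y * pw y j) else 0#)
    slide true j = *-identityˡ _
    slide false j = zeroˡ _
    go : ∀ P → Desc 0 P → colW P [] ≈ Ψ 0 P * colF P? (length P)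
    go [] d = sym (*-identityˡ _)
    go (l ∷ []) (single p) = trans (*-congʳ (*-congˡ (*-congˡ (resp (pw y) (∸-suc p)))))
      (trans (solve 3 (λ i y a → i :* (:1 :* (y :* a)) :* :1 := a :* (i :* (y :* :1))) refl _ _ _) (*-congˡ (sym (last P? 0))))
    go (l ∷ l′ ∷ P) (p ∷ d) = trans (*-cong (*-congˡ (*-congˡ (resp (pw y) (∸-suc p)))) (go (l′ ∷ P) d))
      (trans (solve 6 (λ i a y b c d → i :* (a :* (y :* b)) :* (c :* d) := a :* b :* c :* (i :* (y :* d))) refl _ _ _ _ _ _) (*-congˡ (slide P? (length P))))
  col-automaton {suc n} P d (false ∷ s) (false ∷ t) = trans (col-automaton P (Desc-pred d) s t) (trans (*-congʳ (Ψ-false n P d))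
    (solve 3 (λ a b c → a :* b :* c := b :* (a :* c)) refl _ _ _))
  col-automaton {suc n} P d (true ∷ s) (false ∷ t) = trans (resp (λ l → colW l (parts t)) (P.sym (LP.++-assoc P (suc n ∷ []) (parts s))))
    (trans (col-automaton (P ++ suc n ∷ []) (Desc-snoc d) s t) (trans (*-cong (Ψ-true n P d) (resp (λ j → Col P? j s t) (length-snoc P (suc n))))
    (solve 3 (λ a b c → a :* b :* c := b :* (a :* c)) refl _ _ _)))
  col-automaton {suc n} [] d (true ∷ s) (true ∷ t) = trans (close (suc n) [] (single NP.≤-refl) s t) (*-cong (resp (pw y) (NP.n∸n≡0 n)) (sym (*-identityˡ _)))
  col-automaton {suc n} (l ∷ P) d (true ∷ s) (true ∷ t) = trans (resp (λ ls → colW (l ∷ ls) (suc n ∷ parts t)) (P.sym (LP.++-assoc P (suc n ∷ []) (parts s))))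
    (trans (close l (P ++ suc n ∷ []) (Desc-snoc d) s t) (trans (*-cong (Ψ-true n (l ∷ P) d) (resp (λ j → Col P? j s t) (length-snoc P (suc n))))
    (solve 3 (λ a b c → a :* b :* c := b :* (a :* c)) refl _ _ _)))
  col-automaton {suc n} [] d (false ∷ s) (true ∷ t) = trans (colW-low s (parts t)) (sym (zeroʳ _))
  col-automaton {suc n} (l ∷ P) d (false ∷ s) (true ∷ t) = trans (close l P (Desc-pred d) s t) (trans (*-congʳ (Ψ-false n (l ∷ P) d))
    (solve 3 (λ a b c → a :* b :* c := b :* (a :* c)) refl _ _ _))

-- Plane partitions as products of one-variable operators

letters : ℕ → List ℕ
letters zero = []
letters (suc r) = letters r ++ suc (dbl r) ∷ suc (suc (dbl r)) ∷ []

letters-≤ : ∀ r → All (_≤ dbl r) (letters r)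
letters-≤ zero = []
letters-≤ (suc r) = AllP.++⁺ (All.map (λ p → NP.m≤n⇒m≤1+n (NP.m≤n⇒m≤1+n p)) (letters-≤ r)) (NP.n≤1+n _ ∷ NP.≤-refl ∷ [])

sub-trans : ∀ ms ks ls → sub ms ls ≡ false → sub ms ks ∧ sub ks ls ≡ false
sub-trans (m ∷ ms) [] ls e = P.refl
sub-trans (m ∷ ms) (k ∷ ks) [] e = BP.∧-zeroʳ _
sub-trans (m ∷ ms) (k ∷ ks) (l ∷ ls) e with m ≤ᵇ k in p | k ≤ᵇ l in q
... | false | _ = P.refl
... | true | false = BP.∧-zeroʳ _
... | true | true = sub-trans ms ks ls (P.trans (P.sym (P.cong (_∧ sub ms ls) (≤⇒≤ᵇ≡ (NP.≤-trans (≤ᵇ⇒≤′ m k p) (≤ᵇ⇒≤′ k l q))))) e)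

module PlanePartitions (R : CommutativeRing 0ℓ 0ℓ) (β : CommutativeRing.Carrier R) (P? : Bool) where
  open RingKit R
  open Pieri R β
  open Fillings R
  open SetValued R β P? using (letter; letter-old; letter-new)

  -- The negation appears because the flag of the plane partition sums selects gp, whose partner is
  -- GQ, while P? selects the pair of GP and gq.
  G : (ℕ → Carrier) → List ℕ → List Box → Carrier
  G = PlaneFillings.G R γ (not P?)

  G-cong : ∀ {z z′} as → All (λ ℓ → z ℓ ≡ z′ ℓ) as → ∀ bs → G z as bs ≈ G z′ as bs
  G-cong {z} {z′} as e bs = FS-cong′ as bs (λ T → *-congˡ (prod T as e))
    where
    prod : ∀ T as → All (λ ℓ → z ℓ ≡ z′ ℓ) as → ∏ as (λ ℓ → PlaneFillings.letterwt R γ (not P?) z ℓ T) ≈ ∏ as (λ ℓ → PlaneFillings.letterwt R γ (not P?) z′ ℓ T)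
    prod T [] [] = refl
    prod T (ℓ ∷ as) (q ∷ qs) = *-cong (resp (λ y → PlaneFillings.stat R γ (not P?) z y (map (PlaneFillings.index R γ (not P?) z ℓ) (filterB (λ e → snd e ≡ᵇ ℓ) T))) q) (prod T as qs)

  -- The indicator of containment makes the rule hold for all pairs of words: without containment no
  -- intermediate partition exists, and both sides vanish.
  G-ideal : ∀ z p as₁ as₂ → All (_≤ p) as₁ → All (p <_) as₂ → ∀ {n} (s m : Vec Bool n) →
    ι (sub (parts m) (parts s)) * G z (as₁ ++ as₂) (segs 1 (parts s) (parts m)) ≈
    Σᵇ n (λ t → ι (sub (parts m) (parts t) ∧ sub (parts t) (parts s)) * (G z as₁ (segs 1 (parts t) (parts m)) * G z as₂ (segs 1 (parts s) (parts t))))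
  G-ideal z p as₁ as₂ lo hi {n} s m with sub (parts m) (parts s) in e
  ... | true = trans (*-identityˡ _) (trans (PlaneFillings.G-split R γ (not P?) z p as₁ as₂ lo hi (segs 1 (parts s) (parts m)))
    (Ideals.ideal-sum R (Str-parts s) (Str-parts m) e NP.≤-refl (λ k t → G z as₁ k * G z as₂ t)))
  ... | false = trans (zeroˡ _) (sym (Σᵇ-zero n (λ t → trans (*-congʳ (resp ι (sub-trans (parts m) (parts t) (parts s) e))) (zeroˡ _))))

  module _ (z : ℕ → Carrier) (ℓ : ℕ) where
    open PlaneFillings R γ (not P?) z using (weight; letterwt; stat; index; good)

    private
      fill : List Box → List PPEntry
      fill = map (_, ℓ)

    FS-one : ∀ bs f → FS (ℓ ∷ []) bs f ≈ f (fill bs)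
    FS-one [] f = refl
    FS-one (b ∷ bs) f = trans (+-identityʳ _) (FS-one bs (λ E → f ((b , ℓ) ∷ E)))

    keep-all : ∀ bs → filterB (λ e → snd e ≡ᵇ ℓ) (fill bs) ≡ fill bs
    keep-all [] = P.refl
    keep-all (b ∷ bs) rewrite ≡ᵇ-refl ℓ = P.cong ((b , ℓ) ∷_) (keep-all bs)

    pairs : ∀ bs → allPairs (fill bs) ppPairOK ≡ true
    pairs bs = all-true _ (fill bs) (AllP.map⁺ (All.universal (λ b → all-true (ppPairOK (b , ℓ)) (fill bs) (AllP.map⁺ (All.universal (λ b′ →
      P.trans (ppPairOK-rel b ℓ b′ ℓ) (P.trans (P.cong (not (rel b b′) ∨_) (≤⇒≤ᵇ≡ (NP.≤-refl {ℓ}))) (BP.∨-zeroʳ _))) bs))) bs))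

    G-one : ∀ bs → G z (ℓ ∷ []) bs ≈ ι (not (not P?) ∨ all noUnprimedDiag (fill bs)) * stat (z ℓ) (map (λ b → index ℓ (b , ℓ)) bs)
    G-one bs = trans (FS-one bs (weight (ℓ ∷ []))) (*-cong (resp (λ b → ι (b ∧ (not (not P?) ∨ all noUnprimedDiag (fill bs)))) (pairs bs))
      (trans (*-identityʳ _) (resp (stat (z ℓ)) (P.trans (P.cong (map (index ℓ)) (keep-all bs)) (P.sym (LP.map-∘ bs))))))

    module _ where
      open One (z ℓ)
      G-odd : isOdd ℓ ≡ true → ∀ {n} (s t : Vec Bool n) → ι (sub (parts t) (parts s)) * G z (ℓ ∷ []) (segs 1 (parts s) (parts t)) ≈ Row 0 s t
      G-odd odd s t = begin
        ι c * G z (ℓ ∷ []) bs ≈⟨ *-congˡ (G-one bs) ⟩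
        ι c * (ι (not (not P?) ∨ all noUnprimedDiag (fill bs)) * stat (z ℓ) (map (λ b → index ℓ (b , ℓ)) bs))
          ≈⟨ *-congˡ (trans (*-cong (resp ι (P.trans (P.cong (not (not P?) ∨_) (all-true _ (fill bs) (AllP.map⁺ (All.universal free bs)))) (BP.∨-zeroʳ _)))
               (resp (stat (z ℓ)) (LP.map-cong (λ b → P.cong (λ o → if not o then snd b else fst b) odd) bs))) (*-identityˡ _)) ⟩
        ι c * stat (z ℓ) (map fst bs) ≈⟨ rowW-stat 1 (parts s) (parts t) ⟩
        rowW (parts s) (parts t) ≈⟨ trans (row-automaton [] [] s t) (*-identityˡ _) ⟩
        Row 0 s t ∎
        where
        open OneLetter R β P? z (z ℓ)
        c = sub (parts t) (parts s)
        bs = segs 1 (parts s) (parts t)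
        free : ∀ b → noUnprimedDiag (b , ℓ) ≡ true
        free b rewrite odd = BP.∨-zeroʳ _

      G-even : isOdd ℓ ≡ false → ∀ {n} (s t : Vec Bool n) → ι (sub (parts t) (parts s)) * G z (ℓ ∷ []) (segs 1 (parts s) (parts t)) ≈ Col P? 0 s t
      G-even odd s t = begin
        ι c * G z (ℓ ∷ []) bs ≈⟨ *-congˡ (G-one bs) ⟩
        ι c * (ι (not (not P?) ∨ all noUnprimedDiag (fill bs)) * stat (z ℓ) (map (λ b → index ℓ (b , ℓ)) bs))
          ≈⟨ *-congˡ (*-cong (resp ι (P.cong₂ _∨_ (BP.not-involutive P?) (P.trans (all-map {A = Box} (λ b → b , ℓ) noUnprimedDiag bs) (all-cong bs (All.universal off bs)))))
               (resp (stat (z ℓ)) (LP.map-cong (λ b → P.cong (λ o → if not o then snd b else fst b) odd) bs))) ⟩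
        ι c * (diag bs * stat (z ℓ) (map snd bs)) ≈⟨ colW-stat 1 (Str-parts s) (Str-parts t) ⟩
        colW (parts s) (parts t) ≈⟨ trans (col-automaton [] [] s t) (*-identityˡ _) ⟩
        Col P? 0 s t ∎
        where
        open OneLetter R β P? z (z ℓ)
        c = sub (parts t) (parts s)
        bs = segs 1 (parts s) (parts t)
        off : ∀ b → noUnprimedDiag (b , ℓ) ≡ offDiag b
        off b rewrite odd = BP.∨-identityʳ _

  B : Carrier → ∀ {n} → Vec Bool n → Vec Bool n → Carrier
  B y = One.Diag.B y P?

  G-two : ∀ z o y → isOdd o ≡ true → z o ≡ y → z (suc o) ≡ y → isOdd (suc o) ≡ false → ∀ {n} (s m : Vec Bool n) →
    ι (sub (parts m) (parts s)) * G z (o ∷ suc o ∷ []) (segs 1 (parts s) (parts m)) ≈ B y s m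
  G-two z o y odd P.refl z≡ even {n} s m = trans (G-ideal z o (o ∷ []) (suc o ∷ []) (NP.≤-refl ∷ []) (NP.≤-refl ∷ []) s m)
    (Σᵇ-cong n (λ t → trans (trans (*-congʳ (ι-∧ (sub (parts m) (parts t)) (sub (parts t) (parts s)))) (solve 4 (λ a b c d → a :* b :* (c :* d) := b :* d :* (a :* c)) refl _ _ _ _))
      (*-cong (trans (G-even z (suc o) even s t) (resp (λ y → One.Col y P? 0 s t) z≡)) (G-odd z o odd t m))))

  -- The first variable belongs to the two largest letters, so that consing a variable puts a factor
  -- B on the outer side of the skew shape.
  Q : List Carrier → ∀ {n} → Vec Bool n → Vec Bool n → Carrier
  Q ys s m = ι (sub (parts m) (parts s)) * G (letter ys) (letters (length ys)) (segs 1 (parts s) (parts m))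

  Q-∷ : ∀ y ys {n} (s m : Vec Bool n) → Q (y ∷ ys) s m ≈ dot n (B y s) (λ t → Q ys t m)
  Q-∷ y ys {n} s m = trans (G-ideal z p (letters (length ys)) (suc p ∷ suc (suc p) ∷ []) (letters-≤ (length ys)) (NP.≤-refl ∷ NP.n≤1+n _ ∷ []) s m)
    (Σᵇ-cong n (λ t → trans (trans (*-congʳ (ι-∧ (sub (parts m) (parts t)) (sub (parts t) (parts s)))) (solve 4 (λ a b c d → a :* b :* (c :* d) := b :* d :* (a :* c)) refl _ _ _ _))
      (*-cong (G-two z (suc p) y (isOdd-suc-dbl (length ys)) (letter-new y ys (suc p) NP.≤-refl) (letter-new y ys (suc (suc p)) (NP.n≤1+n _)) (isOdd-dbl (length ys)) s t)
        (*-congˡ (G-cong (letters (length ys)) (All.map (λ {ℓ} q → letter-old y ys ℓ q) (letters-≤ (length ys))) (segs 1 (parts t) (parts m)))))))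
    where
    z = letter (y ∷ ys)
    p = dbl (length ys)

  -- Without letters only an empty set of boxes can be filled, that is, the shape with equal outer
  -- and inner partition.
  Q-[] : ∀ {n} (s m : Vec Bool n) → Q [] s m ≈ δ s m
  Q-[] = at 1
    where
    at : ∀ i {n} (s m : Vec Bool n) → ι (sub (parts m) (parts s)) * G (letter []) [] (segs i (parts s) (parts m)) ≈ δ s m
    gap : ∀ i {n} (s : Vec Bool n) ms → ι (sub (suc n ∷ ms) (parts s)) * G (letter []) [] (segs i (parts s) (suc n ∷ ms)) ≈ 0#
    gap i s ms with parts s | Str-parts s
    ... | [] | _ = zeroˡ _
    ... | l ∷ ls | p ∷ _ = trans (*-congʳ (resp (λ b → ι (b ∧ sub ms ls)) (<⇒≰ᵇ (s≤s p)))) (zeroˡ _)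
    some : ∀ i {n} (s : Vec Bool n) ms → Str n ms → G (letter []) [] (segs i (suc n ∷ parts s) ms) ≈ 0#
    some i s [] st = refl
    some i {n} s (suc m ∷ ms) (p ∷ st) = resp (λ r → G (letter []) [] (cells i (i ℕ.+ suc m) r ++ segs (suc i) (parts s) ms)) (∸-suc p)
    at i [] [] = trans (*-identityˡ _) (trans (*-identityʳ _) (resp ι (BP.∨-zeroʳ (not (not P?)))))
    at i (false ∷ s) (false ∷ m) = at i s m
    at i (false ∷ s) (true ∷ m) = gap i s (parts m)
    at i (true ∷ s) (false ∷ m) = trans (*-congˡ (some i s (parts m) (Str-parts m))) (zeroʳ _)
    at i {suc n} (true ∷ s) (true ∷ m) = trans (*-cong (resp (λ b → ι (b ∧ sub (parts m) (parts s))) (≤⇒≤ᵇ≡ (NP.≤-refl {suc n})))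
      (resp (λ r → G (letter []) [] (cells i (i ℕ.+ suc n) r ++ segs (suc i) (parts s) (parts m))) (NP.n∸n≡0 n))) (at (suc i) s m)

  -- The multiplicative form of the branching rule; the variables of the larger letters come first.
  Q-++ : ∀ ys′ ys {n} (s m : Vec Bool n) → Q (ys′ ++ ys) s m ≈ dot n (Q ys′ s) (λ t → Q ys t m)
  Q-++ [] ys {n} s m = trans (sym (dot-δ s _)) (dot-cong n (λ t → sym (Q-[] s t)) (λ _ → refl))
  Q-++ (y ∷ ys′) ys {n} s m = begin
    Q (y ∷ ys′ ++ ys) s m ≈⟨ Q-∷ y (ys′ ++ ys) s m ⟩
    dot n (B y s) (λ t → Q (ys′ ++ ys) t m) ≈⟨ dot-cong n (λ _ → refl) (λ t → Q-++ ys′ ys t m) ⟩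
    dot n (B y s) (λ t → dot n (Q ys′ t) (λ r → Q ys r m)) ≈⟨ dot-assoc n n (B y s) (λ t r → Q ys′ t r) (λ r → Q ys r m) ⟩
    dot n (λ r → dot n (B y s) (λ t → Q ys′ t r)) (λ r → Q ys r m) ≈⟨ dot-cong n (λ r → sym (Q-∷ y ys′ s r)) (λ _ → refl) ⟩
    dot n (Q (y ∷ ys′) s) (λ r → Q ys r m) ∎

  module _ (F : Filtration R) where
    open Cauchy R F β using (chain; δ∅)

    Q≈chain : ∀ ys {n} (s : Vec Bool n) → Q ys s empty ≈ chain P? ys s
    Q≈chain [] s = trans (Q-[] s empty) (go s)
      where
      go : ∀ {n} (s : Vec Bool n) → δ s empty ≈ δ∅ s
      go [] = refl
      go (false ∷ s) = go s
      go (true ∷ s) = refl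
    Q≈chain (y ∷ ys) {n} s = trans (Q-∷ y ys s empty) (dot-cong n (λ _ → refl) (λ t → Q≈chain ys t))

-- Strict partitions as words of bits

size-parts : ∀ {n} (s : Vec Bool n) → sum (parts s) ≡ size s
size-parts [] = P.refl
size-parts (false ∷ s) = size-parts s
size-parts {suc n} (true ∷ s) = P.cong (suc n ℕ.+_) (size-parts s)

subsets-sum : ∀ n (f : List ℕ → ℤ) → PS.∑ 0 (subsets n) f ≡ Σ₀ n (λ s → f (parts s))
subsets-sum zero f = ZP.+-identityʳ _
subsets-sum (suc n) f = P.trans (PS.∑-++ 0 (subsets n) (map (suc n ∷_) (subsets n)) f)
  (P.cong₂ ℤ._+_ (subsets-sum n f) (P.trans (PS.∑-map 0 (suc n ∷_) (subsets n) f) (subsets-sum n (λ l → f (suc n ∷ l)))))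

-- Words of n bits contain every strict partition of size at most n, but also larger ones, which the
-- indicator removes.
strict-sum : ∀ n f → Σℤ (strictUpTo n) f ≡ Σ₀ n (λ s → ι₀ (sum (parts s) ≤ᵇ n) ℤ.* f (parts s))
strict-sum n f = P.trans (Σℤ≡∑ (strictUpTo n) f) (P.trans (PS.∑-filterB 0 (λ l → sum l ≤ᵇ n) (subsets n) f) (subsets-sum n _))

Str⇒Vec : ∀ K {la} → Str K la → ∃ λ (s : Vec Bool K) → parts s ≡ la
Str⇒Vec zero [] = [] , P.refl
Str⇒Vec (suc K) [] with Str⇒Vec K []
... | s , e = false ∷ s , e
Str⇒Vec (suc K) (_∷_ {k = k} p st) with k NP.≟ K
... | no k≢K with Str⇒Vec K (NP.≤∧≢⇒< (NP.≤-pred p) k≢K ∷ st)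
...   | s , e = false ∷ s , e
Str⇒Vec (suc K) (p ∷ st) | yes P.refl with Str⇒Vec K st
... | s , e = true ∷ s , P.cong (suc K ∷_) e

Strict⇒Str : ∀ {la} → Strict la → ∀ K → All (_≤ K) la → Str K la
Strict⇒Str {[]} st K le = []
Strict⇒Str {zero ∷ la} (_ , () ∷ _) K le
Strict⇒Str {suc k ∷ la} (lk , _ ∷ pos) K (p ∷ _) = p ∷ Strict⇒Str (tail lk , pos) k (bound lk)
  where
  tail : ∀ {k la} → Linked ℕ._>_ (k ∷ la) → Linked ℕ._>_ la
  tail [-] = []
  tail (_ ∷ l) = l
  bound : ∀ {k la} → Linked ℕ._>_ (suc k ∷ la) → All (_≤ k) la
  bound [-] = []
  bound {k} (s≤s q ∷ [-]) = q ∷ []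
  bound {k} {suc m ∷ la} (s≤s q ∷ l@(_ ∷ _)) = q ∷ All.map (λ r → NP.≤-trans r (NP.≤-trans (NP.n≤1+n m) q)) (bound l)
  bound {k} {zero ∷ la} (s≤s q ∷ (() ∷ _))

Strict⇒Vec : ∀ {la} → Strict la → ∀ K → All (_≤ K) la → ∃ λ (s : Vec Bool K) → parts s ≡ la
Strict⇒Vec st K le = Str⇒Vec K (Strict⇒Str st K le)

All-≤sum : ∀ la → All (_≤ sum la) la
All-≤sum [] = []
All-≤sum (l ∷ la) = NP.m≤m+n l _ ∷ All.map (λ p → NP.≤-trans p (NP.m≤n+m _ l)) (All-≤sum la)

-- Linear independence

module Triangular (f : ℤ) where

  -- At β = 0 the coefficient of z^m in the one-variable transfer matrices; all four families
  -- give the same two-state automaton and differ only in the final value f.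
  Zc : Bool → ℕ → ∀ {n} → Vec Bool n → Vec Bool n → ℤ
  Zc false m (false ∷ s) (false ∷ t) = Zc false m s t
  Zc false m (true ∷ s) (true ∷ t) = Zc false m s t
  Zc false m (true ∷ s) (false ∷ t) = Zc true m s t
  Zc false m (false ∷ s) (true ∷ t) = + 0
  Zc false zero [] [] = + 1
  Zc false (suc m) [] [] = + 0
  Zc true (suc m) (false ∷ s) (false ∷ t) = Zc true m s t
  Zc true (suc m) (true ∷ s) (true ∷ t) = Zc true m s t
  Zc true (suc m) (false ∷ s) (true ∷ t) = + 2 ℤ.* Zc false m s t
  Zc true (suc m) (true ∷ s) (false ∷ t) = + 0
  Zc true (suc zero) [] [] = f
  Zc true (suc (suc m)) [] [] = + 0
  Zc true zero _ _ = + 0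

  cc : List ℕ → ∀ {n} → Vec Bool n → ℤ
  cc [] [] = + 1
  cc [] (false ∷ s) = cc [] s
  cc [] (true ∷ s) = + 0
  cc (m ∷ a) {n} s = Σ₀ n (λ t → Zc false m s t ℤ.* cc a t)

  Zc-degree : ∀ b m {n} (s t : Vec Bool n) → (if b then suc n else n) < m → Zc b m s t ≡ + 0
  Zc-degree false (suc m) [] [] p = P.refl
  Zc-degree true (suc zero) [] [] (s≤s ())
  Zc-degree true (suc (suc m)) [] [] p = P.refl
  Zc-degree false m (false ∷ s) (false ∷ t) p = Zc-degree false m s t (NP.<-trans (NP.n<1+n _) p)
  Zc-degree false m (true ∷ s) (true ∷ t) p = Zc-degree false m s t (NP.<-trans (NP.n<1+n _) p)
  Zc-degree false m (true ∷ s) (false ∷ t) p = Zc-degree true m s t p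
  Zc-degree false m (false ∷ s) (true ∷ t) p = P.refl
  Zc-degree true (suc m) (false ∷ s) (false ∷ t) (s≤s p) = Zc-degree true m s t p
  Zc-degree true (suc m) (true ∷ s) (true ∷ t) (s≤s p) = Zc-degree true m s t p
  Zc-degree true (suc m) (false ∷ s) (true ∷ t) (s≤s p) = P.cong (+ 2 ℤ.*_) (Zc-degree false m s t (NP.<-trans (NP.n<1+n _) p))
  Zc-degree true (suc m) (true ∷ s) (false ∷ t) p = P.refl

  -- Homogeneity at β = 0. A pending part counts with the length that it has at the current level,
  -- which is suc n.
  Zc-size : ∀ b m {n} (s t : Vec Bool n) → Zc b m s t ≡ + 0 ⊎ size s ℕ.+ (if b then suc n else 0) ≡ m ℕ.+ size t
  Zc-size false zero [] [] = inj₂ P.refl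
  Zc-size false (suc m) [] [] = inj₁ P.refl
  Zc-size true zero [] [] = inj₁ P.refl
  Zc-size true (suc zero) [] [] = inj₂ P.refl
  Zc-size true (suc (suc m)) [] [] = inj₁ P.refl
  Zc-size false m (false ∷ s) (false ∷ t) = Zc-size false m s t
  Zc-size false m {suc n} (true ∷ s) (true ∷ t) with Zc-size false m s t
  ... | inj₁ e = inj₁ e
  ... | inj₂ e = inj₂ (P.trans (NP.+-assoc (suc n) (size s) 0) (P.trans (P.cong (suc n ℕ.+_) e) (swap (suc n) m (size t))))
    where
    swap : ∀ a b c → a ℕ.+ (b ℕ.+ c) ≡ b ℕ.+ (a ℕ.+ c)
    swap a b c = P.trans (P.sym (NP.+-assoc a b c)) (P.trans (P.cong (ℕ._+ c) (NP.+-comm a b)) (NP.+-assoc b a c))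
  Zc-size false m {suc n} (true ∷ s) (false ∷ t) with Zc-size true m s t
  ... | inj₁ e = inj₁ e
  ... | inj₂ e = inj₂ (P.trans (NP.+-identityʳ _) (P.trans (NP.+-comm (suc n) (size s)) e))
  Zc-size false m (false ∷ s) (true ∷ t) = inj₁ P.refl
  Zc-size true zero (_ ∷ s) (_ ∷ t) = inj₁ P.refl
  Zc-size true (suc m) {suc n} (false ∷ s) (false ∷ t) with Zc-size true m s t
  ... | inj₁ e = inj₁ e
  ... | inj₂ e = inj₂ (P.trans (NP.+-suc (size s) (suc n)) (P.cong suc e))
  Zc-size true (suc m) {suc n} (true ∷ s) (true ∷ t) with Zc-size true m s t
  ... | inj₁ e = inj₁ e
  ... | inj₂ e = inj₂ (P.trans (P.cong (ℕ._+ suc (suc n)) (NP.+-comm (suc n) (size s))) (P.trans (P.cong (ℕ._+ suc (suc n)) e)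
    (P.trans (NP.+-assoc m (size t) (suc (suc n))) (P.trans (P.cong (m ℕ.+_) (NP.+-comm (size t) (suc (suc n)))) (NP.+-suc m (suc n ℕ.+ size t))))))
  Zc-size true (suc m) {suc n} (false ∷ s) (true ∷ t) with Zc-size false m s t
  ... | inj₁ e = inj₁ (P.cong (+ 2 ℤ.*_) e)
  ... | inj₂ e = inj₂ (P.trans (P.cong (ℕ._+ suc (suc n)) (P.trans (P.sym (NP.+-identityʳ (size s))) e))
    (P.trans (NP.+-assoc m (size t) (suc (suc n))) (P.trans (P.cong (m ℕ.+_) (NP.+-comm (size t) (suc (suc n)))) (NP.+-suc m (suc n ℕ.+ size t)))))
  Zc-size true (suc m) (true ∷ s) (false ∷ t) = inj₁ P.refl

  cc-size : ∀ a {n} (s : Vec Bool n) → sum a ≢ size s → cc a s ≡ + 0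
  cc-size [] [] p = ⊥-elim (p P.refl)
  cc-size [] (false ∷ s) p = cc-size [] s p
  cc-size [] (true ∷ s) p = P.refl
  cc-size (m ∷ a) {n} s p = Σ₀-zero n term
    where
    term : ∀ t → Zc false m s t ℤ.* cc a t ≡ + 0
    term t with Zc-size false m s t
    ... | inj₁ e = P.trans (P.cong (ℤ._* cc a t) e) (ZP.*-zeroˡ (cc a t))
    ... | inj₂ e = P.trans (P.cong (Zc false m s t ℤ.*_) (cc-size a t (λ q → p (P.trans (P.cong (m ℕ.+_) q) (P.trans (P.sym e) (NP.+-identityʳ _)))))) (ZP.*-zeroʳ (Zc false m s t))

  cc-false : ∀ a {n} (s : Vec Bool n) → cc a (false ∷ s) ≡ cc a s
  cc-false [] s = P.refl
  cc-false (m ∷ a) {n} s = P.trans (P.cong₂ ℤ._+_ (Σ₀-cong n (λ t → P.cong (Zc false m s t ℤ.*_) (cc-false a t))) (Σ₀-zero n (λ t → ZP.*-zeroˡ (cc a (true ∷ t))))) (ZP.+-identityʳ _)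

  cc-degree : ∀ m a {n} (s : Vec Bool n) → n < m → cc (m ∷ a) s ≡ + 0
  cc-degree m a {n} s p = Σ₀-zero n (λ t → P.trans (P.cong (ℤ._* cc a t) (Zc-degree false m s t p)) (ZP.*-zeroˡ (cc a t)))

  -- The largest possible exponent forces the largest part to be removed whole.
  Zc-top : ∀ {n} (s : Vec Bool n) g → Σ₀ n (λ t → Zc true (suc n) s t ℤ.* g t) ≡ f ℤ.* g s
  Zc-top [] g = P.refl
  Zc-top {suc n} (false ∷ s) g = P.trans (P.cong₂ ℤ._+_ (Zc-top s (λ t → g (false ∷ t)))
      (Σ₀-zero n (λ t → P.trans (P.cong (λ c → + 2 ℤ.* c ℤ.* g (true ∷ t)) (Zc-degree false (suc n) s t NP.≤-refl)) (ZP.*-zeroˡ (g (true ∷ t)))))) (ZP.+-identityʳ _)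
  Zc-top {suc n} (true ∷ s) g = P.trans (P.cong₂ ℤ._+_ (Σ₀-zero n (λ t → ZP.*-zeroˡ (g (false ∷ t)))) (Zc-top s (λ t → g (true ∷ t)))) (ZP.+-identityˡ _)

  cc-top : ∀ a {n} (s : Vec Bool n) → cc (suc n ∷ a) (true ∷ s) ≡ f ℤ.* cc a s
  cc-top a {n} s = P.trans (P.cong₂ ℤ._+_ (Zc-top s (λ t → cc a (false ∷ t)))
      (Σ₀-zero n (λ t → P.trans (P.cong (ℤ._* cc a (true ∷ t)) (Zc-degree false (suc n) s t NP.≤-refl)) (ZP.*-zeroˡ (cc a (true ∷ t))))))
    (P.trans (ZP.+-identityʳ _) (P.cong (f ℤ.*_) (cc-false a s)))

  module _ {{_ : ℤ.NonZero f}} where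
    -- Words without the part suc n have no monomial with exponent suc n in the first variable
    -- listed. Words with it yield f times the coefficient for the rest of the word. Testing with
    -- that exponent isolates the values of d at words with top letter true, and the nonzero f is
    -- cancelled in ℤ.
    cc-independent : ∀ n (d : Vec Bool n → ℤ) → (∀ a → Σ₀ n (λ s → cc a s ℤ.* d s) ≡ + 0) → ∀ s → d s ≡ + 0
    cc-independent zero d h [] = P.trans (P.sym (ZP.*-identityˡ (d []))) (h [])
    cc-independent (suc n) d h = λ { (true ∷ s) → top s ; (false ∷ s) → cc-independent n (λ s → d (false ∷ s)) bottom s }
      where
      top : ∀ s → d (true ∷ s) ≡ + 0
      top = cc-independent n (λ s → d (true ∷ s)) (λ a → ZP.*-cancelˡ-≡ f _ _ (P.trans
        (P.trans (P.sym (Σ₀-*ˡ n f (λ s → cc a s ℤ.* d (true ∷ s)))) (P.trans (Σ₀-cong n (λ s → P.trans (P.sym (ZP.*-assoc f (cc a s) (d (true ∷ s)))) (P.cong (ℤ._* d (true ∷ s)) (P.sym (cc-top a s)))))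
          (P.trans (P.sym (ZP.+-identityˡ _)) (P.trans (P.cong₂ ℤ._+_ (P.sym (Σ₀-zero n (λ s → P.trans (P.cong (ℤ._* d (false ∷ s)) (P.trans (cc-false (suc n ∷ a) s) (cc-degree (suc n) a s NP.≤-refl))) (ZP.*-zeroˡ (d (false ∷ s)))))) P.refl)
            (h (suc n ∷ a)))))) (P.sym (ZP.*-zeroʳ f))))
      bottom : ∀ a → Σ₀ n (λ s → cc a s ℤ.* d (false ∷ s)) ≡ + 0
      bottom a = P.trans (P.sym (ZP.+-identityʳ _)) (P.trans (P.cong₂ ℤ._+_ (Σ₀-cong n (λ s → P.cong (ℤ._* d (false ∷ s)) (P.sym (cc-false a s))))
        (P.sym (Σ₀-zero n (λ s → P.trans (P.cong (cc a (true ∷ s) ℤ.*_) (top s)) (ZP.*-zeroʳ (cc a (true ∷ s))))))) (h a))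

    -- A part above M already makes the size exceed M, so the additional letters do not contribute.
    stable : ∀ k M (g : List ℕ → ℤ) → (∀ μ → M < sum μ → g μ ≡ + 0) → Σ₀ (k ℕ.+ M) (λ s → g (parts s)) ≡ Σ₀ M (λ s → g (parts s))
    stable zero M g h = P.refl
    stable (suc k) M g h = P.trans (P.cong₂ ℤ._+_ (stable k M g h) (Σ₀-zero (k ℕ.+ M) (λ s → h _ (NP.≤-trans (s≤s (NP.m≤n+m M k)) (NP.m≤m+n _ (sum (parts s))))))) (ZP.+-identityʳ _)

    pad : ∀ k {n} → Vec Bool n → Vec Bool (k ℕ.+ n)
    pad zero s = s
    pad (suc k) s = false ∷ pad k s

    parts-pad : ∀ k {n} (s : Vec Bool n) → parts (pad k s) ≡ parts s
    parts-pad zero s = P.refl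
    parts-pad (suc k) s = parts-pad k s

    -- By the induction hypothesis the lower powers of β in d vanish; only the β-free coefficient of
    -- X then meets the top coefficient of d.
    tail-zero : ∀ b (g : ℕ → ℤ) → (∀ i → i < b → g (b ∸ suc i) ≡ + 0) → ∀ (h : ℕ → ℤ) → Σℤ (range0 b) (λ i → h i ℤ.* g (b ∸ i)) ≡ h 0 ℤ.* g b
    tail-zero b g z h = P.trans (P.cong (λ c → h 0 ℤ.* g b ℤ.+ c) (go suc b (λ i p → z i p))) (ZP.+-identityʳ _)
      where
      go : ∀ (c : ℕ → ℕ) m → (∀ i → i < m → g (b ∸ c i) ≡ + 0) → Σℤ (applyUpTo c m) (λ i → h i ℤ.* g (b ∸ i)) ≡ + 0
      go c zero p = P.refl
      go c (suc m) p = P.cong₂ ℤ._+_ (P.trans (P.cong (h (c 0) ℤ.*_) (p 0 (s≤s z≤n))) (ZP.*-zeroʳ (h (c 0)))) (go (λ i → c (suc i)) m (λ i q → p (suc i) (s≤s q)))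

    -- Induction on the power of β reduces to β = 0, where each degree is unitriangular up to f.
    independent : (X : List ℕ → ℕ → List ℕ → ℤ) → (∀ {n} (s : Vec Bool n) a → X (parts s) 0 a ≡ cc (reverse a) s) →
      (d : List ℕ → ℕ → ℤ) →
      (∀ b a → ∃ λ N → sum a ≤ N × Σℤ (strictUpTo N) (λ μ → Σℤ (range0 b) (λ b₁ → X μ b₁ a ℤ.* d μ (b ∸ b₁))) ≡ + 0) →
      ∀ b {n} (s : Vec Bool n) → d (parts s) b ≡ + 0
    independent X X₀ d hyp = <-rec (λ b → ∀ {n} (s : Vec Bool n) → d (parts s) b ≡ + 0) step
      where
      step : ∀ b → (∀ {b′} → b′ < b → ∀ {n} (s : Vec Bool n) → d (parts s) b′ ≡ + 0) → ∀ {n} (s : Vec Bool n) → d (parts s) b ≡ + 0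
      step b ih {n} σ = P.trans (P.sym (P.trans (P.cong (λ μ → if sum μ ≡ᵇ M then d μ b else + 0) (parts-pad M σ))
          (P.cong (if_then d (parts σ) b else + 0) (P.trans (P.cong (_≡ᵇ M) (size-parts σ)) (≡ᵇ-refl M)))))
        (cc-independent (M ℕ.+ n) (λ s → d′ (parts s)) zero-sum (pad M σ))
        where
        M = size σ
        -- At β = 0 everything is homogeneous, so d is cut down to the partitions of the size of σ.
        -- The sum up to any N ≥ M contains all of them, whichever N the hypothesis provides.
        d′ : List ℕ → ℤ
        d′ μ = if sum μ ≡ᵇ M then d μ b else + 0
        d′-zero : ∀ μ → sum μ ≢ M → d′ μ ≡ + 0
        d′-zero μ p with sum μ ≡ᵇ M in e
        ... | false = P.refl
        ... | true = ⊥-elim (p (NP.≡ᵇ⇒≡ (sum μ) M (P.subst T (P.sym e) _)))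
        X-zero : ∀ {n} (s : Vec Bool n) a → sum a ≢ size s → X (parts s) 0 a ≡ + 0
        X-zero s a p = P.trans (X₀ s a) (cc-size (reverse a) s (λ q → p (P.trans (sum-reverse a) q)))
          where
          open import Data.List.Relation.Binary.Permutation.Propositional.Properties using (↭-reverse)
          open import Data.List.Relation.Binary.Permutation.Propositional using (↭-sym)
          open import Data.Nat.ListAction.Properties using (sum-↭)
          sum-reverse : ∀ a → sum a ≡ sum (reverse a)
          sum-reverse a = sum-↭ (↭-sym (↭-reverse a))
        main : ∀ a → sum a ≡ M → ∃ λ N → M ≤ N × Σ₀ N (λ s → X (parts s) 0 a ℤ.* d′ (parts s)) ≡ + 0
        main a e with hyp b a
        ... | N , le , h = N , P.subst (_≤ N) e le , P.trans (Σ₀-cong N (λ s → P.sym (term s))) (P.trans (P.sym (strict-sum N (λ μ → Σℤ (range0 b) (λ b₁ → X μ b₁ a ℤ.* d μ (b ∸ b₁))))) h)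
          where
          term : ∀ s → ι₀ (sum (parts s) ≤ᵇ N) ℤ.* Σℤ (range0 b) (λ b₁ → X (parts s) b₁ a ℤ.* d (parts s) (b ∸ b₁)) ≡ X (parts s) 0 a ℤ.* d′ (parts s)
          term s = P.trans (P.cong (ι₀ (sum (parts s) ≤ᵇ N) ℤ.*_) (tail-zero b (d (parts s)) (λ i p → ih (NP.∸-monoʳ-< (s≤s z≤n) p) s) (λ b₁ → X (parts s) b₁ a))) go
            where
            go : ι₀ (sum (parts s) ≤ᵇ N) ℤ.* (X (parts s) 0 a ℤ.* d (parts s) b) ≡ X (parts s) 0 a ℤ.* d′ (parts s)
            go with size s NP.≟ M
            ... | yes q = P.trans (P.cong (λ c → ι₀ c ℤ.* (X (parts s) 0 a ℤ.* d (parts s) b)) (≤⇒≤ᵇ≡ (P.subst (_≤ N) (P.trans e (P.sym (P.trans (size-parts s) q))) le)))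
                (P.trans (ZP.*-identityˡ _) (P.cong (λ c → X (parts s) 0 a ℤ.* (if c then d (parts s) b else + 0)) (P.sym (P.trans (P.cong (_≡ᵇ M) (P.trans (size-parts s) q)) (≡ᵇ-refl M)))))
            ... | no q = P.trans (P.cong (λ c → ι₀ (sum (parts s) ≤ᵇ N) ℤ.* (c ℤ.* d (parts s) b)) x0) (P.trans (P.cong (ι₀ (sum (parts s) ≤ᵇ N) ℤ.*_) (ZP.*-zeroˡ (d (parts s) b)))
                (P.trans (ZP.*-zeroʳ (ι₀ (sum (parts s) ≤ᵇ N))) (P.sym (P.trans (P.cong (ℤ._* d′ (parts s)) x0) (ZP.*-zeroˡ (d′ (parts s)))))))
              where
              x0 = X-zero s a (λ r → q (P.trans (P.sym r) e))
        zero-sum : ∀ a → Σ₀ (M ℕ.+ n) (λ s → cc a s ℤ.* d′ (parts s)) ≡ + 0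
        zero-sum a with sum (reverse a) NP.≟ M
        ... | no q = Σ₀-zero (M ℕ.+ n) term
          where
          term : ∀ s → cc a s ℤ.* d′ (parts s) ≡ + 0
          term s with size s NP.≟ M
          ... | no p = P.trans (P.cong (cc a s ℤ.*_) (d′-zero (parts s) (λ r → p (P.trans (P.sym (size-parts s)) r)))) (ZP.*-zeroʳ (cc a s))
          ... | yes p = P.trans (P.cong (ℤ._* d′ (parts s)) (P.trans (P.trans (P.cong (λ l → cc l s) (P.sym (LP.reverse-involutive a))) (P.sym (X₀ s (reverse a))))
              (X-zero s (reverse a) (λ r → q (P.trans r p))))) (ZP.*-zeroˡ (d′ (parts s)))
        ... | yes e with main (reverse a) e
        ...   | N , le , h = P.trans (Σ₀-cong (M ℕ.+ n) (λ s → P.cong (ℤ._* d′ (parts s)) (P.trans (P.cong (λ l → cc l s) (P.sym (LP.reverse-involutive a))) (P.sym (X₀ s (reverse a))))))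
            (P.trans (P.trans (P.cong (λ k → Σ₀ k g′) (NP.+-comm M n)) (stable n M g vanish)) (P.trans (P.sym (stable (N ∸ M) M g vanish)) (P.trans (P.cong (λ k → Σ₀ k g′) (NP.m∸n+n≡m le)) h)))
          where
          g : List ℕ → ℤ
          g μ = X μ 0 (reverse a) ℤ.* d′ μ
          g′ : ∀ {k} → Vec Bool k → ℤ
          g′ s = g (parts s)
          vanish : ∀ μ → M < sum μ → g μ ≡ + 0
          vanish μ p = P.trans (P.cong (X μ 0 (reverse a) ℤ.*_) (d′-zero μ (λ q → NP.<⇒≢ p (P.sym q)))) (ZP.*-zeroʳ (X μ 0 (reverse a)))

-- Coefficients

-- (w , i , n) stands for w βⁱ xⁿ
Term : Set
Term = ℤ × ℕ × List ℕ

at : ℕ → List ℕ → Term → ℤ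
at b a (w , i , n) = w ℤ.* ι₀ ((i ≡ᵇ b) ∧ eqList n a)

mul : Term → Term → Term
mul (w , i , n) (w′ , j , m) = w ℤ.* w′ , i ℕ.+ j , n ++ m

cnt : List Term → ℕ → List ℕ → ℤ
cnt ts b a = ∑₀ ts (at b a)

eqList-++ : ∀ n m a c → length n ≡ length a → eqList (n ++ m) (a ++ c) ≡ eqList n a ∧ eqList m c
eqList-++ [] m [] c e = P.refl
eqList-++ (x ∷ n) m (y ∷ a) c e = P.trans (P.cong ((x ≡ᵇ y) ∧_) (eqList-++ n m a c (NP.suc-injective e))) (P.sym (BP.∧-assoc (x ≡ᵇ y) (eqList n a) (eqList m c)))

split-δ : ∀ i j b → ∑₀ (range0 b) (λ b₁ → ι₀ (i ≡ᵇ b₁) ℤ.* ι₀ (j ≡ᵇ b ∸ b₁)) ≡ ι₀ (i ℕ.+ j ≡ᵇ b)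
split-δ i j b = go i b
  where
  vanish : ∀ (l : List ℕ) (g : ℕ → ℤ) → ∑₀ l (λ b₁ → + 0 ℤ.* g b₁) ≡ + 0
  vanish l g = P.trans (∑₀-cong l (λ b₁ → ZP.*-zeroˡ (g b₁))) (∑₀-zero l)
  shifted : ∀ m (g : ℕ → ℤ) → ∑₀ (applyUpTo suc m) g ≡ ∑₀ (upTo m) (λ k → g (suc k))
  shifted m g = P.trans (P.cong (λ l → ∑₀ l g) (P.sym (LP.map-upTo suc m))) (PS.∑-map 0 suc (upTo m) g)
  go : ∀ i b → ∑₀ (range0 b) (λ b₁ → ι₀ (i ≡ᵇ b₁) ℤ.* ι₀ (j ≡ᵇ b ∸ b₁)) ≡ ι₀ (i ℕ.+ j ≡ᵇ b)
  go zero b = P.trans (P.cong₂ ℤ._+_ (ZP.*-identityˡ (ι₀ (j ≡ᵇ b))) (P.trans (shifted b _) (vanish (upTo b) (λ k → ι₀ (j ≡ᵇ b ∸ suc k))))) (ZP.+-identityʳ _)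
  go (suc i) zero = P.trans (ZP.+-identityʳ _) (ZP.*-zeroˡ (ι₀ (j ≡ᵇ 0)))
  go (suc i) (suc b) = P.trans (P.cong₂ ℤ._+_ (ZP.*-zeroˡ (ι₀ (j ≡ᵇ suc b))) (shifted (suc b) (λ b₁ → ι₀ (suc i ≡ᵇ b₁) ℤ.* ι₀ (j ≡ᵇ suc b ∸ b₁)))) (P.trans (ZP.+-identityˡ _) (go i b))

module Powers (R : CommutativeRing 0ℓ 0ℓ) where
  open RingKit R hiding (refl; trans)
  open CommutativeRing R using () renaming (refl to ≈-refl; trans to ≈-trans)

  xp : List Carrier → List ℕ → Carrier
  xp (x ∷ xs) (n ∷ ns) = pw x n * xp xs ns
  xp _ _ = 1#

  pw-+ : ∀ x m n → pw x (m ℕ.+ n) ≈ pw x m * pw x n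
  pw-+ x zero n = sym (*-identityˡ _)
  pw-+ x (suc m) n = ≈-trans (*-congˡ (pw-+ x m n)) (sym (*-assoc _ _ _))

  xp-++ : ∀ xs ys n m → length n ≡ length xs → xp (xs ++ ys) (n ++ m) ≈ xp xs n * xp ys m
  xp-++ [] ys [] m e = sym (*-identityˡ _)
  xp-++ (x ∷ xs) ys (k ∷ n) m e = ≈-trans (*-congˡ (xp-++ xs ys n m (NP.suc-injective e))) (sym (*-assoc _ _ _))

  term : Carrier → List Carrier → Term → Carrier
  term β xs (w , i , n) = fromℤ w * (pw β i * xp xs n)

  eval : Carrier → List Carrier → List Term → Carrier
  eval β xs ts = ∑ ts (term β xs)

embed : ∀ L → PS.Carrier L → PS.Carrier (suc L)
embed L f zero = f
embed L f (suc n) = PS.0# L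

embed-* : ∀ L f g → PS._≈_ (suc L) (embed L (PS._*_ L f g)) (PS._*_ (suc L) (embed L f) (embed L g))
embed-* L f g zero = PS.refl L
embed-* L f g (suc n) = PS.sym L (PS.trans L (PS.+-cong L (PS.zeroʳ L f) (PowerSeries.·-zeroˡ (PS L) (embed L g) n)) (PS.+-identityʳ L _))

embed-1 : ∀ L → PS._≈_ (suc L) (embed L (PS.1# L)) (PS.1# (suc L))
embed-1 L zero = PS.refl L
embed-1 L (suc n) = PS.refl L

embed-var : ∀ L k → PS._≈_ (suc L) (var (suc L) (suc k)) (embed L (var L k))
embed-var L k zero = PS.refl L
embed-var L k (suc n) = PS.refl L

embed-pw : ∀ L k n → PS._≈_ (suc L) (PS.pw (suc L) (var (suc L) (suc k)) n) (embed L (PS.pw L (var L k) n))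
embed-pw L k zero = PS.sym (suc L) (embed-1 L)
embed-pw L k (suc n) = PS.trans (suc L) (PS.*-cong (suc L) (embed-var L k) (embed-pw L k n)) (PS.sym (suc L) (embed-* L (var L k) (PS.pw L (var L k) n)))

-- Multiplication by the n-th power of the outermost variable moves a constant series to position n.
shift-var : ∀ L n f m → PS._≈_ L (PS._*_ (suc L) (PS.pw (suc L) (var (suc L) 0) n) (embed L f) m) (if n ≡ᵇ m then f else PS.0# L)
shift-var L zero f zero = PS.*-identityˡ (suc L) (embed L f) 0
shift-var L zero f (suc m) = PS.*-identityˡ (suc L) (embed L f) (suc m)
shift-var L (suc n) f m = PS.trans L (PS.*-assoc (suc L) v (PS.pw (suc L) v n) (embed L f) m) (times m)
  where
  v = var (suc L) 0
  F = PS._*_ (suc L) (PS.pw (suc L) v n) (embed L f)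
  one : ∀ k → PS._≈_ L (v (suc k)) (PS.1# (suc L) k)
  one zero = PS.refl L
  one (suc k) = PS.refl L
  times : ∀ m → PS._≈_ L (PS._*_ (suc L) v F m) (if suc n ≡ᵇ m then f else PS.0# L)
  times zero = PS.zeroˡ L (F 0)
  times (suc m) = PS.trans L (PS.+-cong L (PS.zeroˡ L (F (suc m))) (PS.trans L (PowerSeries.·-cong (PS L) {g = F} one (λ _ → PS.refl L) m)
    (PS.trans L (PowerSeries.·-identityˡ (PS L) F m) (shift-var L n f m)))) (PS.+-identityˡ L _)

vlist : ∀ L → ℕ → ℕ → List (PS.Carrier L)
vlist L k zero = []
vlist L k (suc j) = var L k ∷ vlist L (suc k) j

xp-embed : ∀ L k j n → PS._≈_ (suc L) (Powers.xp (PS (suc L)) (vlist (suc L) (suc k) j) n) (embed L (Powers.xp (PS L) (vlist L k j) n))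
xp-embed L k zero n = PS.sym (suc L) (embed-1 L)
xp-embed L k (suc j) [] = PS.sym (suc L) (embed-1 L)
xp-embed L k (suc j) (m ∷ n) = PS.trans (suc L) (PS.*-cong (suc L) (embed-pw L k m) (xp-embed L (suc k) j n)) (PS.sym (suc L) (embed-* L (PS.pw L (var L k) m) (Powers.xp (PS L) (vlist L (suc k) j) n)))

coef-monomial : ∀ L n → length n ≡ L → ∀ e → coef L (Powers.xp (PS L) (vlist L 0 L) n) e ≡ ι₀ (eqList n (Vec.toList e))
coef-monomial zero [] e [] = P.refl
coef-monomial (suc L) (m ∷ n) p (k ∷ e) = P.trans (coef-cong L (PS.trans L (PS.*-congˡ (suc L) {PS.pw (suc L) (var (suc L) 0) m} (xp-embed L 0 L n) k) (shift-var L m F k)) e) (go (m ≡ᵇ k))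
  where
  F = Powers.xp (PS L) (vlist L 0 L) n
  go : ∀ b → coef L (if b then F else PS.0# L) e ≡ ι₀ (b ∧ eqList n (Vec.toList e))
  go true = coef-monomial L n (NP.suc-injective p) e
  go false = coef-0 L e

coef-fromℕ : ∀ L k f e → coef L (PS._*_ L (PS.fromℕ L k) f) e ≡ + k ℤ.* coef L f e
coef-fromℕ L zero f e = P.trans (coef-cong L (PS.zeroˡ L f) e) (P.trans (coef-0 L e) (P.sym (ZP.*-zeroˡ (coef L f e))))
coef-fromℕ L (suc k) f e = P.trans (coef-cong L (PS.trans L (PS.*-congʳ L (PS.fromℕ-suc L k)) (PS.trans L (PS.distribʳ L f (PS.1# L) (PS.fromℕ L k)) (PS.+-congʳ L (PS.*-identityˡ L f)))) e)
  (P.trans (coef-+ L f _ e) (P.trans (P.cong (λ z → coef L f e ℤ.+ z) (coef-fromℕ L k f e)) (P.sym (ZP.suc-* (+ k) (coef L f e)))))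

coef-scale : ∀ L w f e → coef L (PS._*_ L (PS.fromℤ L w) f) e ≡ w ℤ.* coef L f e
coef-scale L (+ k) f e = coef-fromℕ L k f e
coef-scale L -[1+ k ] f e = P.trans (coef-cong L (PS.sym L (PS.-‿distribˡ-* L (PS.fromℕ L (suc k)) f)) e) (P.trans (coef-neg L _ e)
  (P.trans (P.cong ℤ.-_ (coef-fromℕ L (suc k) f e)) (ZP.neg-distribˡ-* (+ suc k) (coef L f e))))

module Detection (L : ℕ) (e : Vec ℕ L) where
  open PS L using (Carrier; _≈_; _*_; fromℤ; pw; 0#; 1#; ∑)
  open Powers (PS L)

  -- The monomials in the values of ps have distinct exponents at e, up to the ones given by ps.
  Detects : List (Carrier × ℕ) → Set
  Detects ps = ∀ n → length n ≡ length ps → coef L (xp (map fst ps) n) e ≡ ι₀ (eqList n (map snd ps))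

  detects-drop : ∀ {v ps} → Detects ((v , 0) ∷ ps) → Detects ps
  detects-drop D n p = P.trans (coef-cong L (PS.sym L (PS.*-identityˡ L _)) e) (D (0 ∷ n) (P.cong suc p))

  detects-drops : ∀ {zs ps} → All (λ q → snd q ≡ 0) zs → Detects (zs ++ ps) → Detects ps
  detects-drops [] D = D
  detects-drops (P.refl ∷ z) D = detects-drops z (detects-drop D)

  -- A vanishing value behaves like a variable of which only the exponent 0 is looked for. This
  -- serves both for setting β to 0 and for a variable that is left out.
  detects-zero : ∀ {ps} → Detects ps → Detects ((0# , 0) ∷ ps)
  detects-zero D (zero ∷ n) p = P.trans (coef-cong L (PS.*-identityˡ L _) e) (D n (NP.suc-injective p))
  detects-zero D (suc k ∷ n) p = P.trans (coef-cong L (PS.trans L (PS.*-congʳ L (PS.zeroˡ L _)) (PS.zeroˡ L _)) e) (coef-0 L e)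

  rearrange : ∀ {ps qs} → ps ↭ qs → ∀ n → length n ≡ length qs →
    ∃ λ m → length m ≡ length ps × (xp (map fst qs) n ≈ xp (map fst ps) m) × eqList m (map snd ps) ≡ eqList n (map snd qs)
  rearrange ↭.refl n p = n , p , PS.refl L , P.refl
  rearrange (↭.prep (v , a) π) (k ∷ n) p with rearrange π n (NP.suc-injective p)
  ... | m , q , x , y = k ∷ m , P.cong suc q , PS.*-congˡ L x , P.cong ((k ≡ᵇ a) ∧_) y
  rearrange (↭.swap (v , a) (u , c) π) (k ∷ l ∷ n) p with rearrange π n (NP.suc-injective (NP.suc-injective p))
  ... | m , q , x , y = l ∷ k ∷ m , P.cong (λ i → suc (suc i)) q ,
    PS.trans L (PS.*-congˡ L (PS.*-congˡ L x)) (solve 3 (λ a b c → a :* (b :* c) := b :* (a :* c)) (PS.refl L) _ _ _) ,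
    P.trans (P.cong (λ z → (l ≡ᵇ a) ∧ (k ≡ᵇ c) ∧ z) y) (exchange (l ≡ᵇ a) (k ≡ᵇ c) _)
    where
    open PS L using (solve; _:*_; _:=_)
    exchange : ∀ a b c → a ∧ b ∧ c ≡ b ∧ a ∧ c
    exchange false false c = P.refl
    exchange false true c = P.refl
    exchange true b c = P.refl
  rearrange (↭.trans π ρ) n p with rearrange ρ n p
  ... | m , q , x , y with rearrange π m q
  ...   | m′ , q′ , x′ , y′ = m′ , q′ , PS.trans L x x′ , P.trans y′ y

  detects-↭ : ∀ {ps qs} → ps ↭ qs → Detects ps → Detects qs
  detects-↭ π D n p with rearrange π n p
  ... | m , q , x , y = P.trans (coef-cong L x e) (P.trans (D m q) (P.cong ι₀ y))

  Fits : ℕ → List Term → Set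
  Fits k = All (λ t → length (snd (snd t)) ≡ k)

  -- The bridge from ring elements to counting: a coefficient of an evaluated list of terms is the
  -- signed number of terms with the wanted exponents.
  coef-eval : ∀ {β b} qs {ts} → Detects ((β , b) ∷ qs) → Fits (length qs) ts → coef L (eval β (map fst qs) ts) e ≡ cnt ts b (map snd qs)
  coef-eval qs D [] = coef-0 L e
  coef-eval qs {(w , i , n) ∷ ts} D (p ∷ ps) = P.trans (coef-+ L _ _ e) (P.cong₂ ℤ._+_
    (P.trans (coef-scale L w _ e) (P.cong (w ℤ.*_) (D (i ∷ n) (P.cong suc p)))) (coef-eval qs D ps))

  infixl 7 _⊗_
  _⊗_ : List Term → List Term → List Term
  [] ⊗ us = []
  (t ∷ ts) ⊗ us = map (mul t) us ++ ts ⊗ us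

  eval-⊗ : ∀ β xs ys {ts} → Fits (length xs) ts → ∀ us → eval β xs ts * eval β ys us ≈ eval β (xs ++ ys) (ts ⊗ us)
  eval-⊗ β xs ys [] us = PS.zeroˡ L _
  eval-⊗ β xs ys {t@(w , i , n) ∷ ts} (p ∷ ps) us = PS.trans L (PS.distribʳ L _ _ _) (PS.trans L
    (PS.+-cong L (PS.trans L (PS.∑-*ˡ L (term β xs t) us (term β ys)) (PS.trans L (PS.∑-cong L us one) (PS.sym L (PS.∑-map L (mul t) us (term β (xs ++ ys)))))) (eval-⊗ β xs ys ps us))
    (PS.sym L (PS.∑-++ L (map (mul t) us) (ts ⊗ us) (term β (xs ++ ys)))))
    where
    one : ∀ u → term β xs t * term β ys u ≈ term β (xs ++ ys) (mul t u)
    one (w′ , j , m) = PS.sym L (PS.trans L (PS.*-cong L (PS.fromℤ-* L w w′) (PS.*-cong L (pw-+ β i j) (xp-++ xs ys n m p)))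
      (solve 6 (λ a b c d f g → a :* b :* (c :* d :* (f :* g)) := a :* (c :* f) :* (b :* (d :* g))) (PS.refl L) _ _ _ _ _ _))
      where open PS L using (solve; _:*_; _:=_)

  cnt-++ : ∀ ts us b a → cnt (ts ++ us) b a ≡ cnt ts b a ℤ.+ cnt us b a
  cnt-++ ts us b a = PS.∑-++ 0 ts us (at b a)

  -- The x-part and the y-part of the exponents are compared separately, but the powers of β add up;
  -- this leaves the convolution in b.
  cnt-⊗ : ∀ a c {ts} → Fits (length a) ts → ∀ us b → cnt (ts ⊗ us) b (a ++ c) ≡ ∑₀ (range0 b) (λ b₁ → cnt ts b₁ a ℤ.* cnt us (b ∸ b₁) c)
  cnt-⊗ a c [] us b = P.sym (P.trans (∑₀-cong (range0 b) (λ b₁ → ZP.*-zeroˡ (cnt us (b ∸ b₁) c))) (∑₀-zero (range0 b)))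
  cnt-⊗ a c {t@(w , i , n) ∷ ts} (p ∷ ps) us b = P.trans (cnt-++ (map (mul t) us) (ts ⊗ us) b (a ++ c)) (P.trans (P.cong₂ ℤ._+_ (P.trans (PS.∑-map 0 (mul t) us (at b (a ++ c))) one) (cnt-⊗ a c ps us b))
    (P.trans (P.sym (PS.∑-+ 0 (range0 b) (λ b₁ → at b₁ a t ℤ.* cnt us (b ∸ b₁) c) (λ b₁ → cnt ts b₁ a ℤ.* cnt us (b ∸ b₁) c)))
      (∑₀-cong (range0 b) (λ b₁ → P.sym (ZP.*-distribʳ-+ (cnt us (b ∸ b₁) c) (at b₁ a t) (cnt ts b₁ a))))))
    where
    open PS 0 using (solve; _:*_; _:=_)
    one : ∑₀ us (λ u → at b (a ++ c) (mul t u)) ≡ ∑₀ (range0 b) (λ b₁ → at b₁ a t ℤ.* cnt us (b ∸ b₁) c)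
    one = P.trans (∑₀-cong us conv) (P.trans (∑₀-swap us (range0 b) (λ u b₁ → at b₁ a t ℤ.* at (b ∸ b₁) c u)) (∑₀-cong (range0 b) (λ b₁ → P.sym (∑₀-*ˡ (at b₁ a t) us (at (b ∸ b₁) c)))))
      where
      conv : ∀ u → at b (a ++ c) (mul t u) ≡ ∑₀ (range0 b) (λ b₁ → at b₁ a t ℤ.* at (b ∸ b₁) c u)
      conv (w′ , j , m) = P.trans (P.cong (w ℤ.* w′ ℤ.*_) (P.trans (ι₀-∧ (i ℕ.+ j ≡ᵇ b) _) (P.cong₂ ℤ._*_ (P.sym (split-δ i j b)) (P.trans (P.cong ι₀ (eqList-++ n m a c p)) (ι₀-∧ (eqList n a) (eqList m c))))))
        (P.trans (P.cong (w ℤ.* w′ ℤ.*_) (∑₀-*ʳ (ι₀ (eqList n a) ℤ.* ι₀ (eqList m c)) (range0 b) (λ b₁ → ι₀ (i ≡ᵇ b₁) ℤ.* ι₀ (j ≡ᵇ b ∸ b₁))))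
        (P.trans (∑₀-*ˡ (w ℤ.* w′) (range0 b) (λ b₁ → ι₀ (i ≡ᵇ b₁) ℤ.* ι₀ (j ≡ᵇ b ∸ b₁) ℤ.* (ι₀ (eqList n a) ℤ.* ι₀ (eqList m c)))) (∑₀-cong (range0 b) (λ b₁ →
          P.trans (solve 6 (λ w w′ i j n m → w :* w′ :* (i :* j :* (n :* m)) := w :* (i :* n) :* (w′ :* (j :* m))) P.refl w w′ (ι₀ (i ≡ᵇ b₁)) (ι₀ (j ≡ᵇ b ∸ b₁)) (ι₀ (eqList n a)) (ι₀ (eqList m c)))
            (P.cong₂ ℤ._*_ (P.cong (w ℤ.*_) (P.sym (ι₀-∧ (i ≡ᵇ b₁) (eqList n a)))) (P.cong (w′ ℤ.*_) (P.sym (ι₀-∧ (j ≡ᵇ b ∸ b₁) (eqList m c)))))))))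

-- Diagrams and coefficients in the form of the definitions

boxesFrom-segs : ∀ i la → boxesFrom i la ≡ segs i la []
boxesFrom-segs i [] = P.refl
boxesFrom-segs i (l ∷ la) = P.cong₂ _++_ (map-cells i i l) (boxesFrom-segs (suc i) la)

memB-++ : ∀ p bs bs′ → memB p (bs ++ bs′) ≡ memB p bs ∨ memB p bs′
memB-++ p [] bs′ = P.refl
memB-++ p (b ∷ bs) bs′ = P.trans (P.cong ((p ≡B b) ∨_) (memB-++ p bs bs′)) (P.sym (BP.∨-assoc (p ≡B b) _ _))

memB-false : ∀ p bs → All (λ b → (p ≡B b) ≡ false) bs → memB p bs ≡ false
memB-false p [] [] = P.refl
memB-false p (b ∷ bs) (e ∷ es) rewrite e = memB-false p bs es

memB-lower : ∀ i j la → memB (i , j) (segs (suc i) la []) ≡ false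
memB-lower i j la = memB-false (i , j) (segs (suc i) la []) (All.map (λ {x} p → P.cong (_∧ (j ≡ᵇ snd x)) (<⇒≢ᵇ p)) (segs-lower (suc i) la []))

memB-upper : ∀ i c r b → i < fst b → memB b (cells i c r) ≡ false
memB-upper i c r b p = memB-false b (cells i c r) (All.map (λ { {x} (e , _) → P.cong (_∧ (snd b ≡ᵇ snd x)) (P.trans (P.cong (fst b ≡ᵇ_) e) (>⇒≢ᵇ p)) }) (cells-in i c r))

memB-skip : ∀ i c r k → c < k → memB (i , k) (cells i c (suc r)) ≡ memB (i , k) (cells i (suc c) r)
memB-skip i c r k p rewrite >⇒≢ᵇ p | BP.∧-zeroʳ (i ≡ᵇ i) = P.refl

cells-⊆ : ∀ i c r r′ → all (λ p → memB p (cells i c r′)) (cells i c r) ≡ (r ≤ᵇ r′)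
cells-⊆ i c zero r′ = P.refl
cells-⊆ i c (suc r) zero = P.refl
cells-⊆ i c (suc r) (suc r′) = P.trans (P.cong₂ _∧_ (P.cong₂ (λ u v → (u ∧ v) ∨ memB (i , c) (cells i (suc c) r′)) (≡ᵇ-refl i) (≡ᵇ-refl c))
  (all-cong (cells i (suc c) r) (All.map (λ { {_ , k} (P.refl , p , _) → memB-skip i c r′ k p }) (cells-in i (suc c) r))))
  (P.trans (cells-⊆ i (suc c) r r′) (≤ᵇ-suc r r′))
  where
  ≤ᵇ-suc : ∀ m n → (m ≤ᵇ n) ≡ (suc m ≤ᵇ suc n)
  ≤ᵇ-suc zero n = P.refl
  ≤ᵇ-suc (suc m) n = P.refl

all-++ : {A : Set} (p : A → Bool) (l l′ : List A) → all p (l ++ l′) ≡ all p l ∧ all p l′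
all-++ p [] l′ = P.refl
all-++ p (a ∷ l) l′ = P.trans (P.cong (p a ∧_) (all-++ p l l′)) (P.sym (BP.∧-assoc (p a) _ _))

contained : ∀ i {M} {mu} → Str M mu → ∀ la → all (λ p → memB p (segs i la [])) (segs i mu []) ≡ sub mu la
contained i [] la = P.refl
contained i (q ∷ st) [] = P.refl
contained i {mu = suc m ∷ mu} (q ∷ st) (l ∷ la) = P.trans (all-++ _ (cells i i (suc m)) (segs (suc i) mu [])) (P.cong₂ _∧_
  (P.trans (all-cong (cells i i (suc m)) (All.map (λ { {_ , k} (P.refl , _) → P.trans (memB-++ (i , k) (cells i i l) _) (P.trans (P.cong (memB (i , k) (cells i i l) ∨_) (memB-lower i k la)) (BP.∨-identityʳ _)) }) (cells-in i i (suc m)))) (cells-⊆ i i (suc m) l))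
  (P.trans (all-cong (segs (suc i) mu []) (All.map (λ {b} p → P.trans (memB-++ b (cells i i l) _) (P.cong (_∨ memB b (segs (suc i) la [])) (memB-upper i i l b p))) (segs-lower (suc i) mu []))) (contained (suc i) st la)))

containedB-sub : ∀ {M mu} → Str M mu → ∀ la → containedB mu la ≡ sub mu la
containedB-sub {mu = mu} st la = P.trans (P.cong₂ (λ u v → all (λ p → memB p u) v) (boxesFrom-segs 1 la) (boxesFrom-segs 1 mu)) (contained 1 st la)

filterB-cong : {A : Set} {p q : A → Bool} (l : List A) → All (λ a → p a ≡ q a) l → filterB p l ≡ filterB q l
filterB-cong [] [] = P.refl
filterB-cong {p = p} (a ∷ l) (e ∷ es) rewrite e | filterB-cong l es = P.refl

filterB-true : {A : Set} (l : List A) → filterB (λ _ → true) l ≡ l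
filterB-true [] = P.refl
filterB-true (a ∷ l) = P.cong (a ∷_) (filterB-true l)

cells-∖ : ∀ i c m l → m ≤ l → filterB (λ p → not (memB p (cells i c m))) (cells i c l) ≡ cells i (c ℕ.+ m) (l ∸ m)
cells-∖ i c zero l le = P.trans (filterB-true (cells i c l)) (P.cong (λ k → cells i k l) (P.sym (NP.+-identityʳ c)))
cells-∖ i c (suc m) (suc l) (s≤s le) rewrite ≡ᵇ-refl i | ≡ᵇ-refl c = P.trans
  (filterB-cong (cells i (suc c) l) (All.map (λ { {_ , k} (P.refl , p , _) → P.cong not (memB-skip′ k p) }) (cells-in i (suc c) l)))
  (P.trans (cells-∖ i (suc c) m l le) (P.cong (λ k → cells i k (l ∸ m)) (P.sym (NP.+-suc c m))))
  where
  memB-skip′ : ∀ k → c < k → ((i ≡ᵇ i) ∧ (k ≡ᵇ c)) ∨ memB (i , k) (cells i (suc c) m) ≡ memB (i , k) (cells i (suc c) m)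
  memB-skip′ k p = memB-skip i c m k p

skew : ∀ i la {M mu} → Str M mu → sub mu la ≡ true → filterB (λ p → not (memB p (segs i mu []))) (segs i la []) ≡ segs i la mu
skew i la [] ok = filterB-true (segs i la [])
skew i (l ∷ la) {mu = suc m ∷ mu} (q ∷ st) ok with suc m ≤ᵇ l in f
... | true = P.trans (filterB-++ _ (cells i i l) (segs (suc i) la [])) (P.cong₂ _++_
  (P.trans (filterB-cong (cells i i l) (All.map (λ { {_ , k} (P.refl , _) → P.cong not (P.trans (memB-++ (i , k) (cells i i (suc m)) _) (P.trans (P.cong (memB (i , k) (cells i i (suc m)) ∨_) (memB-lower i k mu)) (BP.∨-identityʳ _))) }) (cells-in i i l)))
    (cells-∖ i i (suc m) l (≤ᵇ⇒≤′ (suc m) l f)))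
  (P.trans (filterB-cong (segs (suc i) la []) (All.map (λ {b} p → P.cong not (P.trans (memB-++ b (cells i i (suc m)) _) (P.cong (_∨ memB b (segs (suc i) mu [])) (memB-upper i i (suc m) b p)))) (segs-lower (suc i) la []))) (skew (suc i) la st ok)))

skewBoxes-segs : ∀ la {M mu} → Str M mu → sub mu la ≡ true → skewBoxes la mu ≡ segs 1 la mu
skewBoxes-segs la {mu = mu} st ok = P.trans (P.cong₂ (λ u v → filterB (λ p → not (memB p v)) u) (boxesFrom-segs 1 la) (boxesFrom-segs 1 mu)) (skew 1 la st ok)

eqList-refl : ∀ l → eqList l l ≡ true
eqList-refl [] = P.refl
eqList-refl (x ∷ l) rewrite ≡ᵇ-refl x = eqList-refl l

eqList-sound : ∀ l l′ → eqList l l′ ≡ true → l ≡ l′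
eqList-sound [] [] e = P.refl
eqList-sound (x ∷ l) (y ∷ l′) e with x ≡ᵇ y in p
... | true = P.cong₂ _∷_ (NP.≡ᵇ⇒≡ x y (P.subst T (P.sym p) _)) (eqList-sound l l′ e)

bool-ext : ∀ {a b} → (a ≡ true → b ≡ true) → (b ≡ true → a ≡ true) → a ≡ b
bool-ext {true} {true} f g = P.refl
bool-ext {true} {false} f g = P.sym (f P.refl)
bool-ext {false} {true} f g = g P.refl
bool-ext {false} {false} f g = P.refl

-- Lists of variables start with the last variable, the one to be removed first, so exponent vectors
-- are reversed with respect to the definitions.
eqList-reverse : ∀ (w : ℕ → ℕ) k a → eqList (map w (downFrom k)) (reverse a) ≡ eqList (map w (upTo k)) a
eqList-reverse w k a = P.trans (P.cong (λ l → eqList l (reverse a)) (P.trans (P.cong (map w) (P.sym (LP.reverse-upTo k))) (LP.reverse-map w (upTo k))))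
  (bool-ext (λ e → P.trans (P.cong (eqList (map w (upTo k))) (P.sym (LP.reverse-injective {x = map w (upTo k)} {a} (eqList-sound (reverse (map w (upTo k))) (reverse a) e)))) (eqList-refl (map w (upTo k))))
    (λ e → P.trans (P.cong (λ l → eqList (reverse (map w (upTo k))) (reverse l)) (P.sym (eqList-sound (map w (upTo k)) a e))) (eqList-refl (reverse (map w (upTo k))))))

≡ᵇ-cancel : ∀ c i b → (c ℕ.+ i ≡ᵇ c ℕ.+ b) ≡ (i ≡ᵇ b)
≡ᵇ-cancel zero i b = P.refl
≡ᵇ-cancel (suc c) i b = ≡ᵇ-cancel c i b

count-∑ : {A : Set} (p : A → Bool) (l : List A) → + count p l ≡ ∑₀ l (λ a → ι₀ (p a))
count-∑ p [] = P.refl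
count-∑ p (a ∷ l) with p a
... | true = P.cong (λ z → + 1 ℤ.+ z) (count-∑ p l)
... | false = P.trans (count-∑ p l) (P.sym (ZP.+-identityˡ _))

half : ℕ → ℕ
half zero = zero
half (suc zero) = zero
half (suc (suc n)) = suc (half n)

2*≡dbl : ∀ t → 2 ℕ.* t ≡ dbl t
2*≡dbl zero = P.refl
2*≡dbl (suc t) = P.cong suc (P.trans (NP.+-suc t (t ℕ.+ 0)) (P.cong suc (2*≡dbl t)))

isVar-half : ∀ t ℓ → isVar t (suc ℓ) ≡ (t ≡ᵇ half ℓ)
isVar-half t ℓ rewrite NP.+-comm (2 ℕ.* t) 1 | NP.+-comm (2 ℕ.* t) 2 | 2*≡dbl t = go t ℓ
  where
  go : ∀ t ℓ → (ℓ ≡ᵇ dbl t) ∨ (ℓ ≡ᵇ suc (dbl t)) ≡ (t ≡ᵇ half ℓ)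
  go zero zero = P.refl
  go zero (suc zero) = P.refl
  go zero (suc (suc ℓ)) = P.refl
  go (suc t) zero = P.refl
  go (suc t) (suc zero) = P.refl
  go (suc t) (suc (suc ℓ)) = go t ℓ

half-< : ∀ ℓ r → suc ℓ ≤ dbl r → half ℓ < r
half-< zero (suc r) p = s≤s z≤n
half-< (suc zero) (suc r) p = s≤s z≤n
half-< (suc (suc ℓ)) (suc r) (s≤s (s≤s p)) = s≤s (half-< ℓ r p)

half-≡ : ∀ ℓ r → dbl r < suc ℓ → suc ℓ ≤ dbl (suc r) → half ℓ ≡ r
half-≡ zero zero p q = P.refl
half-≡ (suc zero) zero p q = P.refl
half-≡ (suc (suc ℓ)) zero p (s≤s (s≤s ()))
half-≡ zero (suc r) (s≤s ()) q
half-≡ (suc zero) (suc r) (s≤s (s≤s ())) q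
half-≡ (suc (suc ℓ)) (suc r) (s≤s (s≤s p)) (s≤s (s≤s q)) = P.cong suc (half-≡ ℓ r p q)

Letter : ℕ → ℕ → Set
Letter L ℓ = 0 < ℓ × ℓ ≤ L

record Entry (L : ℕ) (S : List ℕ) : Set where
  field
    nonempty : 0 < length S
    bounded : All (Letter L) S

NE-entries : ∀ L → All (Entry L) (NE L)
NE-entries L = go (subsets L) (bounds L)
  where
  bounds : ∀ L → All (All (Letter L)) (subsets L)
  bounds zero = [] ∷ []
  bounds (suc L) = AllP.++⁺ (All.map (All.map (λ { (p , q) → p , NP.m≤n⇒m≤1+n q })) (bounds L))
    (AllP.map⁺ (All.map (λ b → (s≤s z≤n , NP.≤-refl) ∷ All.map (λ { (p , q) → p , NP.m≤n⇒m≤1+n q }) b) (bounds L)))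
  go : ∀ l → All (All (Letter L)) l → All (Entry L) (filterB nonemptyB l)
  go [] [] = []
  go ([] ∷ l) (b ∷ bs) = go l bs
  go ((x ∷ S) ∷ l) (b ∷ bs) = record { nonempty = s≤s z≤n ; bounded = b } ∷ go l bs

fillings : {A : Set} → List A → List Box → List (List (Box × A))
fillings as bs = map (zip bs) (tuples (length bs) as)

svWt : ℕ → List SVEntry → ℕ
svWt t T = sum (map (λ E → count (isVar t) (snd E)) T)

excess : List SVEntry → ℕ
excess T = sum (map (λ E → length (snd E) ∸ 1) T)

svGood : Bool → List SVEntry → Bool
svGood P? T = allPairs T svPairOK ∧ (not P? ∨ all noPrimedDiag T)

svTerm : Bool → ℕ → List SVEntry → Term
svTerm P? r T = ι₀ (svGood P? T) , excess T , map (λ t → svWt t T) (downFrom r)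

svTerms : Bool → ∀ {n} → Vec Bool n → ℕ → List Term
svTerms P? s r = map (svTerm P? r) (fillings (NE (dbl r)) (rows 1 s))

dist len : ℕ → List PPEntry → ℕ
dist ℓ T = distinct (map (λ e → if isEven ℓ then snd (fst e) else fst (fst e)) (filterB (λ e → snd e ≡ᵇ ℓ) T))
len ℓ T = length (filterB (λ e → snd e ≡ᵇ ℓ) T)

ppWt : ℕ → List PPEntry → ℕ
ppWt t T = dist (suc (suc (dbl t))) T ℕ.+ dist (suc (dbl t)) T

defect : ℕ → List PPEntry → ℕ
defect r T = sum (map (λ ℓ → len ℓ T ∸ dist ℓ T) (letters r))

ppGood : Bool → List PPEntry → Bool
ppGood P? T = allPairs T ppPairOK ∧ (not P? ∨ all noUnprimedDiag T)

-- c is the containment of the inner in the outer partition. The defect counts the boxes that repeat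
-- a line; it is the exponent of -β, hence also the source of the sign.
ppTerm : Bool → Bool → ℕ → List PPEntry → Term
ppTerm P? c r T = ι₀ c ℤ.* (ι₀ (ppGood P? T) ℤ.* signℤ (defect r T)) , defect r T , map (λ t → ppWt t T) (downFrom r)

ppTerms : Bool → ∀ {n} → Vec Bool n → Vec Bool n → ℕ → List Term
ppTerms P? s m r = map (ppTerm P? (sub (parts m) (parts s)) r) (fillings (letters r) (segs 1 (parts s) (parts m)))

module Expansion (R : CommutativeRing 0ℓ 0ℓ) where
  open RingKit R
  open Fillings R
  open Powers R

  FS-congˡ : {A : Set} {P : A → Set} (as : List A) → All P as → ∀ bs {f g} →
    (∀ E → length E ≡ length bs → All (λ e → P (snd e)) E → f E ≈ g E) → FS as bs f ≈ FS as bs g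
  FS-congˡ as ps [] h = h [] P.refl []
  FS-congˡ as ps (b ∷ bs) h = ∑-congᵃ as ps (λ a p → FS-congˡ as ps bs (λ E e q → h ((b , a) ∷ E) (P.cong suc e) (p ∷ q)))

  fromℤ-ι : ∀ b → fromℤ (ι₀ b) ≈ ι b
  fromℤ-ι true = refl
  fromℤ-ι false = refl

  xp-map : ∀ (xs : List Carrier) (l : List ℕ) f g → xp xs (map f l) * xp xs (map g l) ≈ xp xs (map (λ t → f t ℕ.+ g t) l)
  xp-map [] l f g = *-identityˡ _
  xp-map (x ∷ xs) [] f g = *-identityˡ _
  xp-map (x ∷ xs) (t ∷ l) f g = trans (solve 4 (λ a b c d → a :* b :* (c :* d) := a :* c :* (b :* d)) refl _ _ _ _) (*-cong (sym (pw-+ x (f t) (g t))) (xp-map xs l f g))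

  xp-zero : ∀ (xs : List Carrier) (l : List ℕ) (f : ℕ → ℕ) → All (λ t → f t ≡ 0) l → xp xs (map f l) ≈ 1#
  xp-zero [] l f z = refl
  xp-zero (x ∷ xs) [] f z = refl
  xp-zero (x ∷ xs) (t ∷ l) f (e ∷ es) = trans (*-cong (resp (pw x) e) (xp-zero xs l f es)) (*-identityˡ _)

  downFrom-< : ∀ r → All (_< r) (downFrom r)
  downFrom-< zero = []
  downFrom-< (suc r) = NP.≤-refl ∷ All.map NP.m≤n⇒m≤1+n (downFrom-< r)

  module _ (β : Carrier) (P? : Bool) where
    open SetValued R β P? using (W; letter; letter-old; letter-new)

    letter-xp : ∀ xs ℓ → Letter (dbl (length xs)) ℓ → letter xs ℓ ≈ xp xs (map (λ t → if isVar t ℓ then 1 else 0) (downFrom (length xs)))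
    letter-xp [] ℓ (p , q) = ⊥-elim (NP.<⇒≱ p q)
    letter-xp (x ∷ xs) (suc ℓ) (p , q) with suc ℓ ≤ᵇ dbl (length xs) in e
    ... | true = trans (letter-xp xs (suc ℓ) (p , ≤ᵇ⇒≤′ (suc ℓ) _ e)) (trans (sym (*-identityˡ _)) (*-congʳ (resp (λ b → pw x (if b then 1 else 0))
      (P.sym (P.trans (isVar-half (length xs) ℓ) (>⇒≢ᵇ (half-< ℓ (length xs) (≤ᵇ⇒≤′ (suc ℓ) _ e))))))))
    ... | false = sym (trans (*-cong (trans (resp (λ b → pw x (if b then 1 else 0)) (P.trans (isVar-half (length xs) ℓ) (P.trans (P.cong (length xs ≡ᵇ_) h) (≡ᵇ-refl (length xs))))) (*-identityʳ _))
      (xp-zero xs (downFrom (length xs)) _ (All.map (λ {t} r → P.cong (if_then 1 else 0) (P.trans (isVar-half t ℓ) (<⇒≢ᵇ (P.subst (t <_) (P.sym h) r)))) (downFrom-< (length xs))))) (*-identityʳ _))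
      where
      h = half-≡ ℓ (length xs) (≰ᵇ⇒> (suc ℓ) (dbl (length xs)) e) q

    word-xp : ∀ xs S → All (Letter (dbl (length xs))) S → ∏ S (letter xs) ≈ xp xs (map (λ t → count (isVar t) S) (downFrom (length xs)))
    word-xp xs [] [] = sym (xp-zero xs (downFrom (length xs)) _ (All.universal (λ _ → P.refl) _))
    word-xp xs (ℓ ∷ S) (p ∷ ps) = trans (*-cong (letter-xp xs ℓ p) (word-xp xs S ps)) (xp-map xs (downFrom (length xs)) _ _)

    W-eval : ∀ xs {n} (s : Vec Bool n) → W xs s ≈ eval β xs (svTerms P? s (length xs))
    W-eval xs s = trans (FS-cong (NE (dbl r)) (NE-entries (dbl r)) (rows 1 s) (λ E v → *-cong (sym (fromℤ-ι (svGood P? E))) (prod E v)))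
      (trans (sym (FS-fillings (NE (dbl r)) (rows 1 s) (λ E → term β xs (svTerm P? r E)))) (sym (∑-map (svTerm P? r) (fillings (NE (dbl r)) (rows 1 s)) (term β xs))))
      where
      r = length xs
      prod : ∀ E → All (λ e → Entry (dbl r) (snd e)) E → ∏ E (λ e → Peel.boxwt R β P? (letter xs) (snd e)) ≈ pw β (excess E) * xp xs (map (λ t → svWt t E) (downFrom r))
      prod [] [] = sym (trans (*-identityˡ _) (xp-zero xs (downFrom r) _ (All.universal (λ _ → P.refl) _)))
      prod (e ∷ E) (v ∷ vs) = trans (*-cong (*-congˡ (word-xp xs (snd e) (Entry.bounded v))) (prod E vs))
        (trans (solve 4 (λ a b c d → a :* b :* (c :* d) := a :* c :* (b :* d)) refl _ _ _ _) (*-cong (sym (pw-+ β (length (snd e) ∸ 1) (excess E))) (xp-map xs (downFrom r) _ _)))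

    open PlanePartitions R β P? using (Q)

    pw-neg : ∀ i → pw (- β) i ≈ fromℤ (signℤ i) * pw β i
    pw-neg zero = sym (*-identityʳ _)
    pw-neg (suc zero) = solve 1 (λ b → :- b :* :1 := con (ℤ.- + 1) :* (b :* :1)) refl β
    pw-neg (suc (suc i)) = trans (*-congˡ (*-congˡ (pw-neg i))) (solve 3 (λ b s p → :- b :* (:- b :* (s :* p)) := s :* (b :* (b :* p))) refl β _ _)

    letters-xp : ∀ γ ys (D K : ℕ → ℕ) → ∏ (letters (length ys)) (λ ℓ → pw (letter ys ℓ) (D ℓ) * pw γ (K ℓ)) ≈
      pw γ (sum (map K (letters (length ys)))) * xp ys (map (λ t → D (suc (suc (dbl t))) ℕ.+ D (suc (dbl t))) (downFrom (length ys)))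
    letters-xp γ [] D K = sym (*-identityˡ _)
    letters-xp γ (y ∷ ys) D K = begin
      ∏ (letters r ++ o ∷ suc o ∷ []) (λ ℓ → pw (letter (y ∷ ys) ℓ) (D ℓ) * pw γ (K ℓ))
        ≈⟨ trans (∏-++ (letters r) (o ∷ suc o ∷ []) _) (*-cong (trans (old (letters r) (letters-≤ r)) (letters-xp γ ys D K))
             (reflexive (P.cong₂ (λ u v → pw u (D o) * pw γ (K o) * (pw v (D (suc o)) * pw γ (K (suc o)) * 1#)) (letter-new y ys o NP.≤-refl) (letter-new y ys (suc o) (NP.n≤1+n _))))) ⟩
      pw γ (sum (map K (letters r))) * X * (pw y (D o) * pw γ (K o) * (pw y (D (suc o)) * pw γ (K (suc o)) * 1#))
        ≈⟨ solve 6 (λ g x a p b q → g :* x :* (a :* p :* (b :* q :* :1)) := g :* (p :* (q :* :1)) :* (b :* a :* x)) refl _ _ _ _ _ _ ⟩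
      pw γ (sum (map K (letters r))) * (pw γ (K o) * (pw γ (K (suc o)) * 1#)) * (pw y (D (suc o)) * pw y (D o) * X)
        ≈⟨ *-cong (trans (*-congˡ (trans (*-congˡ (sym (pw-+ γ (K (suc o)) 0))) (sym (pw-+ γ (K o) _)))) (trans (sym (pw-+ γ (sum (map K (letters r))) _))
             (resp (pw γ) (P.sym (P.trans (P.cong sum (LP.map-++ K (letters r) (o ∷ suc o ∷ []))) (sum-++ (map K (letters r)) _))))))
             (*-congʳ (sym (pw-+ y (D (suc o)) (D o)))) ⟩
      pw γ (sum (map K (letters (suc r)))) * xp (y ∷ ys) (map (λ t → D (suc (suc (dbl t))) ℕ.+ D (suc (dbl t))) (downFrom (suc r))) ∎
      where
      open import Data.Nat.ListAction.Properties using (sum-++)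
      r = length ys
      o = suc (dbl r)
      X = xp ys (map (λ t → D (suc (suc (dbl t))) ℕ.+ D (suc (dbl t))) (downFrom r))
      old : ∀ l → All (_≤ dbl r) l → ∏ l (λ ℓ → pw (letter (y ∷ ys) ℓ) (D ℓ) * pw γ (K ℓ)) ≈ ∏ l (λ ℓ → pw (letter ys ℓ) (D ℓ) * pw γ (K ℓ))
      old [] [] = refl
      old (ℓ ∷ l) (p ∷ ps) = *-cong (*-congʳ (resp (λ u → pw u (D ℓ)) (letter-old y ys ℓ p))) (old l ps)

    Q-eval : ∀ ys {n} (s m : Vec Bool n) → Q ys s m ≈ eval β ys (ppTerms (not P?) s m (length ys))
    Q-eval ys s m = trans (sym (FS-*ˡ (letters r) bs (ι c) _)) (trans (FS-cong′ (letters r) bs one)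
      (trans (sym (FS-fillings (letters r) bs (λ E → term β ys (ppTerm (not P?) c r E)))) (sym (∑-map (ppTerm (not P?) c r) (fillings (letters r) bs) (term β ys)))))
      where
      r = length ys
      c = sub (parts m) (parts s)
      bs = segs 1 (parts s) (parts m)
      one : ∀ T → ι c * PlaneFillings.weight R (- β) (not P?) (letter ys) (letters r) T ≈ term β ys (ppTerm (not P?) c r T)
      one T = begin
        ι c * (ι (ppGood (not P?) T) * ∏ (letters r) (λ ℓ → PlaneFillings.letterwt R (- β) (not P?) (letter ys) ℓ T))
          ≈⟨ *-congˡ (*-congˡ (trans (same (letters r)) (trans (letters-xp (- β) ys (λ ℓ → dist ℓ T) (λ ℓ → len ℓ T ∸ dist ℓ T)) (*-congʳ (pw-neg (defect r T)))))) ⟩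
        ι c * (ι (ppGood (not P?) T) * (fromℤ (signℤ (defect r T)) * pw β (defect r T) * X))
          ≈⟨ solve 5 (λ a b s p x → a :* (b :* (s :* p :* x)) := a :* (b :* s) :* (p :* x)) refl _ _ _ _ _ ⟩
        ι c * (ι (ppGood (not P?) T) * fromℤ (signℤ (defect r T))) * (pw β (defect r T) * X)
          ≈⟨ *-congʳ (sym (trans (fromℤ-* (ι₀ c) _) (*-cong (fromℤ-ι c) (trans (fromℤ-* (ι₀ (ppGood (not P?) T)) _) (*-congʳ (fromℤ-ι (ppGood (not P?) T))))))) ⟩
        term β ys (ppTerm (not P?) c r T) ∎
        where
        X = xp ys (map (λ t → ppWt t T) (downFrom r))
        same : ∀ l → ∏ l (λ ℓ → PlaneFillings.letterwt R (- β) (not P?) (letter ys) ℓ T) ≈ ∏ l (λ ℓ → pw (letter ys ℓ) (dist ℓ T) * pw (- β) (len ℓ T ∸ dist ℓ T))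
        same l = ∏-cong l (λ ℓ → resp (λ k → pw (letter ys ℓ) (dist ℓ T) * pw (- β) (k ∸ dist ℓ T)) (LP.length-map _ (filterB (λ e → snd e ≡ᵇ ℓ) T)))

open Fillings ZP.+-*-commutativeRing using () renaming (FS to FS₀; FS-fillings to FS₀-fillings)
open Expansion ZP.+-*-commutativeRing using () renaming (FS-congˡ to FS₀-congˡ)

≡ᵇ-sound : ∀ m n → (m ≡ᵇ n) ≡ true → m ≡ n
≡ᵇ-sound m n e = NP.≡ᵇ⇒≡ m n (P.subst T (P.sym e) _)

svTerms-fit : ∀ P? {n} (s : Vec Bool n) r → All (λ t → length (snd (snd t)) ≡ r) (svTerms P? s r)
svTerms-fit P? s r = AllP.map⁺ (All.universal (λ T → P.trans (LP.length-map (λ t → svWt t T) (downFrom r)) (LP.length-downFrom r)) _)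

ppTerms-fit : ∀ P? {n} (s m : Vec Bool n) r → All (λ t → length (snd (snd t)) ≡ r) (ppTerms P? s m r)
ppTerms-fit P? s m r = AllP.map⁺ (All.universal (λ T → P.trans (LP.length-map (λ t → ppWt t T) (downFrom r)) (LP.length-downFrom r)) _)

∑-fillings-cong : {A : Set} {P : A → Set} (as : List A) → All P as → ∀ bs {f g : List (Box × A) → ℤ} →
  (∀ E → length E ≡ length bs → All (λ e → P (snd e)) E → f E ≡ g E) → ∑₀ (fillings as bs) f ≡ ∑₀ (fillings as bs) g
∑-fillings-cong as ps bs {f} {g} h = P.trans (FS₀-fillings as bs f) (P.trans (FS₀-congˡ as ps bs h) (P.sym (FS₀-fillings as bs g)))

total-excess : ∀ {L} T → All (λ e → Entry L (snd e)) T → sum (map (λ E → length (snd E)) T) ≡ length T ℕ.+ excess T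
total-excess [] [] = P.refl
total-excess (e ∷ T) (v ∷ vs) = P.trans (P.cong₂ ℕ._+_ (P.sym (NP.m+[n∸m]≡n (Entry.nonempty v))) (total-excess T vs)) (interchange 1 (length (snd e) ∸ 1) (length T) (excess T))

-- The definition fixes the total number of entries, the term fixes the excess over one entry per
-- box. The two differ by the number of boxes.
cnt-GCoef : ∀ P? {n} (s : Vec Bool n) b a → cnt (svTerms P? s (length a)) b (reverse a) ≡ GCoef P? (parts s) b a
cnt-GCoef P? s b a = P.trans (∑₀-map (svTerm P? k) F (at b (reverse a)))
    (P.trans (∑-fillings-cong (NE (dbl k)) (NE-entries (dbl k)) (rows 1 s) point)
      (P.sym (P.trans (count-∑ good (svFillings (parts s) k)) (P.cong₂ (λ u v → ∑₀ (fillings (NE u) v) (λ T → ι₀ (good T))) (2*≡dbl k) (boxesFrom-rows 1 s)))))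
  where
  k = length a
  F = fillings (NE (dbl k)) (rows 1 s)
  good : List SVEntry → Bool
  good T = allPairs T svPairOK ∧ (not P? ∨ all noPrimedDiag T) ∧ eqList (svWeight k T) a ∧ (sum (map (λ E → length (snd E)) T) ≡ᵇ sum (parts s) ℕ.+ b)
  point : ∀ T → length T ≡ length (rows 1 s) → All (λ e → Entry (dbl k) (snd e)) T → at b (reverse a) (svTerm P? k T) ≡ ι₀ (good T)
  point T e v = P.trans (P.sym (ι₀-∧ (svGood P? T) _)) (P.cong ι₀ (P.trans (P.cong₂ (λ u w → svGood P? T ∧ (u ∧ w)) deg (eqList-reverse (λ t → svWt t T) k a))
      (shuffle (allPairs T svPairOK) (not P? ∨ all noPrimedDiag T) (sum (map (λ E → length (snd E)) T) ≡ᵇ sum (parts s) ℕ.+ b) (eqList (svWeight k T) a))))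
    where
    deg : (excess T ≡ᵇ b) ≡ (sum (map (λ E → length (snd E)) T) ≡ᵇ sum (parts s) ℕ.+ b)
    deg = P.sym (P.trans (P.cong₂ _≡ᵇ_ (total-excess T v) (P.cong (ℕ._+ b) (P.trans (size-parts s) (P.trans (P.sym (length-rows 1 s)) (P.sym e))))) (≡ᵇ-cancel (length T) (excess T) b))
    shuffle : ∀ p q r t → (p ∧ q) ∧ (r ∧ t) ≡ p ∧ q ∧ t ∧ r
    shuffle false q r t = P.refl
    shuffle true false r t = P.refl
    shuffle true true r t = BP.∧-comm r t

letters-upTo : ∀ r → map suc (upTo (2 ℕ.* r)) ≡ letters r
letters-upTo r = P.trans (P.cong (λ k → map suc (upTo k)) (2*≡dbl r)) (go r)
  where
  go : ∀ r → map suc (upTo (dbl r)) ≡ letters r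
  go zero = P.refl
  go (suc r) = P.trans (P.cong (map suc) (P.trans (P.sym (LP.upTo-∷ʳ (suc (dbl r)))) (P.cong (_++ suc (dbl r) ∷ []) (P.sym (LP.upTo-∷ʳ (dbl r))))))
    (P.trans (P.cong (map suc) (LP.++-assoc (upTo (dbl r)) _ _)) (P.trans (LP.map-++ suc (upTo (dbl r)) _) (P.cong (_++ suc (dbl r) ∷ suc (suc (dbl r)) ∷ []) (go r))))

letters-valid : ∀ r → All (Letter (dbl r)) (letters r)
letters-valid zero = []
letters-valid (suc r) = AllP.++⁺ (All.map (λ { (p , q) → p , NP.m≤n⇒m≤1+n (NP.m≤n⇒m≤1+n q) }) (letters-valid r)) ((s≤s z≤n , NP.n≤1+n _) ∷ (s≤s z≤n , NP.≤-refl) ∷ [])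

sum-map-++ : ∀ (D : ℕ → ℕ) l l′ → sum (map D (l ++ l′)) ≡ sum (map D l) ℕ.+ sum (map D l′)
sum-map-++ D l l′ = P.trans (P.cong sum (LP.map-++ D l l′)) (sum-++ (map D l) (map D l′))

sum-map-+ : ∀ (f g h : ℕ → ℕ) → (∀ ℓ → f ℓ ℕ.+ g ℓ ≡ h ℓ) → ∀ l → sum (map f l) ℕ.+ sum (map g l) ≡ sum (map h l)
sum-map-+ f g h e [] = P.refl
sum-map-+ f g h e (ℓ ∷ l) = P.trans (interchange (f ℓ) _ (g ℓ) _) (P.cong₂ ℕ._+_ (e ℓ) (sum-map-+ f g h e l))

sum-pairs : ∀ (D : ℕ → ℕ) r → sum (map (λ t → D (suc (suc (dbl t))) ℕ.+ D (suc (dbl t))) (downFrom r)) ≡ sum (map D (letters r))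
sum-pairs D zero = P.refl
sum-pairs D (suc r) = P.sym (P.trans (sum-map-++ D (letters r) _) (P.trans (NP.+-comm (sum (map D (letters r))) _)
  (P.cong₂ ℕ._+_ (P.trans (P.cong (D (suc (dbl r)) ℕ.+_) (NP.+-identityʳ _)) (NP.+-comm (D (suc (dbl r))) _)) (P.sym (sum-pairs D r)))))

occurs : ∀ r ℓ → 0 < ℓ → sum (map (λ k → if ℓ ≡ᵇ k then 1 else 0) (letters r)) ≡ (if ℓ ≤ᵇ dbl r then 1 else 0)
occurs zero (suc ℓ) p = P.refl
occurs (suc r) ℓ p = P.trans (sum-map-++ _ (letters r) _) (P.trans (P.cong (ℕ._+ ((if ℓ ≡ᵇ suc (dbl r) then 1 else 0) ℕ.+ ((if ℓ ≡ᵇ suc (suc (dbl r)) then 1 else 0) ℕ.+ 0))) (occurs r ℓ p)) (go (NP.<-cmp ℓ (suc (dbl r)))))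
  where
  open import Relation.Binary.Definitions using (tri<; tri≈; tri>; Tri)
  go : Tri (ℓ < suc (dbl r)) (ℓ ≡ suc (dbl r)) (suc (dbl r) < ℓ) →
    (if ℓ ≤ᵇ dbl r then 1 else 0) ℕ.+ ((if ℓ ≡ᵇ suc (dbl r) then 1 else 0) ℕ.+ ((if ℓ ≡ᵇ suc (suc (dbl r)) then 1 else 0) ℕ.+ 0)) ≡ (if ℓ ≤ᵇ dbl (suc r) then 1 else 0)
  go (tri< (s≤s q) _ _) rewrite ≤⇒≤ᵇ≡ q | <⇒≢ᵇ (s≤s q) | <⇒≢ᵇ (s≤s (NP.m≤n⇒m≤1+n q)) | ≤⇒≤ᵇ≡ (NP.m≤n⇒m≤1+n (NP.m≤n⇒m≤1+n q)) = P.refl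
  go (tri≈ _ P.refl _) rewrite <⇒≰ᵇ (NP.≤-refl {suc (dbl r)}) | ≡ᵇ-refl (dbl r) | <⇒≢ᵇ (NP.≤-refl {suc (dbl r)}) | ≤⇒≤ᵇ≡ (NP.n≤1+n (suc (dbl r))) = P.refl
  go (tri> _ _ q) with ℓ NP.≟ suc (suc (dbl r))
  ... | yes P.refl rewrite <⇒≰ᵇ (NP.n≤1+n (suc (dbl r))) | >⇒≢ᵇ (NP.≤-refl {suc (dbl r)}) | ≡ᵇ-refl (dbl r) | ≤⇒≤ᵇ≡ (NP.≤-refl {suc (suc (dbl r))}) = P.refl
  ... | no ne rewrite <⇒≰ᵇ (NP.<-trans (NP.n<1+n (dbl r)) q) | >⇒≢ᵇ q | >⇒≢ᵇ (NP.≤∧≢⇒< q (λ e → ne (P.sym e))) | <⇒≰ᵇ (NP.≤∧≢⇒< q (λ e → ne (P.sym e))) = P.refl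

sum-len : ∀ r T → All (λ e → Letter (dbl r) (snd e)) T → sum (map (λ ℓ → len ℓ T) (letters r)) ≡ length T
sum-len r [] [] = zeros (letters r)
  where
  zeros : ∀ (l : List ℕ) → sum (map (λ _ → 0) l) ≡ 0
  zeros [] = P.refl
  zeros (_ ∷ l) = zeros l
sum-len r (e ∷ T) ((p , q) ∷ v) = P.trans (P.sym (sum-map-+ (λ ℓ → if snd e ≡ᵇ ℓ then 1 else 0) (λ ℓ → len ℓ T) (λ ℓ → len ℓ (e ∷ T)) one (letters r)))
  (P.cong₂ ℕ._+_ (P.trans (occurs r (snd e) p) (P.cong (if_then 1 else 0) (≤⇒≤ᵇ≡ q))) (sum-len r T v))
  where
  one : ∀ ℓ → (if snd e ≡ᵇ ℓ then 1 else 0) ℕ.+ len ℓ T ≡ len ℓ (e ∷ T)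
  one ℓ with snd e ≡ᵇ ℓ
  ... | true = P.refl
  ... | false = P.refl

-- For each letter its boxes are the distinct lines plus the repetitions, and each box has exactly
-- one letter of the range.
total-defect : ∀ r T → All (λ e → Letter (dbl r) (snd e)) T → defect r T ℕ.+ sum (map (λ t → ppWt t T) (downFrom r)) ≡ length T
total-defect r T v = P.trans (P.cong (defect r T ℕ.+_) (sum-pairs (λ ℓ → dist ℓ T) r))
  (P.trans (sum-map-+ (λ ℓ → len ℓ T ∸ dist ℓ T) (λ ℓ → dist ℓ T) (λ ℓ → len ℓ T) (λ ℓ → NP.m∸n+n≡m (bound ℓ)) (letters r)) (sum-len r T v))
  where
  bound : ∀ ℓ → dist ℓ T ≤ len ℓ T
  bound ℓ = NP.≤-trans (LP.length-deduplicate NP._≟_ (map (λ e → if isEven ℓ then snd (fst e) else fst (fst e)) (filterB (λ e → snd e ≡ᵇ ℓ) T)))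
    (NP.≤-reflexive (LP.length-map _ (filterB (λ e → snd e ≡ᵇ ℓ) T)))

-- Once the weight equals a, the condition on the number of boxes is equivalent to the defect being
-- b, and the sign may be taken at b for all terms.
cnt-combCoef : ∀ P? {n} (s m : Vec Bool n) b a → cnt (ppTerms P? s m (length a)) b (reverse a) ≡ combCoef P? (parts s) (parts m) b a
cnt-combCoef P? s m b a = P.trans (∑₀-map (ppTerm P? c k) F (at b (reverse a))) (P.trans (cases c P.refl) (P.cong (if_then signℤ b ℤ.* (+ count good (ppFillings (parts s) (parts m) k)) else + 0) (P.sym (containedB-sub (Str-parts m) (parts s)))))
  where
  k = length a
  c = sub (parts m) (parts s)
  bs = segs 1 (parts s) (parts m)
  F = fillings (letters k) bs
  good : List PPEntry → Bool
  good T = allPairs T ppPairOK ∧ (not P? ∨ all noUnprimedDiag T) ∧ eqList (ppWeight k T) a ∧ (sum a ℕ.+ b ≡ᵇ length (skewBoxes (parts s) (parts m)))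
  cases : ∀ d → c ≡ d → ∑₀ F (λ T → at b (reverse a) (ppTerm P? c k T)) ≡ (if d then signℤ b ℤ.* (+ count good (ppFillings (parts s) (parts m) k)) else + 0)
  cases false e = P.trans (∑₀-cong F (λ T → P.trans (P.cong (λ d → ι₀ d ℤ.* w T ℤ.* i T) e) (P.trans (P.cong (ℤ._* i T) (ZP.*-zeroˡ (w T))) (ZP.*-zeroˡ (i T))))) (PS.∑-zero 0 F)
    where
    w i : List PPEntry → ℤ
    w T = ι₀ (ppGood P? T) ℤ.* signℤ (defect k T)
    i T = ι₀ ((defect k T ≡ᵇ b) ∧ eqList (map (λ t → ppWt t T) (downFrom k)) (reverse a))
  cases true e = P.trans (∑-fillings-cong (letters k) (letters-valid k) bs {g = λ T → signℤ b ℤ.* ι₀ (good T)} point) (P.trans (P.sym (∑₀-*ˡ (signℤ b) F (λ T → ι₀ (good T))))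
    (P.cong (signℤ b ℤ.*_) (P.sym (P.trans (count-∑ good (ppFillings (parts s) (parts m) k)) (P.cong₂ (λ u v → ∑₀ (fillings u v) (λ T → ι₀ (good T))) (letters-upTo k) shape)))))
    where
    shape : skewBoxes (parts s) (parts m) ≡ bs
    shape = skewBoxes-segs (parts s) (Str-parts m) e
    point : ∀ T → length T ≡ length bs → All (λ x → Letter (dbl k) (snd x)) T → at b (reverse a) (ppTerm P? c k T) ≡ signℤ b ℤ.* ι₀ (good T)
    point T h v = P.trans (P.cong (λ d → ι₀ d ℤ.* (ι₀ (ppGood P? T) ℤ.* signℤ (defect k T)) ℤ.* ι₀ ((defect k T ≡ᵇ b) ∧ q)) e)
      (P.trans (P.cong (ℤ._* ι₀ ((defect k T ≡ᵇ b) ∧ q)) (ZP.*-identityˡ (ι₀ (ppGood P? T) ℤ.* signℤ (defect k T)))) (P.trans fix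
        (P.trans (P.cong (ℤ._* ι₀ ((defect k T ≡ᵇ b) ∧ q)) (ZP.*-comm (ι₀ (ppGood P? T)) (signℤ b))) (P.trans (ZP.*-assoc (signℤ b) _ _)
          (P.cong (signℤ b ℤ.*_) (P.trans (P.sym (ι₀-∧ (ppGood P? T) _)) (P.cong ι₀ (P.trans (P.cong (ppGood P? T ∧_) deg) (BP.∧-assoc (allPairs T ppPairOK) _ _)))))))))
      where
      q = eqList (map (λ t → ppWt t T) (downFrom k)) (reverse a)
      weights : map (λ t → ppWt t T) (upTo k) ≡ ppWeight k T
      weights = LP.map-cong (λ t → P.cong₂ ℕ._+_
        (P.sym (P.trans (P.cong (λ ℓ → distinct (map (λ E → snd (fst E)) (filterB (λ E → snd E ≡ᵇ ℓ) T))) (P.trans (NP.+-comm (2 ℕ.* t) 2) (P.cong (2 ℕ.+_) (2*≡dbl t))))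
          (P.cong (λ o → distinct (map (λ e → if not o then snd (fst e) else fst (fst e)) (filterB (λ e → snd e ≡ᵇ suc (suc (dbl t))) T))) (P.sym (isOdd-dbl t)))))
        (P.sym (P.trans (P.cong (λ ℓ → distinct (map (λ E → fst (fst E)) (filterB (λ E → snd E ≡ᵇ ℓ) T))) (P.trans (NP.+-comm (2 ℕ.* t) 1) (P.cong suc (2*≡dbl t))))
          (P.cong (λ o → distinct (map (λ e → if not o then snd (fst e) else fst (fst e)) (filterB (λ e → snd e ≡ᵇ suc (dbl t)) T))) (P.sym (isOdd-suc-dbl t)))))) (upTo k)
      q≡ : q ≡ eqList (ppWeight k T) a
      q≡ = P.trans (eqList-reverse (λ t → ppWt t T) k a) (P.cong (λ l → eqList l a) weights)
      deg : (defect k T ≡ᵇ b) ∧ q ≡ eqList (ppWeight k T) a ∧ (sum a ℕ.+ b ≡ᵇ length (skewBoxes (parts s) (parts m)))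
      deg = P.trans (go q P.refl) (P.cong₂ _∧_ q≡ (P.cong (λ l → sum a ℕ.+ b ≡ᵇ length l) (P.sym shape)))
        where
        go : ∀ r → q ≡ r → (defect k T ≡ᵇ b) ∧ r ≡ r ∧ (sum a ℕ.+ b ≡ᵇ length bs)
        go false _ = BP.∧-zeroʳ _
        go true r = P.trans (BP.∧-identityʳ _) (P.sym (P.trans (P.cong (sum a ℕ.+ b ≡ᵇ_) (P.trans (P.sym h) (P.trans (P.sym (total-defect k T v))
          (P.trans (P.cong (λ l → defect k T ℕ.+ sum l) (eqList-sound (map (λ t → ppWt t T) (downFrom k)) (reverse a) r)) (P.trans (P.cong (defect k T ℕ.+_) (sum-↭ (↭-reverse a))) (NP.+-comm _ (sum a)))))))
          (P.trans (≡ᵇ-cancel (sum a) b (defect k T)) (sym-≡ᵇ b (defect k T)))))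
          where
          sym-≡ᵇ : ∀ i j → (i ≡ᵇ j) ≡ (j ≡ᵇ i)
          sym-≡ᵇ zero zero = P.refl
          sym-≡ᵇ zero (suc j) = P.refl
          sym-≡ᵇ (suc i) zero = P.refl
          sym-≡ᵇ (suc i) (suc j) = sym-≡ᵇ i j
      fix : ι₀ (ppGood P? T) ℤ.* signℤ (defect k T) ℤ.* ι₀ ((defect k T ≡ᵇ b) ∧ q) ≡ ι₀ (ppGood P? T) ℤ.* signℤ b ℤ.* ι₀ ((defect k T ≡ᵇ b) ∧ q)
      fix with defect k T ≡ᵇ b in r
      ... | true = P.cong (λ d → ι₀ (ppGood P? T) ℤ.* signℤ d ℤ.* ι₀ q) (≡ᵇ-sound (defect k T) b r)
      ... | false = P.trans (ZP.*-zeroʳ (ι₀ (ppGood P? T) ℤ.* signℤ (defect k T))) (P.sym (ZP.*-zeroʳ (ι₀ (ppGood P? T) ℤ.* signℤ b)))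

fA fB : Bool → ℤ
fA P? = if P? then + 1 else + 2
fB P? = if P? then + 2 else + 1

-- Specialisation at β = 0

module AtZero (R : CommutativeRing 0ℓ 0ℓ) where
  open RingKit R
  open Pieri R 0# using (dot; dot-cong; S; SS; dot-0ˡ; dot-0ʳ; BSS≈X; module One)
  open Triangular using (Zc)

  Zr : ℤ → Bool → Carrier → ∀ {n} → Vec Bool n → Vec Bool n → Carrier
  Zr f false z [] [] = 1#
  Zr f true z [] [] = fromℤ f * z
  Zr f false z (false ∷ s) (false ∷ t) = Zr f false z s t
  Zr f false z (true ∷ s) (true ∷ t) = Zr f false z s t
  Zr f false z (true ∷ s) (false ∷ t) = Zr f true z s t
  Zr f false z (false ∷ s) (true ∷ t) = 0#
  Zr f true z (false ∷ s) (false ∷ t) = z * Zr f true z s t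
  Zr f true z (true ∷ s) (true ∷ t) = z * Zr f true z s t
  Zr f true z (false ∷ s) (true ∷ t) = z * (fromℤ (+ 2) * Zr f false z s t)
  Zr f true z (true ∷ s) (false ∷ t) = 0#

  poly : (ℕ → ℤ) → ℕ → Carrier → Carrier
  poly g N z = ∑ (upTo (suc N)) (λ i → fromℤ (g i) * pw z i)

  poly-split : ∀ g N z → poly g N z ≈ fromℤ (g 0) + ∑ (upTo N) (λ i → fromℤ (g (suc i)) * pw z (suc i))
  poly-split g N z = trans (PowerSeries.∑-upTo-suc R N _) (+-congʳ (*-identityʳ _))

  poly-suc : ∀ g N z → poly g (suc N) z ≈ fromℤ (g 0) + z * poly (λ i → g (suc i)) N z
  poly-suc g N z = trans (poly-split g (suc N) z) (+-congˡ (trans (∑-cong (upTo (suc N)) (λ i → solve 3 (λ a b c → a :* (b :* c) := b :* (a :* c)) refl _ _ _)) (sym (∑-*ˡ z (upTo (suc N)) _))))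

  poly-const : ∀ g N z → (∀ i → g (suc i) ≡ + 0) → poly g N z ≈ fromℤ (g 0)
  poly-const g N z h = trans (poly-split g N z) (trans (+-congˡ (trans (∑-cong (upTo N) (λ i → trans (*-congʳ (resp fromℤ (h i))) (zeroˡ _))) (∑-zero (upTo N)))) (+-identityʳ _))

  -- The degree in z is bounded by the number of levels left, including that of a pending part, so
  -- the polynomial can be written with any larger bound N.
  Zr-poly : ∀ f b z N {n} (s t : Vec Bool n) → (if b then suc n else n) ≤ N → Zr f b z s t ≈ poly (λ i → Zc f b i s t) N z
  Zr-poly f false z N [] [] p = sym (poly-const (λ i → Zc f false i [] []) N z (λ _ → P.refl))
  Zr-poly f true z (suc N) [] [] p = sym (trans (poly-suc (λ i → Zc f true i [] []) N z) (trans (+-identityˡ _) (trans (*-congˡ (poly-const (λ i → Zc f true (suc i) [] []) N z (λ _ → P.refl))) (*-comm _ _))))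
  Zr-poly f false z N (false ∷ s) (false ∷ t) p = Zr-poly f false z N s t (NP.<⇒≤ p)
  Zr-poly f false z N (true ∷ s) (true ∷ t) p = Zr-poly f false z N s t (NP.<⇒≤ p)
  Zr-poly f false z N (true ∷ s) (false ∷ t) p = Zr-poly f true z N s t p
  Zr-poly f false z N (false ∷ s) (true ∷ t) p = sym (poly-const (λ i → Zc f false i (false ∷ s) (true ∷ t)) N z (λ _ → P.refl))
  Zr-poly f true z (suc N) (false ∷ s) (false ∷ t) (s≤s p) = trans (*-congˡ (Zr-poly f true z N s t p)) (sym (trans (poly-suc (λ i → Zc f true i (false ∷ s) (false ∷ t)) N z) (+-identityˡ _)))
  Zr-poly f true z (suc N) (true ∷ s) (true ∷ t) (s≤s p) = trans (*-congˡ (Zr-poly f true z N s t p)) (sym (trans (poly-suc (λ i → Zc f true i (true ∷ s) (true ∷ t)) N z) (+-identityˡ _)))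
  Zr-poly f true z (suc N) (false ∷ s) (true ∷ t) (s≤s p) = trans (*-congˡ (trans (*-congˡ (Zr-poly f false z N s t (NP.<⇒≤ p)))
      (trans (∑-*ˡ (fromℤ (+ 2)) (upTo (suc N)) (λ i → fromℤ (Zc f false i s t) * pw z i)) (∑-cong (upTo (suc N)) (λ i → trans (sym (*-assoc _ _ _)) (*-congʳ (sym (fromℤ-* (+ 2) (Zc f false i s t)))))))))
    (sym (trans (poly-suc (λ i → Zc f true i (false ∷ s) (true ∷ t)) N z) (+-identityˡ _)))
  Zr-poly f true z (suc N) (true ∷ s) (false ∷ t) p = sym (poly-const (λ i → Zc f true i (true ∷ s) (false ∷ t)) (suc N) z (λ _ → P.refl))

  -- At β = 0 the corner weight ξ is 1, and s₂ can no longer be told from s₀.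
  κ : St → Bool
  κ s₁ = true
  κ _ = false

  module _ (P? : Bool) (x : Carrier) where
    private
      module T = Transfer R 0# x 0#
      module X = Transfer R 0# x

    A≈Zr : ∀ q {n} (s t : Vec Bool n) → T.A P? q s t ≈ Zr (fA P?) (κ q) x s t
    A≈Zr q [] [] = fin P? q
      where
      open Tables R
      fin : ∀ P? q → Sol.⟦ aF P? q ⟧ (0# ∷ x ∷ 0# ∷ []) ≈ Zr (fA P?) (κ q) x [] []
      fin true s₀ = refl
      fin true s₁ = sym (*-identityˡ _)
      fin true s₂ = solve 1 (λ x → :1 :+ :0 :* x := :1) refl x
      fin false s₀ = refl
      fin false s₁ = solve 1 (λ x → x :* (:1 :+ (:1 :+ :0 :* x)) := con (+ 2) :* x) refl x
      fin false s₂ = solve 1 (λ x → (:1 :+ :0 :* x) :* (:1 :+ :0 :* x) := :1) refl x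
    A≈Zr q {suc n} (a ∷ s) (b ∷ t) = trans (+-cong (*-congˡ (A≈Zr s₀ s t)) (+-cong (*-congˡ (A≈Zr s₁ s t)) (+-congʳ (*-congˡ (A≈Zr s₂ s t))))) (table q a b)
      where
      open Tables R
      Z₀ = Zr (fA P?) false x s t
      Z₁ = Zr (fA P?) true x s t
      ⟪_⟫ : Sol.Polynomial 3 → Carrier
      ⟪ p ⟫ = Sol.⟦ p ⟧ (0# ∷ x ∷ 0# ∷ [])
      table : ∀ q a b → ⟪ aW q a b s₀ ⟫ * Z₀ + (⟪ aW q a b s₁ ⟫ * Z₁ + (⟪ aW q a b s₂ ⟫ * Z₀ + 0#)) ≈ Zr (fA P?) (κ q) x (a ∷ s) (b ∷ t)
      table s₀ false false = solve 2 (λ p q → :lin :1 p :0 q :0 p := p) refl _ _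
      table s₀ true false = solve 2 (λ p q → :lin :0 p :1 q :0 p := q) refl _ _
      table s₀ true true = solve 2 (λ p q → :lin :0 p :0 q :1 p := p) refl _ _
      table s₀ false true = solve 2 (λ p q → :lin :0 p :0 q :0 p := :0) refl Z₀ Z₁
      table s₁ false false = solve 3 (λ x p q → :lin :0 p x q :0 p := x :* q) refl _ _ _
      table s₁ false true = solve 3 (λ x p q → x :* (:1 :+ :0 :* x) :* p :+ (:0 :* q :+ (x :* p :+ :0)) := x :* (con (+ 2) :* p)) refl _ _ _
      table s₁ true true = solve 3 (λ x p q → :lin :0 p x q :0 p := x :* q) refl _ _ _
      table s₁ true false = solve 2 (λ p q → :lin :0 p :0 q :0 p := :0) refl Z₀ Z₁
      table s₂ false false = solve 3 (λ x p q → (:1 :+ :0 :* x) :* (:1 :+ :0 :* x) :* p :+ (:0 :* q :+ (:0 :* p :+ :0)) := p) refl x _ _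
      table s₂ true false = solve 3 (λ x p q → :lin :0 p (:1 :+ :0 :* x) q :0 p := q) refl x _ _
      table s₂ true true = solve 2 (λ p q → :lin :0 p :0 q :1 p := p) refl _ _
      table s₂ false true = solve 2 (λ p q → :lin :0 p :0 q :0 p := :0) refl Z₀ Z₁

    -- At β = 0, where u = y, state s₀ leads to s₁ and s₂ with equal weight and only their sum
    -- matters. It behaves like the single pending state.
    X≈Zr : ∀ y {n} (s t : Vec Bool n) → X.X y P? s₀ s t ≈ Zr (fB P?) false y s t
    X₁≈Zr : ∀ y {n} (s t : Vec Bool n) → X.X y P? s₁ s t + X.X y P? s₂ s t ≈ Zr (fB P?) true y s t

    X≈Zr y [] [] = refl
    X≈Zr y (false ∷ s) (false ∷ t) = trans (solve 3 (λ p q r → :lin :1 p :0 q :0 r := p) refl _ _ _) (X≈Zr y s t)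
    X≈Zr y (true ∷ s) (true ∷ t) = trans (solve 3 (λ p q r → :lin :1 p :0 q :0 r := p) refl _ _ _) (X≈Zr y s t)
    X≈Zr y (true ∷ s) (false ∷ t) = trans (solve 3 (λ p q r → :lin :0 p :1 q :1 r := q :+ r) refl _ _ _) (X₁≈Zr y s t)
    X≈Zr y (false ∷ s) (true ∷ t) = solve 3 (λ p q r → :lin :0 p :0 q :0 r := :0) refl _ _ _
    X₁≈Zr y [] [] = fin P?
      where
      open Tables R
      fin : ∀ P? → Sol.⟦ xF P? s₁ ⟧ (0# ∷ x ∷ y ∷ []) + Sol.⟦ xF P? s₂ ⟧ (0# ∷ x ∷ y ∷ []) ≈ fromℤ (fB P?) * y
      fin true = solve 1 (λ y → y :+ :0 :+ (y :+ :0) := con (+ 2) :* y) refl y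
      fin false = solve 1 (λ y → y :+ :0 :+ :0 := :1 :* y) refl y
    X₁≈Zr y (false ∷ s) (false ∷ t) = trans (solve 4 (λ y p q r → :lin :0 p y q (y :+ :0) r :+ (:lin :0 p :0 q :0 r) := y :* (q :+ r)) refl y _ _ _) (*-congˡ (X₁≈Zr y s t))
    X₁≈Zr y (true ∷ s) (true ∷ t) = trans (solve 4 (λ y p q r → :lin :0 p :0 q :0 r :+ (:lin :0 p (y :+ :0) q y r) := y :* (q :+ r)) refl y _ _ _) (*-congˡ (X₁≈Zr y s t))
    X₁≈Zr y (false ∷ s) (true ∷ t) = trans (solve 4 (λ y p q r → :lin (y :+ :0) p :0 q :0 r :+ (:lin (y :+ :0) p :0 q :0 r) := y :* (con (+ 2) :* p)) refl y _ _ _) (*-congˡ (*-congˡ (X≈Zr y s t)))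
    X₁≈Zr y (true ∷ s) (false ∷ t) = solve 3 (λ p q r → :lin :0 p :0 q :0 r :+ (:lin :0 p :0 q :0 r) := :0) refl _ _ _

  open Pieri R 0# using (δ; dot-δ)

  S≈δ : ∀ c {n} (s t : Vec Bool n) → S c false s t ≈ δ s t
  S≈δ c [] [] = refl
  S≈δ c (false ∷ s) (false ∷ t) = S≈δ c s t
  S≈δ c (true ∷ s) (true ∷ t) = S≈δ c s t
  S≈δ c (true ∷ s) (false ∷ t) = zeroˡ _
  S≈δ c (false ∷ s) (true ∷ t) = refl

  δ-sym : ∀ {n} (s t : Vec Bool n) → δ s t ≈ δ t s
  δ-sym [] [] = refl
  δ-sym (false ∷ s) (false ∷ t) = δ-sym s t
  δ-sym (true ∷ s) (true ∷ t) = δ-sym s t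
  δ-sym (true ∷ s) (false ∷ t) = refl
  δ-sym (false ∷ s) (true ∷ t) = refl

  -- At β = 0 the rook strips are trivial, so B itself is the automaton X.
  B≈Zr : ∀ P? y {n} (s t : Vec Bool n) → One.Diag.B y P? s t ≈ Zr (fB P?) false y s t
  B≈Zr P? y {n} s t = trans (sym (trans (Σᵇ-cong n (λ k → trans (*-comm _ _) (*-congʳ (trans (SS≈δ k) (δ-sym k t))))) (dot-δ t _))) (trans (BSS≈X P? 0# y s t) (X≈Zr P? 0# y s t))
    where
    SS≈δ : ∀ k → SS P? k t ≈ δ k t
    SS≈δ k = trans (dot-cong n (λ l → S≈δ true k l) (λ l → S≈δ P? l t)) (dot-δ k _)

coef-Σᵇ : ∀ L n (f : Vec Bool n → PS.Carrier L) e → coef L (PS.Σᵇ L n f) e ≡ Σ₀ n (λ s → coef L (f s) e)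
coef-Σᵇ L zero f e = P.refl
coef-Σᵇ L (suc n) f e = P.trans (coef-+ L (PS.Σᵇ L n (λ s → f (false ∷ s))) (PS.Σᵇ L n (λ s → f (true ∷ s))) e) (P.cong₂ ℤ._+_ (coef-Σᵇ L n _ e) (coef-Σᵇ L n _ e))

idx : ∀ L → ℕ → List ℕ → List (PS.Carrier L × ℕ)
idx L k [] = []
idx L k (c ∷ cs) = (var L k , c) ∷ idx L (suc k) cs

idx-vars : ∀ L k cs → map fst (idx L k cs) ≡ vlist L k (length cs)
idx-vars L k [] = P.refl
idx-vars L k (c ∷ cs) = P.cong (var L k ∷_) (idx-vars L (suc k) cs)

idx-exps : ∀ L k cs → map snd (idx L k cs) ≡ cs
idx-exps L k [] = P.refl
idx-exps L k (c ∷ cs) = P.cong (c ∷_) (idx-exps L (suc k) cs)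

length-idx : ∀ L k cs → length (idx L k cs) ≡ length cs
length-idx L k cs = P.trans (P.sym (LP.length-map snd (idx L k cs))) (P.cong length (idx-exps L k cs))

detects-idx : ∀ cs → Detection.Detects (length cs) (Vec.fromList cs) (idx (length cs) 0 cs)
detects-idx cs n p = P.trans (P.cong (λ l → coef L (Powers.xp (PS L) l n) (Vec.fromList cs)) (idx-vars L 0 cs))
  (P.trans (coef-monomial L n (P.trans p (length-idx L 0 cs)) (Vec.fromList cs)) (P.cong (λ l → ι₀ (eqList n l)) (P.trans (VecP.toList∘fromList cs) (P.sym (idx-exps L 0 cs)))))
  where L = length cs

module Products (L : ℕ) (e : Vec ℕ L) where
  open Detection L e
  open PS L using (Carrier; _*_)
  open Powers (PS L)

  fits-⊗ : ∀ {k l ts us} → Fits k ts → Fits l us → Fits (k ℕ.+ l) (ts ⊗ us)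
  fits-⊗ [] v = []
  fits-⊗ {ts = (_ , _ , n) ∷ _} (p ∷ ps) v = AllP.++⁺ (AllP.map⁺ (All.map (λ { {_ , _ , m} q → P.trans (LP.length-++ n) (P.cong₂ ℕ._+_ p q) }) v)) (fits-⊗ ps v)

  coef-product : ∀ {β b} qx qy {ts us} → Detects ((β , b) ∷ qx ++ qy) → Fits (length qx) ts → Fits (length qy) us →
    coef L (eval β (map fst qx) ts * eval β (map fst qy) us) e ≡ ∑₀ (range0 b) (λ b₁ → cnt ts b₁ (map snd qx) ℤ.* cnt us (b ∸ b₁) (map snd qy))
  coef-product {β} {b} qx qy {ts} {us} D v w = P.trans (coef-cong L (eval-⊗ β (map fst qx) (map fst qy) (P.subst (λ k → Fits k ts) (P.sym (LP.length-map fst qx)) v) us) e)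
    (P.trans (P.cong (λ l → coef L (eval β l (ts ⊗ us)) e) (P.sym (LP.map-++ fst qx qy)))
    (P.trans (coef-eval (qx ++ qy) D (P.subst (λ k → Fits k (ts ⊗ us)) (P.sym (LP.length-++ qx)) (fits-⊗ v w)))
    (P.trans (P.cong (cnt (ts ⊗ us) b) (LP.map-++ snd qx qy)) (cnt-⊗ (map snd qx) (map snd qy) (P.subst (λ k → Fits k ts) (P.sym (LP.length-map snd qx)) v) us b))))

pick : ∀ m N (g : ℕ → ℤ) → m ≤ N → ∑₀ (upTo (suc N)) (λ i → g i ℤ.* ι₀ ((i ≡ᵇ m) ∧ true)) ≡ g m
pick zero N g p = P.trans (PowerSeries.∑-upTo-suc (PS 0) N (λ i → g i ℤ.* ι₀ ((i ≡ᵇ 0) ∧ true))) (P.trans (P.cong₂ ℤ._+_ (ZP.*-identityʳ (g 0)) (P.trans (∑₀-cong (upTo N) (λ i → ZP.*-zeroʳ (g (suc i)))) (∑₀-zero (upTo N)))) (ZP.+-identityʳ _))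
pick (suc m) (suc N) g (s≤s p) = P.trans (PowerSeries.∑-upTo-suc (PS 0) (suc N) (λ i → g i ℤ.* ι₀ ((i ≡ᵇ suc m) ∧ true))) (P.trans (P.cong₂ ℤ._+_ (ZP.*-zeroʳ (g 0)) (pick m N (λ i → g (suc i)) p)) (ZP.+-identityˡ _))

module _ (f : ℤ) (ts : ∀ {n} → Vec Bool n → ℕ → List Term)
    (fit : ∀ {n} (s : Vec Bool n) r → All (λ t → length (snd (snd t)) ≡ r) (ts s r))
    (base : ∀ {n} (s : Vec Bool n) → Powers.eval (PS 0) (+ 0) [] (ts s 0) ≡ Triangular.cc f [] s)
    (step : ∀ L x xs r → length xs ≡ r → ∀ {n} (s : Vec Bool n) → PS._≈_ L (Powers.eval (PS L) (PS.0# L) (x ∷ xs) (ts s (suc r)))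
      (PS.Σᵇ L n (λ t → PS._*_ L (AtZero.Zr (PS L) f false x s t) (Powers.eval (PS L) (PS.0# L) xs (ts t r))))) where
  open Triangular f using (Zc; cc)

  -- Extracting the coefficient of the first variable from the one-step recursion of the family
  -- gives the recursion that defines `cc`.
  cnt≡cc : ∀ a {n} (s : Vec Bool n) → cnt (ts s (length a)) 0 a ≡ cc a s
  cnt≡cc [] s = P.trans (P.sym (Detection.coef-eval 0 [] [] (Detection.detects-zero 0 [] (λ { [] _ → P.refl ; (_ ∷ _) () })) (fit s 0))) (base s)
  cnt≡cc (m ∷ a) {n} s = P.trans (P.sym (P.trans (coef-eval qs (detects-zero (detects-idx (m ∷ a))) (P.subst (λ k → Fits k (ts s L)) (P.sym (length-idx L 0 (m ∷ a))) (fit s L)))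
      (P.cong (cnt (ts s L) 0) (idx-exps L 0 (m ∷ a)))))
    (P.trans (coef-cong L (step L (var L 0) (map fst qs′) (length a) (P.trans (LP.length-map fst qs′) (length-idx L 1 a)) s) e) (P.trans (coef-Σᵇ L n _ e) (Σ₀-cong n term′)))
    where
    L = suc (length a)
    e = Vec.fromList (m ∷ a)
    open Detection L e
    open Powers (PS L)
    qs = idx L 0 (m ∷ a)
    qs′ = idx L 1 a
    -- Large enough both for the degree of `Zr`, at most n, and for the exponent m that `pick` reads
    -- off.
    N = m ℕ.+ n
    term′ : ∀ t → coef L (PS._*_ L (AtZero.Zr (PS L) f false (var L 0) s t) (eval (PS.0# L) (map fst qs′) (ts t (length a)))) e ≡ Zc false m s t ℤ.* cc a t
    term′ t = P.trans (coef-cong L (PS.*-congʳ L Z≈) e)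
      (P.trans (Products.coef-product L e ((var L 0 , m) ∷ []) qs′ (detects-zero (detects-idx (m ∷ a))) (AllP.map⁺ (All.universal (λ _ → P.refl) (upTo (suc N))))
        (P.subst (λ k → Fits k (ts t (length a))) (P.sym (length-idx L 1 a)) (fit t (length a))))
      (P.trans (ZP.+-identityʳ _) (P.cong₂ ℤ._*_ (P.trans (PS.∑-map 0 z (upTo (suc N)) (at 0 (m ∷ []))) (pick m N (λ i → Zc false i s t) (NP.m≤m+n m n)))
        (P.trans (P.cong (cnt (ts t (length a)) 0) (idx-exps L 1 a)) (cnt≡cc a t)))))
      where
      z : ℕ → Term
      z i = Zc false i s t , 0 , i ∷ []
      Z≈ : PS._≈_ L (AtZero.Zr (PS L) f false (var L 0) s t) (eval (PS.0# L) (var L 0 ∷ []) (map z (upTo (suc N))))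
      Z≈ = PS.trans L (AtZero.Zr-poly (PS L) f false (var L 0) N s t (NP.m≤n+m n m)) (PS.sym L (PS.trans L (PS.∑-map L z (upTo (suc N)) (term (PS.0# L) (var L 0 ∷ [])))
        (PS.∑-cong L (upTo (suc N)) (λ i → PS.*-congˡ L (PS.trans L (PS.*-identityˡ L _) (PS.*-identityʳ L _))))))

δ∅≡cc : ∀ f P? {n} (s : Vec Bool n) → SetValued.δ∅ (PS 0) (+ 0) P? s ≡ Triangular.cc f [] s
δ∅≡cc f P? [] = P.refl
δ∅≡cc f P? (false ∷ s) = δ∅≡cc f P? s
δ∅≡cc f P? (true ∷ s) = P.refl

δ≡cc : ∀ f {n} (s : Vec Bool n) → Pieri.δ (PS 0) (+ 0) s empty ≡ Triangular.cc f [] s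
δ≡cc f [] = P.refl
δ≡cc f (false ∷ s) = δ≡cc f s
δ≡cc f (true ∷ s) = P.refl

svTerms-cc : ∀ P? a {n} (s : Vec Bool n) → cnt (svTerms P? s (length a)) 0 a ≡ Triangular.cc (fA P?) a s
svTerms-cc P? = cnt≡cc (fA P?) (svTerms P?) (svTerms-fit P?)
  (λ s → P.trans (P.sym (Expansion.W-eval (PS 0) (+ 0) P? [] s)) (P.trans (SetValued.W-[] (PS 0) (+ 0) P? s) (δ∅≡cc (fA P?) P? s)))
  (λ { L x xs _ P.refl {n} s → PS.trans L (PS.sym L (Expansion.W-eval (PS L) (PS.0# L) P? (x ∷ xs) s)) (PS.trans L (SetValued.W-∷ (PS L) (PS.0# L) P? x xs s)
    (PS.Σᵇ-cong L n (λ t → PS.*-cong L (AtZero.A≈Zr (PS L) P? x s₀ s t) (Expansion.W-eval (PS L) (PS.0# L) P? xs t)))) })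

ppTerms-cc : ∀ P? a {n} (s : Vec Bool n) → cnt (ppTerms (not P?) s empty (length a)) 0 a ≡ Triangular.cc (fB P?) a s
ppTerms-cc P? = cnt≡cc (fB P?) (λ s → ppTerms (not P?) s empty) (λ s → ppTerms-fit (not P?) s empty)
  (λ s → P.trans (P.sym (Expansion.Q-eval (PS 0) (+ 0) P? [] s empty)) (P.trans (PlanePartitions.Q-[] (PS 0) (+ 0) P? s empty) (δ≡cc (fB P?) s)))
  (λ { L x xs _ P.refl {n} s → PS.trans L (PS.sym L (Expansion.Q-eval (PS L) (PS.0# L) P? (x ∷ xs) s empty)) (PS.trans L (PlanePartitions.Q-∷ (PS L) (PS.0# L) P? x xs s empty)
    (PS.Σᵇ-cong L n (λ t → PS.*-cong L (AtZero.B≈Zr (PS L) P? x s t) (Expansion.Q-eval (PS L) (PS.0# L) P? xs t empty)))) })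

-- The variables are β, x₁, y₁, x₂, y₂, and so on; each x gets weight 1, β and the y's get weight 0.
xdeg : ℕ → ℕ
xdeg zero = 0
xdeg (suc zero) = 1
xdeg (suc (suc k)) = xdeg k

xdeg-x : ∀ i → xdeg (suc (dbl i)) ≡ 1
xdeg-x zero = P.refl
xdeg-x (suc i) = xdeg-x i

degree-interleave : ∀ a c → degree (λ i → xdeg (suc i)) (Vec.fromList (interleave a c)) ≡ sum a
degree-interleave [] [] = P.refl
degree-interleave [] (y ∷ c) = degree-interleave [] c
degree-interleave (x ∷ a) [] = P.cong₂ ℕ._+_ (NP.*-identityˡ x) (degree-interleave a [])
degree-interleave (x ∷ a) (y ∷ c) = P.cong₂ ℕ._+_ (NP.*-identityˡ x) (degree-interleave a c)

parts-empty : ∀ n → parts (empty {n}) ≡ []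
parts-empty zero = P.refl
parts-empty (suc n) = parts-empty n

applyUpTo-+suc : ∀ {A : Set} (f : ℕ → A) o n → applyUpTo (λ i → f (suc o ℕ.+ i)) n ≡ applyUpTo (λ i → f (o ℕ.+ suc i)) n
applyUpTo-+suc f o n = P.trans (P.sym (LP.map-upTo _ n)) (P.trans (LP.map-cong (λ i → P.cong f (P.sym (NP.+-suc o i))) (upTo n)) (LP.map-upTo _ n))

-- The Cauchy identity

pairing : Bool → ℕ → ℕ → List ℕ → List ℕ → ℤ
pairing P? N b a c = Σℤ (strictUpTo N) (λ la → Σℤ (range0 b) (λ b₁ → GCoef P? la b₁ a ℤ.* combCoef (not P?) la [] (b ∸ b₁) c))

module Core (P? : Bool) (b : ℕ) (a c₀ : List ℕ) where
  L = length (interleave a c₀)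
  e = Vec.fromList (b ∷ interleave a c₀)
  F = 𝔽 xdeg (suc L)
  open PS (suc L) hiding (refl; trans)
  open PS (suc L) using () renaming (refl to ≈-refl; trans to ≈-trans)
  open Filtration F using (I; I-cong; I-*; I-all; I-mono)
  open Detection (suc L) e
  open Expansion (PS (suc L)) using (W-eval; Q-eval)
  open Powers (PS (suc L))

  β : Carrier
  β = var (suc L) 0

  open Cauchy (PS (suc L)) F β using (chain; dens; nums; cauchy; δ∅; _≈[_]_)
  open Pieri (PS (suc L)) β using (dot; dot-cong)
  open SetValued (PS (suc L)) β P? using (W; W-[]; W-∷; W-I)
  open PlanePartitions (PS (suc L)) β P? using (Q; Q≈chain)

  X Y : ℕ → Carrier
  X i = var (suc L) (suc (dbl i))
  Y j = var (suc L) (suc (suc (dbl j)))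

  -- The value 0 stands for a variable that is not there.
  yo : Maybe ℕ → Carrier
  yo (just j) = Y j
  yo nothing = 0#

  y? : Maybe ℕ × ℕ → Carrier × ℕ
  y? (o , c) = yo o , c

  xs : List Carrier
  xs = map X (downFrom (length a))

  xpairs : ℕ → List ℕ → List (Carrier × ℕ)
  xpairs o [] = []
  xpairs o (k ∷ a) = (X o , k) ∷ xpairs (suc o) a

  ypairs : ℕ → List ℕ → List (Maybe ℕ × ℕ)
  ypairs o [] = []
  ypairs o (k ∷ c) = (just o , k) ∷ ypairs (suc o) c

  -- Interleaving pads the shorter list. The variables are sorted into the padding `zs`, looked for
  -- with exponent 0, the x's and the y's.
  split : ∀ o a c → ∃ λ zs → All (λ q → snd q ≡ 0) zs × idx (suc L) (suc (dbl o)) (interleave a c) ↭ zs ++ (xpairs o a ++ map y? (ypairs o c))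
  split o [] [] = [] , [] , ↭.refl
  split o [] (y ∷ c) with split (suc o) [] c
  ... | zs , z , π = (X o , 0) ∷ zs , P.refl ∷ z , ↭.prep (X o , 0) (↭.trans (↭.prep (Y o , y) π) (↭-sym (shift (Y o , y) zs _)))
  split o (x ∷ a) [] with split (suc o) a []
  ... | zs , z , π = (Y o , 0) ∷ zs , P.refl ∷ z , ↭.trans (↭.swap (X o , x) (Y o , 0) π) (↭.prep (Y o , 0) (↭-sym (shift (X o , x) zs _)))
  split o (x ∷ a) (y ∷ c) with split (suc o) a c
  ... | zs , z , π = zs , z , ↭.trans (↭.prep (X o , x) (↭.trans (↭.prep (Y o , y) π) (↭.trans (↭-sym (shift (Y o , y) zs _)) (++⁺ˡ zs (↭-sym (shift (Y o , y) (xpairs (suc o) a) _))))))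
    (↭-sym (shift (X o , x) zs _))

  qx : List (Carrier × ℕ)
  qx = reverse (xpairs 0 a)

  detects : ∀ {πs} → ypairs 0 c₀ ↭ πs → Detects ((β , b) ∷ qx ++ map y? πs)
  detects π with split 0 a c₀
  ... | zs , z , ρ = detects-↭ (↭.prep (β , b) (++⁺ (↭-sym (↭-reverse (xpairs 0 a))) (map⁺ y? π)))
    (detects-drops z (detects-↭ (↭.trans (↭.prep (β , b) ρ) (↭-sym (shift (β , b) zs _))) (detects-idx (b ∷ interleave a c₀))))

  detects-nothing : ∀ {πs} → Detects ((β , b) ∷ qx ++ map y? πs) → Detects ((β , b) ∷ qx ++ map y? ((nothing , 0) ∷ πs))
  detects-nothing {πs} D = detects-↭ (↭-sym (shift (0# , 0) ((β , b) ∷ qx) (map y? πs))) (detects-zero D)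

  qx-vars : map fst qx ≡ xs
  qx-vars = P.trans (LP.reverse-map fst (xpairs 0 a)) (P.trans (P.cong reverse (go 0 a)) (P.trans (LP.reverse-applyUpTo X (length a)) (P.sym (LP.map-downFrom X (length a)))))
    where
    go : ∀ o a → map fst (xpairs o a) ≡ applyUpTo (λ i → X (o ℕ.+ i)) (length a)
    go o [] = P.refl
    go o (k ∷ a) = P.cong₂ _∷_ (P.cong X (P.sym (NP.+-identityʳ o))) (P.trans (go (suc o) a) (applyUpTo-+suc X o (length a)))

  qx-exps : map snd qx ≡ reverse a
  qx-exps = P.trans (LP.reverse-map snd (xpairs 0 a)) (P.cong reverse (go 0 a))
    where
    go : ∀ o a → map snd (xpairs o a) ≡ a
    go o [] = P.refl
    go o (k ∷ a) = P.cong (k ∷_) (go (suc o) a)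

  length-qx : length qx ≡ length a
  length-qx = P.trans (P.sym (LP.length-map snd qx)) (P.trans (P.cong length qx-exps) (LP.length-reverse a))

  -- The x-degree of the exponent under consideration. With words of N bits the error in `cauchy`
  -- lies in `I (suc N)` and is invisible there.
  N : ℕ
  N = sum a

  low-degree : degree xdeg e < suc N
  low-degree = s≤s (NP.≤-reflexive (degree-interleave a c₀))

  xs-I : All (I 1) xs
  xs-I = AllP.map⁺ (All.universal (λ i → P.subst (λ k → I k (X i)) (xdeg-x i) (I-var xdeg (suc L) (suc (dbl i)))) (downFrom (length a)))

  -- Each product of a set-valued and a plane partition sum is expanded into terms, whose
  -- convolution is the summand in the definition. The order of πs is left free, so that permuted
  -- exponents c can be compared with one fixed monomial.
  coef-pairing : ∀ πs c → map snd πs ≡ reverse c → Detects ((β , b) ∷ qx ++ map y? πs) →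
    coef (suc L) (dot N (W xs) (chain P? (map yo (map fst πs)))) e ≡ pairing P? N b a c
  coef-pairing πs c ex D = P.trans (coef-Σᵇ (suc L) N _ e) (P.trans (Σ₀-cong N each) (P.sym (strict-sum N f)))
    where
    ys = map yo (map fst πs)
    qy = map y? πs
    k = length a
    qy-vars : map fst qy ≡ ys
    qy-vars = P.trans (P.sym (LP.map-∘ πs)) (LP.map-∘ πs)
    qy-exps : map snd qy ≡ reverse c
    qy-exps = P.trans (P.sym (LP.map-∘ πs)) ex
    length-qy : length qy ≡ length c
    length-qy = P.trans (P.sym (LP.length-map snd qy)) (P.trans (P.cong length qy-exps) (LP.length-reverse c))
    length-ys : length ys ≡ length c
    length-ys = P.trans (P.cong length (P.sym qy-vars)) (P.trans (LP.length-map fst qy) length-qy)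
    f : List ℕ → ℤ
    f la = Σℤ (range0 b) (λ b₁ → GCoef P? la b₁ a ℤ.* combCoef (not P?) la [] (b ∸ b₁) c)
    value : ∀ s → coef (suc L) (W xs s * chain P? ys s) e ≡ f (parts s)
    value s = P.trans (coef-cong (suc L) (*-cong
        (≈-trans (W-eval β P? xs s) (reflexive (P.cong₂ (λ u r → eval β u (svTerms P? s r)) (P.sym qx-vars) (P.trans (P.cong length (P.sym qx-vars)) (P.trans (LP.length-map fst qx) length-qx)))))
        (≈-trans (sym (Q≈chain F ys s)) (≈-trans (Q-eval β P? ys s empty) (reflexive (P.cong₂ (λ u r → eval β u (ppTerms (not P?) s empty r)) (P.sym qy-vars) length-ys))))) e)
      (P.trans (Products.coef-product (suc L) e qx qy D (P.subst (λ r → Fits r (svTerms P? s k)) (P.sym length-qx) (svTerms-fit P? s k))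
        (P.subst (λ r → Fits r (ppTerms (not P?) s empty (length c))) (P.sym length-qy) (ppTerms-fit (not P?) s empty (length c))))
      (P.trans (PS.∑-cong 0 (range0 b) (λ b₁ → P.cong₂ ℤ._*_ (P.trans (P.cong (cnt (svTerms P? s k) b₁) qx-exps) (cnt-GCoef P? s b₁ a))
        (P.trans (P.cong (cnt (ppTerms (not P?) s empty (length c)) (b ∸ b₁)) qy-exps) (P.trans (cnt-combCoef (not P?) s empty (b ∸ b₁) c) (P.cong (λ m → combCoef (not P?) (parts s) m (b ∸ b₁) c) (parts-empty N))))))
        (P.sym (Σℤ≡∑ (range0 b) (λ b₁ → GCoef P? (parts s) b₁ a ℤ.* combCoef (not P?) (parts s) [] (b ∸ b₁) c)))))
    each : ∀ s → coef (suc L) (W xs s * chain P? ys s) e ≡ ι₀ (sum (parts s) ℕ.≤ᵇ N) ℤ.* f (parts s)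
    each s with sum (parts s) ℕ.≤ᵇ N in le
    ... | true = P.trans (value s) (P.sym (ZP.*-identityˡ (f (parts s))))
    -- A word of N bits may describe a partition of size above N; its set-valued sum has too high a
    -- degree in x to be seen at e.
    ... | false = P.trans (coef-I xdeg (suc L) (I-mono (P.subst (suc N ≤_) (P.trans (size-parts s) (P.sym (NP.+-identityʳ _))) (≰ᵇ⇒> (sum (parts s)) N le)) (I-* (W-I F xs-I s) (I-all (chain P? ys s)))) e low-degree)
      (P.sym (ZP.*-zeroˡ (f (parts s))))

  open Kernel L using (xv; yv; inv; inv-den; kernel-den; φ-kernel)

  X≡xv : ∀ i → xv i ≡ X i
  X≡xv i = P.cong (λ k → var (suc L) (suc k)) (2*≡dbl i)

  Y≡yv : ∀ j → yv j ≡ Y j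
  Y≡yv j = P.cong (λ k → var (suc L) (suc k)) (P.trans (NP.+-comm (2 ℕ.* j) 1) (P.cong suc (2*≡dbl j)))

  den num : ℕ → Maybe ℕ → Carrier
  den i o = (1# + β * X i) * (1# - X i * yo o)
  num i o = 1# + (yo o + β) * X i

  factor unit : ℕ → Maybe ℕ → Carrier
  factor i (just j) = φ L (kernelFactor i j)
  factor i nothing = 1#
  unit i (just j) = inv i j
  -- With y = 0 the denominator is 1 + βx alone. Its inverse is recovered from that of `den i 0` by
  -- undoing the other factor.
  unit i nothing = inv i 0 * (1# - X i * Y 0)

  inv-den′ : ∀ i j → inv i j * den i (just j) ≈ 1#
  inv-den′ i j = P.subst₂ (λ x y → inv i j * ((1# + β * x) * (1# - x * y)) ≈ 1#) (X≡xv i) (Y≡yv j) (inv-den i j)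

  unit-den : ∀ i o → unit i o * den i o ≈ 1#
  unit-den i (just j) = inv-den′ i j
  unit-den i nothing = ≈-trans (solve 4 (λ u k x y → u :* (:1 :- x :* y) :* (k :* (:1 :- x :* :0)) := u :* (k :* (:1 :- x :* y))) ≈-refl _ _ _ _) (inv-den′ i 0)

  factor-den : ∀ i o → factor i o * den i o ≈ num i o
  factor-den i (just j) = P.subst₂ (λ x y → φ L (kernelFactor i j) * ((1# + β * x) * (1# - x * y)) ≈ 1# + (y + β) * x) (X≡xv i) (Y≡yv j) (kernel-den i j)
  factor-den i nothing = solve 2 (λ b x → :1 :* ((:1 :+ b :* x) :* (:1 :- x :* :0)) := :1 :+ (:0 :+ b) :* x) ≈-refl β (X i)

  ∏∏ : List ℕ → List (Maybe ℕ) → (ℕ → Maybe ℕ → Carrier) → Carrier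
  ∏∏ is os f = ∏ is (λ i → ∏ os (f i))

  ∏∏-* : ∀ is os f g h → (∀ i o → f i o * g i o ≈ h i o) → ∏∏ is os f * ∏∏ is os g ≈ ∏∏ is os h
  ∏∏-* is os f g h eq = ≈-trans (sym (∏-* is _ _)) (∏-cong is (λ i → ≈-trans (sym (∏-* os _ _)) (∏-cong os (eq i))))

  ∏-one : ∀ {A : Set} (l : List A) → ∏ l (λ _ → 1#) ≈ 1#
  ∏-one [] = ≈-refl
  ∏-one (x ∷ l) = ≈-trans (*-identityˡ _) (∏-one l)

  ∏-map₂ : ∀ (g : Carrier → Carrier → Carrier) is os → ∏ (map X is) (λ x → ∏ (map yo os) (g x)) ≈ ∏∏ is os (λ i o → g (X i) (yo o))
  ∏-map₂ g is os = ≈-trans (∏-map X is _) (∏-cong is (λ i → ∏-map yo os _))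

  -- Multiplying `cauchy` by the inverse of all denominators leaves the difference of the two sides
  -- in `I (suc N)`, whereas e has x-degree N.
  coef-kernel : ∀ os → coef (suc L) (dot N (W xs) (chain P? (map yo os))) e ≡ coef (suc L) (∏∏ (downFrom (length a)) os factor) e
  coef-kernel os = ZP.i-j≡0⇒i≡j _ _ (P.trans (P.sym (P.trans (coef-+ (suc L) Z (- K) e) (P.cong (λ z → coef (suc L) Z e ℤ.+ z) (coef-neg (suc L) K e))))
      (coef-I xdeg (suc L) (I-cong eq (I-* {j = 0} (I-all U) bound)) e low-degree))
    where
    is = downFrom (length a)
    Z = dot N (W xs) (chain P? (map yo os))
    K = ∏∏ is os factor
    D = ∏∏ is os den
    U = ∏∏ is os unit
    δ∅-same : ∀ {n} (s : Vec Bool n) → SetValued.δ∅ (PS (suc L)) β P? s ≈ δ∅ s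
    δ∅-same [] = ≈-refl
    δ∅-same (false ∷ s) = δ∅-same s
    δ∅-same (true ∷ s) = ≈-refl
    bound : I (suc N) (∏ xs (λ x → dens x (map yo os)) * Z - ∏ xs (λ x → nums x (map yo os)))
    bound = cauchy P? W (λ s → ≈-trans (W-[] s) (δ∅-same s)) W-∷ (W-I F) xs-I (map yo os) N
    eq : U * (∏ xs (λ x → dens x (map yo os)) * Z - ∏ xs (λ x → nums x (map yo os))) ≈ Z - K
    eq = begin
      U * (∏ xs (λ x → dens x (map yo os)) * Z - ∏ xs (λ x → nums x (map yo os)))
        ≈⟨ *-congˡ (+-cong (*-congʳ (∏-map₂ (λ x y → (1# + β * x) * (1# - x * y)) is os)) (-‿cong (≈-trans (∏-map₂ (λ x y → 1# + (y + β) * x) is os) (sym (∏∏-* is os factor den num factor-den))))) ⟩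
      U * (D * Z - K * D) ≈⟨ solve 4 (λ u d z k → u :* (d :* z :- k :* d) := u :* d :* (z :- k)) ≈-refl U D Z K ⟩
      U * D * (Z - K) ≈⟨ *-congʳ (≈-trans (∏∏-* is os unit den (λ _ _ → 1#) unit-den) (≈-trans (∏-cong is (λ _ → ∏-one os)) (∏-one is))) ⟩
      1# * (Z - K) ≈⟨ *-identityˡ _ ⟩
      Z - K ∎

  pairing-kernel : ∀ πs c → map snd πs ≡ reverse c → Detects ((β , b) ∷ qx ++ map y? πs) →
    pairing P? N b a c ≡ coef (suc L) (∏∏ (downFrom (length a)) (map fst πs) factor) e
  pairing-kernel πs c ex D = P.trans (P.sym (coef-pairing πs c ex D)) (coef-kernel (map fst πs))

  ∏-↭ : ∀ {A : Set} {l l′ : List A} (f : A → Carrier) → l ↭ l′ → ∏ l f ≈ ∏ l′ f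
  ∏-↭ f ↭.refl = ≈-refl
  ∏-↭ f (↭.prep x π) = *-congˡ (∏-↭ f π)
  ∏-↭ f (↭.swap x y π) = ≈-trans (*-congˡ (*-congˡ (∏-↭ f π))) (solve 3 (λ a b c → a :* (b :* c) := b :* (a :* c)) ≈-refl _ _ _)
  ∏-↭ f (↭.trans π ρ) = ≈-trans (∏-↭ f π) (∏-↭ f ρ)

  ypairs-exps : ∀ o c → map snd (ypairs o c) ≡ c
  ypairs-exps o [] = P.refl
  ypairs-exps o (k ∷ c) = P.cong (k ∷_) (ypairs-exps (suc o) c)

  os₀ : List (Maybe ℕ)
  os₀ = map fst (ypairs 0 c₀)

  K₀ : ℤ
  K₀ = coef (suc L) (∏∏ (downFrom (length a)) os₀ factor) e

  -- Permuting the exponents amounts to taking the factors B in another order. The double product of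
  -- kernel factors does not depend on that order.
  pairing-↭ : ∀ {c} → c₀ ↭ c → pairing P? N b a c ≡ K₀
  pairing-↭ {c} π with ↭-map-inv snd {xs = ypairs 0 c₀} (P.subst (_↭ reverse c) (P.sym (ypairs-exps 0 c₀)) (↭.trans π (↭-sym (↭-reverse c))))
  ... | ps , ex , ρ = P.trans (pairing-kernel ps c (P.sym ex) (detects ρ)) (coef-cong (suc L) (∏-cong (downFrom (length a)) (λ i → ∏-↭ (factor i) (map⁺ fst (↭-sym ρ)))) e)

  -- An additional exponent 0 is realised by an additional variable with value 0, whose kernel
  -- factor is 1.
  pairing-pad : pairing P? N b a (c₀ ++ 0 ∷ []) ≡ K₀
  pairing-pad = P.trans (pairing-kernel ((nothing , 0) ∷ ps) (c₀ ++ 0 ∷ []) (P.trans (P.cong (0 ∷_) exps) (P.sym (LP.reverse-++ c₀ (0 ∷ [])))) (detects-nothing {ps} (detects π)))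
    (coef-cong (suc L) (∏-cong (downFrom (length a)) (λ i → ≈-trans (*-identityˡ _) (∏-↭ (factor i) (map⁺ fst (↭-sym π))))) e)
    where
    ps = reverse (ypairs 0 c₀)
    π = ↭-sym (↭-reverse (ypairs 0 c₀))
    exps : map snd ps ≡ reverse c₀
    exps = P.trans (LP.reverse-map snd (ypairs 0 c₀)) (P.cong reverse (ypairs-exps 0 c₀))

  pairing-kernelCoef : pairing P? N b a c₀ ≡ kernelCoef b a c₀
  pairing-kernelCoef = P.trans (pairing-↭ ↭.refl)
    (P.trans (coef-cong (suc L) (≈-trans (∏-cong (downFrom (length a)) (λ i → ≈-trans (resp (λ l → ∏ l (factor i)) vars) (∏-map just (upTo (length c₀)) (factor i))))
      (≈-trans (∏-↭ _ (P.subst (_↭ upTo (length a)) (LP.reverse-upTo (length a)) (↭-reverse (upTo (length a))))) (sym (φ-kernel (length a) (length c₀))))) e)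
    (P.trans (coef-curry L (kernelS (length a) (length c₀) b) (Vec.fromList (interleave a c₀))) (P.cong (kernelS (length a) (length c₀) b) (VecP.toList∘fromList (interleave a c₀)))))
    where
    vars : os₀ ≡ map just (upTo (length c₀))
    vars = P.trans (go 0 c₀) (P.sym (LP.map-upTo just (length c₀)))
      where
      go : ∀ o c → map fst (ypairs o c) ≡ applyUpTo (λ j → just (o ℕ.+ j)) (length c)
      go o [] = P.refl
      go o (k ∷ c) = P.cong₂ _∷_ (P.cong just (P.sym (NP.+-identityʳ o))) (P.trans (go (suc o) c) (applyUpTo-+suc just o (length c)))

-- Uniqueness, symmetry and branching

Σℤ-cong : ∀ {A : Set} (as : List A) {f g : A → ℤ} → (∀ a → f a ≡ g a) → Σℤ as f ≡ Σℤ as g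
Σℤ-cong [] h = P.refl
Σℤ-cong (a ∷ as) h = P.cong₂ ℤ._+_ (h a) (Σℤ-cong as h)

Σℤ-sub : ∀ {A : Set} (as : List A) (f g : A → ℤ) → Σℤ as (λ a → f a ℤ.- g a) ≡ Σℤ as f ℤ.- Σℤ as g
Σℤ-sub [] f g = P.refl
Σℤ-sub (a ∷ as) f g = P.trans (P.cong (λ z → f a ℤ.- g a ℤ.+ z) (Σℤ-sub as f g)) (solve 4 (λ p q r s → p :- q :+ (r :- s) := p :+ r :- (q :+ s)) P.refl (f a) (g a) (Σℤ as f) (Σℤ as g))
  where open PS 0 using (solve; _:+_; _:-_; _:=_)

strict-cong : ∀ N {f g : List ℕ → ℤ} → (∀ (s : Vec Bool N) → f (parts s) ≡ g (parts s)) → Σℤ (strictUpTo N) f ≡ Σℤ (strictUpTo N) g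
strict-cong N {f} {g} h = P.trans (strict-sum N f) (P.trans (Σ₀-cong N (λ s → P.cong (ι₀ (sum (parts s) ℕ.≤ᵇ N) ℤ.*_) (h s))) (P.sym (strict-sum N g)))

convolution : ℕ → ℕ → (List ℕ → ℕ → ℤ) → (List ℕ → ℕ → ℤ) → ℤ
convolution N b X u = Σℤ (strictUpTo N) (λ μ → Σℤ (range0 b) (λ b₁ → X μ b₁ ℤ.* u μ (b ∸ b₁)))

independent-≡ : ∀ f {{_ : ℤ.NonZero f}} (X : List ℕ → ℕ → List ℕ → ℤ) → (∀ {n} (s : Vec Bool n) a → X (parts s) 0 a ≡ Triangular.cc f (reverse a) s) →
  (u v : List ℕ → ℕ → ℤ) → (∀ b a → ∃ λ N → sum a ≤ N × convolution N b (λ μ b₁ → X μ b₁ a) u ≡ convolution N b (λ μ b₁ → X μ b₁ a) v) →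
  ∀ b {n} (s : Vec Bool n) → u (parts s) b ≡ v (parts s) b
independent-≡ f X X₀ u v hyp b s = ZP.i-j≡0⇒i≡j _ _ (Triangular.independent f X X₀ (λ μ b → u μ b ℤ.- v μ b) difference b s)
  where
  difference : ∀ b a → ∃ λ N → sum a ≤ N × convolution N b (λ μ b₁ → X μ b₁ a) (λ μ b → u μ b ℤ.- v μ b) ≡ + 0
  difference b a with hyp b a
  ... | N , le , eq = N , le , P.trans (Σℤ-cong (strictUpTo N) (λ μ → P.trans (Σℤ-cong (range0 b) (λ b₁ → ℤ*-sub (X μ b₁ a) (u μ (b ∸ b₁)) (v μ (b ∸ b₁)))) (Σℤ-sub (range0 b) (λ b₁ → X μ b₁ a ℤ.* u μ (b ∸ b₁)) (λ b₁ → X μ b₁ a ℤ.* v μ (b ∸ b₁)))))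
      (P.trans (Σℤ-sub (strictUpTo N) (λ μ → Σℤ (range0 b) (λ b₁ → X μ b₁ a ℤ.* u μ (b ∸ b₁))) (λ μ → Σℤ (range0 b) (λ b₁ → X μ b₁ a ℤ.* v μ (b ∸ b₁)))) (ZP.i≡j⇒i-j≡0 eq))
    where
    ℤ*-sub : ∀ x p q → x ℤ.* (p ℤ.- q) ≡ x ℤ.* p ℤ.- x ℤ.* q
    ℤ*-sub = solve 3 (λ x p q → x :* (p :- q) := x :* p :- x :* q) P.refl
      where open PS 0 using (solve; _:*_; _:-_; _:=_)

GCoef-cc : ∀ P? {n} (s : Vec Bool n) a → GCoef P? (parts s) 0 a ≡ Triangular.cc (fA P?) (reverse a) s
GCoef-cc P? s a = P.trans (P.sym (cnt-GCoef P? s 0 a)) (P.trans (P.cong (λ k → cnt (svTerms P? s k) 0 (reverse a)) (P.sym (LP.length-reverse a))) (svTerms-cc P? (reverse a) s))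

combCoef-cnt : ∀ P? {n} (s : Vec Bool n) b a → cnt (ppTerms (not P?) s empty (length a)) b (reverse a) ≡ combCoef (not P?) (parts s) [] b a
combCoef-cnt P? {n} s b a = P.trans (cnt-combCoef (not P?) s empty b a) (P.cong (λ m → combCoef (not P?) (parts s) m b a) (parts-empty n))

combCoef-cc : ∀ P? {n} (s : Vec Bool n) a → combCoef (not P?) (parts s) [] 0 a ≡ Triangular.cc (fB P?) (reverse a) s
combCoef-cc P? s a = P.trans (P.sym (combCoef-cnt P? s 0 a)) (P.trans (P.cong (λ k → cnt (ppTerms (not P?) s empty k) 0 (reverse a)) (P.sym (LP.length-reverse a))) (ppTerms-cc P? (reverse a) s))

fA-nonzero : ∀ P? → ℤ.NonZero (fA P?)
fA-nonzero true = _
fA-nonzero false = _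

fB-nonzero : ∀ P? → ℤ.NonZero (fB P?)
fB-nonzero true = _
fB-nonzero false = _

combCoef-zero : ∀ P? la mu b a → containedB mu la ≡ false → combCoef P? la mu b a ≡ + 0
combCoef-zero P? la mu b a e rewrite e = P.refl

module _ (P? : Bool) where

  comb : List ℕ → ℕ → List ℕ → ℤ
  comb la = combCoef (not P?) la []

  -- Pairings against all set-valued sums separate coefficients, because those sums are independent.
  -- Properties of the kernel thus pass to the plane partition sums without any bijection.
  comb-ext : ∀ c c′ → (∀ b a → pairing P? (sum a) b a c ≡ pairing P? (sum a) b a c′) → ∀ b {n} (s : Vec Bool n) → comb (parts s) b c ≡ comb (parts s) b c′
  comb-ext c c′ h = independent-≡ (fA P?) {{fA-nonzero P?}} (GCoef P?) (GCoef-cc P?) (λ la b → comb la b c) (λ la b → comb la b c′) (λ b a → sum a , NP.≤-refl , h b a)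

  comb-↭ : ∀ {c c′} → c ↭ c′ → ∀ b {n} (s : Vec Bool n) → comb (parts s) b c ≡ comb (parts s) b c′
  comb-↭ {c} {c′} π = comb-ext c c′ (λ b a → P.trans (Core.pairing-↭ P? b a c ↭.refl) (P.sym (Core.pairing-↭ P? b a c π)))

  comb-pad : ∀ k c b {n} (s : Vec Bool n) → comb (parts s) b (c ++ replicate k 0) ≡ comb (parts s) b c
  comb-pad zero c b s = P.cong (comb (parts s) b) (LP.++-identityʳ c)
  comb-pad (suc k) c b s = P.trans (P.cong (comb (parts s) b) (P.sym (LP.++-assoc c (0 ∷ []) (replicate k 0))))
    (P.trans (comb-pad k (c ++ 0 ∷ []) b s) (comb-ext (c ++ 0 ∷ []) c (λ b a → P.trans (Core.pairing-pad P? b a c) (P.sym (Core.pairing-↭ P? b a c ↭.refl))) b s))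

  interleave-↭ : ∀ a c → ∃ λ k → interleave a c ↭ (a ++ c) ++ replicate k 0
  interleave-↭ [] [] = 0 , ↭.refl
  interleave-↭ [] (y ∷ c) with interleave-↭ [] c
  ... | k , π = suc k , ↭.trans (↭.prep 0 (↭.prep y π)) (↭-sym (shift 0 (y ∷ c) (replicate k 0)))
  interleave-↭ (x ∷ a) [] with interleave-↭ a []
  ... | k , π = suc k , ↭.prep x (↭.trans (↭.prep 0 π) (↭-sym (shift 0 (a ++ []) (replicate k 0))))
  interleave-↭ (x ∷ a) (y ∷ c) with interleave-↭ a c
  ... | k , π = k , ↭.prep x (↭.trans (↭.prep y π) (++⁺ʳ (replicate k 0) (↭-sym (shift y a c))))

  -- The skew functions are defined with alternating variables, while splitting the letters produces
  -- one set of variables after the other. Symmetry and stability under padding reconcile the two.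
  comb-interleave : ∀ a c b {n} (s : Vec Bool n) → comb (parts s) b (interleave a c) ≡ comb (parts s) b (a ++ c)
  comb-interleave a c b s with interleave-↭ a c
  ... | k , π = P.trans (comb-↭ π b s) (comb-pad k (a ++ c) b s)

  sub-sum : ∀ ms ls → sub ms ls ≡ true → sum ms ≤ sum ls
  sub-sum [] ls e = z≤n
  sub-sum (m ∷ ms) (l ∷ ls) e with m ℕ.≤ᵇ l in f
  ... | true = NP.+-mono-≤ (≤ᵇ⇒≤′ m l f) (sub-sum ms ls e)

  qa qc : ∀ L → List ℕ → List ℕ → List (PS.Carrier L × ℕ)
  qa L a c = reverse (idx L 1 a)
  qc L a c = reverse (idx L (suc (length a)) c)

  idx-++ : ∀ L k a c → idx L k (a ++ c) ≡ idx L k a ++ idx L (k ℕ.+ length a) c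
  idx-++ L k [] c = P.cong (λ i → idx L i c) (P.sym (NP.+-identityʳ k))
  idx-++ L k (x ∷ a) c = P.cong ((var L k , x) ∷_) (P.trans (idx-++ L (suc k) a c) (P.cong (λ i → idx L (suc k) a ++ idx L i c) (P.sym (NP.+-suc k (length a)))))

  detects-++ : ∀ b a c → let L = length (b ∷ a ++ c) in Detection.Detects L (Vec.fromList (b ∷ a ++ c)) ((var L 0 , b) ∷ qa L a c ++ qc L a c)
  detects-++ b a c = Detection.detects-↭ L (Vec.fromList (b ∷ a ++ c)) (↭.prep (var L 0 , b) (↭.trans (P.subst (λ l → idx L 1 (a ++ c) ↭ l) (idx-++ L 1 a c) ↭.refl)
      (++⁺ (↭-sym (↭-reverse (idx L 1 a))) (↭-sym (↭-reverse (idx L (suc (length a)) c)))))) (detects-idx (b ∷ a ++ c))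
    where L = length (b ∷ a ++ c)

  module Branch (L b : ℕ) (a c : List ℕ) (e : Vec ℕ L) (detects : Detection.Detects L e ((var L 0 , b) ∷ qa L a c ++ qc L a c)) where
    open PS L using (Carrier; _*_; _≈_; resp; *-comm; *-cong) renaming (trans to ≈-trans; sym to ≈-sym)
    open Detection L e
    open Powers (PS L)
    open Expansion (PS L) using (Q-eval)

    β : Carrier
    β = var L 0

    open PlanePartitions (PS L) β P? using (Q; Q-++)

    xq yq : List (Carrier × ℕ)
    xq = qa L a c
    yq = qc L a c

    exps : ∀ k l → map snd (reverse (idx L k l)) ≡ reverse l
    exps k l = P.trans (LP.reverse-map snd (idx L k l)) (P.cong reverse (idx-exps L k l))

    length-q : ∀ k l → length (reverse (idx L k l)) ≡ length l
    length-q k l = P.trans (LP.length-reverse (idx L k l)) (length-idx L k l)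

    coef-Q : ∀ {n} (s m : Vec Bool n) (qs : List (Carrier × ℕ)) → Q (map fst qs) s m ≈ eval β (map fst qs) (ppTerms (not P?) s m (length qs))
    coef-Q s m qs = ≈-trans (Q-eval β P? (map fst qs) s m) (resp (λ r → eval β (map fst qs) (ppTerms (not P?) s m r)) (LP.length-map fst qs))

    -- The coefficient form of `Q-++`. The variables of a belong to the small letters, which fill
    -- the inner straight shape, and those of c to the large letters on the skew shape.
    branch : ∀ {n} (s : Vec Bool n) → comb (parts s) b (a ++ c) ≡
      Σ₀ n (λ t → Σℤ (range0 b) (λ b₁ → comb (parts t) b₁ a ℤ.* combCoef (not P?) (parts s) (parts t) (b ∸ b₁) c))
    branch {n} s = P.trans (P.sym straight) (P.trans (coef-cong L (≈-trans (resp (λ l → Q l s empty) (LP.map-++ fst yq xq)) (Q-++ (map fst yq) (map fst xq) s empty)) e)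
        (P.trans (coef-Σᵇ L n _ e) (Σ₀-cong n one)))
      where
      rev : map snd (yq ++ xq) ≡ reverse (a ++ c)
      rev = P.trans (LP.map-++ snd yq xq) (P.trans (P.cong₂ _++_ (exps (suc (length a)) c) (exps 1 a)) (P.sym (LP.reverse-++ a c)))
      len-q : length (yq ++ xq) ≡ length (a ++ c)
      len-q = P.trans (P.sym (LP.length-map snd (yq ++ xq))) (P.trans (P.cong length rev) (LP.length-reverse (a ++ c)))
      straight : coef L (Q (map fst (yq ++ xq)) s empty) e ≡ comb (parts s) b (a ++ c)
      straight = P.trans (coef-cong L (coef-Q s empty (yq ++ xq)) e) (P.trans (coef-eval (yq ++ xq) (detects-↭ (↭.prep (β , b) (++-comm xq yq)) detects) (ppTerms-fit (not P?) s empty (length (yq ++ xq))))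
        (P.trans (P.cong₂ (λ r l → cnt (ppTerms (not P?) s empty r) b l) len-q rev) (combCoef-cnt P? s b (a ++ c))))
      one : ∀ t → coef L (Q (map fst yq) s t * Q (map fst xq) t empty) e ≡ Σℤ (range0 b) (λ b₁ → comb (parts t) b₁ a ℤ.* combCoef (not P?) (parts s) (parts t) (b ∸ b₁) c)
      one t = P.trans (coef-cong L (≈-trans (*-comm _ _) (*-cong (coef-Q t empty xq) (coef-Q s t yq))) e)
        (P.trans (Products.coef-product L e {β = β} {b = b} xq yq {ts = ppTerms (not P?) t empty (length xq)} {us = ppTerms (not P?) s t (length yq)} detects (ppTerms-fit (not P?) t empty (length xq)) (ppTerms-fit (not P?) s t (length yq)))
        (P.trans (∑₀-cong (range0 b) (λ b₁ → P.cong₂ ℤ._*_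
          (P.trans (P.cong₂ (λ r l → cnt (ppTerms (not P?) t empty r) b₁ l) (length-q 1 a) (exps 1 a)) (combCoef-cnt P? t b₁ a))
          (P.trans (P.cong₂ (λ r l → cnt (ppTerms (not P?) s t r) (b ∸ b₁) l) (length-q (suc (length a)) c) (exps (suc (length a)) c)) (cnt-combCoef (not P?) s t (b ∸ b₁) c))))
          (P.sym (Σℤ≡∑ (range0 b) (λ b₁ → comb (parts t) b₁ a ℤ.* combCoef (not P?) (parts s) (parts t) (b ∸ b₁) c)))))

    branch-strict : ∀ {N} (s : Vec Bool N) → sum (parts s) ≤ N → convolution N b (λ μ b₁ → comb μ b₁ a) (λ μ b₁ → combCoef (not P?) (parts s) μ b₁ c) ≡ comb (parts s) b (a ++ c)
    branch-strict {N} s le = P.trans (strict-sum N f) (P.trans (Σ₀-cong N small) (P.sym (branch s)))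
      where
      f : List ℕ → ℤ
      f μ = Σℤ (range0 b) (λ b₁ → comb μ b₁ a ℤ.* combCoef (not P?) (parts s) μ (b ∸ b₁) c)
      -- The restriction to sizes up to N loses nothing: either t is contained in s and is no
      -- larger, or its skew sum vanishes.
      small : ∀ t → ι₀ (sum (parts t) ℕ.≤ᵇ N) ℤ.* f (parts t) ≡ f (parts t)
      small t with sub (parts t) (parts s) in ok
      ... | true = P.trans (P.cong (λ d → ι₀ d ℤ.* f (parts t)) (≤⇒≤ᵇ≡ (NP.≤-trans (sub-sum (parts t) (parts s) ok) le))) (ZP.*-identityˡ (f (parts t)))
      ... | false = P.trans (P.cong (ι₀ (sum (parts t) ℕ.≤ᵇ N) ℤ.*_) zero-f) (P.trans (ZP.*-zeroʳ (ι₀ (sum (parts t) ℕ.≤ᵇ N))) (P.sym zero-f))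
        where
        zero-f : f (parts t) ≡ + 0
        zero-f = P.trans (Σℤ≡∑ (range0 b) (λ b₁ → comb (parts t) b₁ a ℤ.* combCoef (not P?) (parts s) (parts t) (b ∸ b₁) c)) (P.trans (∑₀-cong (range0 b) (λ b₁ → P.trans (P.cong (comb (parts t) b₁ a ℤ.*_) (combCoef-zero (not P?) (parts s) (parts t) (b ∸ b₁) c (P.trans (containedB-sub (Str-parts t) (parts s)) ok)))
          (ZP.*-zeroʳ (comb (parts t) b₁ a)))) (∑₀-zero (range0 b)))

  -- g and the plane partition sums have equal pairings with GP or GQ, namely the kernel
  -- coefficients.
  dual-unique : ∀ {g} → CauchyDual (GCoef P?) g → ∀ c b {n} (s : Vec Bool n) → g (parts s) b c ≡ comb (parts s) b c
  dual-unique {g} dual c = independent-≡ (fA P?) {{fA-nonzero P?}} (GCoef P?) (GCoef-cc P?) (λ la b → g la b c) (λ la b → comb la b c)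
    (λ b a → sum a , NP.≤-refl , P.trans (dual b a c) (P.sym (Core.pairing-kernelCoef P? b a c)))

  -- The given skew functions and the plane partition sums are coefficients of one and the same
  -- expansion, in terms of the straight-shape sums; independence of the latter identifies them for
  -- each fixed c.
  skew-unique : ∀ {g gs} → CauchyDual (GCoef P?) g → SkewOf g gs → ∀ {la mu} → Strict la → Strict mu → ∀ b c → gs la mu b c ≡ combCoef (not P?) la mu b c
  skew-unique {g} {gs} dual skew {la} {mu} stl stm b c with Strict⇒Vec stm (sum mu) (All-≤sum mu)
  ... | m , eq = P.subst (λ μ → gs la μ b c ≡ combCoef (not P?) la μ b c) eq
      (independent-≡ (fB P?) {{fB-nonzero P?}} (λ μ b a → comb μ b a) (combCoef-cc P?) (λ μ b → gs la μ b c) (λ μ b → combCoef (not P?) la μ b c) hyp b m)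
    where
    branching : ∀ {N} (s : Vec Bool N) {la} → parts s ≡ la → sum la ≤ N → ∀ b a →
      g la b (interleave a c) ≡ convolution N b (λ μ b₁ → comb μ b₁ a) (λ μ b → combCoef (not P?) la μ b c)
    branching s P.refl le b a = P.trans (dual-unique dual (interleave a c) b s) (P.trans (comb-interleave a c b s) (P.sym (Branch.branch-strict (length (b ∷ a ++ c)) b a c (Vec.fromList (b ∷ a ++ c)) (detects-++ b a c) s le)))
    hyp : ∀ b a → ∃ λ N → sum a ≤ N × convolution N b (λ μ b₁ → comb μ b₁ a) (λ μ b → gs la μ b c) ≡ convolution N b (λ μ b₁ → comb μ b₁ a) (λ μ b → combCoef (not P?) la μ b c)
    hyp b a with skew la stl b a c
    ... | N₀ , eventually = N , NP.≤-trans (NP.m≤n+m (sum a) N₀) (NP.m≤m+n _ (sum la)) , P.trans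
        (strict-cong N {λ μ → Σℤ (range0 b) (λ b₁ → comb μ b₁ a ℤ.* gs la μ (b ∸ b₁) c)} {λ μ → Σℤ (range0 b) (λ b₁ → g μ b₁ a ℤ.* gs la μ (b ∸ b₁) c)} (λ t → Σℤ-cong (range0 b) (λ b₁ → P.cong (ℤ._* gs la (parts t) (b ∸ b₁) c) (P.sym (dual-unique dual a b₁ t)))))
        (P.trans (eventually N (NP.≤-trans (NP.m≤m+n N₀ (sum a)) (NP.m≤m+n _ (sum la)))) (branching (fst vec) (snd vec) (NP.m≤n+m (sum la) _) b a))
      where
      -- N₀ makes the defining sum for the skew functions stationary, sum a is what independence
      -- asks for, and sum la ensures that la is a word of N bits of admissible size.
      N = N₀ ℕ.+ sum a ℕ.+ sum la
      vec = Strict⇒Vec stl N (All.map (λ p → NP.≤-trans p (NP.m≤n+m (sum la) _)) (All-≤sum la))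

theorem4p24 : (gp gq : List ℕ → Ser) (gpSkew gqSkew : List ℕ → List ℕ → Ser) →
  CauchyDual GQCoef gp → CauchyDual GPCoef gq →
  SkewOf gp gpSkew → SkewOf gq gqSkew →
  (la mu : List ℕ) → Strict la → Strict mu →
  ((b : ℕ) (c : List ℕ) → gpSkew la mu b c ≡ gpComb la mu b c)
  × ((b : ℕ) (c : List ℕ) → gqSkew la mu b c ≡ gqComb la mu b c)
theorem4p24 gp gq gpSkew gqSkew dp dq sp sq la mu stl stm = skew-unique false dp sp stl stm , skew-unique true dq sq stl stm
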